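{- For every $\gamma\in(0,1)$ there exists $\epsilon=\epsilon(\gamma)>0$ such that the following holds. Let $p$ be a sufficiently large prime, let $E\subseteq\mathbb{F}_p^2\setminus\{(0,0)\}$, and let $S$ be a symmetric subset of $SL_2(\mathbb{F}_p)$ with $p^\gamma<|S|<p^{3-2\gamma}$ and $|S\cap gH|<p^{ -\gamma/2}|S|$ for every proper subgroup $H\subsetneq SL_2(\mathbb{F}_p)$ and every $g\in SL_2(\mathbb{F}_p)$. Then \[|S(E)|\gg\min\left\{p^2,~\frac{|S|^{1/2}|E|}{p^{1-\frac{\epsilon}{2}}}\right\}.\] Moreover, if every line through the origin contains at most $k$ points of $E$, then \[|S(E)|\gg\min\left\{p^2,~\frac{|S|^{1/2}|E|}{p^{\frac{1-\epsilon}{2}}k^{1/2}}\right\}.\]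
   Context: $S$ symmetric means $S=S^{ -1}$. Matrices act on column vectors and $S(E)=\{\theta e:e\in E,\theta\in S\}$. A line through the origin is a one-dimensional subspace of $\mathbb{F}_p^2$. $X\gg Y$ means $X\ge cY$ for a constant $c>0$ independent of $p,E,S,k$. -}

module Defs where

open import Data.Nat using (ℕ; zero; suc; _+_; _*_; _∸_; _%_; _<_; _≤_; NonZero)
open import Data.Nat.DivMod using (m%n<n)
open import Data.Fin using (Fin; toℕ; fromℕ<)
import Data.Fin as F
open import Data.Bool using (Bool; true; false; _∧_; if_then_else_)
open import Data.List using (List; []; _∷_; allFin; cartesianProduct)
open import Data.Bool.ListAction using (any)
open import Data.Product using (_×_; _,_; Σ; ∃)
open import Relation.Binary.PropositionalEquality using (_≡_; _≢_)
open import Relation.Nullary.Decidable using (⌊_⌋)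

-- Finite subsets of a finite type are represented as Bool-valued predicates.
countB : {A : Set} → (A → Bool) → List A → ℕ
countB f [] = 0
countB f (x ∷ xs) = if f x then suc (countB f xs) else countB f xs

module _ (p : ℕ) .{{_ : NonZero p}} where

  Fp : Set
  Fp = Fin p

  red : ℕ → Fp
  red n = fromℕ< (m%n<n n p)

  _+F_ : Fp → Fp → Fp
  x +F y = red (toℕ x + toℕ y)

  _*F_ : Fp → Fp → Fp
  x *F y = red (toℕ x * toℕ y)

  -F_ : Fp → Fp
  -F x = red (p ∸ toℕ x)

  0F 1F : Fp
  0F = red 0
  1F = red 1

  _=F_ : Fp → Fp → Bool
  x =F y = ⌊ x F.≟ y ⌋

  allFp : List Fp
  allFp = allFin p

  Pt : Set
  Pt = Fp × Fp

  origin : Pt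
  origin = (0F , 0F)

  _=P_ : Pt → Pt → Bool
  (x , y) =P (x' , y') = (x =F x') ∧ (y =F y')

  allPts : List Pt
  allPts = cartesianProduct allFp allFp

  scale : Fp → Pt → Pt
  scale t (x , y) = (t *F x , t *F y)

  -- 2x2 matrices (a , b , c , d) = [[a , b] , [c , d]].
  Mat : Set
  Mat = Fp × Fp × Fp × Fp

  allMats : List Mat
  allMats = cartesianProduct allFp (cartesianProduct allFp (cartesianProduct allFp allFp))

  det : Mat → Fp
  det (a , b , c , d) = (a *F d) +F (-F (b *F c))

  isSL : Mat → Bool
  isSL θ = det θ =F 1F

  idM : Mat
  idM = (1F , 0F , 0F , 1F)

  mul : Mat → Mat → Mat
  mul (a , b , c , d) (a' , b' , c' , d') =
    ((a *F a') +F (b *F c') , (a *F b') +F (b *F d') ,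
     (c *F a') +F (d *F c') , (c *F b') +F (d *F d'))

  -- inverse of a determinant-one matrix
  inv : Mat → Mat
  inv (a , b , c , d) = (d , -F b , -F c , a)

  act : Mat → Pt → Pt
  act (a , b , c , d) (x , y) = ((a *F x) +F (b *F y) , (c *F x) +F (d *F y))

  SubsetSL : (Mat → Bool) → Set
  SubsetSL S = ∀ θ → S θ ≡ true → isSL θ ≡ true

  Symmetric : (Mat → Bool) → Set
  Symmetric S = ∀ θ → S θ ≡ true → S (inv θ) ≡ true

  IsSubgroup : (Mat → Bool) → Set
  IsSubgroup H = SubsetSL H × H idM ≡ true
    × (∀ x y → H x ≡ true → H y ≡ true → H (mul x y) ≡ true)
    × (∀ x → H x ≡ true → H (inv x) ≡ true)

  Proper : (Mat → Bool) → Set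
  Proper H = Σ Mat λ g → isSL g ≡ true × H g ≡ false

  cardM : (Mat → Bool) → ℕ
  cardM S = countB S allMats

  cardP : (Pt → Bool) → ℕ
  cardP E = countB E allPts

  -- |S ∩ gH|, where θ ∈ gH iff g⁻¹θ ∈ H
  cardSCoset : (Mat → Bool) → Mat → (Mat → Bool) → ℕ
  cardSCoset S g H = cardM (λ θ → S θ ∧ H (mul (inv g) θ))

  imageSet : (Mat → Bool) → (Pt → Bool) → Pt → Bool
  imageSet S E x = any (λ θ → S θ ∧ any (λ e → E e ∧ (act θ e =P x)) allPts) allMats

  onLine : (Pt → Bool) → Pt → ℕ
  onLine E v = cardP (λ x → E x ∧ any (λ t → x =P scale t v) allFp)

  LinesAtMost : (Pt → Bool) → ℕ → Set
  LinesAtMost E k = ∀ v → v ≢ origin → onLine E v ≤ k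

{-# OPTIONS --safe #-}
module Submission where

-- Let n = |S|, N = |E||A| with A = S(E), and let K be an integer close to p^ε. Two second-moment
-- bounds are combined. Counting pairs (e , a), (e' , a') in E × A with det (e , e') = det (a , a') as
-- orthogonal pairs for a symplectic form on F⁴, and using that dilations preserve orthogonality,
-- bounds the variance of g ↦ |gE ∩ A| over SL₂ by O(kpN). Applied to S itself this settles the
-- case n > Kp². Applied to the function r(g) = |{(s , t) ∈ S² : s⁻¹t = g}| and A = E it reduces
-- the remaining case to an energy gain Σ r² < n³/K.
--
-- If that gain fails, the Balog–Szemerédi–Gowers argument and a construction of Tao give a symmetric
-- set X with |X⁶| ≤ J|X|, J = K^O(1), which like S meets each coset of a proper subgroup in a small
-- proportion. Since three independent conditions tr(g hᵢ) = τ confine g to a line of matrices, whose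
-- intersection with SL₂ lies in a coset of a centralizer, X⁴ contains few elements of any given trace.
-- Hence conjugation of any u ∈ X² by X has large fibres: the centralizer of u meets X² in many
-- elements, and then so do its conjugates by X. For a regular t ∈ X the set of g for which g C(t) g⁻¹
-- has this property is therefore stable under X, and it is all of SL₂ because its stabilizer is a
-- subgroup containing X. Counting the elements of X² in all conjugates of the torus C(t) shows that
-- |X| is much larger than Kp², a contradiction.

-- Everything is counted in ℕ, so a deviation from a mean never appears as a difference: 2ab ≤ a² +
-- b² is applied with b one quantity and a the other one plus the mean of b, and equal main terms
-- cancel at the end. All losses between S and the contradiction are polynomial in K, hence only the
-- exponent M of their total matters. With γ = u/v, K is the integer part of p^(u/b) for b =
-- 2v(M+1); this keeps K^M below the saving p^(γ/2) that the coset hypothesis grants, and gives ε =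
-- u/b. The obstacle in the argument with tori is that conjugation by X leads from X² to X⁴, so that
-- powers of X would grow at each step. The way back rests on the fact that the centralizer of a
-- noncentral element of SL₂ is commutative: a torus may be recorded by any noncentral element in
-- it, and the conjugate torus again has one in X². X⁶ enters only because the incidence count over
-- X⁵ needs X⁵ itself to meet cosets in a small proportion.

-- Sums and cardinalities over finite types.

module Sums where

  open import Data.Nat hiding (_≟_)
  open import Data.Nat.Properties hiding (_≟_)
  open import Data.Bool using (Bool; true; false; _∧_)
  open import Data.List using (List; []; _∷_; cartesianProduct; map; _++_)
  open import Data.Product using (_×_; _,_; ∃; proj₁; proj₂)
  open import Data.Product.Properties using (≡-dec)
  open import Data.Sum using (_⊎_; inj₁; inj₂)
  open import Data.Empty using (⊥-elim)
  open import Relation.Binary.PropositionalEquality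
  open import Relation.Binary.Definitions using (DecidableEquality)
  open import Relation.Nullary using (Dec; yes; no; ¬_)
  open import Relation.Nullary.Decidable using (⌊_⌋; map′)
  open import Data.Nat.Tactic.RingSolver using (solve-∀)

  𝟙 : Bool → ℕ
  𝟙 true = 1
  𝟙 false = 0

  does⇒ : {P : Set} (d : Dec P) → ⌊ d ⌋ ≡ true → P
  does⇒ (yes p) _ = p

  does⇒¬ : {P : Set} (d : Dec P) → ⌊ d ⌋ ≡ false → ¬ P
  does⇒¬ (no p) _ = p

  ⇒does : {P : Set} (d : Dec P) → P → ⌊ d ⌋ ≡ true
  ⇒does (yes _) _ = refl
  ⇒does (no ¬p) p = ⊥-elim (¬p p)

  ⇒does¬ : {P : Set} (d : Dec P) → ¬ P → ⌊ d ⌋ ≡ false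
  ⇒does¬ (no _) _ = refl
  ⇒does¬ (yes p) ¬p = ⊥-elim (¬p p)

  ∧-fst : ∀ {a b} → a ∧ b ≡ true → a ≡ true
  ∧-fst {true} _ = refl

  ∧-snd : ∀ {a b} → a ∧ b ≡ true → b ≡ true
  ∧-snd {true} e = e

  ∧-intro : ∀ {a b} → a ≡ true → b ≡ true → a ∧ b ≡ true
  ∧-intro refl refl = refl

  𝟙-∧ : ∀ a b → 𝟙 (a ∧ b) ≡ 𝟙 a * 𝟙 b
  𝟙-∧ true b = sym (+-identityʳ _)
  𝟙-∧ false b = refl

  𝟙≤1 : ∀ b → 𝟙 b ≤ 1
  𝟙≤1 true = ≤-refl
  𝟙≤1 false = z≤n

  𝟙-idem : ∀ b → 𝟙 b * 𝟙 b ≡ 𝟙 b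
  𝟙-idem true = refl
  𝟙-idem false = refl

  𝟙* : ∀ b {m n} → (b ≡ true → m ≤ n) → 𝟙 b * m ≤ n
  𝟙* true h = ≤-trans (≤-reflexive (+-identityʳ _)) (h refl)
  𝟙* false h = z≤n

  𝟙≤ : ∀ b {n} → (b ≡ true → 1 ≤ n) → 𝟙 b ≤ n
  𝟙≤ true h = h refl
  𝟙≤ false h = z≤n

  𝟙*-cong : ∀ b {m n} → (b ≡ true → m ≡ n) → 𝟙 b * m ≡ 𝟙 b * n
  𝟙*-cong true h = cong (1 *_) (h refl)
  𝟙*-cong false h = refl

  𝟙*-mono : ∀ b {m n} → (b ≡ true → m ≤ n) → 𝟙 b * m ≤ 𝟙 b * n
  𝟙*-mono true h = *-monoʳ-≤ 1 (h refl)
  𝟙*-mono false h = z≤n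

  𝟙-mono : ∀ a b → (a ≡ true → b ≡ true) → 𝟙 a ≤ 𝟙 b
  𝟙-mono true b h rewrite h refl = ≤-refl
  𝟙-mono false b h = z≤n

  𝟙-cong : ∀ a b → (a ≡ true → b ≡ true) → (b ≡ true → a ≡ true) → 𝟙 a ≡ 𝟙 b
  𝟙-cong a b f g = ≤-antisym (𝟙-mono a b f) (𝟙-mono b a g)

  true-of-𝟙 : ∀ b → 1 ≤ 𝟙 b → b ≡ true
  true-of-𝟙 true _ = refl

  sumL : {A : Set} → List A → (A → ℕ) → ℕ
  sumL [] f = 0
  sumL (x ∷ xs) f = f x + sumL xs f

  module _ {A : Set} where

    sumL-cong : ∀ xs {f g : A → ℕ} → (∀ x → f x ≡ g x) → sumL xs f ≡ sumL xs g
    sumL-cong [] h = refl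
    sumL-cong (x ∷ xs) h = cong₂ _+_ (h x) (sumL-cong xs h)

    sumL-mono : ∀ xs {f g : A → ℕ} → (∀ x → f x ≤ g x) → sumL xs f ≤ sumL xs g
    sumL-mono [] h = z≤n
    sumL-mono (x ∷ xs) h = +-mono-≤ (h x) (sumL-mono xs h)

    sumL-0 : ∀ (xs : List A) → sumL xs (λ _ → 0) ≡ 0
    sumL-0 [] = refl
    sumL-0 (x ∷ xs) = sumL-0 xs

    sumL-+ : ∀ xs (f g : A → ℕ) → sumL xs (λ x → f x + g x) ≡ sumL xs f + sumL xs g
    sumL-+ [] f g = refl
    sumL-+ (x ∷ xs) f g = trans (cong (f x + g x +_) (sumL-+ xs f g)) (shuffle (f x) (g x) _ _)
      where
      shuffle : ∀ a b c d → a + b + (c + d) ≡ a + c + (b + d)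
      shuffle = solve-∀

    sumL-* : ∀ xs c (f : A → ℕ) → sumL xs (λ x → c * f x) ≡ c * sumL xs f
    sumL-* [] c f = sym (*-zeroʳ c)
    sumL-* (x ∷ xs) c f = trans (cong (c * f x +_) (sumL-* xs c f)) (sym (*-distribˡ-+ c _ _))

    sumL-++ : ∀ xs ys (f : A → ℕ) → sumL (xs ++ ys) f ≡ sumL xs f + sumL ys f
    sumL-++ [] ys f = refl
    sumL-++ (x ∷ xs) ys f = trans (cong (f x +_) (sumL-++ xs ys f)) (sym (+-assoc (f x) _ _))

  sumL-map : {A B : Set} (φ : A → B) (xs : List A) (f : B → ℕ) → sumL (map φ xs) f ≡ sumL xs (λ x → f (φ x))
  sumL-map φ [] f = refl
  sumL-map φ (x ∷ xs) f = cong (f (φ x) +_) (sumL-map φ xs f)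

  sumL-swap : {A B : Set} (xs : List A) (ys : List B) (f : A → B → ℕ) →
    sumL xs (λ x → sumL ys (f x)) ≡ sumL ys (λ y → sumL xs (λ x → f x y))
  sumL-swap [] ys f = sym (sumL-0 ys)
  sumL-swap (x ∷ xs) ys f = trans (cong (sumL ys (f x) +_) (sumL-swap xs ys f)) (sym (sumL-+ ys _ _))

  sumL-cartesian : {A B : Set} (xs : List A) (ys : List B) (f : A × B → ℕ) →
    sumL (cartesianProduct xs ys) f ≡ sumL xs (λ x → sumL ys (λ y → f (x , y)))
  sumL-cartesian [] ys f = refl
  sumL-cartesian (x ∷ xs) ys f = trans (sumL-++ (map (x ,_) ys) _ f)
    (cong₂ _+_ (sumL-map (x ,_) ys f) (sumL-cartesian xs ys f))

  -- `once` says at the same time that the list is complete and free of repetitions.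
  record Finite (A : Set) : Set where
    no-eta-equality
    infix 4 _≟_
    field
      elements : List A
      _≟_ : DecidableEquality A
      once : ∀ x → sumL elements (λ y → 𝟙 ⌊ x ≟ y ⌋) ≡ 1

  open Finite {{...}} public

  -- Opaque, so that unification never looks inside a sum.
  opaque

    ∑ : {A : Set} {{_ : Finite A}} → (A → ℕ) → ℕ
    ∑ = sumL elements

    ∑≡sumL : {A : Set} {{_ : Finite A}} (f : A → ℕ) → ∑ f ≡ sumL elements f
    ∑≡sumL f = refl

  module _ {A : Set} {{FA : Finite A}} where

    opaque
      unfolding ∑

      ∑-cong : {f g : A → ℕ} → (∀ x → f x ≡ g x) → ∑ f ≡ ∑ g
      ∑-cong = sumL-cong elements

      ∑-mono : {f g : A → ℕ} → (∀ x → f x ≤ g x) → ∑ f ≤ ∑ g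
      ∑-mono = sumL-mono elements

      ∑-+ : (f g : A → ℕ) → ∑ (λ x → f x + g x) ≡ ∑ f + ∑ g
      ∑-+ = sumL-+ elements

      ∑-*ˡ : ∀ c (f : A → ℕ) → ∑ (λ x → c * f x) ≡ c * ∑ f
      ∑-*ˡ = sumL-* elements

      ∑-0 : ∑ {A} (λ _ → 0) ≡ 0
      ∑-0 = sumL-0 elements

      ∑-<-witness : (f g : A → ℕ) → ∑ f < ∑ g → ∃ λ x → f x < g x
      ∑-<-witness f g = go elements
        where
        go : ∀ xs → sumL xs f < sumL xs g → ∃ λ x → f x < g x
        go (x ∷ xs) h with f x <? g x
        ... | yes fx<gx = x , fx<gx
        ... | no fx≮gx = go xs (+-cancelˡ-< (g x) _ _ (≤-<-trans (+-monoˡ-≤ _ (≮⇒≥ fx≮gx)) h))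

      ∑-single : ∀ (x : A) → ∑ (λ y → 𝟙 ⌊ x ≟ y ⌋) ≡ 1
      ∑-single = once

  module _ {A B : Set} {{FA : Finite A}} {{FB : Finite B}} where

    opaque
      unfolding ∑

      ∑-swap : (f : A → B → ℕ) → ∑ (λ x → ∑ (f x)) ≡ ∑ (λ y → ∑ (λ x → f x y))
      ∑-swap = sumL-swap elements elements

  infix 8 #_
  #_ : {A : Set} {{_ : Finite A}} → (A → Bool) → ℕ
  # U = ∑ λ x → 𝟙 (U x)

  module _ {A : Set} {{FA : Finite A}} where

    ∑-*ʳ : ∀ c (f : A → ℕ) → ∑ (λ x → f x * c) ≡ ∑ f * c
    ∑-*ʳ c f = trans (∑-cong λ x → *-comm (f x) c) (trans (∑-*ˡ c f) (*-comm c _))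

    δ : A → A → ℕ
    δ x y = 𝟙 ⌊ x ≟ y ⌋

    δ-refl : ∀ x → δ x x ≡ 1
    δ-refl x = cong 𝟙 (⇒does (x ≟ x) refl)

    δ-≢ : ∀ {x y} → x ≢ y → δ x y ≡ 0
    δ-≢ {x} {y} ne = cong 𝟙 (⇒does¬ (x ≟ y) ne)

    sift : ∀ x (f : A → ℕ) → ∑ (λ y → δ x y * f y) ≡ f x
    sift x f = trans (∑-cong pointwise) (trans (∑-*ˡ (f x) (δ x)) (trans (cong (f x *_) (∑-single x)) (*-identityʳ _)))
      where
      pointwise : ∀ y → δ x y * f y ≡ f x * δ x y
      pointwise y with x ≟ y
      ... | yes refl = *-comm 1 (f x)
      ... | no _ = sym (*-zeroʳ (f x))

    term≤∑ : (f : A → ℕ) (x : A) → f x ≤ ∑ f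
    term≤∑ f x = ≤-trans (≤-reflexive (sym (sift x f)))
      (∑-mono λ y → ≤-trans (*-monoˡ-≤ (f y) (𝟙≤1 ⌊ x ≟ y ⌋)) (≤-reflexive (+-identityʳ (f y))))

    #-witness : (U : A → Bool) → 0 < # U → ∃ λ x → U x ≡ true
    #-witness U h with ∑-<-witness (λ _ → 0) (λ x → 𝟙 (U x)) (subst (_< # U) (sym ∑-0) h)
    ... | x , 0<Ux = x , true-of-𝟙 (U x) 0<Ux

    #-pos : (U : A → Bool) {x : A} → U x ≡ true → 0 < # U
    #-pos U {x} Ux = ≤-trans (≤-reflexive (sym (cong 𝟙 Ux))) (term≤∑ _ x)

    #-mono : {U V : A → Bool} → (∀ x → U x ≡ true → V x ≡ true) → # U ≤ # V
    #-mono {U} {V} h = ∑-mono λ x → 𝟙-mono (U x) (V x) (h x)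

    #≤1 : (U : A → Bool) → (∀ x y → U x ≡ true → U y ≡ true → x ≡ y) → # U ≤ 1
    #≤1 U h with 0 <? # U
    ... | no e = ≤-trans (≮⇒≥ e) z≤n
    ... | yes pos with #-witness U pos
    ... | x , Ux = ≤-trans (∑-mono λ y → 𝟙≤ (U y) λ Uy → ≤-reflexive (sym (cong 𝟙 (⇒does (x ≟ y) (h x y Ux Uy))))) (≤-reflexive (∑-single x))

    #≤2 : (U : A → Bool) (a b : A) → (∀ x → U x ≡ true → x ≡ a ⊎ x ≡ b) → # U ≤ 2
    #≤2 U a b h = ≤-trans (∑-mono pointwise) (≤-reflexive (trans (∑-+ (δ a) (δ b)) (cong₂ _+_ (∑-single a) (∑-single b))))
      where
      pointwise : ∀ x → 𝟙 (U x) ≤ δ a x + δ b x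
      pointwise x = 𝟙≤ (U x) λ Ux → split (h x Ux)
        where
        split : x ≡ a ⊎ x ≡ b → 1 ≤ δ a x + δ b x
        split (inj₁ refl) = ≤-trans (≤-reflexive (sym (δ-refl x))) (m≤m+n _ _)
        split (inj₂ refl) = ≤-trans (≤-reflexive (sym (δ-refl x))) (m≤n+m _ _)

    opaque

      exists : (A → Bool) → Bool
      exists U = ⌊ 0 <? # U ⌋

      exists⇒ : (U : A → Bool) → exists U ≡ true → ∃ λ x → U x ≡ true
      exists⇒ U e = #-witness U (does⇒ (0 <? # U) e)

      ⇒exists : (U : A → Bool) {x : A} → U x ≡ true → exists U ≡ true
      ⇒exists U Ux = ⇒does (0 <? # U) (#-pos U Ux)

    exists-dec : (U : A → Bool) → (∃ λ x → U x ≡ true) ⊎ (∀ x → U x ≡ false)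
    exists-dec U with 0 <? # U
    ... | yes h = inj₁ (#-witness U h)
    ... | no ¬h = inj₂ none
      where
      none : ∀ x → U x ≡ false
      none x with U x in Ux
      ... | false = refl
      ... | true = ⊥-elim (¬h (#-pos U Ux))

    ≤∑-term : (f : A → ℕ) {m : ℕ} (x : A) → m ≤ f x → m ≤ ∑ f
    ≤∑-term f x h = ≤-trans h (term≤∑ f x)

  module _ {A B : Set} {{FA : Finite A}} {{FB : Finite B}} where

    ∑-reindex : (φ : A → B) (ψ : B → A) → (∀ x → ψ (φ x) ≡ x) → (∀ y → φ (ψ y) ≡ y) →
      (f : B → ℕ) → ∑ (λ x → f (φ x)) ≡ ∑ f
    ∑-reindex φ ψ ψφ φψ f = begin
      ∑ (λ x → f (φ x)) ≡⟨ ∑-cong (λ x → sym (sift (φ x) f)) ⟩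
      ∑ (λ x → ∑ (λ y → δ (φ x) y * f y)) ≡⟨ ∑-swap _ ⟩
      ∑ (λ y → ∑ (λ x → δ (φ x) y * f y)) ≡⟨ ∑-cong (λ y → trans (∑-*ʳ (f y) (λ x → δ (φ x) y)) (cong (_* f y) (fibre y))) ⟩
      ∑ (λ y → 1 * f y) ≡⟨ ∑-cong (λ y → *-identityˡ (f y)) ⟩
      ∑ f ∎
      where
      open ≡-Reasoning
      fibre : ∀ y → ∑ (λ x → δ (φ x) y) ≡ 1
      fibre y = trans (∑-cong λ x → 𝟙-cong ⌊ φ x ≟ y ⌋ ⌊ ψ y ≟ x ⌋
        (λ e → ⇒does (ψ y ≟ x) (trans (cong ψ (sym (does⇒ (φ x ≟ y) e))) (ψφ x)))
        (λ e → ⇒does (φ x ≟ y) (trans (cong φ (sym (does⇒ (ψ y ≟ x) e))) (φψ y)))) (∑-single (ψ y))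

    ∑-inject : (φ : A → B) (U : A → Bool) (V : B → Bool) →
      (∀ x → U x ≡ true → V (φ x) ≡ true) →
      (∀ x y → U x ≡ true → U y ≡ true → φ x ≡ φ y → x ≡ y) → # U ≤ # V
    ∑-inject φ U V into inj = begin
      # U ≤⟨ ∑-mono (λ x → 𝟙≤ (U x) λ Ux → ≤-reflexive (sym (trans (sift (φ x) _) (cong₂ (λ a b → 𝟙 a * 𝟙 b) Ux (into x Ux))))) ⟩
      ∑ (λ x → ∑ (λ y → δ (φ x) y * (𝟙 (U x) * 𝟙 (V y)))) ≡⟨ ∑-swap _ ⟩
      ∑ (λ y → ∑ (λ x → δ (φ x) y * (𝟙 (U x) * 𝟙 (V y)))) ≤⟨ ∑-mono column ⟩
      # V ∎
      where
      open ≤-Reasoning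
      column : ∀ y → ∑ (λ x → δ (φ x) y * (𝟙 (U x) * 𝟙 (V y))) ≤ 𝟙 (V y)
      column y = begin
        ∑ (λ x → δ (φ x) y * (𝟙 (U x) * 𝟙 (V y))) ≡⟨ ∑-cong (λ x → trans (sym (*-assoc (δ (φ x) y) _ _)) (cong (_* 𝟙 (V y)) (sym (𝟙-∧ ⌊ φ x ≟ y ⌋ (U x))))) ⟩
        ∑ (λ x → 𝟙 (⌊ φ x ≟ y ⌋ ∧ U x) * 𝟙 (V y)) ≡⟨ ∑-*ʳ (𝟙 (V y)) (λ x → 𝟙 (⌊ φ x ≟ y ⌋ ∧ U x)) ⟩
        # (λ x → ⌊ φ x ≟ y ⌋ ∧ U x) * 𝟙 (V y) ≤⟨ *-monoˡ-≤ (𝟙 (V y)) (#≤1 _ λ x x' e e' → inj x x' (∧-snd e) (∧-snd e')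
            (trans (does⇒ (φ x ≟ y) (∧-fst e)) (sym (does⇒ (φ x' ≟ y) (∧-fst e'))))) ⟩
        1 * 𝟙 (V y) ≡⟨ *-identityˡ _ ⟩
        𝟙 (V y) ∎

    -- A fibre that meets `U` is the fibre of one of its own points, so bounds at points of `U`
    -- suffice. The base point `x₀` is the origin by which the applications translate a fibre into a
    -- centralizer.
    fibre-bound : (φ : A → B) (U : A → Bool) (V : B → Bool) (f : ℕ) →
      (∀ x → U x ≡ true → V (φ x) ≡ true) →
      (∀ x₀ → U x₀ ≡ true → # (λ x → ⌊ φ x ≟ φ x₀ ⌋ ∧ U x) ≤ f) → # U ≤ # V * f
    fibre-bound φ U V f into fibres = begin
      # U ≡⟨ ∑-cong (λ x → sym (sift (φ x) (λ _ → 𝟙 (U x)))) ⟩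
      ∑ (λ x → ∑ λ y → δ (φ x) y * 𝟙 (U x)) ≡⟨ ∑-swap _ ⟩
      ∑ (λ y → ∑ λ x → δ (φ x) y * 𝟙 (U x)) ≤⟨ ∑-mono (λ y → ≤-trans (≤-reflexive (∑-cong λ x → sym (𝟙-∧ ⌊ φ x ≟ y ⌋ (U x)))) (column y (exists-dec (λ x → ⌊ φ x ≟ y ⌋ ∧ U x)))) ⟩
      ∑ (λ y → 𝟙 (V y) * f) ≡⟨ ∑-*ʳ f _ ⟩
      # V * f ∎
      where
      open ≤-Reasoning
      column : ∀ y → (∃ λ x → ⌊ φ x ≟ y ⌋ ∧ U x ≡ true) ⊎ (∀ x → ⌊ φ x ≟ y ⌋ ∧ U x ≡ false) → # (λ x → ⌊ φ x ≟ y ⌋ ∧ U x) ≤ 𝟙 (V y) * f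
      column y (inj₂ none) = ≤-trans (≤-reflexive (trans (∑-cong λ x → cong 𝟙 (none x)) ∑-0)) z≤n
      column y (inj₁ (x₀ , e)) with does⇒ (φ x₀ ≟ y) (∧-fst e)
      ... | refl = ≤-trans (fibres x₀ (∧-snd e)) (≤-reflexive (trans (sym (*-identityˡ f)) (cong (λ b → 𝟙 b * f) (sym (into x₀ (∧-snd e))))))

  -- The larger number is written as the smaller plus `c`, since ℕ has no differences; the two sides
  -- then differ by `c * c`.
  2ab≤a²+b² : ∀ a b → 2 * (a * b) ≤ a * a + b * b
  2ab≤a²+b² a b with ≤-total a b
  ... | inj₁ a≤b = ordered a (b ∸ a) b (m+[n∸m]≡n a≤b)
    where
    ordered : ∀ a c b → a + c ≡ b → 2 * (a * b) ≤ a * a + b * b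
    ordered a c _ refl = ≤-trans (m≤m+n _ (c * c)) (≤-reflexive (expand a c))
      where
      expand : ∀ a c → 2 * (a * (a + c)) + c * c ≡ a * a + (a + c) * (a + c)
      expand = solve-∀
  ... | inj₂ b≤a = ordered b (a ∸ b) a (m+[n∸m]≡n b≤a)
    where
    ordered : ∀ b c a → b + c ≡ a → 2 * (a * b) ≤ a * a + b * b
    ordered b c _ refl = ≤-trans (m≤m+n _ (c * c)) (≤-reflexive (expand b c))
      where
      expand : ∀ b c → 2 * ((b + c) * b) + c * c ≡ (b + c) * (b + c) + b * b
      expand = solve-∀

  -- Twice the square of the sum, expanded over pairs (x , y), has the terms 2 (f x g y)(g x f y),
  -- to which `2ab≤a²+b²` applies; no root or division occurs.
  cauchy : {A : Set} {{_ : Finite A}} (f g : A → ℕ) →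
    ∑ (λ x → f x * g x) * ∑ (λ x → f x * g x) ≤ ∑ (λ x → f x * f x) * ∑ (λ x → g x * g x)
  cauchy {A} f g = *-cancelˡ-≤ 2 (begin
    2 * (s * s) ≡⟨ cong (2 *_) (product _ _) ⟩
    2 * ∑ (λ x → ∑ (λ y → f x * g x * (f y * g y))) ≡⟨ sym (∑-*ˡ 2 _) ⟩
    ∑ (λ x → 2 * ∑ (λ y → f x * g x * (f y * g y))) ≡⟨ ∑-cong (λ x → sym (∑-*ˡ 2 _)) ⟩
    ∑ (λ x → ∑ (λ y → 2 * (f x * g x * (f y * g y)))) ≤⟨ ∑-mono (λ x → ∑-mono λ y → pointwise (f x) (g x) (f y) (g y)) ⟩
    ∑ (λ x → ∑ (λ y → f x * f x * (g y * g y) + g x * g x * (f y * f y))) ≡⟨ ∑-cong (λ x → ∑-+ _ _) ⟩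
    ∑ (λ x → ∑ (λ y → f x * f x * (g y * g y)) + ∑ (λ y → g x * g x * (f y * f y))) ≡⟨ ∑-+ _ _ ⟩
    ∑ (λ x → ∑ (λ y → f x * f x * (g y * g y))) + ∑ (λ x → ∑ (λ y → g x * g x * (f y * f y))) ≡⟨ cong₂ _+_ (sym (product _ _)) (sym (product _ _)) ⟩
    F * G + G * F ≡⟨ double F G ⟩
    2 * (F * G) ∎)
    where
    open ≤-Reasoning
    s = ∑ (λ x → f x * g x)
    F = ∑ (λ x → f x * f x)
    G = ∑ (λ x → g x * g x)
    product : (f g : A → ℕ) → ∑ f * ∑ g ≡ ∑ (λ x → ∑ (λ y → f x * g y))
    product f g = trans (sym (∑-*ʳ (∑ g) f)) (∑-cong λ x → sym (∑-*ˡ (f x) g))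
    double : ∀ a b → a * b + b * a ≡ 2 * (a * b)
    double = solve-∀
    pointwise : ∀ a b c d → 2 * (a * b * (c * d)) ≤ a * a * (d * d) + b * b * (c * c)
    pointwise a b c d = ≤-trans (≤-reflexive (lhs a b c d)) (≤-trans (2ab≤a²+b² (a * d) (b * c)) (≤-reflexive (rhs a b c d)))
      where
      lhs : ∀ a b c d → 2 * (a * b * (c * d)) ≡ 2 * (a * d * (b * c))
      lhs = solve-∀
      rhs : ∀ a b c d → a * d * (a * d) + b * c * (b * c) ≡ a * a * (d * d) + b * b * (c * c)
      rhs = solve-∀

  ∑-product : {A B : Set} {{_ : Finite A}} {{_ : Finite B}} (f : A → ℕ) (g : B → ℕ) →
    ∑ f * ∑ g ≡ ∑ (λ x → ∑ (λ y → f x * g y))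
  ∑-product f g = trans (sym (∑-*ʳ (∑ g) f)) (∑-cong λ x → sym (∑-*ˡ (f x) g))

  -- An indicator equals its square, so one factor of Cauchy-Schwarz becomes the size of `U`. In
  -- this form mass on a small set forces a large second moment.
  cauchy-# : {A : Set} {{_ : Finite A}} (U : A → Bool) (g : A → ℕ) →
    ∑ (λ x → 𝟙 (U x) * g x) * ∑ (λ x → 𝟙 (U x) * g x) ≤ # U * ∑ (λ x → 𝟙 (U x) * (g x * g x))
  cauchy-# U g = begin
    ∑ (λ x → 𝟙 (U x) * g x) * ∑ (λ x → 𝟙 (U x) * g x) ≡⟨ cong (λ s → s * s) (∑-cong λ x → trans (cong (_* g x) (sym (𝟙-idem (U x)))) (*-assoc (𝟙 (U x)) _ _)) ⟩
    ∑ (λ x → 𝟙 (U x) * (𝟙 (U x) * g x)) * ∑ (λ x → 𝟙 (U x) * (𝟙 (U x) * g x)) ≤⟨ cauchy (λ x → 𝟙 (U x)) _ ⟩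
    ∑ (λ x → 𝟙 (U x) * 𝟙 (U x)) * ∑ (λ x → 𝟙 (U x) * g x * (𝟙 (U x) * g x)) ≡⟨ cong₂ _*_ (∑-cong λ x → 𝟙-idem (U x)) (∑-cong λ x → trans (rearrange (𝟙 (U x)) (g x)) (cong (_* (g x * g x)) (𝟙-idem (U x)))) ⟩
    # U * ∑ (λ x → 𝟙 (U x) * (g x * g x)) ∎
    where
    open ≤-Reasoning
    rearrange : ∀ u g → u * g * (u * g) ≡ u * u * (g * g)
    rearrange = solve-∀

  opaque

    Finite-×′ : {A B : Set} {{_ : Finite A}} {{_ : Finite B}} → Finite (A × B)
    Finite-×′ {A} {B} {{FA}} {{FB}} = record
      { elements = cartesianProduct elements elements
      ; _≟_ = ≡-dec _≟_ _≟_
      ; once = λ { (a , b) → trans (sumL-cartesian (elements {{FA}}) (elements {{FB}}) _)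
          (trans (trans (sumL-cong (elements {{FA}}) λ x → trans (sumL-cong (elements {{FB}}) λ y → split a b x y) (sym (∑≡sumL _))) (sym (∑≡sumL _)))
          (trans (sym (∑-product (δ a) (δ b))) (cong₂ _*_ (∑-single a) (∑-single b)))) }
      }
      where
      split : ∀ a b x y → 𝟙 ⌊ ≡-dec (_≟_ {{FA}}) (_≟_ {{FB}}) (a , b) (x , y) ⌋ ≡ δ a x * δ b y
      split a b x y = trans (𝟙-cong ⌊ dec ⌋ (⌊ a ≟ x ⌋ ∧ ⌊ b ≟ y ⌋)
        (λ e → ∧-intro (⇒does (a ≟ x) (cong proj₁ (does⇒ dec e))) (⇒does (b ≟ y) (cong proj₂ (does⇒ dec e))))
        (λ e → ⇒does dec (cong₂ _,_ (does⇒ (a ≟ x) (∧-fst e)) (does⇒ (b ≟ y) (∧-snd e)))))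
        (𝟙-∧ ⌊ a ≟ x ⌋ ⌊ b ≟ y ⌋)
        where
        dec : Dec ((a , b) ≡ (x , y))
        dec = ≡-dec (_≟_ {{FA}}) (_≟_ {{FB}}) (a , b) (x , y)

    elements-× : {A B : Set} {{FA : Finite A}} {{FB : Finite B}} →
      elements {{Finite-×′ {A} {B}}} ≡ cartesianProduct (elements {{FA}}) (elements {{FB}})
    elements-× = refl

  instance
    Finite-× : {A B : Set} {{_ : Finite A}} {{_ : Finite B}} → Finite (A × B)
    Finite-× = Finite-×′

  isYes-map′ : {P Q : Set} {f : P → Q} {g : Q → P} (d : Dec P) → 𝟙 ⌊ map′ f g d ⌋ ≡ 𝟙 ⌊ d ⌋
  isYes-map′ (yes _) = refl
  isYes-map′ (no _) = refl

  Finite-bijection : {A B : Set} {{_ : Finite A}} (φ : A → B) (ψ : B → A) →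
    (∀ y → φ (ψ y) ≡ y) → (∀ x → ψ (φ x) ≡ x) → Finite B
  Finite-bijection φ ψ φψ ψφ = record
    { elements = map φ elements
    ; _≟_ = λ y y' → map′ (λ e → trans (sym (φψ y)) (trans (cong φ e) (φψ y'))) (cong ψ) (ψ y ≟ ψ y')
    ; once = λ y → trans (sumL-map φ elements _) (trans (sumL-cong elements λ x →
        trans (isYes-map′ (ψ y ≟ ψ (φ x))) (cong (λ z → 𝟙 ⌊ ψ y ≟ z ⌋) (ψφ x))) (once (ψ y)))
    }

  opaque
    unfolding ∑ Finite-×′

    ∑-× : {A B : Set} {{_ : Finite A}} {{_ : Finite B}} (f : A × B → ℕ) → ∑ f ≡ ∑ (λ x → ∑ (λ y → f (x , y)))
    ∑-× {{FA}} {{FB}} = sumL-cartesian (elements {{FA}}) (elements {{FB}})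

  -- A copy of A × B without η, which is much cheaper for unification.
  data Pair (A B : Set) : Set where
    _,,_ : A → B → Pair A B

  fst : {A B : Set} → Pair A B → A
  fst (a ,, b) = a

  snd : {A B : Set} → Pair A B → B
  snd (a ,, b) = b

  opaque

    Finite-Pair′ : {A B : Set} {{_ : Finite A}} {{_ : Finite B}} → Finite (Pair A B)
    Finite-Pair′ {A} {B} = Finite-bijection {A × B} (λ { (a , b) → a ,, b }) (λ { (a ,, b) → (a , b) }) (λ { (a ,, b) → refl }) (λ _ → refl)

  instance
    Finite-Pair : {A B : Set} {{_ : Finite A}} {{_ : Finite B}} → Finite (Pair A B)
    Finite-Pair = Finite-Pair′

  opaque
    unfolding ∑ Finite-×′ Finite-Pair′

    ∑-Pair : {A B : Set} {{_ : Finite A}} {{_ : Finite B}} (f : Pair A B → ℕ) → ∑ f ≡ ∑ (λ a → ∑ (λ b → f (a ,, b)))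
    ∑-Pair {A} {B} {{FA}} {{FB}} f = trans (sumL-map _ (cartesianProduct (elements {{FA}}) (elements {{FB}})) f) (sumL-cartesian (elements {{FA}}) (elements {{FB}}) _)

-- Counting in finite groups and the Balog-Szemerédi-Gowers argument.

module GroupEnergy where

  open Sums
  open import Data.Nat hiding (_≟_)
  open import Data.Nat.Properties hiding (_≟_)
  open import Data.Bool using (Bool; true; false; _∧_; not)
  open import Data.Product using (_×_; _,_; ∃)
  open import Relation.Binary.PropositionalEquality
  open import Relation.Nullary.Decidable using (⌊_⌋)
  open import Data.Nat.Tactic.RingSolver using (solve-∀)
  open import Algebra.Structures using (IsGroup)
  open import Algebra.Bundles using (Group)
  open import Level using (0ℓ)
  import Algebra.Properties.Group

  record FiniteGroup : Set₁ where
    infixl 7 _∙_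
    infix 8 _⁻¹
    field
      G : Set
      _∙_ : G → G → G
      ε : G
      _⁻¹ : G → G
      isGroup : IsGroup _≡_ _∙_ ε _⁻¹
      finite : Finite G

    group : Group 0ℓ 0ℓ
    group = record { isGroup = isGroup }

  module GroupSums (𝔾 : FiniteGroup) where
    open FiniteGroup 𝔾 public
    open IsGroup isGroup public using (assoc; identityˡ; identityʳ; inverseˡ; inverseʳ)
    open Algebra.Properties.Group group public using (⁻¹-involutive; ⁻¹-anti-homo-∙; ∙-cancelˡ; ∙-cancelʳ; ε⁻¹≈ε)

    instance
      Finite-G : Finite G
      Finite-G = finite

    x∙x⁻¹y : ∀ x y → x ∙ (x ⁻¹ ∙ y) ≡ y
    x∙x⁻¹y x y = trans (sym (assoc x _ y)) (trans (cong (_∙ y) (inverseʳ x)) (identityˡ y))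

    x⁻¹∙xy : ∀ x y → x ⁻¹ ∙ (x ∙ y) ≡ y
    x⁻¹∙xy x y = trans (sym (assoc _ x y)) (trans (cong (_∙ y) (inverseˡ x)) (identityˡ y))

    xy∙y⁻¹ : ∀ x y → x ∙ y ∙ y ⁻¹ ≡ x
    xy∙y⁻¹ x y = trans (assoc x y _) (trans (cong (x ∙_) (inverseʳ y)) (identityʳ x))

    xy⁻¹∙y : ∀ x y → x ∙ y ⁻¹ ∙ y ≡ x
    xy⁻¹∙y x y = trans (assoc x _ y) (trans (cong (x ∙_) (inverseˡ y)) (identityʳ x))

    x⁻¹y⁻¹ : ∀ x y → (x ⁻¹ ∙ y) ⁻¹ ≡ y ⁻¹ ∙ x
    x⁻¹y⁻¹ x y = trans (⁻¹-anti-homo-∙ _ y) (cong (y ⁻¹ ∙_) (⁻¹-involutive x))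

    xy⁻¹⁻¹ : ∀ x y → (x ∙ y ⁻¹) ⁻¹ ≡ y ∙ x ⁻¹
    xy⁻¹⁻¹ x y = trans (⁻¹-anti-homo-∙ x _) (cong (_∙ x ⁻¹) (⁻¹-involutive y))

    telescope⁻¹ : ∀ a b c → (a ⁻¹ ∙ b) ⁻¹ ∙ (a ⁻¹ ∙ c) ≡ b ⁻¹ ∙ c
    telescope⁻¹ a b c = trans (cong (_∙ (a ⁻¹ ∙ c)) (x⁻¹y⁻¹ a b)) (trans (assoc _ a _) (cong (b ⁻¹ ∙_) (x∙x⁻¹y a c)))

    ∑-translateˡ : ∀ g (f : G → ℕ) → ∑ (λ x → f (g ∙ x)) ≡ ∑ f
    ∑-translateˡ g = ∑-reindex (g ∙_) (g ⁻¹ ∙_) (x⁻¹∙xy g) (x∙x⁻¹y g)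

    ∑-translateʳ : ∀ g (f : G → ℕ) → ∑ (λ x → f (x ∙ g)) ≡ ∑ f
    ∑-translateʳ g = ∑-reindex (_∙ g) (_∙ g ⁻¹) (λ x → xy∙y⁻¹ x g) (λ x → xy⁻¹∙y x g)

    ∑-inverse : (f : G → ℕ) → ∑ (λ x → f (x ⁻¹)) ≡ ∑ f
    ∑-inverse = ∑-reindex _⁻¹ _⁻¹ ⁻¹-involutive ⁻¹-involutive

    -- Representations x = a⁻¹ b with a in `U` and b in `V`. For `U` = `V` = `S` this is the
    -- function r of the overview, and its second moment is the energy.
    corr : (G → Bool) → (G → Bool) → G → ℕ
    corr U V x = ∑ λ a → 𝟙 (U a) * 𝟙 (V (a ∙ x))

    -- Representations t = d w with d in `U` and w in `V`.
    conv : (G → Bool) → (G → Bool) → G → ℕ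
    conv U V t = ∑ λ d → 𝟙 (U d) * 𝟙 (V (d ⁻¹ ∙ t))

    ∑-corr : ∀ U V → ∑ (corr U V) ≡ # U * # V
    ∑-corr U V = begin
      ∑ (λ x → ∑ λ a → 𝟙 (U a) * 𝟙 (V (a ∙ x))) ≡⟨ ∑-swap _ ⟩
      ∑ (λ a → ∑ λ x → 𝟙 (U a) * 𝟙 (V (a ∙ x))) ≡⟨ ∑-cong (λ a → trans (∑-*ˡ (𝟙 (U a)) _) (cong (𝟙 (U a) *_) (∑-translateˡ a (λ x → 𝟙 (V x))))) ⟩
      ∑ (λ a → 𝟙 (U a) * # V) ≡⟨ ∑-*ʳ (# V) _ ⟩
      # U * # V ∎
      where open ≡-Reasoning

    ∑-conv : ∀ U V → ∑ (conv U V) ≡ # U * # V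
    ∑-conv U V = begin
      ∑ (λ x → ∑ λ a → 𝟙 (U a) * 𝟙 (V (a ⁻¹ ∙ x))) ≡⟨ ∑-swap _ ⟩
      ∑ (λ a → ∑ λ x → 𝟙 (U a) * 𝟙 (V (a ⁻¹ ∙ x))) ≡⟨ ∑-cong (λ a → trans (∑-*ˡ (𝟙 (U a)) _) (cong (𝟙 (U a) *_) (∑-translateˡ (a ⁻¹) (λ x → 𝟙 (V x))))) ⟩
      ∑ (λ a → 𝟙 (U a) * # V) ≡⟨ ∑-*ʳ (# V) _ ⟩
      # U * # V ∎
      where open ≡-Reasoning

    corr≤ : ∀ U V x → corr U V x ≤ # U
    corr≤ U V x = ∑-mono λ a → ≤-trans (*-monoʳ-≤ (𝟙 (U a)) (𝟙≤1 _)) (≤-reflexive (*-identityʳ _))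

    corr-inverse : ∀ U V x → corr U V (x ⁻¹) ≡ corr V U x
    corr-inverse U V x = trans (sym (∑-translateʳ x _)) (∑-cong λ a →
      trans (cong (λ y → 𝟙 (U (a ∙ x)) * 𝟙 (V y)) (xy∙y⁻¹ a x)) (*-comm (𝟙 (U (a ∙ x))) _))

    -- Every element of `T` uses at least m/c of the |U||V| products, and different elements use
    -- different ones. Popularity is turned into an upper bound for a set in this way several times
    -- below.
    conv-bound : ∀ (T U V : G → Bool) c m → (∀ t → T t ≡ true → m ≤ c * conv U V t) → # T * m ≤ c * (# U * # V)
    conv-bound T U V c m h = begin
      # T * m ≡⟨ sym (∑-*ʳ m _) ⟩
      ∑ (λ t → 𝟙 (T t) * m) ≤⟨ ∑-mono (λ t → 𝟙* (T t) (h t)) ⟩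
      ∑ (λ t → c * conv U V t) ≡⟨ trans (∑-*ˡ c _) (cong (c *_) (∑-conv U V)) ⟩
      c * (# U * # V) ∎
      where open ≤-Reasoning

    -- A ∖ W is the product set A⁻¹ W, not a difference of sets.
    infixr 7 _∖_ _·_
    _∖_ : (G → Bool) → (G → Bool) → G → Bool
    (A ∖ W) t = exists λ a → A a ∧ W (a ∙ t)

    ∖-intro : ∀ {A W a w} → A a ≡ true → W w ≡ true → (A ∖ W) (a ⁻¹ ∙ w) ≡ true
    ∖-intro {A} {W} {a} {w} Aa Ww = ⇒exists _ {a} (∧-intro Aa (trans (cong W (x∙x⁻¹y a w)) Ww))

    ∖-elim : ∀ {A W t} → (A ∖ W) t ≡ true → ∃ λ a → ∃ λ w → A a ≡ true × W w ≡ true × t ≡ a ⁻¹ ∙ w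
    ∖-elim {A} {W} {t} h with exists⇒ _ h
    ... | a , e = a , a ∙ t , ∧-fst e , ∧-snd e , sym (x⁻¹∙xy a t)

    _·_ : (G → Bool) → (G → Bool) → G → Bool
    (U · V) t = exists λ u → U u ∧ V (u ⁻¹ ∙ t)

    ·-intro : ∀ {U V u v} → U u ≡ true → V v ≡ true → (U · V) (u ∙ v) ≡ true
    ·-intro {U} {V} {u} {v} Uu Vv = ⇒exists _ {u} (∧-intro Uu (trans (cong V (x⁻¹∙xy u v)) Vv))

    ·-elim : ∀ {U V t} → (U · V) t ≡ true → ∃ λ u → ∃ λ v → U u ≡ true × V v ≡ true × t ≡ u ∙ v
    ·-elim {U} {V} {t} h with exists⇒ _ h
    ... | u , e = u , u ⁻¹ ∙ t , ∧-fst e , ∧-snd e , sym (x∙x⁻¹y u t)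

    infixl 7 _^^_
    _^^_ : G → G → G
    g ^^ y = y ∙ g ∙ y ⁻¹

    conj-∙ : ∀ g h y → (g ∙ h) ^^ y ≡ (g ^^ y) ∙ (h ^^ y)
    conj-∙ g h y = sym (begin
      (y ∙ g ∙ y ⁻¹) ∙ (y ∙ h ∙ y ⁻¹) ≡⟨ assoc (y ∙ g) (y ⁻¹) _ ⟩
      y ∙ g ∙ (y ⁻¹ ∙ (y ∙ h ∙ y ⁻¹)) ≡⟨ cong (λ z → y ∙ g ∙ (y ⁻¹ ∙ z)) (assoc y h _) ⟩
      y ∙ g ∙ (y ⁻¹ ∙ (y ∙ (h ∙ y ⁻¹))) ≡⟨ cong (y ∙ g ∙_) (x⁻¹∙xy y _) ⟩
      y ∙ g ∙ (h ∙ y ⁻¹) ≡⟨ sym (assoc (y ∙ g) h _) ⟩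
      y ∙ g ∙ h ∙ y ⁻¹ ≡⟨ cong (_∙ y ⁻¹) (assoc y g h) ⟩
      y ∙ (g ∙ h) ∙ y ⁻¹ ∎)
      where open ≡-Reasoning

    conj-commute : ∀ {g h} y → g ∙ h ≡ h ∙ g → (g ^^ y) ∙ (h ^^ y) ≡ (h ^^ y) ∙ (g ^^ y)
    conj-commute {g} {h} y e = trans (sym (conj-∙ g h y)) (trans (cong (_^^ y) e) (conj-∙ h g y))

    conj-conj : ∀ g x y → (g ^^ x) ^^ y ≡ g ^^ (y ∙ x)
    conj-conj g x y = begin
      y ∙ (x ∙ g ∙ x ⁻¹) ∙ y ⁻¹ ≡⟨ cong (_∙ y ⁻¹) (trans (sym (assoc y _ _)) (cong (_∙ x ⁻¹) (sym (assoc y x g)))) ⟩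
      y ∙ x ∙ g ∙ x ⁻¹ ∙ y ⁻¹ ≡⟨ assoc _ _ _ ⟩
      y ∙ x ∙ g ∙ (x ⁻¹ ∙ y ⁻¹) ≡⟨ cong (y ∙ x ∙ g ∙_) (sym (⁻¹-anti-homo-∙ y x)) ⟩
      y ∙ x ∙ g ∙ (y ∙ x) ⁻¹ ∎
      where open ≡-Reasoning

    conj-ε : ∀ g → g ^^ ε ≡ g
    conj-ε g = trans (cong (ε ∙ g ∙_) ε⁻¹≈ε) (trans (identityʳ _) (identityˡ g))

    unconj : ∀ g y → (g ^^ y) ^^ (y ⁻¹) ≡ g
    unconj g y = trans (conj-conj g y (y ⁻¹)) (trans (cong (g ^^_) (inverseˡ y)) (conj-ε g))

    -- The fibres of g ↦ t ^^ g are left cosets of the centralizer of t.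
    conj-≡⇒commute : ∀ h g t → t ^^ g ≡ t ^^ h → (h ⁻¹ ∙ g) ∙ t ≡ t ∙ (h ⁻¹ ∙ g)
    conj-≡⇒commute h g t e = trans (sym (xy⁻¹∙y (h ⁻¹ ∙ g ∙ t) (h ⁻¹ ∙ g))) (cong (_∙ (h ⁻¹ ∙ g)) (trans (sym (conj-conj t g (h ⁻¹))) (trans (cong (_^^ (h ⁻¹)) e) (unconj t h))))

  *-cancelˡ-≤-pos : ∀ {k m n} → 0 < k → k * m ≤ k * n → m ≤ n
  *-cancelˡ-≤-pos {suc k} _ = *-cancelˡ-≤ (suc k)

  *-cancelʳ-≤-pos : ∀ {k m n} → 0 < k → m * k ≤ n * k → m ≤ n
  *-cancelʳ-≤-pos {suc k} {m} {n} _ = *-cancelʳ-≤ m n (suc k)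

  -- The Balog–Szemerédi–Gowers argument.
  module Energy (𝔾 : FiniteGroup) where
    open GroupSums 𝔾

    module Rich (S : G → Bool) (K : ℕ) (n>0 : 0 < # S)
      (rich : # S * (# S * # S) ≤ K * ∑ (λ x → corr S S x * corr S S x)) where

      n : ℕ
      n = # S

      R : G → ℕ
      R = corr S S

      -- The thresholds are opaque because case distinctions would otherwise normalise them.
      opaque

        -- Popular quotients, with at least n/(2K) representations. They define a graph on `S` that
        -- joins a to v when a⁻¹ v is popular; `e` is its number of edges, `deg` and `codeg` count
        -- neighbours and common neighbours.
        P : G → Bool
        P x = ⌊ n ≤? 2 * K * R x ⌋

        P⇒ : ∀ x → P x ≡ true → n ≤ 2 * K * R x
        P⇒ x = does⇒ (n ≤? _)

        ¬P⇒ : ∀ x → P x ≡ false → 2 * K * R x ≤ n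
        ¬P⇒ x h = <⇒≤ (≰⇒> (does⇒¬ (n ≤? _) h))

        P-inverse : ∀ x → P (x ⁻¹) ≡ P x
        P-inverse x = cong (λ r → ⌊ n ≤? 2 * K * r ⌋) (corr-inverse S S x)

      #P : # P ≤ 2 * K * n
      #P = *-cancelʳ-≤-pos n>0 (begin
        # P * n ≡⟨ sym (∑-*ʳ n _) ⟩
        ∑ (λ x → 𝟙 (P x) * n) ≤⟨ ∑-mono (λ x → 𝟙* (P x) (P⇒ x)) ⟩
        ∑ (λ x → 2 * K * R x) ≡⟨ ∑-*ˡ (2 * K) R ⟩
        2 * K * ∑ R ≡⟨ cong (2 * K *_) (∑-corr S S) ⟩
        2 * K * (n * n) ≡⟨ sym (*-assoc (2 * K) n n) ⟩
        2 * K * n * n ∎)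
        where open ≤-Reasoning

      e : ℕ
      e = ∑ λ x → 𝟙 (P x) * R x

      -- Quotients outside `P` contribute at most (n/2K) Σ R = n³/2K, half of the energy. The other
      -- half comes from `P`, where R ≤ n, so `P` carries at least n²/2K of the mass of R.
      many-edges : n * n ≤ 2 * K * e
      many-edges = *-cancelˡ-≤-pos n>0 (+-cancelʳ-≤ (n * (n * n)) _ _ (begin
        n * (n * n) + n * (n * n) ≤⟨ +-mono-≤ rich rich ⟩
        K * E + K * E ≡⟨ double K E ⟩
        2 * K * E ≡⟨ sym (∑-*ˡ (2 * K) _) ⟩
        ∑ (λ x → 2 * K * (R x * R x)) ≤⟨ ∑-mono pointwise ⟩
        ∑ (λ x → n * (2 * K) * (𝟙 (P x) * R x) + n * R x) ≡⟨ trans (∑-+ _ _) (cong₂ _+_ (∑-*ˡ (n * (2 * K)) _) (∑-*ˡ n R)) ⟩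
        n * (2 * K) * e + n * ∑ R ≡⟨ cong₂ _+_ (*-assoc n _ e) (cong (n *_) (∑-corr S S)) ⟩
        n * (2 * K * e) + n * (n * n) ∎))
        where
        open ≤-Reasoning
        E = ∑ λ x → R x * R x
        double : ∀ k m → k * m + k * m ≡ 2 * k * m
        double = solve-∀
        pointwise : ∀ x → 2 * K * (R x * R x) ≤ n * (2 * K) * (𝟙 (P x) * R x) + n * R x
        pointwise x with P x in Px
        ... | true = ≤-trans (*-monoʳ-≤ (2 * K) (*-monoˡ-≤ (R x) (corr≤ S S x)))
          (≤-trans (≤-reflexive (rearrange K n (R x))) (m≤m+n _ _))
          where
          rearrange : ∀ k n r → 2 * k * (n * r) ≡ n * (2 * k) * (1 * r)
          rearrange = solve-∀
        ... | false = ≤-trans (≤-reflexive (sym (*-assoc (2 * K) (R x) (R x))))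
          (≤-trans (*-monoˡ-≤ (R x) (¬P⇒ x Px)) (m≤n+m (n * R x) (n * (2 * K) * (0 * R x))))

      deg : G → ℕ
      deg v = ∑ λ a → 𝟙 (S a) * 𝟙 (P (a ⁻¹ ∙ v))

      ∑deg : ∑ (λ v → 𝟙 (S v) * deg v) ≡ e
      ∑deg = begin
        ∑ (λ v → 𝟙 (S v) * deg v) ≡⟨ ∑-cong (λ v → sym (∑-*ˡ (𝟙 (S v)) _)) ⟩
        ∑ (λ v → ∑ λ a → 𝟙 (S v) * (𝟙 (S a) * 𝟙 (P (a ⁻¹ ∙ v)))) ≡⟨ ∑-swap _ ⟩
        ∑ (λ a → ∑ λ v → 𝟙 (S v) * (𝟙 (S a) * 𝟙 (P (a ⁻¹ ∙ v)))) ≡⟨ ∑-cong (λ a → sym (∑-translateˡ a _)) ⟩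
        ∑ (λ a → ∑ λ x → 𝟙 (S (a ∙ x)) * (𝟙 (S a) * 𝟙 (P (a ⁻¹ ∙ (a ∙ x))))) ≡⟨ ∑-swap _ ⟩
        ∑ (λ x → ∑ λ a → 𝟙 (S (a ∙ x)) * (𝟙 (S a) * 𝟙 (P (a ⁻¹ ∙ (a ∙ x))))) ≡⟨ ∑-cong (λ x → ∑-cong λ a →
            trans (cong (λ y → 𝟙 (S (a ∙ x)) * (𝟙 (S a) * 𝟙 (P y))) (x⁻¹∙xy a x)) (rearrange (𝟙 (S (a ∙ x))) (𝟙 (S a)) (𝟙 (P x)))) ⟩
        ∑ (λ x → ∑ λ a → 𝟙 (P x) * (𝟙 (S a) * 𝟙 (S (a ∙ x)))) ≡⟨ ∑-cong (λ x → ∑-*ˡ (𝟙 (P x)) _) ⟩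
        e ∎
        where
        open ≡-Reasoning
        rearrange : ∀ a b c → a * (b * c) ≡ c * (b * a)
        rearrange = solve-∀

      deg² : ℕ
      deg² = ∑ λ v → 𝟙 (S v) * (deg v * deg v)

      -- Cauchy-Schwarz for the degrees: a dense graph has many paths a, v, b of length two.
      many-cherries : n * (n * n) ≤ 4 * (K * K) * deg²
      many-cherries = *-cancelˡ-≤-pos n>0 (begin
        n * (n * (n * n)) ≡⟨ sym (*-assoc n n (n * n)) ⟩
        n * n * (n * n) ≤⟨ *-mono-≤ many-edges many-edges ⟩
        2 * K * e * (2 * K * e) ≡⟨ square K e ⟩
        4 * (K * K) * (e * e) ≡⟨ cong (λ m → 4 * (K * K) * (m * m)) (sym ∑deg) ⟩
        4 * (K * K) * (∑ (λ v → 𝟙 (S v) * deg v) * ∑ (λ v → 𝟙 (S v) * deg v)) ≤⟨ *-monoʳ-≤ (4 * (K * K)) (cauchy-# S deg) ⟩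
        4 * (K * K) * (n * deg²) ≡⟨ move (4 * (K * K)) n _ ⟩
        n * (4 * (K * K) * deg²) ∎)
        where
        open ≤-Reasoning
        square : ∀ k e → 2 * k * e * (2 * k * e) ≡ 4 * (k * k) * (e * e)
        square = solve-∀
        move : ∀ k n c → k * (n * c) ≡ n * (k * c)
        move = solve-∀

      codeg : G → G → ℕ
      codeg a b = ∑ λ v → 𝟙 (S v) * (𝟙 (P (a ⁻¹ ∙ v)) * 𝟙 (P (b ⁻¹ ∙ v)))

      codeg-comm : ∀ a b → codeg a b ≡ codeg b a
      codeg-comm a b = ∑-cong λ v → cong (𝟙 (S v) *_) (*-comm (𝟙 (P (a ⁻¹ ∙ v))) _)

      opaque

        -- A pair will be good when it has at least n/Δ common neighbours. The factor 2 * 64 is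
        -- matched to `pivot`: there twice the weight 64 K² of the bad pairs has to be covered by
        -- `few-bad`.
        Δ : ℕ
        Δ = 2 * 64 * (K * K)

        Δ≡ : Δ ≡ 2 * 64 * (K * K)
        Δ≡ = refl

        good : G → G → Bool
        good a b = ⌊ n ≤? Δ * codeg a b ⌋

        good⇒ : ∀ a b → good a b ≡ true → n ≤ Δ * codeg a b
        good⇒ a b = does⇒ (n ≤? _)

        ¬good⇒ : ∀ a b → good a b ≡ false → Δ * codeg a b ≤ n
        ¬good⇒ a b h = <⇒≤ (≰⇒> (does⇒¬ (n ≤? _) h))

        good-comm : ∀ a b → good a b ≡ good b a
        good-comm a b = cong (λ c → ⌊ n ≤? Δ * c ⌋) (codeg-comm a b)

      N : G → G → Bool
      N v a = S a ∧ P (a ⁻¹ ∙ v)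

      #N : ∀ v → # (N v) ≡ deg v
      #N v = ∑-cong λ a → 𝟙-∧ (S a) _

      bad : G → ℕ
      bad v = ∑ λ a → ∑ λ b → 𝟙 (N v a) * (𝟙 (N v b) * 𝟙 (not (good a b)))

      -- A pair that is not good has at most n/Δ common neighbours v, and there are n² pairs.
      few-bad : Δ * ∑ (λ v → 𝟙 (S v) * bad v) ≤ n * (n * n)
      few-bad = begin
        Δ * ∑ (λ v → 𝟙 (S v) * bad v) ≡⟨ cong (Δ *_) (∑-cong λ v → trans (sym (∑-*ˡ (𝟙 (S v)) _)) (∑-cong λ a → sym (∑-*ˡ (𝟙 (S v)) _))) ⟩
        Δ * ∑ (λ v → ∑ λ a → ∑ λ b → 𝟙 (S v) * (𝟙 (N v a) * (𝟙 (N v b) * 𝟙 (not (good a b))))) ≡⟨ cong (Δ *_) (trans (∑-swap _) (∑-cong λ a → ∑-swap _)) ⟩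
        Δ * ∑ (λ a → ∑ λ b → ∑ λ v → 𝟙 (S v) * (𝟙 (N v a) * (𝟙 (N v b) * 𝟙 (not (good a b))))) ≡⟨ cong (Δ *_) (∑-cong λ a → ∑-cong λ b → trans (∑-cong λ v →
            trans (cong₂ (λ p q → 𝟙 (S v) * (p * (q * 𝟙 (not (good a b))))) (𝟙-∧ (S a) _) (𝟙-∧ (S b) _)) (rearrange (𝟙 (S v)) (𝟙 (S a)) _ (𝟙 (S b)) _ _)) (∑-*ˡ (𝟙 (S a) * (𝟙 (S b) * 𝟙 (not (good a b)))) _)) ⟩
        Δ * ∑ (λ a → ∑ λ b → 𝟙 (S a) * (𝟙 (S b) * 𝟙 (not (good a b))) * codeg a b) ≡⟨ trans (sym (∑-*ˡ Δ _)) (∑-cong λ a → sym (∑-*ˡ Δ _)) ⟩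
        ∑ (λ a → ∑ λ b → Δ * (𝟙 (S a) * (𝟙 (S b) * 𝟙 (not (good a b))) * codeg a b)) ≤⟨ ∑-mono (λ a → ∑-mono λ b → pointwise a b) ⟩
        ∑ (λ a → ∑ λ b → 𝟙 (S a) * (𝟙 (S b) * n)) ≡⟨ ∑-cong (λ a → trans (∑-*ˡ (𝟙 (S a)) _) (cong (𝟙 (S a) *_) (∑-*ʳ n _))) ⟩
        ∑ (λ a → 𝟙 (S a) * (n * n)) ≡⟨ ∑-*ʳ (n * n) _ ⟩
        n * (n * n) ∎
        where
        open ≤-Reasoning
        rearrange : ∀ s a p b q g → s * (a * p * (b * q * g)) ≡ a * (b * g) * (s * (p * q))
        rearrange = solve-∀
        pointwise : ∀ a b → Δ * (𝟙 (S a) * (𝟙 (S b) * 𝟙 (not (good a b))) * codeg a b) ≤ 𝟙 (S a) * (𝟙 (S b) * n)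
        pointwise a b with good a b in g
        ... | true = ≤-trans (≤-reflexive (vanish Δ (𝟙 (S a)) (𝟙 (S b)) (codeg a b))) z≤n
          where
          vanish : ∀ d s t c → d * (s * (t * 0) * c) ≡ 0
          vanish = solve-∀
        ... | false = ≤-trans (≤-reflexive (move Δ (𝟙 (S a)) (𝟙 (S b)) (codeg a b)))
          (*-monoʳ-≤ (𝟙 (S a)) (*-monoʳ-≤ (𝟙 (S b)) (¬good⇒ a b g)))
          where
          move : ∀ d s t c → d * (s * (t * 1) * c) ≡ s * (t * (d * c))
          move = solve-∀

      -- One average provides two properties. Summed over `S`, twice the left side is at most 3n³
      -- and twice the right side at least 4n³. At the vertex obtained, the term n² bounds the
      -- degree from below (`n≤3Kd`), and the other term makes bad pairs at most an eighth of all
      -- pairs of neighbours (`8bad≤d²`).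
      pivot : ∃ λ v → S v ≡ true × n * n + 64 * (K * K) * bad v < 8 * (K * K) * (deg v * deg v)
      pivot = conclude (∑-<-witness f g (*-cancelˡ-< 2 (∑ f) (∑ g) 2∑f<2∑g))
        where
        open ≤-Reasoning
        B = ∑ λ v → 𝟙 (S v) * bad v
        n³ = n * (n * n)
        f g : G → ℕ
        f v = 𝟙 (S v) * (n * n + 64 * (K * K) * bad v)
        g v = 𝟙 (S v) * (8 * (K * K) * (deg v * deg v))
        distribute : ∀ s m k b → s * (m + k * b) ≡ s * m + k * (s * b)
        distribute = solve-∀
        expand : ∀ c m k b → 2 * (m + c * k * b) ≡ 2 * m + 2 * c * k * b
        expand = solve-∀
        collect : ∀ c k d → 2 * (c * k * d) + 2 * (c * k * d) ≡ 2 * (2 * c * k * d)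
        collect = solve-∀
        move : ∀ s k d → s * (k * d) ≡ k * (s * d)
        move = solve-∀
        m<2m : ∀ {m} → 0 < m → m < 2 * m
        m<2m {m} m>0 = m<m+n m (≤-trans m>0 (m≤m+n m 0))
        ∑f : ∑ f ≡ n³ + 64 * (K * K) * B
        ∑f = trans (∑-cong λ v → distribute (𝟙 (S v)) (n * n) (64 * (K * K)) (bad v)) (trans (∑-+ _ _) (cong₂ _+_ (∑-*ʳ (n * n) (λ v → 𝟙 (S v))) (∑-*ˡ (64 * (K * K)) (λ v → 𝟙 (S v) * bad v))))
        ∑g : ∑ g ≡ 8 * (K * K) * deg²
        ∑g = trans (∑-cong λ v → move (𝟙 (S v)) (8 * (K * K)) (deg v * deg v)) (∑-*ˡ (8 * (K * K)) (λ v → 𝟙 (S v) * (deg v * deg v)))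
        n³>0 : 0 < n³
        n³>0 = *-mono-≤ n>0 (*-mono-≤ n>0 n>0)
        2∑f<2∑g : 2 * ∑ f < 2 * ∑ g
        2∑f<2∑g = begin-strict
          2 * ∑ f ≡⟨ cong (2 *_) ∑f ⟩
          2 * (n³ + 64 * (K * K) * B) ≡⟨ expand 64 n³ (K * K) B ⟩
          2 * n³ + 2 * 64 * (K * K) * B ≡⟨ cong (λ m → 2 * n³ + m * B) (sym Δ≡) ⟩
          2 * n³ + Δ * B ≤⟨ +-monoʳ-≤ (2 * n³) few-bad ⟩
          2 * n³ + n³ <⟨ +-monoʳ-< (2 * n³) (m<2m n³>0) ⟩
          2 * n³ + 2 * n³ ≤⟨ +-mono-≤ (*-monoʳ-≤ 2 many-cherries) (*-monoʳ-≤ 2 many-cherries) ⟩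
          2 * (4 * (K * K) * deg²) + 2 * (4 * (K * K) * deg²) ≡⟨ collect 4 (K * K) deg² ⟩
          2 * (8 * (K * K) * deg²) ≡⟨ cong (2 *_) (sym ∑g) ⟩
          2 * ∑ g ∎
        conclude : (∃ λ v → f v < g v) → ∃ λ v → S v ≡ true × n * n + 64 * (K * K) * bad v < 8 * (K * K) * (deg v * deg v)
        conclude (v , lt) with S v in Sv
        ... | true = v , Sv , subst₂ _<_ (+-identityʳ _) (+-identityʳ _) lt

      module Neighbours (v₀ : G) (pivotal : n * n + 64 * (K * K) * bad v₀ < 8 * (K * K) * (deg v₀ * deg v₀)) where

        d : ℕ
        d = # (N v₀)

        d≡deg : d ≡ deg v₀
        d≡deg = #N v₀

        n≤3Kd : n ≤ 3 * K * d
        n≤3Kd = ≮⇒≥ λ h → <-irrefl refl (begin-strict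
          n * n ≤⟨ m≤m+n (n * n) (64 * (K * K) * bad v₀) ⟩
          n * n + 64 * (K * K) * bad v₀ <⟨ pivotal ⟩
          8 * (K * K) * (deg v₀ * deg v₀) ≡⟨ cong (λ m → 8 * (K * K) * (m * m)) (sym d≡deg) ⟩
          -- Rounding 8 up to the square 9 is the origin of the constant 3.
          8 * (K * K) * (d * d) ≤⟨ *-monoˡ-≤ (d * d) (*-monoˡ-≤ (K * K) (n≤1+n 8)) ⟩
          9 * (K * K) * (d * d) ≡⟨ square 3 K d ⟩
          3 * K * d * (3 * K * d) ≤⟨ *-mono-≤ (<⇒≤ h) (<⇒≤ h) ⟩
          n * n ∎)
          where
          open ≤-Reasoning
          square : ∀ c k d → c * c * (k * k) * (d * d) ≡ c * k * d * (c * k * d)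
          square = solve-∀

        K>0 : 0 < K
        K>0 = positive K (≤-trans n>0 n≤3Kd)
          where
          positive : ∀ k → 0 < 3 * k * d → 0 < k
          positive (suc _) _ = s≤s z≤n

        8bad≤d² : 8 * bad v₀ ≤ d * d
        8bad≤d² = *-cancelˡ-≤-pos {8 * (K * K)} (*-mono-≤ {1} {8} (s≤s z≤n) (*-mono-≤ K>0 K>0)) (begin
          8 * (K * K) * (8 * bad v₀) ≡⟨ regroup 8 (K * K) (bad v₀) ⟩
          64 * (K * K) * bad v₀ ≤⟨ m≤n+m _ (n * n) ⟩
          n * n + 64 * (K * K) * bad v₀ ≤⟨ <⇒≤ (pivotal) ⟩
          8 * (K * K) * (deg v₀ * deg v₀) ≡⟨ cong (λ m → 8 * (K * K) * (m * m)) (sym d≡deg) ⟩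
          8 * (K * K) * (d * d) ∎)
          where
          open ≤-Reasoning
          regroup : ∀ c k b → c * k * (c * b) ≡ c * c * k * b
          regroup = solve-∀

        β : G → ℕ
        β a = ∑ λ b → 𝟙 (N v₀ b) * 𝟙 (not (good a b))

        opaque

          tame : G → Bool
          tame a = ⌊ 4 * β a ≤? d ⌋

          tame⇒ : ∀ a → tame a ≡ true → 4 * β a ≤ d
          tame⇒ a = does⇒ (_ ≤? d)

          ¬tame⇒ : ∀ a → tame a ≡ false → d ≤ 4 * β a
          ¬tame⇒ a h = <⇒≤ (≰⇒> (does⇒¬ (_ ≤? d) h))

        A : G → Bool
        A a = N v₀ a ∧ tame a

        A⊆S : ∀ a → A a ≡ true → S a ≡ true
        A⊆S a Aa = ∧-fst {S a} (∧-fst Aa)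

        q : ℕ
        q = # A

        -- Markov's inequality: a neighbour that is not tame is the first member of more than d/4
        -- bad pairs, and there are at most d²/8 bad pairs, so at most half of the neighbours are
        -- lost.
        d≤2q : d ≤ 2 * q
        d≤2q = cancel d (+-cancelʳ-≤ (d * d) (d * d) (d * (2 * q)) (begin
          d * d + d * d ≡⟨ double (d * d) ⟩
          2 * (d * d) ≡⟨ cong (2 *_) (sym (∑-*ʳ d (λ a → 𝟙 (N v₀ a)))) ⟩
          2 * ∑ (λ a → 𝟙 (N v₀ a) * d) ≤⟨ *-monoʳ-≤ 2 (∑-mono pointwise) ⟩
          2 * ∑ (λ a → d * 𝟙 (A a) + 4 * (𝟙 (N v₀ a) * β a)) ≡⟨ cong (2 *_) (trans (∑-+ _ _) (cong₂ _+_ (∑-*ˡ d (λ a → 𝟙 (A a))) (∑-*ˡ 4 (λ a → 𝟙 (N v₀ a) * β a)))) ⟩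
          2 * (d * q + 4 * ∑ (λ a → 𝟙 (N v₀ a) * β a)) ≡⟨ cong (λ m → 2 * (d * q + 4 * m)) (∑-cong λ a → sym (∑-*ˡ (𝟙 (N v₀ a)) (λ b → 𝟙 (N v₀ b) * 𝟙 (not (good a b))))) ⟩
          2 * (d * q + 4 * bad v₀) ≡⟨ expand d q (bad v₀) ⟩
          d * (2 * q) + 8 * bad v₀ ≤⟨ +-monoʳ-≤ (d * (2 * q)) 8bad≤d² ⟩
          d * (2 * q) + d * d ∎))
          where
          open ≤-Reasoning
          cancel : ∀ m {k} → m * m ≤ m * k → m ≤ k
          cancel zero _ = z≤n
          cancel (suc m) = *-cancelˡ-≤ (suc m)
          double : ∀ m → m + m ≡ 2 * m
          double = solve-∀
          expand : ∀ d q b → 2 * (d * q + 4 * b) ≡ d * (2 * q) + 8 * b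
          expand = solve-∀
          pointwise : ∀ a → 𝟙 (N v₀ a) * d ≤ d * 𝟙 (A a) + 4 * (𝟙 (N v₀ a) * β a)
          pointwise a = split (N v₀ a) (tame a) (¬tame⇒ a)
            where
            split : ∀ x y → (y ≡ false → d ≤ 4 * β a) → 𝟙 x * d ≤ d * 𝟙 (x ∧ y) + 4 * (𝟙 x * β a)
            split false _ _ = z≤n
            split true true _ = ≤-trans (≤-reflexive (*-comm 1 d)) (m≤m+n (d * 1) _)
            split true false h = ≤-trans (≤-reflexive (*-identityˡ d)) (≤-trans (h refl) (≤-trans (*-monoʳ-≤ 4 (≤-reflexive (sym (*-identityˡ (β a))))) (m≤n+m (4 * (1 * β a)) (d * 0))))

        n≤6Kq : n ≤ 6 * K * q
        n≤6Kq = ≤-trans n≤3Kd (≤-trans (*-monoʳ-≤ (3 * K) d≤2q) (≤-reflexive (regroup K q)))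
          where
          regroup : ∀ k q → 3 * k * (2 * q) ≡ 6 * k * q
          regroup = solve-∀

        opaque

          D₀ : G → Bool
          D₀ x = ⌊ n ≤? Δ * conv P P x ⌋

          D₀⇒ : ∀ x → D₀ x ≡ true → n ≤ Δ * conv P P x
          D₀⇒ x = does⇒ (n ≤? _)

          ⇒D₀ : ∀ x → n ≤ Δ * conv P P x → D₀ x ≡ true
          ⇒D₀ x = ⇒does (n ≤? _)

        M : ℕ
        M = 4 * (K * K) * Δ

        #D₀ : # D₀ ≤ M * n
        #D₀ = *-cancelʳ-≤-pos n>0 (begin
          # D₀ * n ≤⟨ conv-bound D₀ P P Δ n D₀⇒ ⟩
          Δ * (# P * # P) ≤⟨ *-monoʳ-≤ Δ (*-mono-≤ #P #P) ⟩
          Δ * (2 * K * n * (2 * K * n)) ≡⟨ regroup Δ K n ⟩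
          M * n * n ∎)
          where
          open ≤-Reasoning
          regroup : ∀ e k n → e * (2 * k * n * (2 * k * n)) ≡ 4 * (k * k) * e * n * n
          regroup = solve-∀

        -- Each common neighbour v writes a⁻¹ b as (a⁻¹ v)(v⁻¹ b), a product of two popular
        -- quotients because `P` is closed under inverses; different v give different
        -- representations.
        good⇒D₀ : ∀ a b → good a b ≡ true → D₀ (a ⁻¹ ∙ b) ≡ true
        good⇒D₀ a b g = ⇒D₀ (a ⁻¹ ∙ b) (≤-trans (good⇒ a b g) (*-monoʳ-≤ Δ (begin
          codeg a b ≤⟨ ∑-mono (λ v → 𝟙* (S v) λ _ → ≤-refl) ⟩
          ∑ (λ v → 𝟙 (P (a ⁻¹ ∙ v)) * 𝟙 (P (b ⁻¹ ∙ v))) ≡⟨ sym (∑-translateˡ a _) ⟩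
          ∑ (λ u → 𝟙 (P (a ⁻¹ ∙ (a ∙ u))) * 𝟙 (P (b ⁻¹ ∙ (a ∙ u)))) ≡⟨ ∑-cong (λ u → cong₂ (λ p q → 𝟙 p * 𝟙 q) (cong P (x⁻¹∙xy a u))
              (trans (sym (P-inverse _)) (cong P (trans (x⁻¹y⁻¹ b (a ∙ u)) (trans (cong (_∙ b) (⁻¹-anti-homo-∙ a u)) (assoc _ _ b)))))) ⟩
          conv P P (a ⁻¹ ∙ b) ∎)))
          where open ≤-Reasoning

        D₁ : G → Bool
        D₁ = A ∖ A

        -- For a and a' in `A`, at most d/4 + d/4 neighbours b are bad for one of them. Each of the
        -- others, at least d/2 in number, gives a representation a⁻¹ a' = (a⁻¹ b)(b⁻¹ a') as a
        -- product of two elements of `D₀`.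
        #D₁-d : # D₁ * d ≤ 2 * (# D₀ * # D₀)
        #D₁-d = conv-bound D₁ D₀ D₀ 2 d many
          where
          open ≤-Reasoning
          expand : ∀ c x y → 4 * (c + (x + y)) ≡ 2 * (2 * c) + (4 * x + 4 * y)
          expand = solve-∀
          many : ∀ t → D₁ t ≡ true → d ≤ 2 * conv D₀ D₀ t
          many t D₁t with ∖-elim {A} {A} D₁t
          ... | a , a' , Aa , Aa' , refl = *-cancelˡ-≤ 2 (+-cancelʳ-≤ (d + d) (2 * d) (2 * (2 * conv D₀ D₀ (a ⁻¹ ∙ a'))) (begin
            2 * d + (d + d) ≡⟨ quadruple d ⟩
            4 * d ≤⟨ *-monoʳ-≤ 4 (∑-mono pointwise) ⟩
            4 * ∑ (λ b → 𝟙 (D₀ (a ⁻¹ ∙ b)) * 𝟙 (D₀ (b ⁻¹ ∙ a')) + (𝟙 (N v₀ b) * 𝟙 (not (good a b)) + 𝟙 (N v₀ b) * 𝟙 (not (good a' b)))) ≡⟨ cong (4 *_) (trans (∑-+ _ _) (cong₂ _+_ paths (∑-+ _ _))) ⟩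
            4 * (conv D₀ D₀ (a ⁻¹ ∙ a') + (β a + β a')) ≡⟨ expand (conv D₀ D₀ (a ⁻¹ ∙ a')) (β a) (β a') ⟩
            2 * (2 * conv D₀ D₀ (a ⁻¹ ∙ a')) + (4 * β a + 4 * β a') ≤⟨ +-monoʳ-≤ (2 * (2 * conv D₀ D₀ (a ⁻¹ ∙ a'))) (+-mono-≤ (tame⇒ a (∧-snd {N v₀ a} Aa)) (tame⇒ a' (∧-snd {N v₀ a'} Aa'))) ⟩
            2 * (2 * conv D₀ D₀ (a ⁻¹ ∙ a')) + (d + d) ∎))
            where
            quadruple : ∀ d → 2 * d + (d + d) ≡ 4 * d
            quadruple = solve-∀
            paths : ∑ (λ b → 𝟙 (D₀ (a ⁻¹ ∙ b)) * 𝟙 (D₀ (b ⁻¹ ∙ a'))) ≡ conv D₀ D₀ (a ⁻¹ ∙ a')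
            paths = trans (∑-cong λ b → cong (λ y → 𝟙 (D₀ (a ⁻¹ ∙ b)) * 𝟙 (D₀ y)) (sym (telescope⁻¹ a b a')))
              (∑-translateˡ (a ⁻¹) (λ u → 𝟙 (D₀ u) * 𝟙 (D₀ (u ⁻¹ ∙ (a ⁻¹ ∙ a')))))
            pointwise : ∀ b → 𝟙 (N v₀ b) ≤ 𝟙 (D₀ (a ⁻¹ ∙ b)) * 𝟙 (D₀ (b ⁻¹ ∙ a')) + (𝟙 (N v₀ b) * 𝟙 (not (good a b)) + 𝟙 (N v₀ b) * 𝟙 (not (good a' b)))
            pointwise b = split (N v₀ b) (good a b) (good a' b) (D₀ (a ⁻¹ ∙ b)) (D₀ (b ⁻¹ ∙ a'))
              (good⇒D₀ a b) (λ g → good⇒D₀ b a' (trans (good-comm b a') g))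
              where
              split : ∀ x g g' y y' → (g ≡ true → y ≡ true) → (g' ≡ true → y' ≡ true) →
                𝟙 x ≤ 𝟙 y * 𝟙 y' + (𝟙 x * 𝟙 (not g) + 𝟙 x * 𝟙 (not g'))
              split false _ _ _ _ _ _ = z≤n
              split true false _ y y' _ _ = ≤-trans (s≤s z≤n) (m≤n+m _ (𝟙 y * 𝟙 y'))
              split true true false y y' _ _ = m≤n+m 1 (𝟙 y * 𝟙 y')
              split true true true y y' h h' rewrite h refl | h' refl = s≤s z≤n

        -- The product of the losses: 6 K M² from n ≤ 3Kd and |D₀| ≤ Mn in the count of `#D₁-d`, and
        -- 6 K from n ≤ 6Kq.
        K₁ : ℕ
        K₁ = 36 * K * K * (M * M)

        #D₁ : # D₁ ≤ K₁ * q
        #D₁ = ≤-trans (*-cancelʳ-≤-pos n>0 (begin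
          # D₁ * n ≤⟨ *-monoʳ-≤ (# D₁) n≤3Kd ⟩
          # D₁ * (3 * K * d) ≡⟨ move (# D₁) (3 * K) d ⟩
          3 * K * (# D₁ * d) ≤⟨ *-monoʳ-≤ (3 * K) #D₁-d ⟩
          3 * K * (2 * (# D₀ * # D₀)) ≤⟨ *-monoʳ-≤ (3 * K) (*-monoʳ-≤ 2 (*-mono-≤ #D₀ #D₀)) ⟩
          3 * K * (2 * (M * n * (M * n))) ≡⟨ regroup K M n ⟩
          6 * K * (M * M) * n * n ∎))
          (≤-trans (*-monoʳ-≤ (6 * K * (M * M)) n≤6Kq) (≤-reflexive (collect 6 K q (M * M))))
          where
          open ≤-Reasoning
          move : ∀ a b c → a * (b * c) ≡ b * (a * c)
          move = solve-∀
          regroup : ∀ k m n → 3 * k * (2 * (m * n * (m * n))) ≡ 6 * k * (m * m) * n * n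
          regroup = solve-∀
          collect : ∀ e k q c → e * k * c * (e * k * q) ≡ e * e * k * k * c * q
          collect = solve-∀

-- Powers of a set and Tao's construction.

module ApproximateGroups where

  open Sums
  open GroupEnergy
  open import Data.Nat hiding (_≟_)
  open import Data.Nat.Properties hiding (_≟_)
  open import Data.Bool using (Bool; true; false; _∧_)
  open import Data.Product using (_,_)
  open import Relation.Binary.PropositionalEquality
  open import Relation.Nullary.Decidable using (⌊_⌋)
  open import Data.Nat.Tactic.RingSolver using (solve-∀)

  module Powers (𝔾 : FiniteGroup) (X : FiniteGroup.G 𝔾 → Bool) where
    open GroupSums 𝔾

    opaque

      pw : ℕ → G → Bool
      pw zero t = ⌊ ε ≟ t ⌋
      pw (suc n) = X · pw n

      pw-∙ : ∀ m {n s t} → pw m s ≡ true → pw n t ≡ true → pw (m + n) (s ∙ t) ≡ true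
      pw-∙ zero {n} {s} {t} hs ht with does⇒ (ε ≟ s) hs
      ... | refl = subst (λ x → pw n x ≡ true) (sym (identityˡ t)) ht
      pw-∙ (suc m) {n} {s} {t} hs ht with ·-elim {X} {pw m} hs
      ... | x , y , Xx , hy , refl = subst (λ z → pw (suc m + n) z ≡ true) (sym (assoc x y t)) (·-intro {X} {pw (m + n)} Xx (pw-∙ m hy ht))

      pw-1 : ∀ {x} → X x ≡ true → pw 1 x ≡ true
      pw-1 {x} Xx = subst (λ z → pw 1 z ≡ true) (identityʳ x) (·-intro {X} {pw 0} Xx (⇒does (ε ≟ ε) refl))

      pw-inverse : (∀ x → X x ≡ true → X (x ⁻¹) ≡ true) → ∀ n {t} → pw n t ≡ true → pw n (t ⁻¹) ≡ true
      pw-inverse X-inverse zero {t} h with does⇒ (ε ≟ t) h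
      ... | refl = ⇒does (ε ≟ _) (sym ε⁻¹≈ε)
      pw-inverse X-inverse (suc n) {t} h with ·-elim {X} {pw n} h
      ... | x , y , Xx , hy , refl = subst₂ (λ k z → pw k z ≡ true) (+-comm n 1) (sym (⁻¹-anti-homo-∙ x y))
        (pw-∙ n (pw-inverse X-inverse n hy) (pw-1 (X-inverse x Xx)))

      pw-suc : X ε ≡ true → ∀ n {t} → pw n t ≡ true → pw (suc n) t ≡ true
      pw-suc Xε n {t} h = subst (λ z → pw (suc n) z ≡ true) (identityˡ t) (·-intro {X} {pw n} Xε h)

    pw-+ : X ε ≡ true → ∀ k n {t} → pw n t ≡ true → pw (k + n) t ≡ true
    pw-+ Xε zero n h = h
    pw-+ Xε (suc k) n h = pw-suc Xε (k + n) (pw-+ Xε k n h)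

  -- Tao's construction of an approximate group from a set A with |A⁻¹A| ≤ K₁|A|: take the popular quotients.
  module Popular (𝔾 : FiniteGroup) where
    open GroupSums 𝔾

    module Quotients (A : G → Bool) (K₁ : ℕ) (q>0 : 0 < # A) (small : # (A ∖ A) ≤ K₁ * # A) where

      q : ℕ
      q = # A

      D : G → Bool
      D = A ∖ A

      -- Representations x = y z⁻¹ with y and z in `A`. These are quotients on the other side than
      -- those in `D`.
      r : G → ℕ
      r x = ∑ λ y → 𝟙 (A y) * 𝟙 (A (x ⁻¹ ∙ y))

      ∑-quotient : ∀ y (f : G → ℕ) → ∑ (λ z → f (y ∙ z ⁻¹)) ≡ ∑ f
      ∑-quotient y f = trans (∑-inverse (λ z → f (y ∙ z))) (∑-translateˡ y f)

      quotient⁻¹ : ∀ y z w → (y ∙ z ⁻¹) ⁻¹ ∙ w ≡ z ∙ (y ⁻¹ ∙ w)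
      quotient⁻¹ y z w = trans (cong (_∙ w) (xy⁻¹⁻¹ y z)) (assoc z _ w)

      quotient⁻¹-self : ∀ y z → (y ∙ z ⁻¹) ⁻¹ ∙ y ≡ z
      quotient⁻¹-self y z = trans (quotient⁻¹ y z y) (trans (cong (z ∙_) (inverseˡ y)) (identityʳ z))

      ∑r : ∑ r ≡ q * q
      ∑r = begin
        ∑ (λ x → ∑ λ y → 𝟙 (A y) * 𝟙 (A (x ⁻¹ ∙ y))) ≡⟨ ∑-swap _ ⟩
        ∑ (λ y → ∑ λ x → 𝟙 (A y) * 𝟙 (A (x ⁻¹ ∙ y))) ≡⟨ ∑-cong (λ y → trans (∑-*ˡ (𝟙 (A y)) _) (cong (𝟙 (A y) *_) (sym (∑-quotient y _)))) ⟩
        ∑ (λ y → 𝟙 (A y) * ∑ (λ z → 𝟙 (A ((y ∙ z ⁻¹) ⁻¹ ∙ y)))) ≡⟨ ∑-cong (λ y → cong (𝟙 (A y) *_) (∑-cong λ z → cong (λ w → 𝟙 (A w)) (quotient⁻¹-self y z))) ⟩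
        ∑ (λ y → 𝟙 (A y) * q) ≡⟨ ∑-*ʳ q _ ⟩
        q * q ∎
        where open ≡-Reasoning

      -- Solutions in `A` of y⁻¹ y' = z⁻¹ w, which may also be read as y z⁻¹ = y' w⁻¹. Hence both
      -- kinds of quotients have the same second moment; the hypothesis controls A⁻¹A, while `X` is
      -- taken from A A⁻¹.
      quadruples : ℕ
      quadruples = ∑ λ y → ∑ λ y' → ∑ λ z → 𝟙 (A y) * 𝟙 (A z) * (𝟙 (A y') * 𝟙 (A (z ∙ (y ⁻¹ ∙ y'))))

      ∑r² : ∑ (λ x → r x * r x) ≡ quadruples
      ∑r² = begin
        ∑ (λ x → r x * r x) ≡⟨ ∑-cong (λ x → ∑-product _ _) ⟩
        ∑ (λ x → ∑ λ y → ∑ λ y' → 𝟙 (A y) * 𝟙 (A (x ⁻¹ ∙ y)) * (𝟙 (A y') * 𝟙 (A (x ⁻¹ ∙ y')))) ≡⟨ trans (∑-swap _) (∑-cong λ y → ∑-swap _) ⟩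
        ∑ (λ y → ∑ λ y' → ∑ λ x → 𝟙 (A y) * 𝟙 (A (x ⁻¹ ∙ y)) * (𝟙 (A y') * 𝟙 (A (x ⁻¹ ∙ y')))) ≡⟨ ∑-cong (λ y → ∑-cong λ y' → sym (∑-quotient y _)) ⟩
        ∑ (λ y → ∑ λ y' → ∑ λ z → 𝟙 (A y) * 𝟙 (A ((y ∙ z ⁻¹) ⁻¹ ∙ y)) * (𝟙 (A y') * 𝟙 (A ((y ∙ z ⁻¹) ⁻¹ ∙ y')))) ≡⟨ ∑-cong (λ y → ∑-cong λ y' → ∑-cong λ z →
            cong₂ (λ u w → 𝟙 (A y) * 𝟙 (A u) * (𝟙 (A y') * 𝟙 (A w))) (quotient⁻¹-self y z) (quotient⁻¹ y z y')) ⟩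
        quadruples ∎
        where open ≡-Reasoning

      ∑corr² : ∑ (λ x → corr A A x * corr A A x) ≡ quadruples
      ∑corr² = begin
        ∑ (λ x → corr A A x * corr A A x) ≡⟨ ∑-cong (λ x → ∑-product _ _) ⟩
        ∑ (λ x → ∑ λ y → ∑ λ z → 𝟙 (A y) * 𝟙 (A (y ∙ x)) * (𝟙 (A z) * 𝟙 (A (z ∙ x)))) ≡⟨ trans (∑-swap _) (∑-cong λ y → ∑-swap _) ⟩
        ∑ (λ y → ∑ λ z → ∑ λ x → 𝟙 (A y) * 𝟙 (A (y ∙ x)) * (𝟙 (A z) * 𝟙 (A (z ∙ x)))) ≡⟨ ∑-cong (λ y → ∑-cong λ z → sym (∑-translateˡ (y ⁻¹) _)) ⟩
        ∑ (λ y → ∑ λ z → ∑ λ y' → 𝟙 (A y) * 𝟙 (A (y ∙ (y ⁻¹ ∙ y'))) * (𝟙 (A z) * 𝟙 (A (z ∙ (y ⁻¹ ∙ y'))))) ≡⟨ ∑-cong (λ y → trans (∑-cong λ z → ∑-cong λ y' →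
            trans (cong (λ u → 𝟙 (A y) * 𝟙 (A u) * (𝟙 (A z) * 𝟙 (A (z ∙ (y ⁻¹ ∙ y'))))) (x∙x⁻¹y y y')) (rearrange (𝟙 (A y)) (𝟙 (A y')) (𝟙 (A z)) _)) (∑-swap _)) ⟩
        quadruples ∎
        where
        open ≡-Reasoning
        rearrange : ∀ a b c d → a * b * (c * d) ≡ a * c * (b * d)
        rearrange = solve-∀

      corr-support : ∀ x → corr A A x ≡ 𝟙 (D x) * corr A A x
      corr-support x with D x in Dx
      ... | true = sym (*-identityˡ _)
      ... | false = trans (∑-cong vanish) ∑-0
        where
        vanish : ∀ a → 𝟙 (A a) * 𝟙 (A (a ∙ x)) ≡ 0
        vanish a with A a in Aa | A (a ∙ x) in Aax
        ... | false | _ = refl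
        ... | true | false = refl
        ... | true | true with trans (sym (trans (cong D (sym (x⁻¹∙xy a x))) (∖-intro {A} {A} Aa Aax))) Dx
        ... | ()

      -- Cauchy-Schwarz on `D`: the q² pairs are spread over at most K₁ q quotients.
      energy : q * (q * q) ≤ K₁ * ∑ (λ x → r x * r x)
      energy = *-cancelˡ-≤-pos q>0 (begin
        q * (q * (q * q)) ≡⟨ sym (*-assoc q q (q * q)) ⟩
        q * q * (q * q) ≡⟨ cong₂ _*_ total total ⟩
        ∑ (λ x → 𝟙 (D x) * corr A A x) * ∑ (λ x → 𝟙 (D x) * corr A A x) ≤⟨ cauchy-# D (corr A A) ⟩
        # D * ∑ (λ x → 𝟙 (D x) * (corr A A x * corr A A x)) ≤⟨ *-mono-≤ small (∑-mono λ x → 𝟙* (D x) λ _ → ≤-refl) ⟩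
        K₁ * q * ∑ (λ x → corr A A x * corr A A x) ≡⟨ cong (K₁ * q *_) (trans ∑corr² (sym ∑r²)) ⟩
        K₁ * q * ∑ (λ x → r x * r x) ≡⟨ move K₁ q _ ⟩
        q * (K₁ * ∑ (λ x → r x * r x)) ∎)
        where
        open ≤-Reasoning
        total : q * q ≡ ∑ (λ x → 𝟙 (D x) * corr A A x)
        total = trans (sym (∑-corr A A)) (∑-cong corr-support)
        move : ∀ k q e → k * q * e ≡ q * (k * e)
        move = solve-∀

      r≤q : ∀ x → r x ≤ q
      r≤q x = ∑-mono λ y → ≤-trans (*-monoʳ-≤ (𝟙 (A y)) (𝟙≤1 _)) (≤-reflexive (*-identityʳ _))

      opaque

        X : G → Bool
        X x = ⌊ q ≤? 2 * K₁ * r x ⌋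

        X⇒ : ∀ x → X x ≡ true → q ≤ 2 * K₁ * r x
        X⇒ x = does⇒ (q ≤? _)

        ⇒X : ∀ x → q ≤ 2 * K₁ * r x → X x ≡ true
        ⇒X x = ⇒does (q ≤? _)

        ¬X⇒ : ∀ x → X x ≡ false → 2 * K₁ * r x ≤ q
        ¬X⇒ x h = <⇒≤ (≰⇒> (does⇒¬ (q ≤? _) h))

      -- As in `many-edges`, unpopular quotients hold at most half of the second moment, and each of
      -- the others holds at most q² of it.
      q≤2K₁#X : q ≤ 2 * K₁ * # X
      q≤2K₁#X = *-cancelˡ-≤-pos (*-mono-≤ q>0 q>0) (+-cancelʳ-≤ (q * (q * q)) (q * q * q) (q * q * (2 * K₁ * # X)) (begin
        q * q * q + q * (q * q) ≡⟨ double q ⟩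
        2 * (q * (q * q)) ≤⟨ *-monoʳ-≤ 2 energy ⟩
        2 * (K₁ * ∑ (λ x → r x * r x)) ≡⟨ trans (sym (*-assoc 2 K₁ _)) (sym (∑-*ˡ (2 * K₁) _)) ⟩
        ∑ (λ x → 2 * K₁ * (r x * r x)) ≤⟨ ∑-mono (λ x → pointwise (X x) (r x) (r≤q x) (¬X⇒ x)) ⟩
        ∑ (λ x → q * q * (2 * K₁) * 𝟙 (X x) + q * r x) ≡⟨ trans (∑-+ _ _) (cong₂ _+_ (∑-*ˡ (q * q * (2 * K₁)) (λ x → 𝟙 (X x))) (trans (∑-*ˡ q r) (cong (q *_) ∑r))) ⟩
        q * q * (2 * K₁) * # X + q * (q * q) ≡⟨ cong (_+ q * (q * q)) (*-assoc (q * q) (2 * K₁) (# X)) ⟩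
        q * q * (2 * K₁ * # X) + q * (q * q) ∎))
        where
        open ≤-Reasoning
        double : ∀ q → q * q * q + q * (q * q) ≡ 2 * (q * (q * q))
        double = solve-∀
        move : ∀ k q → 2 * k * (q * q) ≡ q * q * (2 * k) * 1
        move = solve-∀
        pointwise : ∀ b ρ → ρ ≤ q → (b ≡ false → 2 * K₁ * ρ ≤ q) → 2 * K₁ * (ρ * ρ) ≤ q * q * (2 * K₁) * 𝟙 b + q * ρ
        pointwise true ρ ρ≤q _ = ≤-trans (*-monoʳ-≤ (2 * K₁) (*-mono-≤ ρ≤q ρ≤q)) (≤-trans (≤-reflexive (move K₁ q)) (m≤m+n (q * q * (2 * K₁) * 1) (q * ρ)))
        pointwise false ρ _ h = ≤-trans (≤-reflexive (sym (*-assoc (2 * K₁) ρ ρ))) (≤-trans (*-monoˡ-≤ ρ (h refl)) (m≤n+m (q * ρ) (q * q * (2 * K₁) * 0)))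

      -- On `X` the ratio 2K₁ r / q is at least 1, so a sum over `X` is dominated by a sum over
      -- pairs from `A`. Bounds known for `A` are passed on to `X` in this way.
      weigh : (f : G → ℕ) → ∑ (λ x → 𝟙 (X x) * f x) * q ≤ 2 * K₁ * ∑ (λ x → f x * r x)
      weigh f = begin
        ∑ (λ x → 𝟙 (X x) * f x) * q ≡⟨ sym (∑-*ʳ q _) ⟩
        ∑ (λ x → 𝟙 (X x) * f x * q) ≤⟨ ∑-mono (λ x → ≤-trans (≤-reflexive (*-assoc (𝟙 (X x)) (f x) q)) (𝟙* (X x) λ Xx → ≤-trans (*-monoʳ-≤ (f x) (X⇒ x Xx)) (≤-reflexive (move (f x) (2 * K₁) (r x))))) ⟩
        ∑ (λ x → 2 * K₁ * (f x * r x)) ≡⟨ ∑-*ˡ (2 * K₁) _ ⟩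
        2 * K₁ * ∑ (λ x → f x * r x) ∎
        where
        open ≤-Reasoning
        move : ∀ f k r → f * (k * r) ≡ k * (f * r)
        move = solve-∀

      #X≤2K₁q : # X ≤ 2 * K₁ * q
      #X≤2K₁q = *-cancelʳ-≤-pos q>0 (begin
        # X * q ≡⟨ cong (_* q) (∑-cong λ x → sym (*-identityʳ _)) ⟩
        ∑ (λ x → 𝟙 (X x) * 1) * q ≤⟨ weigh (λ _ → 1) ⟩
        2 * K₁ * ∑ (λ x → 1 * r x) ≡⟨ cong (2 * K₁ *_) (trans (∑-cong λ x → *-identityˡ (r x)) ∑r) ⟩
        2 * K₁ * (q * q) ≡⟨ sym (*-assoc (2 * K₁) q q) ⟩
        2 * K₁ * q * q ∎)
        where open ≤-Reasoning

      K₁>0 : 0 < K₁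
      K₁>0 = positive K₁ (≤-trans q>0 q≤2K₁#X)
        where
        positive : ∀ k → 0 < 2 * k * # X → 0 < k
        positive (suc _) _ = s≤s z≤n

      X-inverse : ∀ x → X x ≡ true → X (x ⁻¹) ≡ true
      X-inverse x Xx = ⇒X (x ⁻¹) (subst (λ ρ → q ≤ 2 * K₁ * ρ) (sym r-inverse) (X⇒ x Xx))
        where
        r-inverse : r (x ⁻¹) ≡ r x
        r-inverse = trans (sym (∑-translateˡ (x ⁻¹) _)) (∑-cong λ y →
          trans (*-comm (𝟙 (A (x ⁻¹ ∙ y))) _) (cong (λ z → 𝟙 (A z) * 𝟙 (A (x ⁻¹ ∙ y))) (x⁻¹∙xy (x ⁻¹) y)))

      Xε : X ε ≡ true
      Xε = ⇒X ε (≤-trans (m≤n*m q (2 * K₁) {{>-nonZero (*-mono-≤ {1} {2} (s≤s z≤n) K₁>0)}}) (*-monoʳ-≤ (2 * K₁) (≤-reflexive (sym rε))))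
        where
        rε : r ε ≡ q
        rε = ∑-cong λ y → trans (cong (λ z → 𝟙 (A y) * 𝟙 (A z)) (trans (cong (_∙ y) ε⁻¹≈ε) (identityˡ y))) (𝟙-idem (A y))

      -- An element a⁻¹ x w equals (a⁻¹ y)(z⁻¹ w) for each of the at least q/2K₁ representations x =
      -- y z⁻¹, so it has many representations as a product from A⁻¹A and A⁻¹W. Each further factor
      -- `X` therefore costs only 2K₁².
      growth : ∀ W → # (A ∖ (X · W)) ≤ 2 * (K₁ * K₁) * # (A ∖ W)
      growth W = *-cancelʳ-≤-pos q>0 (begin
        # (A ∖ (X · W)) * q ≤⟨ conv-bound (A ∖ (X · W)) D (A ∖ W) (2 * K₁) q many ⟩
        2 * K₁ * (# D * # (A ∖ W)) ≤⟨ *-monoʳ-≤ (2 * K₁) (*-monoˡ-≤ (# (A ∖ W)) small) ⟩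
        2 * K₁ * (K₁ * q * # (A ∖ W)) ≡⟨ move K₁ q (# (A ∖ W)) ⟩
        2 * (K₁ * K₁) * # (A ∖ W) * q ∎)
        where
        open ≤-Reasoning
        move : ∀ k q w → 2 * k * (k * q * w) ≡ 2 * (k * k) * w * q
        move = solve-∀
        many : ∀ t → (A ∖ (X · W)) t ≡ true → q ≤ 2 * K₁ * conv D (A ∖ W) t
        many t ht with ∖-elim {A} {X · W} ht
        ... | a , t' , Aa , ht' , refl with ·-elim {X} {W} ht'
        ... | x , w , Xx , Ww , refl = ≤-trans (X⇒ x Xx) (*-monoʳ-≤ (2 * K₁) (begin
          r x ≤⟨ ∑-mono (λ y → *-mono-≤ (𝟙-mono (A y) (D (a ⁻¹ ∙ y)) (∖-intro {A} {A} Aa))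
              (𝟙-mono (A (x ⁻¹ ∙ y)) _ λ h → trans (cong (A ∖ W) (target y)) (∖-intro {A} {W} h Ww))) ⟩
          ∑ (λ y → 𝟙 (D (a ⁻¹ ∙ y)) * 𝟙 ((A ∖ W) ((a ⁻¹ ∙ y) ⁻¹ ∙ (a ⁻¹ ∙ (x ∙ w))))) ≡⟨ ∑-translateˡ (a ⁻¹) (λ d → 𝟙 (D d) * 𝟙 ((A ∖ W) (d ⁻¹ ∙ (a ⁻¹ ∙ (x ∙ w))))) ⟩
          conv D (A ∖ W) (a ⁻¹ ∙ (x ∙ w)) ∎))
          where
          target : ∀ y → (a ⁻¹ ∙ y) ⁻¹ ∙ (a ⁻¹ ∙ (x ∙ w)) ≡ (x ⁻¹ ∙ y) ⁻¹ ∙ w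
          target y = trans (telescope⁻¹ a y (x ∙ w)) (trans (sym (assoc _ x w)) (cong (_∙ w) (sym (x⁻¹y⁻¹ x y))))

      open Powers 𝔾 X public

      XⁿA : ℕ → G → Bool
      XⁿA zero = A
      XⁿA (suc n) = X · XⁿA n

      #A⁻¹XⁿA : ∀ n → # (A ∖ XⁿA n) ≤ (2 * (K₁ * K₁)) ^ n * (K₁ * q)
      #A⁻¹XⁿA zero = ≤-trans small (≤-reflexive (sym (*-identityˡ _)))
      #A⁻¹XⁿA (suc n) = ≤-trans (growth (XⁿA n)) (≤-trans (*-monoʳ-≤ (2 * (K₁ * K₁)) (#A⁻¹XⁿA n)) (≤-reflexive (sym (*-assoc (2 * (K₁ * K₁)) _ _))))

      opaque
        unfolding pw

        pw-A : ∀ n {t a} → pw n t ≡ true → A a ≡ true → XⁿA n (t ∙ a) ≡ true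
        pw-A zero {t} {a} h Aa with does⇒ (ε ≟ t) h
        ... | refl = trans (cong A (identityˡ a)) Aa
        pw-A (suc n) {t} {a} h Aa with ·-elim {X} {pw n} h
        ... | x , y , Xx , hy , refl = trans (cong (XⁿA (suc n)) (assoc x y a)) (·-intro {X} {XⁿA n} Xx (pw-A n hy Aa))

      -- The bounds obtained from `growth` are for A⁻¹XⁿA; a fixed a in `A` embeds Xⁿ there by t ↦
      -- a⁻¹ t a.
      #pw : ∀ n → # (pw n) ≤ (2 * (K₁ * K₁)) ^ n * (K₁ * (2 * K₁)) * # X
      #pw n with #-witness A q>0
      ... | a , Aa = begin
        # (pw n) ≤⟨ ∑-inject (λ t → a ⁻¹ ∙ (t ∙ a)) (pw n) (A ∖ XⁿA n) (λ t h → ∖-intro {A} {XⁿA n} Aa (pw-A n h Aa))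
            (λ s t _ _ e → ∙-cancelʳ a s t (∙-cancelˡ (a ⁻¹) _ _ e)) ⟩
        # (A ∖ XⁿA n) ≤⟨ #A⁻¹XⁿA n ⟩
        (2 * (K₁ * K₁)) ^ n * (K₁ * q) ≤⟨ *-monoʳ-≤ ((2 * (K₁ * K₁)) ^ n) (*-monoʳ-≤ K₁ q≤2K₁#X) ⟩
        (2 * (K₁ * K₁)) ^ n * (K₁ * (2 * K₁ * # X)) ≡⟨ move ((2 * (K₁ * K₁)) ^ n) K₁ (2 * K₁) (# X) ⟩
        (2 * (K₁ * K₁)) ^ n * (K₁ * (2 * K₁)) * # X ∎
        where
        open ≤-Reasoning
        move : ∀ a b c d → a * (b * (c * d)) ≡ a * (b * c) * d
        move = solve-∀

      -- By `weigh` it is enough to count pairs with y z⁻¹ in gH. For fixed y this places z⁻¹, which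
      -- is in `S` because `S` is symmetric, in the coset y⁻¹gH.
      coset-bound : ∀ (S H : G → Bool) (N : ℕ) →
        (∀ a → A a ≡ true → S a ≡ true) → (∀ x → S x ≡ true → S (x ⁻¹) ≡ true) →
        (∀ g → # (λ x → S x ∧ H (g ⁻¹ ∙ x)) * N ≤ # S) →
        ∀ g → # (λ x → X x ∧ H (g ⁻¹ ∙ x)) * N ≤ 2 * K₁ * # S
      coset-bound S H N A⊆S S-inverse spread g = *-cancelʳ-≤-pos q>0 (begin
        # (λ x → X x ∧ H (g ⁻¹ ∙ x)) * N * q ≡⟨ swapʳ (# (λ x → X x ∧ H (g ⁻¹ ∙ x))) N q ⟩
        # (λ x → X x ∧ H (g ⁻¹ ∙ x)) * q * N ≡⟨ cong (λ m → m * q * N) (∑-cong λ x → 𝟙-∧ (X x) _) ⟩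
        ∑ (λ x → 𝟙 (X x) * 𝟙 (H (g ⁻¹ ∙ x))) * q * N ≤⟨ *-monoˡ-≤ N (weigh (λ x → 𝟙 (H (g ⁻¹ ∙ x)))) ⟩
        2 * K₁ * ∑ (λ x → 𝟙 (H (g ⁻¹ ∙ x)) * r x) * N ≤⟨ *-monoˡ-≤ N (*-monoʳ-≤ (2 * K₁) pairs) ⟩
        2 * K₁ * ∑ (λ y → 𝟙 (A y) * # (λ z → S z ∧ H ((y ⁻¹ ∙ g) ⁻¹ ∙ z))) * N ≡⟨ *-assoc (2 * K₁) _ N ⟩
        2 * K₁ * (∑ (λ y → 𝟙 (A y) * # (λ z → S z ∧ H ((y ⁻¹ ∙ g) ⁻¹ ∙ z))) * N) ≡⟨ cong (2 * K₁ *_) (sym (∑-*ʳ N _)) ⟩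
        2 * K₁ * ∑ (λ y → 𝟙 (A y) * # (λ z → S z ∧ H ((y ⁻¹ ∙ g) ⁻¹ ∙ z)) * N) ≤⟨ *-monoʳ-≤ (2 * K₁) (∑-mono λ y →
            ≤-trans (≤-reflexive (*-assoc (𝟙 (A y)) _ N)) (*-monoʳ-≤ (𝟙 (A y)) (spread (y ⁻¹ ∙ g)))) ⟩
        2 * K₁ * ∑ (λ y → 𝟙 (A y) * # S) ≡⟨ cong (2 * K₁ *_) (∑-*ʳ (# S) _) ⟩
        2 * K₁ * (q * # S) ≡⟨ move (2 * K₁) q (# S) ⟩
        2 * K₁ * # S * q ∎)
        where
        open ≤-Reasoning
        swapʳ : ∀ a b c → a * b * c ≡ a * c * b
        swapʳ = solve-∀
        move : ∀ a b c → a * (b * c) ≡ a * c * b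
        move = solve-∀
        pairs : ∑ (λ x → 𝟙 (H (g ⁻¹ ∙ x)) * r x) ≤ ∑ (λ y → 𝟙 (A y) * # (λ z → S z ∧ H ((y ⁻¹ ∙ g) ⁻¹ ∙ z)))
        pairs = begin
          ∑ (λ x → 𝟙 (H (g ⁻¹ ∙ x)) * r x) ≡⟨ ∑-cong (λ x → sym (∑-*ˡ (𝟙 (H (g ⁻¹ ∙ x))) _)) ⟩
          ∑ (λ x → ∑ λ y → 𝟙 (H (g ⁻¹ ∙ x)) * (𝟙 (A y) * 𝟙 (A (x ⁻¹ ∙ y)))) ≡⟨ ∑-swap _ ⟩
          ∑ (λ y → ∑ λ x → 𝟙 (H (g ⁻¹ ∙ x)) * (𝟙 (A y) * 𝟙 (A (x ⁻¹ ∙ y)))) ≡⟨ ∑-cong (λ y → sym (trans (∑-inverse (λ z → 𝟙 (H (g ⁻¹ ∙ (y ∙ z))) * (𝟙 (A y) * 𝟙 (A ((y ∙ z) ⁻¹ ∙ y))))) (∑-translateˡ y _))) ⟩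
          ∑ (λ y → ∑ λ z → 𝟙 (H (g ⁻¹ ∙ (y ∙ z ⁻¹))) * (𝟙 (A y) * 𝟙 (A ((y ∙ z ⁻¹) ⁻¹ ∙ y)))) ≤⟨ ∑-mono (λ y → ∑-mono λ z → pointwise y z) ⟩
          ∑ (λ y → ∑ λ z → 𝟙 (A y) * 𝟙 (S (z ⁻¹) ∧ H ((y ⁻¹ ∙ g) ⁻¹ ∙ z ⁻¹))) ≡⟨ ∑-cong (λ y → trans (∑-*ˡ (𝟙 (A y)) _) (cong (𝟙 (A y) *_) (∑-inverse λ z → 𝟙 (S z ∧ H ((y ⁻¹ ∙ g) ⁻¹ ∙ z))))) ⟩
          ∑ (λ y → 𝟙 (A y) * # (λ z → S z ∧ H ((y ⁻¹ ∙ g) ⁻¹ ∙ z))) ∎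
          where
          pointwise : ∀ y z → 𝟙 (H (g ⁻¹ ∙ (y ∙ z ⁻¹))) * (𝟙 (A y) * 𝟙 (A ((y ∙ z ⁻¹) ⁻¹ ∙ y))) ≤ 𝟙 (A y) * 𝟙 (S (z ⁻¹) ∧ H ((y ⁻¹ ∙ g) ⁻¹ ∙ z ⁻¹))
          pointwise y z = ≤-trans (≤-reflexive (rearrange (𝟙 (H (g ⁻¹ ∙ (y ∙ z ⁻¹)))) (𝟙 (A y)) _)) (*-monoʳ-≤ (𝟙 (A y))
            (≤-trans (≤-reflexive (sym (𝟙-∧ (A ((y ∙ z ⁻¹) ⁻¹ ∙ y)) _))) (𝟙-mono (A ((y ∙ z ⁻¹) ⁻¹ ∙ y) ∧ H (g ⁻¹ ∙ (y ∙ z ⁻¹))) _ λ e →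
              ∧-intro (S-inverse z (A⊆S z (trans (cong A (sym (quotient⁻¹-self y z))) (∧-fst e))))
                (trans (cong H (trans (cong (_∙ z ⁻¹) (x⁻¹y⁻¹ y g)) (assoc _ y _))) (∧-snd {A ((y ∙ z ⁻¹) ⁻¹ ∙ y)} e)))))
            where
            rearrange : ∀ h a b → h * (a * b) ≡ a * (b * h)
            rearrange = solve-∀

-- Finite fields, a ring solver, vectors and 2 × 2 matrices.

module Fields where

  open import Level using (0ℓ)
  open import Algebra.Structures using (IsCommutativeRing)
  open import Algebra.Bundles using (CommutativeRing)
  import Algebra.Properties.Ring
  import Algebra.Properties.AbelianGroup
  import Algebra.Properties.Semiring.Mult.TCOptimised as Mult
  open import Data.Nat.Base as ℕ using (ℕ; zero; suc)
  import Data.Nat.Properties as ℕ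
  open import Data.Integer as ℤ using (ℤ; +_; -[1+_]; _⊖_)
  import Data.Integer.Properties as ℤ
  open import Data.Bool using (Bool; true; false)
  open import Data.Product using (_×_; _,_; Σ)
  open import Relation.Binary.PropositionalEquality
  open import Relation.Nullary using (yes; no)
  open import Tactic.RingSolver.Core.AlmostCommutativeRing using (AlmostCommutativeRing; fromCommutativeRing)
  open import Tactic.RingSolver.Core.Polynomial.Parameters using (Homomorphism)
  open import Tactic.RingSolver.Core.Expression public
  open import Data.Maybe using (nothing)
  open import Function using (_⟨_⟩_)
  open Sums
  open GroupEnergy using (FiniteGroup)
  open import Data.Sum using (_⊎_; inj₁; inj₂)
  open import Data.Empty using (⊥-elim)

  -- Operations without laws, so that `det`, `mul` and the other formulas can be interpreted twice:
  -- in a field, and in the syntax of the solver (`exprOps`). The formulas of a polynomial identity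
  -- are then shared by its statement and its proof.
  record RingOps : Set₁ where
    infixr 8 -_
    infixl 6 _+_ _-_
    infixl 7 _*_
    field
      F : Set
      _+_ _*_ : F → F → F
      -_ : F → F
      0# 1# : F

    _-_ : F → F → F
    x - y = x + - y

    V : Set
    V = F × F × F

    -- (a , b , c , d) is the matrix with rows (a , b) and (c , d).
    M : Set
    M = F × F × F × F

    det tr disc : M → F
    det (a , b , c , d) = a * d + - (b * c)
    tr (a , b , c , d) = a + d
    disc (a , b , c , d) = (a - d) * (a - d) + (1# + 1# + 1# + 1#) * (b * c)

    mul : M → M → M
    mul (a , b , c , d) (a' , b' , c' , d') =
      (a * a' + b * c' , a * b' + b * d' , c * a' + d * c' , c * b' + d * d')

    inv neg : M → M
    inv (a , b , c , d) = (d , - b , - c , a)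
    neg (a , b , c , d) = (- a , - b , - c , - d)

    -- The component of a matrix transverse to the scalars.
    hat : M → V
    hat (a , b , c , d) = (a - d , b , c)

    affine : F → M → M → M
    affine s (a , b , c , d) (a' , b' , c' , d') = (a + s * (a' - a) , b + s * (b' - b) , c + s * (c' - c) , d + s * (d' - d))

    cross : V → V → V
    cross (a , b , c) (a' , b' , c') = (b * c' - c * b' , c * a' - a * c' , a * b' - b * a')

    dot : V → V → F
    dot (a , b , c) (a' , b' , c') = a * a' + b * b' + c * c'

    infixr 7 _·_
    _·_ : F → V → V
    s · (a , b , c) = (s * a , s * b , s * c)

    -- The linear form x ↦ tr ((m' - m) x) on matrices, when tr m' = tr m, in terms of hat x.
    functional : M → M → V
    functional (a , b , c , d) (a' , b' , c' , d') = (a' - a , c' - c , b' - b)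

    e₁₁ e₁₂ e₂₁ e₂₂ : M → F
    e₁₁ (a , _) = a
    e₁₂ (_ , b , _) = b
    e₂₁ (_ , _ , c , _) = c
    e₂₂ (_ , _ , _ , d) = d

    v₁ v₂ v₃ : V → F
    v₁ (a , _) = a
    v₂ (_ , b , _) = b
    v₃ (_ , _ , c) = c

  record FiniteField : Set₁ where
    field
      ops : RingOps
    open RingOps ops public
    infix 8 _⁻¹
    field
      isCommutativeRing : IsCommutativeRing _≡_ _+_ _*_ -_ 0# 1#
      1≢0 : 1# ≢ 0#
      2≢0 : 1# + 1# ≢ 0#
      _⁻¹ : F → F
      inverse : ∀ x → x ≢ 0# → x * x ⁻¹ ≡ 1#
      finite : Finite F

    commutativeRing : CommutativeRing 0ℓ 0ℓ
    commutativeRing = record { isCommutativeRing = isCommutativeRing }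

  -- Coefficients are taken in ℤ, where being zero can be decided, and are mapped to the field by
  -- `emb`. Identities with numerals and cancellations thus normalise over an abstract field.
  module IntegerSolver (𝔽 : FiniteField) where
    open FiniteField 𝔽 using (F; _+_; _*_; -_; 0#; 1#) renaming (commutativeRing to R)

    ring : AlmostCommutativeRing 0ℓ 0ℓ
    ring = fromCommutativeRing R (λ _ → nothing)

    open CommutativeRing R using (semiring; +-assoc; +-comm; +-identityˡ; +-identityʳ; -‿inverseʳ; -‿inverseˡ; *-comm; zeroˡ; zeroʳ) renaming (ring to ring')
    open Algebra.Properties.Ring ring' using (-‿distribˡ-*; -‿distribʳ-*; -‿involutive; -‿+-comm; -0#≈0#)
    open Mult semiring renaming (_×_ to _·_)
    emb : ℤ → F
    emb (+ n) = n · 1#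
    emb -[1+ n ] = - (suc n · 1#)

    suc· : ∀ n → suc n · 1# ≡ 1# + n · 1#
    suc· n = ×-homo-+ 1# 1 n

    emb-⊖ : ∀ m n → emb (m ⊖ n) ≡ m · 1# + - (n · 1#)
    emb-⊖ m zero = sym (trans (cong (λ y → m · 1# + y) -0#≈0#) (+-identityʳ _))
    emb-⊖ zero (suc n) = sym (+-identityˡ _)
    emb-⊖ (suc m) (suc n) = begin
      emb (suc m ⊖ suc n) ≡⟨ cong emb (ℤ.[1+m]⊖[1+n]≡m⊖n m n) ⟩
      emb (m ⊖ n) ≡⟨ emb-⊖ m n ⟩
      m · 1# + - (n · 1#) ≡⟨ cong (λ y → y + - (n · 1#)) (sym (trans (cong (λ y → y + m · 1#) (-‿inverseʳ 1#)) (+-identityˡ _))) ⟩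
      1# + - 1# + m · 1# + - (n · 1#) ≡⟨ cong (λ y → y + - (n · 1#)) (trans (+-assoc _ _ _) (trans (cong (λ y → 1# + y) (+-comm _ _)) (sym (+-assoc _ _ _)))) ⟩
      1# + m · 1# + - 1# + - (n · 1#) ≡⟨ +-assoc _ _ _ ⟩
      1# + m · 1# + (- 1# + - (n · 1#)) ≡⟨ cong₂ _+_ (sym (suc· m)) (trans (-‿+-comm _ _) (cong -_ (sym (suc· n)))) ⟩
      suc m · 1# + - (suc n · 1#) ∎
      where open ≡-Reasoning

    emb-neg : ∀ i → emb (ℤ.- i) ≡ - emb i
    emb-neg (+ zero) = sym -0#≈0#
    emb-neg (+ suc n) = refl
    emb-neg -[1+ n ] = sym (-‿involutive _)

    emb-+ : ∀ i j → emb (i ℤ.+ j) ≡ emb i + emb j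
    emb-+ (+ m) (+ n) = ×-homo-+ 1# m n
    emb-+ (+ m) -[1+ n ] = emb-⊖ m (suc n)
    emb-+ -[1+ m ] (+ n) = trans (emb-⊖ n (suc m)) (+-comm _ _)
    emb-+ -[1+ m ] -[1+ n ] = begin
      - (suc (suc (m ℕ.+ n)) · 1#) ≡⟨ cong (λ k → - (k · 1#)) (sym (ℕ.+-suc (suc m) n)) ⟩
      - ((suc m ℕ.+ suc n) · 1#) ≡⟨ cong -_ (×-homo-+ 1# (suc m) (suc n)) ⟩
      - (suc m · 1# + suc n · 1#) ≡⟨ sym (-‿+-comm _ _) ⟩
      - (suc m · 1#) + - (suc n · 1#) ∎
      where open ≡-Reasoning

    emb-+* : ∀ m j → emb (+ m ℤ.* j) ≡ m · 1# * emb j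
    emb-+* m (+ n) = trans (cong emb (sym (ℤ.pos-* m n))) (×1-homo-* m n)
    emb-+* m -[1+ n ] = begin
      emb (+ m ℤ.* ℤ.- (+ suc n)) ≡⟨ cong emb (sym (ℤ.neg-distribʳ-* (+ m) (+ suc n))) ⟩
      emb (ℤ.- (+ m ℤ.* + suc n)) ≡⟨ emb-neg (+ m ℤ.* + suc n) ⟩
      - emb (+ m ℤ.* + suc n) ≡⟨ cong -_ (emb-+* m (+ suc n)) ⟩
      - (m · 1# * (suc n · 1#)) ≡⟨ -‿distribʳ-* _ _ ⟩
      m · 1# * - (suc n · 1#) ∎
      where open ≡-Reasoning

    emb-* : ∀ i j → emb (i ℤ.* j) ≡ emb i * emb j
    emb-* (+ m) j = emb-+* m j
    emb-* -[1+ m ] j = begin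
      emb (ℤ.- (+ suc m) ℤ.* j) ≡⟨ cong emb (sym (ℤ.neg-distribˡ-* (+ suc m) j)) ⟩
      emb (ℤ.- (+ suc m ℤ.* j)) ≡⟨ emb-neg (+ suc m ℤ.* j) ⟩
      - emb (+ suc m ℤ.* j) ≡⟨ cong -_ (emb-+* (suc m) j) ⟩
      - (suc m · 1# * emb j) ≡⟨ -‿distribˡ-* _ _ ⟩
      - (suc m · 1#) * emb j ∎
      where open ≡-Reasoning

    isZero : ℤ → Bool
    isZero (+ zero) = true
    isZero _ = false

    homo : Homomorphism 0ℓ 0ℓ 0ℓ 0ℓ
    homo = record
      { from = record { rawRing = ℤ.+-*-rawRing ; isZero = isZero }
      ; to = ring
      ; morphism = record { ⟦_⟧ = emb ; +-homo = emb-+ ; *-homo = emb-* ; -‿homo = emb-neg ; 0-homo = refl ; 1-homo = refl }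
      ; Zero-C⟶Zero-R = λ { (+ zero) _ → refl }
      }

    open Eval (AlmostCommutativeRing.rawRing ring) emb public
    open import Tactic.RingSolver.Core.Polynomial.Base (Homomorphism.from homo)

    norm : ∀ {n} → Expr ℤ n → Poly n
    norm (Κ x)   = κ x
    norm (Ι x)   = ι x
    norm (x ⊕ y) = norm x ⊞ norm y
    norm (x ⊗ y) = norm x ⊠ norm y
    norm (⊝ x)   = ⊟ norm x
    norm (x ⊛ i) = norm x ⊡ i

    open import Data.Vec using (Vec)
    open import Algebra.Properties.Semiring.Exp.TCOptimised semiring using (^-congˡ)

    ⟦_⇓⟧ : ∀ {n} → Expr ℤ n → Vec F n → F
    ⟦ expr ⇓⟧ = ⟦ norm expr ⟧ₚ where
      open import Tactic.RingSolver.Core.Polynomial.Semantics homo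
        renaming (⟦_⟧ to ⟦_⟧ₚ)

    correct : ∀ {n} (expr : Expr ℤ n) ρ → ⟦ expr ⇓⟧ ρ ≡ ⟦ expr ⟧ ρ
    correct {n = n} = go
      where
      open import Tactic.RingSolver.Core.Polynomial.Homomorphism homo
      go : ∀ (expr : Expr ℤ n) ρ → ⟦ expr ⇓⟧ ρ ≡ ⟦ expr ⟧ ρ
      go (Κ x)   ρ = κ-hom x ρ
      go (Ι x)   ρ = ι-hom x ρ
      go (x ⊕ y) ρ = ⊞-hom (norm x) (norm y) ρ ⟨ trans ⟩ cong₂ _+_ (go x ρ) (go y ρ)
      go (x ⊗ y) ρ = ⊠-hom (norm x) (norm y) ρ ⟨ trans ⟩ cong₂ _*_ (go x ρ) (go y ρ)
      go (⊝ x)   ρ = ⊟-hom (norm x) ρ   ⟨ trans ⟩ cong -_ (go x ρ)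
      go (x ⊛ i) ρ = ⊡-hom (norm x) i ρ ⟨ trans ⟩ ^-congˡ i (go x ρ)

    open import Relation.Binary.Reflection (CommutativeRing.setoid R) Ι ⟦_⟧ ⟦_⇓⟧ correct public using (solve; _⊜_)

    exprOps : ∀ {n} → RingOps
    exprOps {n} = record { F = Expr ℤ n ; _+_ = _⊕_ ; _*_ = _⊗_ ; -_ = ⊝_ ; 0# = Κ (+ 0) ; 1# = Κ (+ 1) }

  module FieldLemmas (𝔽 : FiniteField) where
    open FiniteField 𝔽 public
    open CommutativeRing commutativeRing public using (+-assoc; +-comm; +-identityˡ; +-identityʳ; -‿inverseʳ; -‿inverseˡ; *-assoc; *-comm; *-identityˡ; *-identityʳ; zeroˡ; zeroʳ; distribˡ; distribʳ)
    open IntegerSolver 𝔽 public using (solve; _⊜_; exprOps)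
    -- The operations on solver expressions; with them det, mul, … can be applied inside solve.
    module P {n : ℕ} = RingOps (exprOps {n})

    instance
      Finite-F : Finite F
      Finite-F = finite

    q : ℕ
    q = ∑ {F} λ _ → 1

    x≡y+z : ∀ x y → x ≡ y + (x - y)
    x≡y+z = solve 2 (λ x y → x ⊜ (y P.+ (x P.- y))) refl

    x-y≡0 : ∀ {x y} → x - y ≡ 0# → x ≡ y
    x-y≡0 {x} {y} e = trans (x≡y+z x y) (trans (cong (λ z → y + z) e) (+-identityʳ y))

    x≡y⇒0 : ∀ {x y} → x ≡ y → x - y ≡ 0#
    x≡y⇒0 {x} refl = -‿inverseʳ x

    cancel-* : ∀ {x y z} → x ≢ 0# → x * y ≡ x * z → y ≡ z
    cancel-* {x} {y} {z} x≢0 e = trans (sym (unit y)) (trans (cong (λ w → x ⁻¹ * w) e) (unit z))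
      where
      unit : ∀ w → x ⁻¹ * (x * w) ≡ w
      unit w = trans (sym (*-assoc (x ⁻¹) x w)) (trans (cong (λ z → z * w) (trans (*-comm (x ⁻¹) x) (inverse x x≢0))) (*-identityˡ w))

    zero-product : ∀ x y → x * y ≡ 0# → x ≡ 0# ⊎ y ≡ 0#
    zero-product x y e with x ≟ 0#
    ... | yes x≡0 = inj₁ x≡0
    ... | no x≢0 = inj₂ (cancel-* x≢0 (trans e (sym (zeroʳ x))))

    divide : ∀ x y → y ≢ 0# → x * y ⁻¹ * y ≡ x
    divide x y y≢0 = trans (*-assoc x (y ⁻¹) y) (trans (cong (λ z → x * z) (trans (*-comm (y ⁻¹) y) (inverse y y≢0))) (*-identityʳ x))

    V≡ : ∀ {a b c a' b' c' : F} → a ≡ a' → b ≡ b' → c ≡ c' → (a , b , c) ≡ (a' , b' , c')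
    V≡ refl refl refl = refl

    M≡ : ∀ {a b c d a' b' c' d' : F} → a ≡ a' → b ≡ b' → c ≡ c' → d ≡ d' → (a , b , c , d) ≡ (a' , b' , c' , d')
    M≡ refl refl refl refl = refl

    0V : V
    0V = (0# , 0# , 0#)

    Parallel : V → V → Set
    Parallel u v = cross u v ≡ 0V

    nonzero-component : ∀ w → w ≢ 0V → v₁ w ≢ 0# ⊎ v₂ w ≢ 0# ⊎ v₃ w ≢ 0#
    nonzero-component (a , b , c) h with a ≟ 0# | b ≟ 0# | c ≟ 0#
    ... | no a≢0 | _ | _ = inj₁ a≢0
    ... | yes _ | no b≢0 | _ = inj₂ (inj₁ b≢0)
    ... | yes _ | yes _ | no c≢0 = inj₂ (inj₂ c≢0)
    ... | yes refl | yes refl | yes refl = ⊥-elim (h refl)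

    -- Some coordinate of w is nonzero. The scalar is the quotient of the coordinates at that place,
    -- and the vanishing minors give the other two coordinates.
    multiple : ∀ u w → w ≢ 0V → Parallel u w → Σ F λ s → u ≡ s · w
    multiple (x , y , z) (a , b , c) w≢0 par = pick (nonzero-component (a , b , c) w≢0)
      where
      p₁ : y * c ≡ z * b
      p₁ = x-y≡0 (cong v₁ par)
      p₂ : z * a ≡ x * c
      p₂ = x-y≡0 (cong v₂ par)
      p₃ : x * b ≡ y * a
      p₃ = x-y≡0 (cong v₃ par)
      scale : ∀ {m n k l} → k ≢ 0# → m * k ≡ l * n → m ≡ l * k ⁻¹ * n
      scale {m} {n} {k} {l} k≢0 e = cancel-* k≢0 (trans (*-comm k m) (trans e (trans (cong (λ t → t * n) (sym (divide l k k≢0))) (rearrange (l * k ⁻¹) k n))))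
        where
        rearrange : ∀ i k n → i * k * n ≡ k * (i * n)
        rearrange = solve 3 (λ i k n → (i P.* k P.* n) ⊜ (k P.* (i P.* n))) refl
      pick : a ≢ 0# ⊎ b ≢ 0# ⊎ c ≢ 0# → Σ F λ s → (x , y , z) ≡ s · (a , b , c)
      pick (inj₁ a≢0) = x * a ⁻¹ , V≡ (sym (divide x a a≢0)) (scale a≢0 (sym p₃)) (scale a≢0 p₂)
      pick (inj₂ (inj₁ b≢0)) = y * b ⁻¹ , V≡ (scale b≢0 p₃) (sym (divide y b b≢0)) (scale b≢0 (sym p₁))
      pick (inj₂ (inj₂ c≢0)) = z * c ⁻¹ , V≡ (scale c≢0 (sym p₂)) (scale c≢0 p₁) (sym (divide z c c≢0))

    multiples-parallel : ∀ s t w → Parallel (s · w) (t · w)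
    multiples-parallel s t (a , b , c) = V≡ (minor s t b c) (minor s t c a) (minor s t a b)
      where
      minor : ∀ s t x y → s * x * (t * y) - s * y * (t * x) ≡ 0#
      minor = solve 4 (λ s t x y → (s P.* x P.* (t P.* y) P.- s P.* y P.* (t P.* x)) ⊜ P.0#) refl

    parallel-trans : ∀ {u v w} → w ≢ 0V → Parallel u w → Parallel v w → Parallel u v
    parallel-trans {u} {v} {w} w≢0 u∥w v∥w with multiple u w w≢0 u∥w | multiple v w w≢0 v∥w
    ... | s , refl | t , refl = multiples-parallel s t w

    -- u × (v × w) = (u · w) v - (u · v) w
    parallel-cross : ∀ u v w → dot u v ≡ 0# → dot u w ≡ 0# → Parallel u (cross v w)
    parallel-cross (a , b , c) (x , y , z) (x' , y' , z') e e' = V≡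
        (trans (triple₁ a b c x y z x' y' z') (vanish x x'))
        (trans (triple₂ a b c x y z x' y' z') (vanish y y'))
        (trans (triple₃ a b c x y z x' y' z') (vanish z z'))
      where
      vanish : ∀ s t → s * dot (a , b , c) (x' , y' , z') - t * dot (a , b , c) (x , y , z) ≡ 0#
      vanish s t = trans (cong₂ (λ m n → s * m - t * n) e' e) (zeros s t)
        where
        zeros : ∀ s t → s * 0# - t * 0# ≡ 0#
        zeros = solve 2 (λ s t → (s P.* P.0# P.- t P.* P.0#) ⊜ P.0#) refl
      triple₁ : ∀ a b c x y z x' y' z' → v₁ (cross (a , b , c) (cross (x , y , z) (x' , y' , z'))) ≡ x * dot (a , b , c) (x' , y' , z') - x' * dot (a , b , c) (x , y , z)
      triple₁ = solve 9 (λ a b c x y z x' y' z' → P.v₁ (P.cross (a , b , c) (P.cross (x , y , z) (x' , y' , z'))) ⊜ (x P.* P.dot (a , b , c) (x' , y' , z') P.- x' P.* P.dot (a , b , c) (x , y , z))) refl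
      triple₂ : ∀ a b c x y z x' y' z' → v₂ (cross (a , b , c) (cross (x , y , z) (x' , y' , z'))) ≡ y * dot (a , b , c) (x' , y' , z') - y' * dot (a , b , c) (x , y , z)
      triple₂ = solve 9 (λ a b c x y z x' y' z' → P.v₂ (P.cross (a , b , c) (P.cross (x , y , z) (x' , y' , z'))) ⊜ (y P.* P.dot (a , b , c) (x' , y' , z') P.- y' P.* P.dot (a , b , c) (x , y , z))) refl
      triple₃ : ∀ a b c x y z x' y' z' → v₃ (cross (a , b , c) (cross (x , y , z) (x' , y' , z'))) ≡ z * dot (a , b , c) (x' , y' , z') - z' * dot (a , b , c) (x , y , z)
      triple₃ = solve 9 (λ a b c x y z x' y' z' → P.v₃ (P.cross (a , b , c) (P.cross (x , y , z) (x' , y' , z'))) ⊜ (z P.* P.dot (a , b , c) (x' , y' , z') P.- z' P.* P.dot (a , b , c) (x , y , z))) refl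

-- The group SL₂, commuting elements and traces.

module SpecialLinear where

  open Sums
  open GroupEnergy
  open Fields
  open import Data.Nat as ℕ using (ℕ)
  import Data.Nat.Properties as ℕ
  open import Data.Bool using (Bool; true; false)
  open import Data.List using (List; []; _∷_; concatMap)
  open import Data.Product using (_×_; _,_; Σ)
  open import Relation.Binary.PropositionalEquality
  open import Relation.Nullary using (yes; no; Dec; ¬_)
  open import Relation.Nullary.Decidable using (⌊_⌋; map′)
  open import Relation.Nullary.Decidable.Core using (recompute)

  module SL2 (𝔽 : FiniteField) where
    open FieldLemmas 𝔽

    -- The determinant condition is irrelevant, so that elements with the same matrix are equal
    -- (`SL≡`). A proof of it can be recovered in `det-mat` because equality in the field is
    -- decidable.
    record SL : Set where
      constructor sl
      field
        mat : M
        .unimodular : det mat ≡ 1#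
    open SL public

    det-mat : ∀ g → det (mat g) ≡ 1#
    det-mat (sl m e) = recompute (det m ≟ 1#) e

    SL≡ : ∀ {g h} → mat g ≡ mat h → g ≡ h
    SL≡ {sl _ _} {sl _ _} refl = refl

    lift : M → List SL
    lift m with det m ≟ 1#
    ... | yes e = sl m e ∷ []
    ... | no _ = []

    sumL-lift : ∀ m (f : M → ℕ) → sumL (lift m) (λ g → f (mat g)) ≡ 𝟙 ⌊ det m ≟ 1# ⌋ ℕ.* f m
    sumL-lift m f with det m ≟ 1#
    ... | yes _ = refl
    ... | no _ = refl

    sumL-concatMap : ∀ {A B : Set} (φ : A → List B) (xs : List A) (f : B → ℕ) →
      sumL (concatMap φ xs) f ≡ sumL xs (λ x → sumL (φ x) f)
    sumL-concatMap φ [] f = refl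
    sumL-concatMap φ (x ∷ xs) f = trans (sumL-++ (φ x) _ f) (cong (sumL (φ x) f ℕ.+_) (sumL-concatMap φ xs f))

    sumL-SL : (f : M → ℕ) → sumL (concatMap lift elements) (λ g → f (mat g)) ≡ ∑ λ m → 𝟙 ⌊ det m ≟ 1# ⌋ ℕ.* f m
    sumL-SL f = trans (sumL-concatMap lift elements _) (trans (sumL-cong elements λ m → sumL-lift m f) (sym (∑≡sumL _)))

    opaque
      unfolding ∑

      Finite-SL′ : Finite SL
      Finite-SL′ = record
        { elements = concatMap lift elements
        ; _≟_ = λ g h → map′ SL≡ (cong mat) (mat g ≟ mat h)
        ; once = λ g → trans (sumL-cong (concatMap lift elements) λ h → isYes-map′ (mat g ≟ mat h))
            (trans (sumL-SL (δ (mat g))) (trans (∑-cong λ m → ℕ.*-comm (𝟙 ⌊ det m ≟ 1# ⌋) _)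
            (trans (sift (mat g) _) (cong 𝟙 (⇒does (det (mat g) ≟ 1#) (det-mat g))))))
        }

      ∑-SL : (f : M → ℕ) → ∑ {{Finite-SL′}} (λ g → f (mat g)) ≡ ∑ λ m → 𝟙 ⌊ det m ≟ 1# ⌋ ℕ.* f m
      ∑-SL f = sumL-SL f

    instance
      Finite-SL : Finite SL
      Finite-SL = Finite-SL′

    det-mul : ∀ m m' → det (mul m m') ≡ det m * det m'
    det-mul (a , b , c , d) (x , y , z , w) = identity a b c d x y z w
      where
      identity : ∀ a b c d x y z w → det (mul (a , b , c , d) (x , y , z , w)) ≡ det (a , b , c , d) * det (x , y , z , w)
      identity = solve 8 (λ a b c d x y z w → P.det (P.mul (a , b , c , d) (x , y , z , w)) ⊜ (P.det (a , b , c , d) P.* P.det (x , y , z , w))) refl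

    det-inv : ∀ m → det (inv m) ≡ det m
    det-inv (a , b , c , d) = identity a b c d
      where
      identity : ∀ a b c d → det (inv (a , b , c , d)) ≡ det (a , b , c , d)
      identity = solve 4 (λ a b c d → P.det (P.inv (a , b , c , d)) ⊜ P.det (a , b , c , d)) refl

    det-neg : ∀ m → det (neg m) ≡ det m
    det-neg (a , b , c , d) = identity a b c d
      where
      identity : ∀ a b c d → det (neg (a , b , c , d)) ≡ det (a , b , c , d)
      identity = solve 4 (λ a b c d → P.det (P.neg (a , b , c , d)) ⊜ P.det (a , b , c , d)) refl

    idM : M
    idM = (1# , 0# , 0# , 1#)

    det-id : det idM ≡ 1#
    det-id = solve 0 (P.det (P.1# , P.0# , P.0# , P.1#) ⊜ P.1#) refl

    mul-assoc : ∀ m n k → mul (mul m n) k ≡ mul m (mul n k)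
    mul-assoc (a , b , c , d) (x , y , z , w) (p , q , r , s) =
      M≡ (entry a b x y z w p r) (entry a b x y z w q s) (entry c d x y z w p r) (entry c d x y z w q s)
      where
      entry : ∀ a b x y z w p r → (a * x + b * z) * p + (a * y + b * w) * r ≡ a * (x * p + y * r) + b * (z * p + w * r)
      entry = solve 8 (λ a b x y z w p r → ((a P.* x P.+ b P.* z) P.* p P.+ (a P.* y P.+ b P.* w) P.* r) ⊜ (a P.* (x P.* p P.+ y P.* r) P.+ b P.* (z P.* p P.+ w P.* r))) refl

    mul-idˡ : ∀ m → mul idM m ≡ m
    mul-idˡ (a , b , c , d) = M≡ (entry a c) (entry b d) (entry' a c) (entry' b d)
      where
      entry : ∀ a c → 1# * a + 0# * c ≡ a
      entry = solve 2 (λ a c → (P.1# P.* a P.+ P.0# P.* c) ⊜ a) refl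
      entry' : ∀ a c → 0# * a + 1# * c ≡ c
      entry' = solve 2 (λ a c → (P.0# P.* a P.+ P.1# P.* c) ⊜ c) refl

    mul-idʳ : ∀ m → mul m idM ≡ m
    mul-idʳ (a , b , c , d) = M≡ (entry a b) (entry' a b) (entry c d) (entry' c d)
      where
      entry : ∀ a b → a * 1# + b * 0# ≡ a
      entry = solve 2 (λ a b → (a P.* P.1# P.+ b P.* P.0#) ⊜ a) refl
      entry' : ∀ a b → a * 0# + b * 1# ≡ b
      entry' = solve 2 (λ a b → (a P.* P.0# P.+ b P.* P.1#) ⊜ b) refl

    mul-invˡ : ∀ m → det m ≡ 1# → mul (inv m) m ≡ idM
    mul-invˡ (a , b , c , d) e = M≡ (trans (t₁ a b c d) e) (t₂ b d) (t₃ a c) (trans (t₄ a b c d) e)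
      where
      t₁ : ∀ a b c d → d * a + - b * c ≡ a * d + - (b * c)
      t₁ = solve 4 (λ a b c d → (d P.* a P.+ P.- b P.* c) ⊜ (a P.* d P.+ P.- (b P.* c))) refl
      t₂ : ∀ b d → d * b + - b * d ≡ 0#
      t₂ = solve 2 (λ b d → (d P.* b P.+ P.- b P.* d) ⊜ P.0#) refl
      t₃ : ∀ a c → - c * a + a * c ≡ 0#
      t₃ = solve 2 (λ a c → (P.- c P.* a P.+ a P.* c) ⊜ P.0#) refl
      t₄ : ∀ a b c d → - c * b + a * d ≡ a * d + - (b * c)
      t₄ = solve 4 (λ a b c d → (P.- c P.* b P.+ a P.* d) ⊜ (a P.* d P.+ P.- (b P.* c))) refl

    mul-invʳ : ∀ m → det m ≡ 1# → mul m (inv m) ≡ idM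
    mul-invʳ (a , b , c , d) e = M≡ (trans (t₁ a b c d) e) (t₂ a b) (t₃ c d) (trans (t₄ a b c d) e)
      where
      t₁ : ∀ a b c d → a * d + b * - c ≡ a * d + - (b * c)
      t₁ = solve 4 (λ a b c d → (a P.* d P.+ b P.* P.- c) ⊜ (a P.* d P.+ P.- (b P.* c))) refl
      t₂ : ∀ a b → a * - b + b * a ≡ 0#
      t₂ = solve 2 (λ a b → (a P.* P.- b P.+ b P.* a) ⊜ P.0#) refl
      t₄ : ∀ a b c d → c * - b + d * a ≡ a * d + - (b * c)
      t₄ = solve 4 (λ a b c d → (c P.* P.- b P.+ d P.* a) ⊜ (a P.* d P.+ P.- (b P.* c))) refl
      t₃ : ∀ c d → c * d + d * - c ≡ 0#
      t₃ = solve 2 (λ c d → (c P.* d P.+ d P.* P.- c) ⊜ P.0#) refl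

    infixl 7 _∙_
    opaque

      _∙_ : SL → SL → SL
      sl m e ∙ sl m' e' = sl (mul m m') (trans (det-mul m m') (trans (cong₂ _*_ e e') (*-identityˡ 1#)))

      mat-∙ : ∀ g h → mat (g ∙ h) ≡ mul (mat g) (mat h)
      mat-∙ (sl _ _) (sl _ _) = refl

      invSL : SL → SL
      invSL (sl m e) = sl (inv m) (trans (det-inv m) e)

      mat-inv : ∀ g → mat (invSL g) ≡ inv (mat g)
      mat-inv (sl _ _) = refl

      negSL : SL → SL
      negSL (sl m e) = sl (neg m) (trans (det-neg m) e)

      mat-neg : ∀ g → mat (negSL g) ≡ neg (mat g)
      mat-neg (sl _ _) = refl

    ε : SL
    ε = sl idM det-id

    SL₂ : FiniteGroup
    SL₂ = record
      { G = SL ; _∙_ = _∙_ ; ε = ε ; _⁻¹ = invSL ; finite = Finite-SL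
      ; isGroup = record
        { isMonoid = record
          { isSemigroup = record
            { isMagma = record { isEquivalence = isEquivalence ; ∙-cong = cong₂ _∙_ }
            ; assoc = λ g h k → SL≡ (trans (mat-∙ (g ∙ h) k) (trans (cong (λ m → mul m (mat k)) (mat-∙ g h)) (trans (mul-assoc (mat g) (mat h) (mat k))
                (sym (trans (mat-∙ g (h ∙ k)) (cong (mul (mat g)) (mat-∙ h k))))))) }
          ; identity = (λ g → SL≡ (trans (mat-∙ ε g) (mul-idˡ (mat g)))) , (λ g → SL≡ (trans (mat-∙ g ε) (mul-idʳ (mat g)))) }
        ; inverse = (λ g → SL≡ (trans (mat-∙ (invSL g) g) (trans (cong (λ m → mul m (mat g)) (mat-inv g)) (mul-invˡ (mat g) (det-mat g)))))
                    , (λ g → SL≡ (trans (mat-∙ g (invSL g)) (trans (cong (mul (mat g)) (mat-inv g)) (mul-invʳ (mat g) (det-mat g)))))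
        ; ⁻¹-cong = cong invSL }
      }

  module Commuting (𝔽 : FiniteField) where
    open FieldLemmas 𝔽 renaming (_⁻¹ to recip; inverse to inverse-F; q to |F|; _·_ to _·V_) hiding (finite)
    open SL2 𝔽 using (SL; sl; mat; det-mat; SL≡; SL₂; negSL; idM; mat-∙; mat-inv; mat-neg)
    open GroupSums SL₂ public hiding (finite)

    Commute : SL → SL → Set
    Commute g h = g ∙ h ≡ h ∙ g

    -- The entries of m m' - m' m are, up to sign and order, the minors of `hat m` and `hat m'`.
    -- Commuting is thus proportionality of the parts transverse to the scalars.
    commute⇒parallel : ∀ g h → Commute g h → Parallel (hat (mat g)) (hat (mat h))
    commute⇒parallel g h e = minors (mat g) (mat h) (trans (sym (mat-∙ g h)) (trans (cong mat e) (mat-∙ h g)))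
      where
      minors : ∀ m m' → mul m m' ≡ mul m' m → Parallel (hat m) (hat m')
      minors (a , b , c , d) (x , y , z , w) e = V≡
          (trans (t₁ a b c d x y z w) (x≡y⇒0 (cong e₁₁ e)))
          (trans (t₂ a b c d x y z w) (x≡y⇒0 (cong e₂₁ e)))
          (trans (t₃ a b c d x y z w) (x≡y⇒0 (cong e₁₂ e)))
        where
        t₁ : ∀ a b c d x y z w → b * z - c * y ≡ (a * x + b * z) - (x * a + y * c)
        t₁ = solve 8 (λ a b c d x y z w → (b P.* z P.- c P.* y) ⊜ ((a P.* x P.+ b P.* z) P.- (x P.* a P.+ y P.* c))) refl
        t₂ : ∀ a b c d x y z w → c * (x - w) - (a - d) * z ≡ (c * x + d * z) - (z * a + w * c)
        t₂ = solve 8 (λ a b c d x y z w → (c P.* (x P.- w) P.- (a P.- d) P.* z) ⊜ ((c P.* x P.+ d P.* z) P.- (z P.* a P.+ w P.* c))) refl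
        t₃ : ∀ a b c d x y z w → (a - d) * y - b * (x - w) ≡ (a * y + b * w) - (x * b + y * d)
        t₃ = solve 8 (λ a b c d x y z w → ((a P.- d) P.* y P.- b P.* (x P.- w)) ⊜ ((a P.* y P.+ b P.* w) P.- (x P.* b P.+ y P.* d))) refl

    parallel⇒commute : ∀ g h → Parallel (hat (mat g)) (hat (mat h)) → Commute g h
    parallel⇒commute g h p = SL≡ (trans (mat-∙ g h) (trans (equal (mat g) (mat h) p) (sym (mat-∙ h g))))
      where
      equal : ∀ m m' → Parallel (hat m) (hat m') → mul m m' ≡ mul m' m
      equal (a , b , c , d) (x , y , z , w) e = M≡
          (x-y≡0 (trans (t₁ a b c d x y z w) (cong v₁ e)))
          (x-y≡0 (trans (t₂ a b c d x y z w) (cong v₃ e)))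
          (x-y≡0 (trans (t₃ a b c d x y z w) (cong v₂ e)))
          (sym (x-y≡0 (trans (t₄ a b c d x y z w) (cong v₁ e))))
        where
        t₁ : ∀ a b c d x y z w → (a * x + b * z) - (x * a + y * c) ≡ b * z - c * y
        t₁ = solve 8 (λ a b c d x y z w → ((a P.* x P.+ b P.* z) P.- (x P.* a P.+ y P.* c)) ⊜ (b P.* z P.- c P.* y)) refl
        t₂ : ∀ a b c d x y z w → (a * y + b * w) - (x * b + y * d) ≡ (a - d) * y - b * (x - w)
        t₂ = solve 8 (λ a b c d x y z w → ((a P.* y P.+ b P.* w) P.- (x P.* b P.+ y P.* d)) ⊜ ((a P.- d) P.* y P.- b P.* (x P.- w))) refl
        t₃ : ∀ a b c d x y z w → (c * x + d * z) - (z * a + w * c) ≡ c * (x - w) - (a - d) * z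
        t₃ = solve 8 (λ a b c d x y z w → ((c P.* x P.+ d P.* z) P.- (z P.* a P.+ w P.* c)) ⊜ (c P.* (x P.- w) P.- (a P.- d) P.* z)) refl
        t₄ : ∀ a b c d x y z w → (z * b + w * d) - (c * y + d * w) ≡ b * z - c * y
        t₄ = solve 8 (λ a b c d x y z w → ((z P.* b P.+ w P.* d) P.- (c P.* y P.+ d P.* w)) ⊜ (b P.* z P.- c P.* y)) refl

    commute : SL → SL → Bool
    commute g h = ⌊ g ∙ h ≟ h ∙ g ⌋

    commute⇒ : ∀ {g h} → commute g h ≡ true → Commute g h
    commute⇒ {g} {h} = does⇒ (g ∙ h ≟ h ∙ g)

    ⇒commute : ∀ {g h} → Commute g h → commute g h ≡ true
    ⇒commute {g} {h} = ⇒does (g ∙ h ≟ h ∙ g)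

    central : SL → Bool
    central g = ⌊ hat (mat g) ≟ 0V ⌋

    noncentral⇒ : ∀ {g} → central g ≡ false → hat (mat g) ≢ 0V
    noncentral⇒ {g} = does⇒¬ (hat (mat g) ≟ 0V)

    -- Whatever commutes with a noncentral w has its `hat` on the line of `hat w`, so the
    -- centralizer of w is commutative. The whole treatment of tori rests on this.
    commute-trans : ∀ {g h} w → central w ≡ false → Commute g w → Commute h w → Commute g h
    commute-trans {g} {h} w w≢0 gw hw = parallel⇒commute g h
      (parallel-trans (noncentral⇒ {w} w≢0) (commute⇒parallel g w gw) (commute⇒parallel h w hw))

    central⇒Commute : ∀ z h → central z ≡ true → Commute z h
    central⇒Commute z h e = parallel⇒commute z h (subst (λ v → Parallel v (hat (mat h))) (sym (does⇒ (hat (mat z) ≟ 0V) e)) (zero∥ (hat (mat h))))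
      where
      zero∥ : ∀ v → Parallel 0V v
      zero∥ (x , y , z) = V≡ (minor y z) (minor z x) (minor x y)
        where
        minor : ∀ x y → 0# * y - 0# * x ≡ 0#
        minor = solve 2 (λ x y → (P.0# P.* y P.- P.0# P.* x) ⊜ P.0#) refl

    -- A central conjugate of g is unchanged when conjugated back, so it would be g itself.
    central-conj : ∀ g y → central g ≡ false → central (g ^^ y) ≡ false
    central-conj g y h with central (g ^^ y) in e
    ... | false = refl
    ... | true = trans (sym (trans (cong central same) e)) h
      where
      same : g ≡ g ^^ y
      same = trans (sym (unconj g y)) (trans (cong (_∙ (y ⁻¹) ⁻¹) (sym (central⇒Commute (g ^^ y) (y ⁻¹) e))) (xy∙y⁻¹ (g ^^ y) (y ⁻¹)))

    trace : SL → F
    trace g = tr (mat g)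

    trace-comm : ∀ g h → trace (g ∙ h) ≡ trace (h ∙ g)
    trace-comm g h = trans (cong tr (mat-∙ g h)) (trans (identity (mat g) (mat h)) (cong tr (sym (mat-∙ h g))))
      where
      identity : ∀ m m' → tr (mul m m') ≡ tr (mul m' m)
      identity (a , b , c , d) (x , y , z , w) = poly a b c d x y z w
        where
        poly : ∀ a b c d x y z w → tr (mul (a , b , c , d) (x , y , z , w)) ≡ tr (mul (x , y , z , w) (a , b , c , d))
        poly = solve 8 (λ a b c d x y z w → P.tr (P.mul (a , b , c , d) (x , y , z , w)) ⊜ P.tr (P.mul (x , y , z , w) (a , b , c , d))) refl

    trace-conj : ∀ g y → trace (g ^^ y) ≡ trace g
    trace-conj g y = trans (trace-comm (y ∙ g) (y ⁻¹)) (cong trace (x⁻¹∙xy y g))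

    -- Three elements of SL₂ spanning a plane in the space of matrices.
    Coplanar : SL → SL → SL → Set
    Coplanar g g' g'' = Commute (g ⁻¹ ∙ g') (g ⁻¹ ∙ g'')

    -- If k'' = (1 - s) k + s k', then k⁻¹ k'' = (1 - s) + s k⁻¹ k' commutes with k⁻¹ k'; the form
    -- stated is this multiplied by k. With the adjugate for k⁻¹ it is a polynomial identity.
    affine⇒coplanar : ∀ s k k' k'' → mat k'' ≡ affine s (mat k) (mat k') → k' ∙ (k ⁻¹ ∙ k'') ≡ k'' ∙ (k ⁻¹ ∙ k')
    affine⇒coplanar s k k' k'' e = SL≡ (trans (expand k' k k'') (trans (subst (λ m → mul (mat k') (mul (inv (mat k)) m) ≡ mul m (mul (inv (mat k)) (mat k'))) (sym e) (identity (mat k) (mat k'))) (sym (expand k'' k k'))))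
      where
      expand : ∀ a b c → mat (a ∙ (b ⁻¹ ∙ c)) ≡ mul (mat a) (mul (inv (mat b)) (mat c))
      expand a b c = trans (mat-∙ a _) (cong (mul (mat a)) (trans (mat-∙ (b ⁻¹) c) (cong (λ m → mul m (mat c)) (mat-inv b))))
      identity : ∀ m m' → mul m' (mul (inv m) (affine s m m')) ≡ mul (affine s m m') (mul (inv m) m')
      identity (a , b , c , d) (x , y , z , w) = M≡ (t₁ s a b c d x y z w) (t₂ s a b c d x y z w) (t₃ s a b c d x y z w) (t₄ s a b c d x y z w)
        where
        lhs rhs : F → F → F → F → F → F → F → F → F → M
        lhs s a b c d x y z w = mul (x , y , z , w) (mul (inv (a , b , c , d)) (affine s (a , b , c , d) (x , y , z , w)))
        rhs s a b c d x y z w = mul (affine s (a , b , c , d) (x , y , z , w)) (mul (inv (a , b , c , d)) (x , y , z , w))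
        module _ {n : ℕ} where
          lhs' rhs' : (_ _ _ _ _ _ _ _ _ : RingOps.F (exprOps {n})) → RingOps.M (exprOps {n})
          lhs' s a b c d x y z w = P.mul (x , y , z , w) (P.mul (P.inv (a , b , c , d)) (P.affine s (a , b , c , d) (x , y , z , w)))
          rhs' s a b c d x y z w = P.mul (P.affine s (a , b , c , d) (x , y , z , w)) (P.mul (P.inv (a , b , c , d)) (x , y , z , w))
        t₁ : ∀ s a b c d x y z w → e₁₁ (lhs s a b c d x y z w) ≡ e₁₁ (rhs s a b c d x y z w)
        t₁ = solve 9 (λ s a b c d x y z w → P.e₁₁ (lhs' s a b c d x y z w) ⊜ P.e₁₁ (rhs' s a b c d x y z w)) refl
        t₂ : ∀ s a b c d x y z w → e₁₂ (lhs s a b c d x y z w) ≡ e₁₂ (rhs s a b c d x y z w)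
        t₂ = solve 9 (λ s a b c d x y z w → P.e₁₂ (lhs' s a b c d x y z w) ⊜ P.e₁₂ (rhs' s a b c d x y z w)) refl
        t₃ : ∀ s a b c d x y z w → e₂₁ (lhs s a b c d x y z w) ≡ e₂₁ (rhs s a b c d x y z w)
        t₃ = solve 9 (λ s a b c d x y z w → P.e₂₁ (lhs' s a b c d x y z w) ⊜ P.e₂₁ (rhs' s a b c d x y z w)) refl
        t₄ : ∀ s a b c d x y z w → e₂₂ (lhs s a b c d x y z w) ≡ e₂₂ (rhs s a b c d x y z w)
        t₄ = solve 9 (λ s a b c d x y z w → P.e₂₂ (lhs' s a b c d x y z w) ⊜ P.e₂₂ (rhs' s a b c d x y z w)) refl

    -- When the traces agree, the scalar part of x contributes nothing to tr ((k' - k) x), which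
    -- therefore depends on x through `hat` alone.
    dot-functional : ∀ k k' x → trace k' ≡ trace k → trace (k' ∙ x) ≡ trace (k ∙ x) → dot (functional (mat k) (mat k')) (hat (mat x)) ≡ 0#
    dot-functional k k' x e e' = compute (mat k) (mat k') (mat x) e (trans (cong tr (sym (mat-∙ k' x))) (trans e' (cong tr (mat-∙ k x))))
      where
      compute : ∀ m m' n → tr m' ≡ tr m → tr (mul m' n) ≡ tr (mul m n) → dot (functional m m') (hat n) ≡ 0#
      compute (a , b , c , d) (x , y , z , w) (p , q , r , s) e e' = trans (identity a b c d x y z w p q r s)
          (trans (cong₂ (λ m n → m - s * n) (x≡y⇒0 e') (x≡y⇒0 e)) (vanish s))
        where
        vanish : ∀ s → 0# - s * 0# ≡ 0#
        vanish = solve 1 (λ s → (P.0# P.- s P.* P.0#) ⊜ P.0#) refl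
        identity : ∀ a b c d x y z w p q r s → dot (functional (a , b , c , d) (x , y , z , w)) (hat (p , q , r , s))
          ≡ (tr (mul (x , y , z , w) (p , q , r , s)) - tr (mul (a , b , c , d) (p , q , r , s))) - s * (tr (x , y , z , w) - tr (a , b , c , d))
        identity = solve 12 (λ a b c d x y z w p q r s → P.dot (P.functional (a , b , c , d) (x , y , z , w)) (P.hat (p , q , r , s))
          ⊜ ((P.tr (P.mul (x , y , z , w) (p , q , r , s)) P.- P.tr (P.mul (a , b , c , d) (p , q , r , s))) P.- s P.* (P.tr (x , y , z , w) P.- P.tr (a , b , c , d)))) refl

    functional-affine : ∀ s m m' m'' → tr m' ≡ tr m → tr m'' ≡ tr m → functional m m'' ≡ s ·V functional m m' → m'' ≡ affine s m m'
    functional-affine s (a , b , c , d) (x , y , z , w) (p , q , r , t) e' e'' e = M≡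
        (solve-for a p _ (cong v₁ e)) (solve-for b q _ (cong v₃ e)) (solve-for c r _ (cong v₂ e))
        (solve-for d t _ (trans (last a d p t e'') (trans (cong -_ (cong v₁ e)) (trans (neg-* s (x - a)) (cong (λ z → s * z) (sym (last a d x w e')))))))
      where
      solve-for : ∀ a p u → p - a ≡ u → p ≡ a + u
      solve-for a p u e = trans (x≡y+z p a) (cong (λ z → a + z) e)
      neg-* : ∀ s u → - (s * u) ≡ s * - u
      neg-* = solve 2 (λ s u → P.- (s P.* u) ⊜ (s P.* P.- u)) refl
      last : ∀ a d p t → p + t ≡ a + d → t - d ≡ - (p - a)
      last a d p t e = trans (expand a d p t) (trans (cong (λ z → z - (p - a)) (x≡y⇒0 e)) (+-identityˡ _))
        where
        expand : ∀ a d p t → t - d ≡ (p + t - (a + d)) - (p - a)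
        expand = solve 4 (λ a d p t → (t P.- d) ⊜ ((p P.+ t P.- (a P.+ d)) P.- (p P.- a))) refl

    functional-0 : ∀ m m' → tr m' ≡ tr m → functional m m' ≡ 0V → m' ≡ m
    functional-0 (a , b , c , d) (x , y , z , w) e' e = M≡ (x-y≡0 (cong v₁ e)) (x-y≡0 (cong v₃ e)) (x-y≡0 (cong v₂ e))
        (last (x-y≡0 (cong v₁ e)) e')
      where
      last : x ≡ a → x + w ≡ a + d → w ≡ d
      last refl h = trans (expand a w) (trans (cong (λ z → z - a) h) (sym (expand a d)))
        where
        expand : ∀ a w → w ≡ a + w - a
        expand = solve 2 (λ a w → w ⊜ (a P.+ w P.- a)) refl

    -- The functionals of k', k'' relative to k are orthogonal to `hat x` and `hat y`, which are
    -- independent because x and y do not commute. Both are then multiples of the cross product, and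
    -- this puts k'' on the affine line through k and k'. The case k' = k is separate, as it spans
    -- no line.
    three-conditions : ∀ k k' k'' x y → ¬ Commute x y →
      trace k' ≡ trace k → trace (k' ∙ x) ≡ trace (k ∙ x) → trace (k' ∙ y) ≡ trace (k ∙ y) →
      trace k'' ≡ trace k → trace (k'' ∙ x) ≡ trace (k ∙ x) → trace (k'' ∙ y) ≡ trace (k ∙ y) →
      k' ∙ (k ⁻¹ ∙ k'') ≡ k'' ∙ (k ⁻¹ ∙ k')
    three-conditions k k' k'' x y indep e' ex' ey' e'' ex'' ey'' = conclude (functional (mat k) (mat k') ≟ 0V)
      where
      n : V
      n = cross (hat (mat x)) (hat (mat y))
      n≢0 : n ≢ 0V
      n≢0 e = indep (parallel⇒commute x y e)
      ∥n : ∀ l → trace l ≡ trace k → trace (l ∙ x) ≡ trace (k ∙ x) → trace (l ∙ y) ≡ trace (k ∙ y) → Parallel (functional (mat k) (mat l)) n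
      ∥n l e ex ey = parallel-cross (functional (mat k) (mat l)) (hat (mat x)) (hat (mat y)) (dot-functional k l x e ex) (dot-functional k l y e ey)
      degenerate : ∀ l → l ≡ k → l ∙ (k ⁻¹ ∙ k'') ≡ k'' ∙ (k ⁻¹ ∙ l)
      degenerate l refl = trans (x∙x⁻¹y k k'') (trans (sym (identityʳ k'')) (cong (k'' ∙_) (sym (inverseˡ k))))
      generic : (Σ F λ s → functional (mat k) (mat k'') ≡ s ·V functional (mat k) (mat k')) → k' ∙ (k ⁻¹ ∙ k'') ≡ k'' ∙ (k ⁻¹ ∙ k')
      generic (s , e) = affine⇒coplanar s k k' k'' (functional-affine s (mat k) (mat k') (mat k'') e' e'' e)
      conclude : Dec (functional (mat k) (mat k') ≡ 0V) → k' ∙ (k ⁻¹ ∙ k'') ≡ k'' ∙ (k ⁻¹ ∙ k')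
      conclude (yes e) = degenerate k' (SL≡ {k'} {k} (functional-0 (mat k) (mat k') e' e))
      conclude (no u≢0) = generic (multiple (functional (mat k) (mat k'')) (functional (mat k) (mat k')) u≢0
          (parallel-trans {functional (mat k) (mat k'')} {functional (mat k) (mat k')} {n} n≢0 (∥n k'' e'' ex'' ey'') (∥n k' e' ex' ey')))

    Incident : F → SL → SL → SL → SL → Set
    Incident τ h h' h'' g = trace (g ∙ h) ≡ τ × trace (g ∙ h') ≡ τ × trace (g ∙ h'') ≡ τ

    -- Three independent linear conditions leave a line of matrices.
    coplanar-duality : ∀ τ h h' h'' g g' g'' → Incident τ h h' h'' g → Incident τ h h' h'' g' → Incident τ h h' h'' g'' →
      ¬ Coplanar h h' h'' → Coplanar g g' g''
    coplanar-duality τ h h' h'' g g' g'' (a , a' , a'') (b , b' , b'') (c , c' , c'') indep =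
      trans (assoc (g ⁻¹) g' _) (trans (cong (g ⁻¹ ∙_) (∙-cancelʳ h _ _ (trans (sym (move g' g''))
        (trans (three-conditions (g ∙ h) (g' ∙ h) (g'' ∙ h) (h ⁻¹ ∙ h') (h ⁻¹ ∙ h'') indep
          (trans b (sym a)) (at g' h' b' a') (at g' h'' b'' a'') (trans c (sym a)) (at g'' h' c' a') (at g'' h'' c'' a''))
        (move g'' g'))))) (sym (assoc (g ⁻¹) g'' _)))
      where
      shift : ∀ γ η → γ ∙ h ∙ (h ⁻¹ ∙ η) ≡ γ ∙ η
      shift γ η = trans (assoc γ h _) (cong (γ ∙_) (x∙x⁻¹y h η))
      at : ∀ γ η → trace (γ ∙ η) ≡ τ → trace (g ∙ η) ≡ τ → trace (γ ∙ h ∙ (h ⁻¹ ∙ η)) ≡ trace (g ∙ h ∙ (h ⁻¹ ∙ η))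
      at γ η e e' = trans (cong trace (shift γ η)) (trans (trans e (sym e')) (cong trace (sym (shift g η))))
      move : ∀ a b → a ∙ h ∙ ((g ∙ h) ⁻¹ ∙ (b ∙ h)) ≡ a ∙ (g ⁻¹ ∙ b) ∙ h
      move a b = begin
        a ∙ h ∙ ((g ∙ h) ⁻¹ ∙ (b ∙ h)) ≡⟨ cong (λ z → a ∙ h ∙ (z ∙ (b ∙ h))) (⁻¹-anti-homo-∙ g h) ⟩
        a ∙ h ∙ (h ⁻¹ ∙ g ⁻¹ ∙ (b ∙ h)) ≡⟨ cong (a ∙ h ∙_) (assoc (h ⁻¹) (g ⁻¹) (b ∙ h)) ⟩
        a ∙ h ∙ (h ⁻¹ ∙ (g ⁻¹ ∙ (b ∙ h))) ≡⟨ shift a (g ⁻¹ ∙ (b ∙ h)) ⟩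
        a ∙ (g ⁻¹ ∙ (b ∙ h)) ≡⟨ cong (a ∙_) (sym (assoc (g ⁻¹) b h)) ⟩
        a ∙ (g ⁻¹ ∙ b ∙ h) ≡⟨ sym (assoc a (g ⁻¹ ∙ b) h) ⟩
        a ∙ (g ⁻¹ ∙ b) ∙ h ∎
        where open ≡-Reasoning

-- Sizes of centralizers and conjugates of regular elements.

module CentralizerBounds where

  open Sums
  open GroupEnergy
  open Fields
  open SpecialLinear
  open import Data.Nat as ℕ using (ℕ; _≤_; z≤n)
  import Data.Nat.Properties as ℕ
  open import Data.Bool using (Bool; true; false)
  open import Data.Product using (_,_; Σ; ∃)
  open import Data.Sum using (_⊎_; inj₁; inj₂)
  open import Data.Empty using (⊥-elim)
  open import Relation.Binary.PropositionalEquality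
  open import Relation.Nullary using (yes; no; Dec)
  open import Relation.Nullary.Decidable using (⌊_⌋)

  record IsSubgroupOf (𝔾 : FiniteGroup) (H : FiniteGroup.G 𝔾 → Bool) : Set where
    open FiniteGroup 𝔾
    field
      contains-ε : H ε ≡ true
      closed-∙ : ∀ g h → H g ≡ true → H h ≡ true → H (g ∙ h) ≡ true
      closed-⁻¹ : ∀ g → H g ≡ true → H (g ⁻¹) ≡ true

  module Centralizers (𝔽 : FiniteField) where
    open FieldLemmas 𝔽 renaming (_⁻¹ to recip; inverse to inverse-F; q to |F|; _·_ to _·V_) hiding (finite)
    open SL2 𝔽 using (SL; sl; mat; det-mat; SL≡; SL₂; negSL; idM; mat-inv; mat-neg)
    open Commuting 𝔽

    x²≡1 : ∀ a → a * a ≡ 1# → a ≡ 1# ⊎ a ≡ - 1#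
    x²≡1 a e with zero-product (a - 1#) (a + 1#) (trans (factor a) (x≡y⇒0 e))
      where
      factor : ∀ a → (a - 1#) * (a + 1#) ≡ a * a - 1#
      factor = solve 1 (λ a → ((a P.- P.1#) P.* (a P.+ P.1#)) ⊜ (a P.* a P.- P.1#)) refl
    ... | inj₁ z = inj₁ (x-y≡0 z)
    ... | inj₂ z = inj₂ (x-y≡0 (trans (cong (λ w → a + w) (double-neg 1#)) z))
      where
      double-neg : ∀ a → - - a ≡ a
      double-neg = solve 1 (λ a → (P.- P.- a) ⊜ a) refl

    central-±1 : ∀ g → central g ≡ true → g ≡ ε ⊎ g ≡ negSL ε
    central-±1 g e = finish (sign (mat g) (det-mat g) (does⇒ (hat (mat g) ≟ 0V) e))
      where
      sign : ∀ m → det m ≡ 1# → hat m ≡ 0V → m ≡ idM ⊎ m ≡ neg idM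
      sign (a , b , c , d) u h = choose (x²≡1 a square)
        where
        b≡0 : b ≡ 0#
        b≡0 = cong v₂ h
        c≡0 : c ≡ 0#
        c≡0 = cong v₃ h
        d≡a : d ≡ a
        d≡a = sym (x-y≡0 (cong v₁ h))
        simplify : ∀ a → a * a ≡ a * a + - (0# * 0#)
        simplify = solve 1 (λ a → (a P.* a) ⊜ (a P.* a P.+ P.- (P.0# P.* P.0#))) refl
        square : a * a ≡ 1#
        square = trans (simplify a) (trans (cong₂ (λ x y → a * x + - y) (sym d≡a) (cong₂ _*_ (sym b≡0) (sym c≡0))) u)
        0≡-0 : 0# ≡ - 0#
        0≡-0 = solve 0 (P.0# ⊜ P.- P.0#) refl
        choose : a ≡ 1# ⊎ a ≡ - 1# → (a , b , c , d) ≡ idM ⊎ (a , b , c , d) ≡ neg idM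
        choose (inj₁ e) = inj₁ (M≡ e b≡0 c≡0 (trans d≡a e))
        choose (inj₂ e) = inj₂ (M≡ e (trans b≡0 0≡-0) (trans c≡0 0≡-0) (trans d≡a e))
      finish : mat g ≡ idM ⊎ mat g ≡ neg idM → g ≡ ε ⊎ g ≡ negSL ε
      finish (inj₁ e) = inj₁ (SL≡ e)
      finish (inj₂ e) = inj₂ (SL≡ (trans e (sym (mat-neg ε))))

    #central≤2 : # central ≤ 2
    #central≤2 = #≤2 central ε (negSL ε) central-±1

    centralizer : SL → SL → Bool
    centralizer t g = commute g t

    commute-∙ : ∀ {g h t} → Commute g t → Commute h t → Commute (g ∙ h) t
    commute-∙ {g} {h} {t} eg eh = trans (assoc g h t) (trans (cong (g ∙_) eh) (trans (sym (assoc g t h)) (trans (cong (_∙ h) eg) (assoc t g h))))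

    commute-⁻¹ : ∀ {g t} → Commute g t → Commute (g ⁻¹) t
    commute-⁻¹ {g} {t} e = ∙-cancelˡ g (g ⁻¹ ∙ t) (t ∙ g ⁻¹) (trans (x∙x⁻¹y g t) (sym (trans (sym (assoc g t _)) (trans (cong (_∙ g ⁻¹) e) (xy∙y⁻¹ t g)))))

    centralizer-subgroup : ∀ t → IsSubgroupOf SL₂ (centralizer t)
    centralizer-subgroup t = record
      { contains-ε = ⇒commute (trans (identityˡ t) (sym (identityʳ t)))
      ; closed-∙ = λ g h eg eh → ⇒commute (commute-∙ (commute⇒ eg) (commute⇒ eh))
      ; closed-⁻¹ = λ g eg → ⇒commute (commute-⁻¹ (commute⇒ eg)) }

    det-upper : det (1# , 1# , 0# , 1#) ≡ 1#
    det-upper = solve 0 (P.det (P.1# , P.1# , P.0# , P.1#) ⊜ P.1#) refl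

    det-lower : det (1# , 0# , 1# , 1#) ≡ 1#
    det-lower = solve 0 (P.det (P.1# , P.0# , P.1# , P.1#) ⊜ P.1#) refl

    upper lower : SL
    upper = sl (1# , 1# , 0# , 1#) det-upper
    lower = sl (1# , 0# , 1# , 1#) det-lower

    upper-noncentral : central upper ≡ false
    upper-noncentral = ⇒does¬ (hat (mat upper) ≟ 0V) (λ e → 1≢0 (cong v₂ e))

    -- `upper` and `lower` have independent `hat`, so only a central t commutes with both.
    centralizer-proper : ∀ t → central t ≡ false → ∃ λ g → centralizer t g ≡ false
    centralizer-proper t h = decide (upper ∙ t ≟ t ∙ upper) (lower ∙ t ≟ t ∙ lower)
      where
      vanish : ∀ v → Parallel (hat (mat upper)) v → Parallel (hat (mat lower)) v → v ≡ 0V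
      vanish (x , y , z) u l = V≡ (trans (t₁ x y) (trans (cong -_ (cong v₃ u)) neg-0)) (trans (t₂ y z) (trans (cong -_ (cong v₁ l)) neg-0)) (trans (t₃ y z) (cong v₁ u))
        where
        neg-0 : - 0# ≡ 0#
        neg-0 = solve 0 (P.- P.0# ⊜ P.0#) refl
        t₁ : ∀ x y → x ≡ - ((1# - 1#) * y - 1# * x)
        t₁ = solve 2 (λ x y → x ⊜ (P.- ((P.1# P.- P.1#) P.* y P.- P.1# P.* x))) refl
        t₂ : ∀ y z → y ≡ - (0# * z - 1# * y)
        t₂ = solve 2 (λ y z → y ⊜ (P.- (P.0# P.* z P.- P.1# P.* y))) refl
        t₃ : ∀ y z → z ≡ 1# * z - 0# * y
        t₃ = solve 2 (λ y z → z ⊜ (P.1# P.* z P.- P.0# P.* y)) refl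
      decide : Dec (upper ∙ t ≡ t ∙ upper) → Dec (lower ∙ t ≡ t ∙ lower) → ∃ λ g → centralizer t g ≡ false
      decide (no ¬u) _ = upper , ⇒does¬ (upper ∙ t ≟ t ∙ upper) ¬u
      decide (yes _) (no ¬l) = lower , ⇒does¬ (lower ∙ t ≟ t ∙ lower) ¬l
      decide (yes u) (yes l) = ⊥-elim (noncentral⇒ {t} h (vanish (hat (mat t)) (commute⇒parallel upper t u) (commute⇒parallel lower t l)))

    -- For equal `hat` the difference of the determinants factors as (a - a')(a + d'), and it
    -- vanishes because both determinants are 1.
    same-hat : ∀ g h → hat (mat g) ≡ hat (mat h) → g ≡ h ⊎ g ≡ negSL (h ⁻¹)
    same-hat g h e = finish (compare (mat g) (mat h) (det-mat g) (det-mat h) e)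
      where
      compare : ∀ m n → det m ≡ 1# → det n ≡ 1# → hat m ≡ hat n → m ≡ n ⊎ m ≡ neg (inv n)
      compare (a , b , c , d) (a' , b' , c' , d') u u' h = choose (zero-product (a - a') (a + d') product)
        where
        b≡ : b ≡ b'
        b≡ = cong v₂ h
        c≡ : c ≡ c'
        c≡ = cong v₃ h
        factor : ∀ a b c d a' d' → (a - a') * (a + d') ≡ (a * d + - (b * c)) - (a' * d' + - (b * c)) + a * ((a - d) - (a' - d'))
        factor = solve 6 (λ a b c d a' d' → ((a P.- a') P.* (a P.+ d')) ⊜ ((a P.* d P.+ P.- (b P.* c)) P.- (a' P.* d' P.+ P.- (b P.* c)) P.+ a P.* ((a P.- d) P.- (a' P.- d')))) refl
        product : (a - a') * (a + d') ≡ 0#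
        product = trans (factor a b c d a' d') (trans (cong₂ (λ x y → x + a * y)
          (x≡y⇒0 (trans u (sym (trans (cong₂ (λ x y → a' * d' + - (x * y)) b≡ c≡) u')))) (x≡y⇒0 (cong v₁ h))) (vanish a))
          where
          vanish : ∀ a → 0# + a * 0# ≡ 0#
          vanish = solve 1 (λ a → (P.0# P.+ a P.* P.0#) ⊜ P.0#) refl
        choose : a - a' ≡ 0# ⊎ a + d' ≡ 0# → (a , b , c , d) ≡ (a' , b' , c' , d') ⊎ (a , b , c , d) ≡ neg (inv (a' , b' , c' , d'))
        choose (inj₁ z) = inj₁ (M≡ (x-y≡0 z) b≡ c≡ (trans (shift a d) (trans (cong₂ (λ x y → x - y) (x-y≡0 z) (cong v₁ h)) (sym (shift a' d')))))
          where
          shift : ∀ a d → d ≡ a - (a - d)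
          shift = solve 2 (λ a d → d ⊜ (a P.- (a P.- d))) refl
        choose (inj₂ z) = inj₂ (M≡ a≡ (trans b≡ (nn b')) (trans c≡ (nn c')) (trans (shift a d) (trans (cong₂ (λ x y → x - y) a≡ (cong v₁ h)) (simplify a' d'))))
          where
          nn : ∀ a → a ≡ - - a
          nn = solve 1 (λ a → a ⊜ (P.- P.- a)) refl
          a≡ : a ≡ - d'
          a≡ = x-y≡0 (trans (cong (λ w → a + w) (sym (nn d'))) z)
          shift : ∀ a d → d ≡ a - (a - d)
          shift = solve 2 (λ a d → d ⊜ (a P.- (a P.- d))) refl
          simplify : ∀ a d → - d - (a - d) ≡ - a
          simplify = solve 2 (λ a d → (P.- d P.- (a P.- d)) ⊜ (P.- a)) refl
      finish : mat g ≡ mat h ⊎ mat g ≡ neg (inv (mat h)) → g ≡ h ⊎ g ≡ negSL (h ⁻¹)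
      finish (inj₁ e) = inj₁ (SL≡ e)
      finish (inj₂ e) = inj₂ (SL≡ (trans e (sym (trans (mat-neg (h ⁻¹)) (cong neg (mat-inv h))))))

    -- A member has `hat` equal to a multiple of `hat t`, for which there are |F| scalars, and by
    -- `same-hat` each value of `hat` is taken at most twice.
    #centralizer : ∀ t → central t ≡ false → # (centralizer t) ≤ |F| ℕ.* 2
    #centralizer t t≢0 = begin
      # (centralizer t) ≤⟨ ∑-mono (λ g → 𝟙≤ (centralizer t g) (one g)) ⟩
      ∑ (λ g → ∑ λ s → 𝟙 (on s g)) ≡⟨ ∑-swap _ ⟩
      ∑ (λ s → # (on s)) ≤⟨ ∑-mono two ⟩
      ∑ {F} (λ s → 2) ≡⟨ ∑-cong (λ s → sym (ℕ.*-identityˡ 2)) ⟩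
      ∑ {F} (λ s → 1 ℕ.* 2) ≡⟨ ∑-*ʳ 2 (λ _ → 1) ⟩
      |F| ℕ.* 2 ∎
      where
      open ℕ.≤-Reasoning
      on : F → SL → Bool
      on s g = ⌊ hat (mat g) ≟ s ·V hat (mat t) ⌋
      one : ∀ g → centralizer t g ≡ true → 1 ≤ ∑ λ s → 𝟙 (on s g)
      one g e = found (multiple (hat (mat g)) (hat (mat t)) (noncentral⇒ {t} t≢0) (commute⇒parallel g t (commute⇒ e)))
        where
        found : (Σ F λ s → hat (mat g) ≡ s ·V hat (mat t)) → 1 ≤ ∑ λ s → 𝟙 (on s g)
        found (s , e) = ≤∑-term _ s (ℕ.≤-reflexive (sym (cong 𝟙 (⇒does (_ ≟ _) e))))
      two : ∀ s → # (on s) ≤ 2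
      two s = decide (exists-dec (on s))
        where
        decide : (∃ λ g → on s g ≡ true) ⊎ (∀ g → on s g ≡ false) → # (on s) ≤ 2
        decide (inj₁ (h , eh)) = #≤2 (on s) h (negSL (h ⁻¹)) (λ g eg → same-hat g h (trans (does⇒ (_ ≟ _) eg) (sym (does⇒ (_ ≟ _) eh))))
        decide (inj₂ none) = ℕ.≤-trans (ℕ.≤-reflexive (trans (∑-cong λ g → cong 𝟙 (none g)) ∑-0)) z≤n

    disc-trace : ∀ g → disc (mat g) ≡ trace g * trace g - (1# + 1# + 1# + 1#)
    disc-trace g = compute (mat g) (det-mat g)
      where
      compute : ∀ m → det m ≡ 1# → disc m ≡ tr m * tr m - (1# + 1# + 1# + 1#)
      compute (a , b , c , d) u = trans (identity a b c d) (cong (λ w → (a + d) * (a + d) - w) (trans (cong (λ w → (1# + 1# + 1# + 1#) * w) u) (*-identityʳ _)))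
        where
        identity : ∀ a b c d → disc (a , b , c , d) ≡ (a + d) * (a + d) - (1# + 1# + 1# + 1#) * (a * d + - (b * c))
        identity = solve 4 (λ a b c d → P.disc (a , b , c , d) ⊜ ((a P.+ d) P.* (a P.+ d) P.- (P.1# P.+ P.1# P.+ P.1# P.+ P.1#) P.* (a P.* d P.+ P.- (b P.* c)))) refl

    -- `disc` is the discriminant of the characteristic polynomial: its roots are distinct, and the
    -- centralizer is a torus.
    Regular : SL → Set
    Regular t = disc (mat t) ≢ 0#

    regular⇒noncentral : ∀ t → Regular t → central t ≡ false
    regular⇒noncentral t reg = ⇒does¬ (hat (mat t) ≟ 0V) λ e → reg (vanish (mat t) e)
      where
      vanish : ∀ m → hat m ≡ 0V → disc m ≡ 0#
      vanish (a , b , c , d) e = trans (cong₂ (λ x y → x * x + (1# + 1# + 1# + 1#) * (y * c)) (cong v₁ e) (cong v₂ e)) (zeros c)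
        where
        zeros : ∀ c → 0# * 0# + (1# + 1# + 1# + 1#) * (0# * c) ≡ 0#
        zeros = solve 1 (λ c → (P.0# P.* P.0# P.+ (P.1# P.+ P.1# P.+ P.1# P.+ P.1#) P.* (P.0# P.* c)) ⊜ P.0#) refl

    irregular : ∀ t → disc (mat t) ≡ 0# → trace t ≡ 1# + 1# ⊎ trace t ≡ - (1# + 1#)
    irregular t e = choose (zero-product (trace t - (1# + 1#)) (trace t + (1# + 1#)) (trans (factor (trace t)) (trans (sym (disc-trace t)) e)))
      where
      factor : ∀ a → (a - (1# + 1#)) * (a + (1# + 1#)) ≡ a * a - (1# + 1# + 1# + 1#)
      factor = solve 1 (λ a → ((a P.- (P.1# P.+ P.1#)) P.* (a P.+ (P.1# P.+ P.1#))) ⊜ (a P.* a P.- (P.1# P.+ P.1# P.+ P.1# P.+ P.1#))) refl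
      double-neg : ∀ a → - - a ≡ a
      double-neg = solve 1 (λ a → (P.- P.- a) ⊜ a) refl
      choose : trace t - (1# + 1#) ≡ 0# ⊎ trace t + (1# + 1#) ≡ 0# → trace t ≡ 1# + 1# ⊎ trace t ≡ - (1# + 1#)
      choose (inj₁ z) = inj₁ (x-y≡0 z)
      choose (inj₂ z) = inj₂ (x-y≡0 (trans (cong (λ w → trace t + w) (double-neg (1# + 1#))) z))

    -- The discriminant is determined by the trace, and it scales by s² when `hat` scales by s;
    -- hence s is 1 or -1. The diagonal is recovered from a + d and a - d because 2 is invertible.
    regular-conjugates : ∀ c c₀ → Commute c c₀ → trace c ≡ trace c₀ → Regular c₀ → c ≡ c₀ ⊎ c ≡ c₀ ⁻¹
    regular-conjugates c c₀ com e reg = scale (multiple (hat (mat c)) (hat (mat c₀)) (noncentral⇒ {c₀} (regular⇒noncentral c₀ reg)) (commute⇒parallel c c₀ com))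
      where
      disc-scale : ∀ s m n → hat m ≡ s ·V hat n → disc m ≡ s * s * disc n
      disc-scale s (a , b , c , d) (a' , b' , c' , d') e = trans (cong₂ (λ x y → x * x + (1# + 1# + 1# + 1#) * y) (cong v₁ e) (cong₂ _*_ (cong v₂ e) (cong v₃ e))) (identity s (a' - d') b' c')
        where
        identity : ∀ s x b c → s * x * (s * x) + (1# + 1# + 1# + 1#) * (s * b * (s * c)) ≡ s * s * (x * x + (1# + 1# + 1# + 1#) * (b * c))
        identity = solve 4 (λ s x b c → (s P.* x P.* (s P.* x) P.+ (P.1# P.+ P.1# P.+ P.1# P.+ P.1#) P.* (s P.* b P.* (s P.* c))) ⊜ (s P.* s P.* (x P.* x P.+ (P.1# P.+ P.1# P.+ P.1# P.+ P.1#) P.* (b P.* c)))) refl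
      halve : ∀ {x y} → (1# + 1#) * x ≡ (1# + 1#) * y → x ≡ y
      halve = cancel-* 2≢0
      plus : ∀ a d → (1# + 1#) * a ≡ (a + d) + (a - d)
      plus = solve 2 (λ a d → ((P.1# P.+ P.1#) P.* a) ⊜ ((a P.+ d) P.+ (a P.- d))) refl
      minus : ∀ a d → (1# + 1#) * d ≡ (a + d) - (a - d)
      minus = solve 2 (λ a d → ((P.1# P.+ P.1#) P.* d) ⊜ ((a P.+ d) P.- (a P.- d))) refl
      one : ∀ m n → tr m ≡ tr n → hat m ≡ 1# ·V hat n → m ≡ n
      one (a , b , c , d) (a' , b' , c' , d') t h = M≡
          (halve (trans (plus a d) (trans (cong₂ (λ x y → x + y) t (trans (cong v₁ h) (*-identityˡ _))) (sym (plus a' d')))))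
          (trans (cong v₂ h) (*-identityˡ b')) (trans (cong v₃ h) (*-identityˡ c'))
          (halve (trans (minus a d) (trans (cong₂ (λ x y → x - y) t (trans (cong v₁ h) (*-identityˡ _))) (sym (minus a' d')))))
      minus-one : ∀ m n → tr m ≡ tr n → hat m ≡ (- 1#) ·V hat n → m ≡ inv n
      minus-one (a , b , c , d) (a' , b' , c' , d') t h = M≡
          (halve (trans (plus a d) (trans (cong₂ (λ x y → x + y) t (cong v₁ h)) (s₁ a' d'))))
          (trans (cong v₂ h) (s₂ b')) (trans (cong v₃ h) (s₂ c'))
          (halve (trans (minus a d) (trans (cong₂ (λ x y → x - y) t (cong v₁ h)) (s₃ a' d'))))
        where
        s₁ : ∀ a d → (a + d) + - 1# * (a - d) ≡ (1# + 1#) * d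
        s₁ = solve 2 (λ a d → ((a P.+ d) P.+ P.- P.1# P.* (a P.- d)) ⊜ ((P.1# P.+ P.1#) P.* d)) refl
        s₂ : ∀ b → - 1# * b ≡ - b
        s₂ = solve 1 (λ b → (P.- P.1# P.* b) ⊜ (P.- b)) refl
        s₃ : ∀ a d → (a + d) - - 1# * (a - d) ≡ (1# + 1#) * a
        s₃ = solve 2 (λ a d → ((a P.+ d) P.- P.- P.1# P.* (a P.- d)) ⊜ ((P.1# P.+ P.1#) P.* a)) refl
      sign : ∀ s → hat (mat c) ≡ s ·V hat (mat c₀) → s ≡ 1# ⊎ s ≡ - 1# → c ≡ c₀ ⊎ c ≡ c₀ ⁻¹
      sign _ h (inj₁ refl) = inj₁ (SL≡ (one (mat c) (mat c₀) e h))
      sign _ h (inj₂ refl) = inj₂ (SL≡ (trans (minus-one (mat c) (mat c₀) e h) (sym (mat-inv c₀))))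
      scale : (Σ F λ s → hat (mat c) ≡ s ·V hat (mat c₀)) → c ≡ c₀ ⊎ c ≡ c₀ ⁻¹
      scale (s , h) = sign s h (x²≡1 s (cancel-* reg (trans (*-comm (disc (mat c₀)) (s * s)) (trans (sym (disc-scale s (mat c) (mat c₀) h))
        (trans (disc-trace c) (trans (cong (λ w → w * w - (1# + 1# + 1# + 1#)) e) (trans (sym (disc-trace c₀)) (sym (*-identityʳ _)))))))))

    -- All conjugates of t that commute with the noncentral w commute with each other, so by
    -- `regular-conjugates` there are at most two. Each is reached from one coset of the centralizer
    -- of t, which has at most 2|F| elements.
    #conjugators : ∀ w t → central w ≡ false → Regular t → # (λ g → commute w (t ^^ g)) ≤ 4 ℕ.* |F|
    #conjugators w t w≢0 reg = decide (exists-dec U)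
      where
      open ℕ.≤-Reasoning
      U : SL → Bool
      U g = commute w (t ^^ g)
      fibre : SL → SL → Bool
      fibre c g = ⌊ t ^^ g ≟ c ⌋
      #fibre : ∀ c → # (fibre c) ≤ |F| ℕ.* 2
      #fibre c = bound (exists-dec (fibre c))
        where
        bound : (∃ λ g → fibre c g ≡ true) ⊎ (∀ g → fibre c g ≡ false) → # (fibre c) ≤ |F| ℕ.* 2
        bound (inj₂ none) = ℕ.≤-trans (ℕ.≤-reflexive (trans (∑-cong λ g → cong 𝟙 (none g)) ∑-0)) z≤n
        bound (inj₁ (h , eh)) = ℕ.≤-trans (∑-inject (h ⁻¹ ∙_) (fibre c) (centralizer t)
            (λ g eg → ⇒commute (conj-≡⇒commute h g t (trans (does⇒ (_ ≟ _) eg) (sym (does⇒ (_ ≟ _) eh)))))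
            (λ g g' _ _ e → ∙-cancelˡ (h ⁻¹) g g' e)) (#centralizer t (regular⇒noncentral t reg))
      decide : (∃ λ g → U g ≡ true) ⊎ (∀ g → U g ≡ false) → # U ≤ 4 ℕ.* |F|
      decide (inj₂ none) = ℕ.≤-trans (ℕ.≤-reflexive (trans (∑-cong λ g → cong 𝟙 (none g)) ∑-0)) z≤n
      decide (inj₁ (h , eh)) = begin
        # U ≤⟨ ∑-mono (λ g → 𝟙≤ (U g) (either g)) ⟩
        ∑ (λ g → 𝟙 (fibre (t ^^ h) g) ℕ.+ 𝟙 (fibre ((t ^^ h) ⁻¹) g)) ≡⟨ ∑-+ _ _ ⟩
        # (fibre (t ^^ h)) ℕ.+ # (fibre ((t ^^ h) ⁻¹)) ≤⟨ ℕ.+-mono-≤ (#fibre (t ^^ h)) (#fibre ((t ^^ h) ⁻¹)) ⟩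
        |F| ℕ.* 2 ℕ.+ |F| ℕ.* 2 ≡⟨ sym (ℕ.*-distribˡ-+ |F| 2 2) ⟩
        |F| ℕ.* 4 ≡⟨ ℕ.*-comm |F| 4 ⟩
        4 ℕ.* |F| ∎
        where
        regʰ : Regular (t ^^ h)
        regʰ = subst (_≢ 0#) (trans (disc-trace t) (trans (cong (λ z → z * z - (1# + 1# + 1# + 1#)) (sym (trace-conj t h))) (sym (disc-trace (t ^^ h))))) reg
        either : ∀ g → U g ≡ true → 1 ≤ 𝟙 (fibre (t ^^ h) g) ℕ.+ 𝟙 (fibre ((t ^^ h) ⁻¹) g)
        either g eg = pick (regular-conjugates (t ^^ g) (t ^^ h) (commute-trans w w≢0 (sym (commute⇒ {w} {t ^^ g} eg)) (sym (commute⇒ {w} {t ^^ h} eh)))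
            (trans (trace-conj t g) (sym (trace-conj t h))) regʰ)
          where
          pick : t ^^ g ≡ t ^^ h ⊎ t ^^ g ≡ (t ^^ h) ⁻¹ → 1 ≤ 𝟙 (fibre (t ^^ h) g) ℕ.+ 𝟙 (fibre ((t ^^ h) ⁻¹) g)
          pick (inj₁ e) = ℕ.≤-trans (ℕ.≤-reflexive (sym (cong 𝟙 (⇒does (_ ≟ _) e)))) (ℕ.m≤m+n _ _)
          pick (inj₂ e) = ℕ.≤-trans (ℕ.≤-reflexive (sym (cong 𝟙 (⇒does (_ ≟ _) e)))) (ℕ.m≤n+m _ (𝟙 (fibre (t ^^ h) g)))

-- Growth of approximate subgroups of SL₂.

module Pivoting where

  open Sums
  open GroupEnergy
  open ApproximateGroups
  open Fields
  open SpecialLinear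
  open CentralizerBounds
  open import Data.Nat hiding (_≟_)
  open import Data.Nat.Properties hiding (_≟_)
  open import Data.Bool using (Bool; true; false; _∧_; not; _xor_)
  open import Data.Product using (_×_; _,_; ∃; proj₁; proj₂)
  open import Data.Sum using (_⊎_; inj₁; inj₂)
  open import Data.Empty using (⊥; ⊥-elim)
  open import Relation.Binary.PropositionalEquality
  open import Relation.Nullary using (¬_)
  open import Relation.Nullary.Decidable using (⌊_⌋)
  open import Data.Nat.Tactic.RingSolver using (solve-∀)

  not-false : ∀ {b} → not b ≡ true → b ≡ false
  not-false {false} _ = refl

  not-true : ∀ {b} → b ≡ false → not b ≡ true
  not-true {false} _ = refl

  module Pivot (𝔽 : FiniteField) where
    open FieldLemmas 𝔽 using (F; disc; Finite-F; 0#; 1#; -_) renaming (q to |F|; _+_ to _+F_)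
    open Commuting 𝔽
    open Centralizers 𝔽
    open SL2 𝔽 using (SL₂; mat)

    module _ (X : G → Bool) where
      open Powers SL₂ X

      -- 1/N bounds the proportion of `X` in a coset. `L` is the saving in the incidence bound,
      -- which leaves at most (4J/L)|X| elements of X⁴ with a given trace; its cube is compared with
      -- `N` because a third moment is used. `L-large` is what the final count in `absurd`
      -- contradicts.
      record ApproximateGroup (J L N : ℕ) : Set where
        field
          X-inverse : ∀ x → X x ≡ true → X (x ⁻¹) ≡ true
          Xε : X ε ≡ true
          small : # (pw 6) ≤ J * # X
          spread : ∀ H → IsSubgroupOf SL₂ H → (∃ λ g → H g ≡ false) → ∀ g → # (λ x → X x ∧ H (g ⁻¹ ∙ x)) * N ≤ # X
          size : # X ≤ J * (|F| * |F|)
          order : |F| * (|F| * |F|) ≤ 2 * ∑ {G} (λ _ → 1)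
          L³≤N : L * (L * L) ≤ N
          L-large : 32 * (J * (J * J)) + 8 * J < L

    module Contradiction (X : G → Bool) (J L N : ℕ) (hyp : ApproximateGroup X J L N) where
      open Powers SL₂ X
      open ApproximateGroup hyp

      n : ℕ
      n = # X

      n>0 : 0 < n
      n>0 = #-pos X Xε

      #pw5 : # (pw 5) ≤ J * n
      #pw5 = ≤-trans (#-mono λ t → pw-+ Xε 1 5) small

      #pw2 : # (pw 2) ≤ J * n
      #pw2 = ≤-trans (#-mono λ t → pw-+ Xε 4 2) small

      X⊆pw : ∀ k {x} → X x ≡ true → pw (k + 1) x ≡ true
      X⊆pw k Xx = pw-+ Xε k 1 (pw-1 Xx)

      J>0 : 0 < J
      J>0 = positive J (≤-trans n>0 (≤-trans (#-mono λ x → X⊆pw 5) small))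
        where
        positive : ∀ j → 0 < j * n → 0 < j
        positive (suc _) _ = s≤s z≤n

      L>0 : 0 < L
      L>0 = ≤-trans (s≤s z≤n) L-large

      N>0 : 0 < N
      N>0 = ≤-trans (*-mono-≤ L>0 (*-mono-≤ L>0 L>0)) L³≤N

      -- (w , x) ↦ w x maps (X⁵ ∩ gH) × X to X⁶ with fibres inside inverses of X ∩ y⁻¹gH.
      pw5-spread : ∀ H → IsSubgroupOf SL₂ H → (∃ λ g → H g ≡ false) → ∀ g → # (λ w → pw 5 w ∧ H (g ⁻¹ ∙ w)) * N ≤ J * n
      pw5-spread H sub proper g = *-cancelʳ-≤-pos n>0 (begin
        # U * N * n ≡⟨ swapʳ (# U) N n ⟩
        # U * n * N ≡⟨ cong (_* N) (sym (∑-conv U X)) ⟩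
        ∑ (conv U X) * N ≡⟨ sym (∑-*ʳ N (conv U X)) ⟩
        ∑ (λ y → conv U X y * N) ≤⟨ ∑-mono fibre ⟩
        ∑ (λ y → 𝟙 (pw 6 y) * n) ≡⟨ ∑-*ʳ n (λ y → 𝟙 (pw 6 y)) ⟩
        # (pw 6) * n ≤⟨ *-monoˡ-≤ n small ⟩
        J * n * n ∎)
        where
        open ≤-Reasoning
        U : G → Bool
        U w = pw 5 w ∧ H (g ⁻¹ ∙ w)
        swapʳ : ∀ a b c → a * b * c ≡ a * c * b
        swapʳ = solve-∀
        pointwise : ∀ y w → 𝟙 (U w) * 𝟙 (X (w ⁻¹ ∙ y)) ≤ 𝟙 (pw 6 y) * 𝟙 (X (y ⁻¹ ∙ w) ∧ H ((y ⁻¹ ∙ g) ⁻¹ ∙ (y ⁻¹ ∙ w)))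
        pointwise y w = ≤-trans (≤-reflexive (sym (𝟙-∧ (U w) _))) (≤-trans (𝟙-mono (U w ∧ X (w ⁻¹ ∙ y)) (pw 6 y ∧ (X (y ⁻¹ ∙ w) ∧ H ((y ⁻¹ ∙ g) ⁻¹ ∙ (y ⁻¹ ∙ w))))
          (λ e → ∧-intro (trans (cong (pw 6) (sym (x∙x⁻¹y w y))) (pw-∙ 5 (∧-fst (∧-fst e)) (pw-1 (∧-snd {U w} e))))
            (∧-intro (trans (cong X (sym (x⁻¹y⁻¹ w y))) (X-inverse _ (∧-snd {U w} e)))
              (trans (cong H (telescope⁻¹ y g w)) (∧-snd {pw 5 w} (∧-fst e)))))) (≤-reflexive (𝟙-∧ (pw 6 y) _)))
        fibre : ∀ y → conv U X y * N ≤ 𝟙 (pw 6 y) * n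
        fibre y = begin
          conv U X y * N ≤⟨ *-monoˡ-≤ N (∑-mono (pointwise y)) ⟩
          ∑ (λ w → 𝟙 (pw 6 y) * 𝟙 (X (y ⁻¹ ∙ w) ∧ H ((y ⁻¹ ∙ g) ⁻¹ ∙ (y ⁻¹ ∙ w)))) * N ≡⟨ cong (_* N) (∑-*ˡ (𝟙 (pw 6 y)) _) ⟩
          𝟙 (pw 6 y) * ∑ (λ w → 𝟙 (X (y ⁻¹ ∙ w) ∧ H ((y ⁻¹ ∙ g) ⁻¹ ∙ (y ⁻¹ ∙ w)))) * N ≡⟨ cong (λ m → 𝟙 (pw 6 y) * m * N) (∑-translateˡ (y ⁻¹) (λ v → 𝟙 (X v ∧ H ((y ⁻¹ ∙ g) ⁻¹ ∙ v)))) ⟩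
          𝟙 (pw 6 y) * # (λ v → X v ∧ H ((y ⁻¹ ∙ g) ⁻¹ ∙ v)) * N ≡⟨ *-assoc (𝟙 (pw 6 y)) _ N ⟩
          𝟙 (pw 6 y) * (# (λ v → X v ∧ H ((y ⁻¹ ∙ g) ⁻¹ ∙ v)) * N) ≤⟨ *-monoʳ-≤ (𝟙 (pw 6 y)) (spread H sub proper (y ⁻¹ ∙ g)) ⟩
          𝟙 (pw 6 y) * n ∎

      upper-proper : ∃ λ g → centralizer upper g ≡ false
      upper-proper = centralizer-proper upper upper-noncentral

      module Trace (τ : F) where

        inc : G → G → Bool
        inc g h = ⌊ trace (g ∙ h) ≟ τ ⌋

        inc⇒ : ∀ g h → inc g h ≡ true → trace (g ∙ h) ≡ τ
        inc⇒ g h = does⇒ (trace (g ∙ h) ≟ τ)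

        deg : G → ℕ
        deg g = ∑ λ h → 𝟙 (X h) * 𝟙 (inc g h)

        I : ℕ
        I = ∑ λ g → 𝟙 (pw 5 g) * deg g

        coplanar : G → G → G → Bool
        coplanar h h' h'' = commute (h ⁻¹ ∙ h') (h ⁻¹ ∙ h'')

        incident : G → G → G → G → Bool
        incident h h' h'' g = inc g h ∧ (inc g h' ∧ inc g h'')

        line : G → G → G → G → Bool
        line h h' h'' g = pw 5 g ∧ incident h h' h'' g

        line⇒ : ∀ h h' h'' g → line h h' h'' g ≡ true → Incident τ h h' h'' g
        line⇒ h h' h'' g e = inc⇒ g h (∧-fst r) , inc⇒ g h' (∧-fst (∧-snd {inc g h} r)) , inc⇒ g h'' (∧-snd {inc g h'} (∧-snd {inc g h} r))
          where r = ∧-snd {pw 5 g} e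

        -- By duality any three solutions are coplanar. If g' has a noncentral quotient with a fixed
        -- solution g₀, all solutions lie in g₀ C(g₀⁻¹ g'); if there is no such g', they lie in g₀
        -- times the centre, inside g₀ C(`upper`). Both are cosets of proper subgroups, to which
        -- `pw5-spread` applies.
        #line : ∀ h h' h'' → coplanar h h' h'' ≡ false → # (line h h' h'') * N ≤ J * n
        #line h h' h'' indep = decide (exists-dec T)
          where
          T : G → Bool
          T = line h h' h''
          ¬coplanar : ¬ Coplanar h h' h''
          ¬coplanar = does⇒¬ (_ ≟ _) indep
          through : ∀ g₀ → T g₀ ≡ true →
            (∃ λ g' → T g' ∧ not (central (g₀ ⁻¹ ∙ g')) ≡ true) ⊎ (∀ g' → T g' ∧ not (central (g₀ ⁻¹ ∙ g')) ≡ false) → # T * N ≤ J * n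
          through g₀ T₀ (inj₁ (g' , e)) = ≤-trans (*-monoˡ-≤ N (#-mono λ g Tg → ∧-intro (∧-fst Tg)
              (⇒commute (sym (coplanar-duality τ h h' h'' g₀ g' g (line⇒ h h' h'' g₀ T₀) (line⇒ h h' h'' g' (∧-fst e)) (line⇒ h h' h'' g Tg) ¬coplanar)))))
            (pw5-spread (centralizer (g₀ ⁻¹ ∙ g')) (centralizer-subgroup _) (centralizer-proper _ (not-false (∧-snd {T g'} e))) g₀)
          through g₀ T₀ (inj₂ none) = ≤-trans (*-monoˡ-≤ N (#-mono λ g Tg → ∧-intro (∧-fst Tg)
              (⇒commute (central⇒Commute (g₀ ⁻¹ ∙ g) upper (is-central g Tg)))))
            (pw5-spread (centralizer upper) (centralizer-subgroup upper) upper-proper g₀)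
            where
            is-central : ∀ g → T g ≡ true → central (g₀ ⁻¹ ∙ g) ≡ true
            is-central g Tg = extract (T g) (central (g₀ ⁻¹ ∙ g)) Tg (none g)
              where
              extract : ∀ a b → a ≡ true → a ∧ not b ≡ false → b ≡ true
              extract true true _ _ = refl
          decide : (∃ λ g → T g ≡ true) ⊎ (∀ g → T g ≡ false) → # T * N ≤ J * n
          decide (inj₁ (g₀ , T₀)) = through g₀ T₀ (exists-dec _)
          decide (inj₂ none) = ≤-trans (≤-reflexive (cong (_* N) (trans (∑-cong λ g → cong 𝟙 (none g)) ∑-0))) z≤n

        triples : (G → G → G → ℕ) → ℕ
        triples f = ∑ λ h → ∑ λ h' → ∑ λ h'' → 𝟙 (X h) * (𝟙 (X h') * (𝟙 (X h'') * f h h' h''))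

        triples-mono : ∀ {f g} → (∀ h h' h'' → f h h' h'' ≤ g h h' h'') → triples f ≤ triples g
        triples-mono le = ∑-mono λ h → ∑-mono λ h' → ∑-mono λ h'' → *-monoʳ-≤ (𝟙 (X h)) (*-monoʳ-≤ (𝟙 (X h')) (*-monoʳ-≤ (𝟙 (X h'')) (le h h' h'')))

        triples-+ : ∀ f g → triples (λ h h' h'' → f h h' h'' + g h h' h'') ≡ triples f + triples g
        triples-+ f g = trans (∑-cong λ h → trans (∑-cong λ h' → trans (∑-cong λ h'' → distribute (𝟙 (X h)) (𝟙 (X h')) (𝟙 (X h'')) (f h h' h'') (g h h' h'')) (∑-+ _ _)) (∑-+ _ _)) (∑-+ _ _)
          where
          distribute : ∀ a b c x y → a * (b * (c * (x + y))) ≡ a * (b * (c * x)) + a * (b * (c * y))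
          distribute = solve-∀

        triples-* : ∀ k f → triples (λ h h' h'' → k * f h h' h'') ≡ k * triples f
        triples-* k f = trans (∑-cong λ h → trans (∑-cong λ h' → trans (∑-cong λ h'' → move (𝟙 (X h)) (𝟙 (X h')) (𝟙 (X h'')) k (f h h' h'')) (∑-*ˡ k _)) (∑-*ˡ k _)) (∑-*ˡ k _)
          where
          move : ∀ a b c k x → a * (b * (c * (k * x))) ≡ k * (a * (b * (c * x)))
          move = solve-∀

        triples-1 : triples (λ _ _ _ → 1) ≡ n * (n * n)
        triples-1 = trans (∑-cong λ h → trans (∑-cong λ h' → trans (∑-cong λ h'' → rearrange (𝟙 (X h)) (𝟙 (X h')) (𝟙 (X h''))) (∑-*ˡ (𝟙 (X h) * 𝟙 (X h')) (λ h'' → 𝟙 (X h''))))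
            (trans (∑-cong λ h' → *-assoc (𝟙 (X h)) (𝟙 (X h')) n) (trans (∑-*ˡ (𝟙 (X h)) (λ h' → 𝟙 (X h') * n)) (cong (𝟙 (X h) *_) (∑-*ʳ n (λ h' → 𝟙 (X h')))))))
            (∑-*ʳ (n * n) (λ h → 𝟙 (X h)))
          where
          rearrange : ∀ a b c → a * (b * (c * 1)) ≡ a * b * c
          rearrange = solve-∀

        cop : ℕ
        cop = triples λ h h' h'' → 𝟙 (coplanar h h' h'')

        -- Either h⁻¹ h' is central, and then h' lies in the coset h C(`upper`), or h'' lies in the
        -- coset h C(h⁻¹ h'). In both cases one of the three choices is confined to a proportion
        -- 1/N.
        few-coplanar : cop * N ≤ 2 * (n * (n * n))
        few-coplanar = begin
          cop * N ≤⟨ *-monoˡ-≤ N (triples-mono split) ⟩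
          triples (λ h h' h'' → 𝟙 (near h h') + 𝟙 (on h h' h'')) * N ≡⟨ cong (_* N) (triples-+ (λ h h' _ → 𝟙 (near h h')) (λ h h' h'' → 𝟙 (on h h' h''))) ⟩
          (triples (λ h h' h'' → 𝟙 (near h h')) + triples (λ h h' h'' → 𝟙 (on h h' h''))) * N ≡⟨ *-distribʳ-+ N (triples λ h h' h'' → 𝟙 (near h h')) (triples λ h h' h'' → 𝟙 (on h h' h'')) ⟩
          triples (λ h h' h'' → 𝟙 (near h h')) * N + triples (λ h h' h'' → 𝟙 (on h h' h'')) * N ≤⟨ +-mono-≤ near-bound on-bound ⟩
          n * (n * n) + n * (n * n) ≡⟨ double (n * (n * n)) ⟩
          2 * (n * (n * n)) ∎
          where
          open ≤-Reasoning
          double : ∀ m → m + m ≡ 2 * m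
          double = solve-∀
          near : G → G → Bool
          near h h' = commute (h ⁻¹ ∙ h') upper
          on : G → G → G → Bool
          on h h' h'' = not (central (h ⁻¹ ∙ h')) ∧ commute (h ⁻¹ ∙ h'') (h ⁻¹ ∙ h')
          split : ∀ h h' h'' → 𝟙 (coplanar h h' h'') ≤ 𝟙 (near h h') + 𝟙 (on h h' h'')
          split h h' h'' = 𝟙≤ (coplanar h h' h'') λ e → choose (central (h ⁻¹ ∙ h')) (near h h') (commute (h ⁻¹ ∙ h'') (h ⁻¹ ∙ h'))
              (λ z → ⇒commute (central⇒Commute (h ⁻¹ ∙ h') upper z)) (⇒commute (sym (commute⇒ {h ⁻¹ ∙ h'} {h ⁻¹ ∙ h''} e)))
            where
            choose : ∀ z a b → (z ≡ true → a ≡ true) → b ≡ true → 1 ≤ 𝟙 a + 𝟙 (not z ∧ b)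
            choose true a b f _ rewrite f refl = s≤s z≤n
            choose false a true _ refl = m≤n+m 1 (𝟙 a)
          near-bound : triples (λ h h' h'' → 𝟙 (near h h')) * N ≤ n * (n * n)
          near-bound = begin
            triples (λ h h' h'' → 𝟙 (near h h')) * N ≡⟨ cong (_* N) (∑-cong λ h → trans (∑-cong λ h' → trans (∑-cong λ h'' → rearrange (𝟙 (X h)) (𝟙 (X h')) (𝟙 (X h'')) (𝟙 (near h h'))) (∑-*ˡ (𝟙 (X h) * (𝟙 (X h') * 𝟙 (near h h'))) (λ h'' → 𝟙 (X h''))))
                (trans (∑-*ʳ n (λ h' → 𝟙 (X h) * (𝟙 (X h') * 𝟙 (near h h')))) (cong (_* n) (trans (∑-*ˡ (𝟙 (X h)) _) (cong (𝟙 (X h) *_) (∑-cong λ h' → sym (𝟙-∧ (X h') (near h h')))))))) ⟩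
            ∑ (λ h → 𝟙 (X h) * # (λ h' → X h' ∧ near h h') * n) * N ≡⟨ sym (∑-*ʳ N _) ⟩
            ∑ (λ h → 𝟙 (X h) * # (λ h' → X h' ∧ near h h') * n * N) ≤⟨ ∑-mono (λ h → ≤-trans (≤-reflexive (regroup (𝟙 (X h)) _ n N)) (*-monoʳ-≤ (𝟙 (X h)) (*-monoˡ-≤ n (spread (centralizer upper) (centralizer-subgroup upper) upper-proper h)))) ⟩
            ∑ (λ h → 𝟙 (X h) * (n * n)) ≡⟨ ∑-*ʳ (n * n) (λ h → 𝟙 (X h)) ⟩
            n * (n * n) ∎
            where
            rearrange : ∀ a b c d → a * (b * (c * d)) ≡ a * (b * d) * c
            rearrange = solve-∀
            regroup : ∀ a b n k → a * b * n * k ≡ a * (b * k * n)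
            regroup = solve-∀
          on-bound : triples (λ h h' h'' → 𝟙 (on h h' h'')) * N ≤ n * (n * n)
          on-bound = begin
            triples (λ h h' h'' → 𝟙 (on h h' h'')) * N ≡⟨ trans (sym (∑-*ʳ N _)) (∑-cong λ h → sym (∑-*ʳ N _)) ⟩
            ∑ (λ h → ∑ λ h' → ∑ (λ h'' → 𝟙 (X h) * (𝟙 (X h') * (𝟙 (X h'') * 𝟙 (on h h' h'')))) * N) ≤⟨ ∑-mono (λ h → ∑-mono λ h' → inner h h') ⟩
            ∑ (λ h → ∑ λ h' → 𝟙 (X h) * (𝟙 (X h') * n)) ≡⟨ ∑-cong (λ h → trans (∑-*ˡ (𝟙 (X h)) _) (cong (𝟙 (X h) *_) (∑-*ʳ n (λ h' → 𝟙 (X h'))))) ⟩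
            ∑ (λ h → 𝟙 (X h) * (n * n)) ≡⟨ ∑-*ʳ (n * n) (λ h → 𝟙 (X h)) ⟩
            n * (n * n) ∎
            where
            rearrange : ∀ a b c z o → a * (b * (c * (z * o))) ≡ a * (b * z) * (c * o)
            rearrange = solve-∀
            regroup : ∀ a b z m k → a * (b * z) * m * k ≡ a * (b * (z * (m * k)))
            regroup = solve-∀
            inner : ∀ h h' → ∑ (λ h'' → 𝟙 (X h) * (𝟙 (X h') * (𝟙 (X h'') * 𝟙 (on h h' h'')))) * N ≤ 𝟙 (X h) * (𝟙 (X h') * n)
            inner h h' = begin
              ∑ (λ h'' → 𝟙 (X h) * (𝟙 (X h') * (𝟙 (X h'') * 𝟙 (on h h' h'')))) * N ≡⟨ cong (_* N) (trans (∑-cong λ h'' → trans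
                  (cong (λ m → 𝟙 (X h) * (𝟙 (X h') * (𝟙 (X h'') * m))) (𝟙-∧ (not (central w)) (commute (h ⁻¹ ∙ h'') w)))
                  (trans (rearrange (𝟙 (X h)) (𝟙 (X h')) (𝟙 (X h'')) (𝟙 (not (central w))) _) (cong (𝟙 (X h) * (𝟙 (X h') * 𝟙 (not (central w))) *_) (sym (𝟙-∧ (X h'') _))))) (∑-*ˡ (𝟙 (X h) * (𝟙 (X h') * 𝟙 (not (central w)))) (λ h'' → 𝟙 (X h'' ∧ commute (h ⁻¹ ∙ h'') w)))) ⟩
              𝟙 (X h) * (𝟙 (X h') * 𝟙 (not (central w))) * # (λ h'' → X h'' ∧ commute (h ⁻¹ ∙ h'') w) * N ≡⟨ regroup (𝟙 (X h)) (𝟙 (X h')) (𝟙 (not (central w))) _ N ⟩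
              𝟙 (X h) * (𝟙 (X h') * (𝟙 (not (central w)) * (# (λ h'' → X h'' ∧ commute (h ⁻¹ ∙ h'') w) * N))) ≤⟨ *-monoʳ-≤ (𝟙 (X h)) (*-monoʳ-≤ (𝟙 (X h')) (𝟙* (not (central w)) λ nc →
                  spread (centralizer w) (centralizer-subgroup w) (centralizer-proper w (not-false nc)) h)) ⟩
              𝟙 (X h) * (𝟙 (X h') * n) ∎
              where
              w : G
              w = h ⁻¹ ∙ h'

        cubes : ∑ (λ g → 𝟙 (pw 5 g) * (deg g * (deg g * deg g))) ≡ triples λ h h' h'' → # (line h h' h'')
        cubes = begin
          ∑ (λ g → 𝟙 (pw 5 g) * (deg g * (deg g * deg g))) ≡⟨ ∑-cong expand ⟩
          ∑ (λ g → ∑ λ h → ∑ λ h' → ∑ λ h'' → 𝟙 (X h) * (𝟙 (X h') * (𝟙 (X h'') * 𝟙 (line h h' h'' g)))) ≡⟨ trans (∑-swap _) (∑-cong λ h → trans (∑-swap _) (∑-cong λ h' → ∑-swap _)) ⟩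
          ∑ (λ h → ∑ λ h' → ∑ λ h'' → ∑ λ g → 𝟙 (X h) * (𝟙 (X h') * (𝟙 (X h'') * 𝟙 (line h h' h'' g)))) ≡⟨ ∑-cong (λ h → ∑-cong λ h' → ∑-cong λ h'' →
              trans (∑-*ˡ (𝟙 (X h)) _) (cong (𝟙 (X h) *_) (trans (∑-*ˡ (𝟙 (X h')) _) (cong (𝟙 (X h') *_) (∑-*ˡ (𝟙 (X h'')) _))))) ⟩
          triples (λ h h' h'' → # (line h h' h'')) ∎
          where
          open ≡-Reasoning
          rearrange : ∀ p a i b j c k → p * (a * i * (b * j * (c * k))) ≡ a * (b * (c * (p * (i * (j * k)))))
          rearrange = solve-∀
          line-𝟙 : ∀ p i j k → 𝟙 (p ∧ (i ∧ (j ∧ k))) ≡ 𝟙 p * (𝟙 i * (𝟙 j * 𝟙 k))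
          line-𝟙 p i j k = trans (𝟙-∧ p _) (cong (𝟙 p *_) (trans (𝟙-∧ i _) (cong (𝟙 i *_) (𝟙-∧ j k))))
          expand : ∀ g → 𝟙 (pw 5 g) * (deg g * (deg g * deg g)) ≡ ∑ (λ h → ∑ λ h' → ∑ λ h'' → 𝟙 (X h) * (𝟙 (X h') * (𝟙 (X h'') * 𝟙 (line h h' h'' g))))
          expand g = begin
            𝟙 (pw 5 g) * (deg g * (deg g * deg g)) ≡⟨ cong (𝟙 (pw 5 g) *_) (trans (cong (deg g *_) (∑-product t t)) (trans (∑-product t _) (∑-cong λ h → ∑-cong λ h' → sym (∑-*ˡ (t h) (λ h'' → t h' * t h''))))) ⟩
            𝟙 (pw 5 g) * ∑ (λ h → ∑ λ h' → ∑ λ h'' → t h * (t h' * t h'')) ≡⟨ trans (sym (∑-*ˡ (𝟙 (pw 5 g)) _)) (∑-cong λ h → trans (sym (∑-*ˡ (𝟙 (pw 5 g)) _)) (∑-cong λ h' → sym (∑-*ˡ (𝟙 (pw 5 g)) _))) ⟩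
            ∑ (λ h → ∑ λ h' → ∑ λ h'' → 𝟙 (pw 5 g) * (t h * (t h' * t h''))) ≡⟨ ∑-cong (λ h → ∑-cong λ h' → ∑-cong λ h'' →
                trans (rearrange (𝟙 (pw 5 g)) (𝟙 (X h)) (𝟙 (inc g h)) (𝟙 (X h')) (𝟙 (inc g h')) (𝟙 (X h'')) (𝟙 (inc g h'')))
                  (cong (λ m → 𝟙 (X h) * (𝟙 (X h') * (𝟙 (X h'') * m))) (sym (line-𝟙 (pw 5 g) (inc g h) (inc g h') (inc g h''))))) ⟩
            ∑ (λ h → ∑ λ h' → ∑ λ h'' → 𝟙 (X h) * (𝟙 (X h') * (𝟙 (X h'') * 𝟙 (line h h' h'' g)))) ∎
            where
            t : G → ℕ
            t h = 𝟙 (X h) * 𝟙 (inc g h)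

        lines : ℕ
        lines = triples λ h h' h'' → # (line h h' h'')

        -- The few coplanar triples have at most |X⁵| ≤ Jn common g each; the other triples, at most
        -- n³ of them, have at most Jn/N each.
        few-lines : lines * N ≤ 3 * (J * n) * (n * (n * n))
        few-lines = begin
          lines * N ≡⟨ trans (*-comm lines N) (sym (triples-* N _)) ⟩
          triples (λ h h' h'' → N * # (line h h' h'')) ≤⟨ triples-mono pointwise ⟩
          triples (λ h h' h'' → J * n * N * 𝟙 (coplanar h h' h'') + J * n * 1) ≡⟨ trans (triples-+ (λ h h' h'' → J * n * N * 𝟙 (coplanar h h' h'')) (λ _ _ _ → J * n * 1))
              (cong₂ _+_ (triples-* (J * n * N) (λ h h' h'' → 𝟙 (coplanar h h' h''))) (trans (triples-* (J * n) (λ _ _ _ → 1)) (cong (J * n *_) triples-1))) ⟩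
          J * n * N * cop + J * n * (n * (n * n)) ≡⟨ cong (_+ J * n * (n * (n * n))) (move (J * n) N cop) ⟩
          J * n * (cop * N) + J * n * (n * (n * n)) ≤⟨ +-monoˡ-≤ (J * n * (n * (n * n))) (*-monoʳ-≤ (J * n) few-coplanar) ⟩
          J * n * (2 * (n * (n * n))) + J * n * (n * (n * n)) ≡⟨ collect (J * n) (n * (n * n)) ⟩
          3 * (J * n) * (n * (n * n)) ∎
          where
          open ≤-Reasoning
          move : ∀ a b c → a * b * c ≡ a * (c * b)
          move = solve-∀
          collect : ∀ a b → a * (2 * b) + a * b ≡ 3 * a * b
          collect = solve-∀
          pointwise : ∀ h h' h'' → N * # (line h h' h'') ≤ J * n * N * 𝟙 (coplanar h h' h'') + J * n * 1
          pointwise h h' h'' = split (coplanar h h' h'') (#line h h' h'')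
            where
            split : ∀ b → (b ≡ false → # (line h h' h'') * N ≤ J * n) → N * # (line h h' h'') ≤ J * n * N * 𝟙 b + J * n * 1
            split true _ = ≤-trans (≤-trans (*-monoʳ-≤ N (≤-trans (#-mono λ g → ∧-fst) #pw5)) (≤-reflexive (swap₂ N (J * n)))) (m≤m+n (J * n * N * 1) (J * n * 1))
              where
              swap₂ : ∀ a b → a * b ≡ b * a * 1
              swap₂ = solve-∀
            split false f = ≤-trans (≤-reflexive (*-comm N _)) (≤-trans (f refl) (≤-trans (≤-reflexive (sym (*-identityʳ (J * n)))) (m≤n+m (J * n * 1) (J * n * N * 0))))

        -- A substitute for Hölder's inequality: if L d ≤ Q the first term on the right suffices,
        -- and otherwise the second. Summed over d it bounds a first moment by a third moment and
        -- the size of the domain.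
        cubic : ∀ Q d → L * (Q * Q) * d ≤ Q * (Q * Q) + L * (L * L) * (d * (d * d))
        cubic Q d with ≤-total (L * d) Q
        ... | inj₁ le = ≤-trans (≤-reflexive (r₁ L Q d)) (≤-trans (*-monoˡ-≤ (Q * Q) le) (m≤m+n (Q * (Q * Q)) _))
          where
          r₁ : ∀ l q d → l * (q * q) * d ≡ l * d * (q * q)
          r₁ = solve-∀
        ... | inj₂ ge = ≤-trans (≤-reflexive (r₁ L Q d)) (≤-trans (*-monoʳ-≤ (L * d) (*-mono-≤ ge ge)) (≤-trans (≤-reflexive (r₂ L d)) (m≤n+m (L * (L * L) * (d * (d * d))) (Q * (Q * Q)))))
          where
          r₁ : ∀ l q d → l * (q * q) * d ≡ l * d * (q * q)
          r₁ = solve-∀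
          r₂ : ∀ l d → l * d * (l * d * (l * d)) ≡ l * (l * l) * (d * (d * d))
          r₂ = solve-∀

        -- `cubic` with Q = n. The trivial bound for `I` is J n², as |X⁵| ≤ Jn and no degree exceeds
        -- n; a factor L/4 is gained over it.
        few-incidences : L * I ≤ 4 * J * (n * n)
        few-incidences = *-cancelˡ-≤-pos (*-mono-≤ N>0 (*-mono-≤ n>0 n>0)) (begin
          N * (n * n) * (L * I) ≡⟨ r₁ N n L I ⟩
          N * (L * (n * n) * I) ≡⟨ cong (N *_) (sym (∑-*ˡ (L * (n * n)) _)) ⟩
          N * ∑ (λ g → L * (n * n) * (𝟙 (pw 5 g) * deg g)) ≤⟨ *-monoʳ-≤ N (∑-mono pointwise) ⟩
          N * ∑ (λ g → 𝟙 (pw 5 g) * (n * (n * n)) + L * (L * L) * (𝟙 (pw 5 g) * (deg g * (deg g * deg g)))) ≡⟨ cong (N *_) (trans (∑-+ _ _) (cong₂ _+_ (∑-*ʳ (n * (n * n)) (λ g → 𝟙 (pw 5 g))) (trans (∑-*ˡ (L * (L * L)) _) (cong (L * (L * L) *_) cubes)))) ⟩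
          N * (# (pw 5) * (n * (n * n)) + L * (L * L) * lines) ≡⟨ r₂ N (# (pw 5)) (n * (n * n)) (L * (L * L)) lines ⟩
          N * (# (pw 5) * (n * (n * n))) + L * (L * L) * (lines * N) ≤⟨ +-mono-≤ (*-monoʳ-≤ N (*-monoˡ-≤ (n * (n * n)) #pw5)) (*-mono-≤ L³≤N few-lines) ⟩
          N * (J * n * (n * (n * n))) + N * (3 * (J * n) * (n * (n * n))) ≡⟨ r₃ N J n ⟩
          N * (n * n) * (4 * J * (n * n)) ∎)
          where
          open ≤-Reasoning
          r₁ : ∀ N n L I → N * (n * n) * (L * I) ≡ N * (L * (n * n) * I)
          r₁ = solve-∀
          r₂ : ∀ N p m l c → N * (p * m + l * c) ≡ N * (p * m) + l * (c * N)
          r₂ = solve-∀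
          r₃ : ∀ N J n → N * (J * n * (n * (n * n))) + N * (3 * (J * n) * (n * (n * n))) ≡ N * (n * n) * (4 * J * (n * n))
          r₃ = solve-∀
          r₄ : ∀ a p d → a * (p * d) ≡ p * (a * d)
          r₄ = solve-∀
          r₅ : ∀ p m l c → p * (m + l * c) ≡ p * m + l * (p * c)
          r₅ = solve-∀
          pointwise : ∀ g → L * (n * n) * (𝟙 (pw 5 g) * deg g) ≤ 𝟙 (pw 5 g) * (n * (n * n)) + L * (L * L) * (𝟙 (pw 5 g) * (deg g * (deg g * deg g)))
          pointwise g = ≤-trans (≤-reflexive (r₄ (L * (n * n)) (𝟙 (pw 5 g)) (deg g))) (≤-trans (*-monoʳ-≤ (𝟙 (pw 5 g)) (cubic n (deg g)))
            (≤-reflexive (r₅ (𝟙 (pw 5 g)) (n * (n * n)) (L * (L * L)) (deg g * (deg g * deg g)))))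

        slice : G → Bool
        slice z = pw 4 z ∧ ⌊ trace z ≟ τ ⌋

        -- Each z in the slice and each x in `X` give an element z x⁻¹ of X⁵ incident to x, so
        -- |slice| n ≤ I.
        small-slice : L * # slice ≤ 4 * J * n
        small-slice = *-cancelʳ-≤-pos n>0 (begin
          L * # slice * n ≡⟨ *-assoc L (# slice) n ⟩
          L * (# slice * n) ≤⟨ *-monoʳ-≤ L pairs ⟩
          L * I ≤⟨ few-incidences ⟩
          4 * J * (n * n) ≡⟨ sym (*-assoc (4 * J) n n) ⟩
          4 * J * n * n ∎)
          where
          open ≤-Reasoning
          swap₃ : ∀ a b c → a * (b * c) ≡ b * (a * c)
          swap₃ = solve-∀
          pairs : # slice * n ≤ I
          pairs = begin
            # slice * n ≡⟨ *-comm (# slice) n ⟩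
            n * # slice ≡⟨ sym (∑-*ʳ (# slice) (λ x → 𝟙 (X x))) ⟩
            ∑ (λ x → 𝟙 (X x) * # slice) ≤⟨ ∑-mono (λ x → 𝟙*-mono (X x) (translate x)) ⟩
            ∑ (λ x → 𝟙 (X x) * ∑ (λ g → 𝟙 (pw 5 g) * 𝟙 (inc g x))) ≡⟨ ∑-cong (λ x → sym (∑-*ˡ (𝟙 (X x)) _)) ⟩
            ∑ (λ x → ∑ λ g → 𝟙 (X x) * (𝟙 (pw 5 g) * 𝟙 (inc g x))) ≡⟨ ∑-swap _ ⟩
            ∑ (λ g → ∑ λ x → 𝟙 (X x) * (𝟙 (pw 5 g) * 𝟙 (inc g x))) ≡⟨ ∑-cong (λ g → trans (∑-cong λ x → swap₃ (𝟙 (X x)) (𝟙 (pw 5 g)) _) (∑-*ˡ (𝟙 (pw 5 g)) _)) ⟩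
            I ∎
            where
            translate : ∀ x → X x ≡ true → # slice ≤ ∑ (λ g → 𝟙 (pw 5 g) * 𝟙 (inc g x))
            translate x Xx = ≤-trans (∑-mono λ z → ≤-trans (𝟙-mono (slice z) (pw 5 (z ∙ x ⁻¹) ∧ inc (z ∙ x ⁻¹) x) λ e →
                ∧-intro (pw-∙ 4 (∧-fst e) (pw-1 (X-inverse x Xx))) (⇒does (_ ≟ _) (trans (cong trace (xy⁻¹∙y z x)) (does⇒ (trace z ≟ τ) (∧-snd {pw 4 z} e)))))
                (≤-reflexive (𝟙-∧ (pw 5 (z ∙ x ⁻¹)) _)))
              (≤-reflexive (∑-translateʳ (x ⁻¹) (λ g → 𝟙 (pw 5 g) * 𝟙 (inc g x))))

      open Trace using (slice; small-slice)

      J²≤J³ : J * J ≤ J * (J * J)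
      J²≤J³ = *-monoʳ-≤ J (≤-trans (≤-reflexive (sym (*-identityʳ J))) (*-monoʳ-≤ J J>0))

      8J<L : 8 * J < L
      8J<L = ≤-<-trans (m≤n+m (8 * J) (32 * (J * (J * J)))) L-large

      8J²<L : 8 * (J * J) < L
      8J²<L = ≤-<-trans (*-monoʳ-≤ 8 J²≤J³) (≤-<-trans (*-monoˡ-≤ (J * (J * J)) (m≤m+n 8 24)) (≤-<-trans (m≤m+n (32 * (J * (J * J))) (8 * J)) L-large))

      -- Otherwise every trace on `X` is 2 or -2, and `X` is covered by two slices of total size at
      -- most (8J/L) n < n.
      regular-element : ∃ λ t → X t ≡ true × Regular t
      regular-element = decide (exists-dec λ t → X t ∧ not ⌊ disc (mat t) ≟ 0# ⌋)
        where
        2F : F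
        2F = 1# +F 1#
        open ≤-Reasoning
        decide : (∃ λ t → X t ∧ not ⌊ disc (mat t) ≟ 0# ⌋ ≡ true) ⊎ (∀ t → X t ∧ not ⌊ disc (mat t) ≟ 0# ⌋ ≡ false) → ∃ λ t → X t ≡ true × Regular t
        decide (inj₁ (t , e)) = t , ∧-fst e , does⇒¬ (disc (mat t) ≟ 0#) (not-false (∧-snd {X t} e))
        decide (inj₂ none) = ⊥-elim (<⇒≱ 8J<L (*-cancelʳ-≤-pos n>0 (begin
          L * n ≤⟨ *-monoʳ-≤ L (∑-mono λ t → 𝟙≤ (X t) λ Xt → cover t Xt (irregular t (is-irregular t Xt))) ⟩
          L * ∑ (λ t → 𝟙 (slice 2F t) + 𝟙 (slice (- 2F) t)) ≡⟨ cong (L *_) (∑-+ _ _) ⟩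
          L * (# (slice 2F) + # (slice (- 2F))) ≡⟨ *-distribˡ-+ L (# (slice 2F)) (# (slice (- 2F))) ⟩
          L * # (slice 2F) + L * # (slice (- 2F)) ≤⟨ +-mono-≤ (small-slice 2F) (small-slice (- 2F)) ⟩
          4 * J * n + 4 * J * n ≡⟨ collect J n ⟩
          8 * J * n ∎)))
          where
          collect : ∀ j n → 4 * j * n + 4 * j * n ≡ 8 * j * n
          collect = solve-∀
          is-irregular : ∀ t → X t ≡ true → disc (mat t) ≡ 0#
          is-irregular t Xt = does⇒ (disc (mat t) ≟ 0#) (extract (X t) _ Xt (none t))
            where
            extract : ∀ a b → a ≡ true → a ∧ not b ≡ false → b ≡ true
            extract true true _ _ = refl
          cover : ∀ t → X t ≡ true → trace t ≡ 2F ⊎ trace t ≡ - 2F → 1 ≤ 𝟙 (slice 2F t) + 𝟙 (slice (- 2F) t)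
          cover t Xt (inj₁ e) = ≤-trans (≤-reflexive (cong 𝟙 (sym (∧-intro (X⊆pw 3 Xt) (⇒does (trace t ≟ 2F) e))))) (m≤m+n _ _)
          cover t Xt (inj₂ e) = ≤-trans (≤-reflexive (cong 𝟙 (sym (∧-intro (X⊆pw 3 Xt) (⇒does (trace t ≟ - 2F) e))))) (m≤n+m _ (𝟙 (slice 2F t)))

      near-centralizer : G → G → Bool
      near-centralizer u z = pw 2 z ∧ commute z u

      -- x ↦ u ^^ x maps X to a slice, with fibres in cosets of the centralizer of u.
      rich-centralizer : ∀ u → pw 2 u ≡ true → L ≤ 4 * J * # (near-centralizer u)
      rich-centralizer u hu = *-cancelʳ-≤-pos n>0 (begin
        L * n ≤⟨ *-monoʳ-≤ L (fibre-bound (u ^^_) X (slice (trace u)) (# (near-centralizer u)) into fibres) ⟩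
        L * (# (slice (trace u)) * # (near-centralizer u)) ≡⟨ sym (*-assoc L _ _) ⟩
        L * # (slice (trace u)) * # (near-centralizer u) ≤⟨ *-monoˡ-≤ (# (near-centralizer u)) (small-slice (trace u)) ⟩
        4 * J * n * # (near-centralizer u) ≡⟨ swapʳ (4 * J) n _ ⟩
        4 * J * # (near-centralizer u) * n ∎)
        where
        open ≤-Reasoning
        swapʳ : ∀ a b c → a * b * c ≡ a * c * b
        swapʳ = solve-∀
        into : ∀ x → X x ≡ true → slice (trace u) (u ^^ x) ≡ true
        into x Xx = ∧-intro (pw-∙ 3 (pw-∙ 1 (pw-1 Xx) hu) (pw-1 (X-inverse x Xx))) (⇒does (_ ≟ _) (trace-conj u x))
        fibres : ∀ x₀ → X x₀ ≡ true → # (λ x → ⌊ u ^^ x ≟ u ^^ x₀ ⌋ ∧ X x) ≤ # (near-centralizer u)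
        fibres x₀ Xx₀ = ∑-inject (x₀ ⁻¹ ∙_) _ (near-centralizer u)
          (λ x e → ∧-intro (pw-∙ 1 (pw-1 (X-inverse x₀ Xx₀)) (pw-1 (∧-snd {⌊ u ^^ x ≟ u ^^ x₀ ⌋} e))) (⇒commute (conj-≡⇒commute x₀ x u (does⇒ (u ^^ x ≟ u ^^ x₀) (∧-fst e)))))
          (λ x y _ _ → ∙-cancelˡ (x₀ ⁻¹) x y)

      -- (x , z) ↦ x z maps X × (X⁴ ∩ C(u ^^ y)) to X⁵, with fibres inside cosets of X² ∩ C(u ^^ y).
      transfer : ∀ u y → pw 2 u ≡ true → X y ≡ true → # (near-centralizer u) ≤ J * # (near-centralizer (u ^^ y))
      transfer u y hu Xy = ≤-trans conjugate (*-cancelˡ-≤-pos n>0 (begin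
        n * # far ≡⟨ trans (∑-product (λ x → 𝟙 (X x)) (λ z → 𝟙 (far z))) (trans (∑-cong λ x → ∑-cong λ z → sym (𝟙-∧ (X x) (far z))) (sym (∑-× _))) ⟩
        # pairs ≤⟨ fibre-bound (λ p → proj₁ p ∙ proj₂ p) pairs (pw 5) f into fibres ⟩
        # (pw 5) * f ≤⟨ *-monoˡ-≤ f #pw5 ⟩
        J * n * f ≡⟨ move J n f ⟩
        n * (J * f) ∎))
        where
        open ≤-Reasoning
        move : ∀ a b c → a * b * c ≡ b * (a * c)
        move = solve-∀
        v : G
        v = u ^^ y
        far : G → Bool
        far z = pw 4 z ∧ commute z v
        f : ℕ
        f = # (near-centralizer v)
        conjugate : # (near-centralizer u) ≤ # far
        conjugate = ∑-inject (_^^ y) (near-centralizer u) far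
          (λ z e → ∧-intro (pw-∙ 3 (pw-∙ 1 (pw-1 Xy) (∧-fst e)) (pw-1 (X-inverse y Xy))) (⇒commute (conj-commute y (commute⇒ (∧-snd {pw 2 z} e)))))
          (λ z w _ _ e → trans (sym (unconj z y)) (trans (cong (_^^ (y ⁻¹)) e) (unconj w y)))
        pairs : G × G → Bool
        pairs (x , z) = X x ∧ far z
        into : ∀ p → pairs p ≡ true → pw 5 (proj₁ p ∙ proj₂ p) ≡ true
        into (x , z) e = pw-∙ 1 (pw-1 (∧-fst e)) (∧-fst (∧-snd {X x} e))
        fibres : ∀ p₀ → pairs p₀ ≡ true → # (λ p → ⌊ proj₁ p ∙ proj₂ p ≟ proj₁ p₀ ∙ proj₂ p₀ ⌋ ∧ pairs p) ≤ f
        fibres (x₀ , z₀) e₀ = ∑-inject (λ p → x₀ ⁻¹ ∙ proj₁ p) _ (near-centralizer v) lands injective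
          where
          same : ∀ {x z} → ⌊ x ∙ z ≟ x₀ ∙ z₀ ⌋ ∧ pairs (x , z) ≡ true → x ∙ z ≡ x₀ ∙ z₀
          same {x} {z} e = does⇒ (x ∙ z ≟ x₀ ∙ z₀) (∧-fst e)
          member : ∀ {x z} → ⌊ x ∙ z ≟ x₀ ∙ z₀ ⌋ ∧ pairs (x , z) ≡ true → pairs (x , z) ≡ true
          member {x} {z} e = ∧-snd {⌊ x ∙ z ≟ x₀ ∙ z₀ ⌋} e
          quotient : ∀ {x z} → x ∙ z ≡ x₀ ∙ z₀ → x₀ ⁻¹ ∙ x ≡ z₀ ∙ z ⁻¹
          quotient {x} {z} e = trans (cong (x₀ ⁻¹ ∙_) (trans (sym (xy∙y⁻¹ x z)) (trans (cong (_∙ z ⁻¹) e) (assoc x₀ z₀ _)))) (x⁻¹∙xy x₀ _)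
          lands : ∀ p → ⌊ proj₁ p ∙ proj₂ p ≟ x₀ ∙ z₀ ⌋ ∧ pairs p ≡ true → near-centralizer v (x₀ ⁻¹ ∙ proj₁ p) ≡ true
          lands (x , z) e = ∧-intro (pw-∙ 1 (pw-1 (X-inverse x₀ (∧-fst e₀))) (pw-1 (∧-fst (member {x} {z} e))))
            (trans (cong (λ w → commute w v) (quotient (same {x} {z} e)))
              (⇒commute (commute-∙ (commute⇒ (∧-snd {pw 4 z₀} (∧-snd {X x₀} e₀))) (commute-⁻¹ (commute⇒ (∧-snd {pw 4 z} (∧-snd {X x} (member {x} {z} e))))))))
          injective : ∀ p p' → ⌊ proj₁ p ∙ proj₂ p ≟ x₀ ∙ z₀ ⌋ ∧ pairs p ≡ true → ⌊ proj₁ p' ∙ proj₂ p' ≟ x₀ ∙ z₀ ⌋ ∧ pairs p' ≡ true →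
            x₀ ⁻¹ ∙ proj₁ p ≡ x₀ ⁻¹ ∙ proj₁ p' → p ≡ p'
          injective (x , z) (x' , z') e e' h = cong₂ _,_ x≡x' (∙-cancelˡ x z z' (trans (same {x} {z} e) (trans (sym (same {x'} {z'} e')) (cong (_∙ z') (sym x≡x')))))
            where
            x≡x' : x ≡ x'
            x≡x' = ∙-cancelˡ (x₀ ⁻¹) x x' h

      noncentral-member : ∀ v → 2 < # (near-centralizer v) → ∃ λ u → pw 2 u ≡ true × central u ≡ false × Commute u v
      noncentral-member v h = extract (∑-<-witness (λ z → 𝟙 (central z)) (λ z → 𝟙 (near-centralizer v z)) (≤-<-trans #central≤2 h))
        where
        bits : ∀ a b → 𝟙 a < 𝟙 b → a ≡ false × b ≡ true
        bits false true _ = refl , refl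
        bits true true (s≤s ())
        extract : (∃ λ z → 𝟙 (central z) < 𝟙 (near-centralizer v z)) → ∃ λ u → pw 2 u ≡ true × central u ≡ false × Commute u v
        extract (z , lt) = z , ∧-fst (proj₂ (bits (central z) _ lt)) , proj₁ (bits (central z) _ lt) , commute⇒ (∧-snd {pw 2 z} (proj₂ (bits (central z) _ lt)))

      -- Conjugation carries the many elements of X² that commute with u into X⁴, and `transfer`
      -- returns to X² at the cost of a factor J. More than two elements remain because 8J² < L, so
      -- one of them is noncentral.
      step : ∀ u y → pw 2 u ≡ true → X y ≡ true → ∃ λ u' → pw 2 u' ≡ true × central u' ≡ false × Commute u' (u ^^ y)
      step u y hu Xy = noncentral-member (u ^^ y) (≰⇒> λ f≤2 → <⇒≱ 8J²<L (begin
        L ≤⟨ rich-centralizer u hu ⟩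
        4 * J * # (near-centralizer u) ≤⟨ *-monoʳ-≤ (4 * J) (transfer u y hu Xy) ⟩
        4 * J * (J * # (near-centralizer (u ^^ y))) ≤⟨ *-monoʳ-≤ (4 * J) (*-monoʳ-≤ J f≤2) ⟩
        4 * J * (J * 2) ≡⟨ collect J ⟩
        8 * (J * J) ∎))
        where
        open ≤-Reasoning
        collect : ∀ j → 4 * j * (j * 2) ≡ 8 * (j * j)
        collect = solve-∀

      module Conjugates (t : G) (Xt : X t ≡ true) (reg : Regular t) where

        opaque

          -- The conjugate of C(t) by g contains a noncentral element of X². One element is enough
          -- for a definition, since `rich-centralizer` supplies many as soon as there is one.
          involved : G → Bool
          involved g = exists λ u → pw 2 u ∧ (not (central u) ∧ commute u (t ^^ g))

          involved⇒ : ∀ g → involved g ≡ true → ∃ λ u → pw 2 u ≡ true × central u ≡ false × Commute u (t ^^ g)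
          involved⇒ g h = unpack (exists⇒ _ h)
            where
            unpack : (∃ λ u → pw 2 u ∧ (not (central u) ∧ commute u (t ^^ g)) ≡ true) → ∃ λ u → pw 2 u ≡ true × central u ≡ false × Commute u (t ^^ g)
            unpack (u , e) = u , ∧-fst e , not-false (∧-fst (∧-snd {pw 2 u} e)) , commute⇒ (∧-snd {not (central u)} (∧-snd {pw 2 u} e))

          ⇒involved : ∀ g u → pw 2 u ≡ true → central u ≡ false → Commute u (t ^^ g) → involved g ≡ true
          ⇒involved g u hu nc e = ⇒exists _ {u} (∧-intro hu (∧-intro (not-true nc) (⇒commute e)))

        involved-ε : involved ε ≡ true
        involved-ε = ⇒involved ε t (X⊆pw 1 Xt) (regular⇒noncentral t reg) (trans (cong (t ∙_) (conj-ε t)) (cong (_∙ t) (sym (conj-ε t))))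

        -- u ^^ y commutes with t ^^ (y ∙ g) but is known to lie in X⁴ only. The element u' of X²
        -- from `step` commutes with u ^^ y, and commutation passes through the noncentral u ^^ y,
        -- so u' can take its place.
        involved-step : ∀ y g → X y ≡ true → involved g ≡ true → involved (y ∙ g) ≡ true
        involved-step y g Xy h = advance (involved⇒ g h)
          where
          advance : (∃ λ u → pw 2 u ≡ true × central u ≡ false × Commute u (t ^^ g)) → involved (y ∙ g) ≡ true
          advance (u , hu , nc , e) = finish (step u y hu Xy)
            where
            finish : (∃ λ u' → pw 2 u' ≡ true × central u' ≡ false × Commute u' (u ^^ y)) → involved (y ∙ g) ≡ true
            finish (u' , hu' , nc' , e') = ⇒involved (y ∙ g) u' hu' nc'
              (commute-trans (u ^^ y) (central-conj u y nc) e' (subst (λ s → Commute s (u ^^ y)) (conj-conj t g y) (sym (conj-commute y e))))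

        opaque

          -- Left translations that leave `involved` invariant. Asking for equality, and not for an
          -- implication, makes this set closed under inverses at once.
          stab : G → Bool
          stab h = not (exists λ g → involved (h ∙ g) xor involved g)

          stab⇒ : ∀ h → stab h ≡ true → ∀ g → involved (h ∙ g) ≡ involved g
          stab⇒ h e g = agree (involved (h ∙ g)) (involved g) (λ d → absurd (trans (sym (⇒exists _ {g} d)) (not-false e)))
            where
            absurd : true ≡ false → ⊥
            absurd ()
            agree : ∀ a b → (a xor b ≡ true → ⊥) → a ≡ b
            agree true true _ = refl
            agree false false _ = refl
            agree true false h = ⊥-elim (h refl)
            agree false true h = ⊥-elim (h refl)

          ⇒stab : ∀ h → (∀ g → involved (h ∙ g) ≡ involved g) → stab h ≡ true
          ⇒stab h e = negate (exists _) λ x → differ (exists⇒ _ x)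
            where
            negate : ∀ b → (b ≡ true → ⊥) → not b ≡ true
            negate false _ = refl
            negate true f = ⊥-elim (f refl)
            self : ∀ b → b xor b ≡ true → ⊥
            self true ()
            self false ()
            differ : (∃ λ g → involved (h ∙ g) xor involved g ≡ true) → ⊥
            differ (g , d) = self (involved g) (subst (λ b → b xor involved g ≡ true) (e g) d)

        stab-subgroup : IsSubgroupOf SL₂ stab
        stab-subgroup = record
          { contains-ε = ⇒stab ε λ g → cong involved (identityˡ g)
          ; closed-∙ = λ g h eg eh → ⇒stab (g ∙ h) λ k → trans (cong involved (assoc g h k)) (trans (stab⇒ g eg (h ∙ k)) (stab⇒ h eh k))
          ; closed-⁻¹ = λ g eg → ⇒stab (g ⁻¹) λ k → trans (sym (stab⇒ g eg (g ⁻¹ ∙ k))) (cong involved (x∙x⁻¹y g k)) }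

        X⊆stab : ∀ x → X x ≡ true → stab x ≡ true
        X⊆stab x Xx = ⇒stab x λ g → agree (involved (x ∙ g)) (involved g)
            (λ h → subst (λ k → involved k ≡ true) (x⁻¹∙xy x g) (involved-step (x ⁻¹) (x ∙ g) (X-inverse x Xx) h)) (involved-step x g Xx)
          where
          agree : ∀ a b → (a ≡ true → b ≡ true) → (b ≡ true → a ≡ true) → a ≡ b
          agree true true _ _ = refl
          agree false false _ _ = refl
          agree true false f _ = sym (f refl)
          agree false true _ f = f refl

        -- `stab` contains `X`; a proper subgroup could contain only the proportion 1/N < 1 of `X`.
        -- Hence `stab` is everything, and the property moves from ε to each g.
        all-involved : ∀ g → involved g ≡ true
        all-involved g = trans (cong involved (sym (identityʳ g))) (trans (stab⇒ g (all-stab (exists-dec (λ h → not (stab h)))) ε) involved-ε)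
          where
          1<N : 1 < N
          1<N = ≤-trans (*-mono-≤ (≤-trans (s≤s (*-mono-≤ {1} {8} (s≤s z≤n) J>0)) 8J<L) (*-mono-≤ L>0 L>0)) L³≤N
          all-stab : (∃ λ h → not (stab h) ≡ true) ⊎ (∀ h → not (stab h) ≡ false) → stab g ≡ true
          all-stab (inj₂ none) = unnot (stab g) (none g)
            where
            unnot : ∀ b → not b ≡ false → b ≡ true
            unnot true _ = refl
          all-stab (inj₁ (h , e)) = ⊥-elim (<⇒≱ 1<N (*-cancelˡ-≤-pos n>0 (≤-trans (*-monoˡ-≤ N (#-mono λ x Xx →
              ∧-intro Xx (trans (cong stab (trans (cong (_∙ x) ε⁻¹≈ε) (identityˡ x))) (X⊆stab x Xx))))
            (≤-trans (spread stab stab-subgroup (h , not-false e) ε) (≤-reflexive (sym (*-identityʳ n)))))))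

        regular-count : G → ℕ
        regular-count g = # λ w → pw 2 w ∧ (not (central w) ∧ commute w (t ^^ g))

        -- One noncentral u in X² that commutes with t ^^ g brings at least L/4J elements of X²
        -- commuting with u, and therefore with t ^^ g; at most two of these are central.
        rich-torus : ∀ g → L ≤ 4 * J * (regular-count g + 2)
        rich-torus g = bound (involved⇒ g (all-involved g))
          where
          bound : (∃ λ u → pw 2 u ≡ true × central u ≡ false × Commute u (t ^^ g)) → L ≤ 4 * J * (regular-count g + 2)
          bound (u , hu , nc , e) = ≤-trans (rich-centralizer u hu) (*-monoʳ-≤ (4 * J) (≤-trans (∑-mono pointwise)
              (≤-trans (≤-reflexive (∑-+ _ _)) (+-monoʳ-≤ (regular-count g) #central≤2))))
            where
            split : ∀ a z c c' → (c ≡ true → c' ≡ true) → 𝟙 (a ∧ c) ≤ 𝟙 (a ∧ (not z ∧ c')) + 𝟙 z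
            split false _ _ _ _ = z≤n
            split true true c _ _ = 𝟙≤1 c
            split true false c c' f = ≤-trans (𝟙-mono c c' f) (m≤m+n (𝟙 c') 0)
            pointwise : ∀ w → 𝟙 (near-centralizer u w) ≤ 𝟙 (pw 2 w ∧ (not (central w) ∧ commute w (t ^^ g))) + 𝟙 (central w)
            pointwise w = split (pw 2 w) (central w) (commute w u) (commute w (t ^^ g))
              λ c → ⇒commute (commute-trans u nc (commute⇒ {w} {u} c) (sym e))

        order' : ℕ
        order' = ∑ {G} λ _ → 1

        ∑-regular-count : ∑ regular-count ≤ # (pw 2) * (4 * |F|)
        ∑-regular-count = begin
          ∑ regular-count ≡⟨ ∑-swap _ ⟩
          ∑ (λ w → ∑ λ g → 𝟙 (pw 2 w ∧ (not (central w) ∧ commute w (t ^^ g)))) ≤⟨ ∑-mono (λ w → ≤-trans (≤-reflexive (trans (∑-cong λ g → 𝟙-∧ (pw 2 w) _) (∑-*ˡ (𝟙 (pw 2 w)) _)))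
              (*-monoʳ-≤ (𝟙 (pw 2 w)) (column w (central w) refl))) ⟩
          ∑ (λ w → 𝟙 (pw 2 w) * (4 * |F|)) ≡⟨ ∑-*ʳ (4 * |F|) _ ⟩
          # (pw 2) * (4 * |F|) ∎
          where
          open ≤-Reasoning
          column : ∀ w z → central w ≡ z → ∑ (λ g → 𝟙 (not z ∧ commute w (t ^^ g))) ≤ 4 * |F|
          column w true _ = ≤-trans (≤-reflexive ∑-0) z≤n
          column w false nc = #conjugators w t nc reg

        -- Double counting of pairs of g and a noncentral w in X² that commutes with t ^^ g: every g
        -- has at least L/4J - 2 of them, while every w has at most 4|F| by `#conjugators`. Since
        -- |X²| ≤ J²|F|² and |F|³ ≤ 2|G|, this forces L ≤ 32J³ + 8J.
        absurd : ⊥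
        absurd = <⇒≱ L-large (*-cancelʳ-≤-pos {order'} (term≤∑ (λ (_ : G) → 1) ε) (begin
          L * order' ≡⟨ trans (sym (∑-*ˡ L _)) (∑-cong λ _ → *-identityʳ L) ⟩
          ∑ {G} (λ _ → L) ≤⟨ ∑-mono rich-torus ⟩
          ∑ (λ g → 4 * J * (regular-count g + 2)) ≡⟨ trans (∑-*ˡ (4 * J) _) (cong (4 * J *_) (trans (∑-+ regular-count (λ _ → 2)) (cong (∑ regular-count +_) (trans (∑-cong λ _ → sym (*-identityʳ 2)) (∑-*ˡ 2 (λ _ → 1)))))) ⟩
          4 * J * (∑ regular-count + 2 * order') ≤⟨ *-monoʳ-≤ (4 * J) (+-monoˡ-≤ (2 * order') (≤-trans ∑-regular-count (*-monoˡ-≤ (4 * |F|) #pw2))) ⟩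
          4 * J * (J * n * (4 * |F|) + 2 * order') ≤⟨ *-monoʳ-≤ (4 * J) (+-monoˡ-≤ (2 * order') (*-monoˡ-≤ (4 * |F|) (*-monoʳ-≤ J size))) ⟩
          4 * J * (J * (J * (|F| * |F|)) * (4 * |F|) + 2 * order') ≡⟨ r₁ J |F| order' ⟩
          16 * (J * (J * J)) * (|F| * (|F| * |F|)) + 8 * J * order' ≤⟨ +-monoˡ-≤ (8 * J * order') (*-monoʳ-≤ (16 * (J * (J * J))) order) ⟩
          16 * (J * (J * J)) * (2 * order') + 8 * J * order' ≡⟨ r₂ (J * (J * J)) J order' ⟩
          (32 * (J * (J * J)) + 8 * J) * order' ∎))
          where
          open ≤-Reasoning
          r₁ : ∀ j f o → 4 * j * (j * (j * (f * f)) * (4 * f) + 2 * o) ≡ 16 * (j * (j * j)) * (f * (f * f)) + 8 * j * o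
          r₁ = solve-∀
          r₂ : ∀ i j o → 16 * i * (2 * o) + 8 * j * o ≡ (32 * i + 8 * j) * o
          r₂ = solve-∀

      contradiction : ⊥
      contradiction = conclude regular-element
        where
        conclude : (∃ λ t → X t ≡ true × Regular t) → ⊥
        conclude (t , Xt , reg) = Conjugates.absurd t Xt reg

-- The energy gain, with losses polynomial in K.

module EnergyTheorem where

  open Sums
  open GroupEnergy
  open ApproximateGroups
  open Fields
  open SpecialLinear
  open CentralizerBounds
  open Pivoting
  open import Data.Nat hiding (_≟_)
  open import Data.Nat.Properties hiding (_≟_)
  open import Data.Bool using (Bool; true; false; _∧_)
  open import Data.Product using (_×_; _,_; ∃)
  open import Data.Empty using (⊥; ⊥-elim)
  open import Relation.Binary.PropositionalEquality hiding (J)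
  open import Data.Nat.Tactic.RingSolver using (solve-∀)

  -- Only the growth of the constants in K affects the final exponent, so they are never evaluated.
  -- Starting at K = 2 lets numerical factors be absorbed into powers of K.
  PolyBounded : (ℕ → ℕ) → Set
  PolyBounded f = ∃ λ e → ∀ K → 2 ≤ K → f K ≤ K ^ e

  1≤^ : ∀ K e → 2 ≤ K → 1 ≤ K ^ e
  1≤^ K e h = ≤-trans (≤-reflexive (sym (^-zeroˡ e))) (^-monoˡ-≤ e (≤-trans (s≤s z≤n) h))

  poly-const : ∀ c → PolyBounded (λ _ → c)
  poly-const c = c , λ K h → ≤-trans (n≤2^n c) (^-monoˡ-≤ c h)
    where
    n≤2^n : ∀ n → n ≤ 2 ^ n
    n≤2^n zero = z≤n
    n≤2^n (suc n) = ≤-trans (+-mono-≤ (1≤^ 2 n ≤-refl) (n≤2^n n)) (≤-reflexive (cong (2 ^ n +_) (sym (+-identityʳ (2 ^ n)))))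

  poly-id : PolyBounded (λ K → K)
  poly-id = 1 , λ K _ → ≤-reflexive (sym (*-identityʳ K))

  poly-* : ∀ {f g} → PolyBounded f → PolyBounded g → PolyBounded (λ K → f K * g K)
  poly-* (d , f≤) (e , g≤) = d + e , λ K h → ≤-trans (*-mono-≤ (f≤ K h) (g≤ K h)) (≤-reflexive (sym (^-distribˡ-+-* K d e)))

  poly-+ : ∀ {f g} → PolyBounded f → PolyBounded g → PolyBounded (λ K → f K + g K)
  poly-+ {f} {g} (d , f≤) (e , g≤) = 1 + (d + e) , λ K h → begin
    f K + g K ≤⟨ +-mono-≤ (f≤ K h) (g≤ K h) ⟩
    K ^ d + K ^ e ≤⟨ +-mono-≤ (m≤m*n (K ^ d) (K ^ e) {{>-nonZero (1≤^ K e h)}}) (m≤n*m (K ^ e) (K ^ d) {{>-nonZero (1≤^ K d h)}}) ⟩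
    K ^ d * K ^ e + K ^ d * K ^ e ≡⟨ cong (λ m → m + m) (sym (^-distribˡ-+-* K d e)) ⟩
    K ^ (d + e) + K ^ (d + e) ≡⟨ cong (K ^ (d + e) +_) (sym (+-identityʳ _)) ⟩
    2 * K ^ (d + e) ≤⟨ *-monoˡ-≤ (K ^ (d + e)) h ⟩
    K * K ^ (d + e) ∎
    where open ≤-Reasoning

  poly-^ : ∀ {f} → PolyBounded f → ∀ n → PolyBounded (λ K → f K ^ n)
  poly-^ p zero = poly-const 1
  poly-^ p (suc n) = poly-* p (poly-^ p n)

  quotient-constant : ℕ → ℕ
  quotient-constant K = 36 * K * K * (4 * (K * K) * (2 * 64 * (K * K)) * (4 * (K * K) * (2 * 64 * (K * K))))

  -- The first summand bounds |X⁶|/|X|. The second is added so that the same J also bounds |X| by J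
  -- |F|².
  tripling-constant : ℕ → ℕ
  tripling-constant K = (2 * (K₁ * K₁)) ^ 6 * (K₁ * (2 * K₁)) + 2 * K₁ * K
    where K₁ = quotient-constant K

  trace-constant : ℕ → ℕ
  trace-constant K = 1 + (32 * (J * (J * J)) + 8 * J)
    where J = tripling-constant K

  opaque

    -- L³ is what `X` must satisfy, and 24 K K₁² is lost between `S` and `X`: 2K₁ in `coset-bound`
    -- and 12 K K₁ in comparing |S| with |X|.
    spread-constant : ℕ → ℕ
    spread-constant K = 24 * (K * (K₁ * K₁)) * (L * (L * L))
      where
      K₁ L : ℕ
      K₁ = quotient-constant K
      L = trace-constant K

    spread-constant-def : ∀ K → spread-constant K ≡ 24 * (K * (quotient-constant K * quotient-constant K)) * (trace-constant K * (trace-constant K * trace-constant K))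
    spread-constant-def K = refl

    spread-poly : PolyBounded spread-constant
    spread-poly = poly-* (poly-* (poly-const 24) (poly-* poly-id (poly-* k₁ k₁))) (poly-* l (poly-* l l))
      where
      K²-poly : PolyBounded (λ K → K * K)
      K²-poly = poly-* poly-id poly-id
      m : PolyBounded (λ K → 4 * (K * K) * (2 * 64 * (K * K)))
      m = poly-* (poly-* (poly-const 4) K²-poly) (poly-* (poly-const (2 * 64)) K²-poly)
      k₁ : PolyBounded quotient-constant
      k₁ = poly-* (poly-* (poly-* (poly-const 36) poly-id) poly-id) (poly-* m m)
      j : PolyBounded tripling-constant
      j = poly-+ (poly-* (poly-^ (poly-* (poly-const 2) (poly-* k₁ k₁)) 6) (poly-* k₁ (poly-* (poly-const 2) k₁))) (poly-* (poly-* (poly-const 2) k₁) poly-id)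
      l : PolyBounded trace-constant
      l = poly-+ (poly-const 1) (poly-+ (poly-* (poly-const 32) (poly-* j (poly-* j j))) (poly-* (poly-const 8) j))

  module EnergyBound (𝔽 : FiniteField) where
    open FieldLemmas 𝔽 using () renaming (q to |F|)
    open Commuting 𝔽
    open SL2 𝔽 using (SL₂)
    open Pivot 𝔽

    module _ (S : G → Bool) (S-inverse : ∀ x → S x ≡ true → S (x ⁻¹) ≡ true) (K : ℕ)
      (S>0 : 0 < # S)
      (spread : ∀ H → IsSubgroupOf SL₂ H → (∃ λ g → H g ≡ false) → ∀ g → # (λ x → S x ∧ H (g ⁻¹ ∙ x)) * spread-constant K ≤ # S)
      (size : # S ≤ K * (|F| * |F|))
      (order : |F| * (|F| * |F|) ≤ 2 * ∑ {G} (λ _ → 1)) where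

      no-rich-energy : # S * (# S * # S) ≤ K * ∑ (λ x → corr S S x * corr S S x) → ⊥
      no-rich-energy rich = conclude E.pivot
        where
        module E = Energy.Rich SL₂ S K S>0 rich
        conclude : (∃ λ v → S v ≡ true × E.n * E.n + 64 * (K * K) * E.bad v < 8 * (K * K) * (E.deg v * E.deg v)) → ⊥
        conclude (v , _ , pivotal) = Contradiction.contradiction X J L (L * (L * L)) (record
            { X-inverse = P.X-inverse
            ; Xε = P.Xε
            ; small = ≤-trans (P.#pw 6) (*-monoˡ-≤ (# X) (m≤m+n ((2 * (K₁ * K₁)) ^ 6 * (K₁ * (2 * K₁))) (2 * K₁ * K)))
            ; spread = X-spread
            ; size = X-size
            ; order = order
            ; L³≤N = ≤-refl
            ; L-large = ≤-refl })
          where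
          open ≤-Reasoning
          module B = E.Neighbours v pivotal
          K₁ J L : ℕ
          K₁ = quotient-constant K
          J = tripling-constant K
          L = trace-constant K
          q>0 : 0 < # B.A
          q>0 = positive (# B.A) (≤-trans S>0 B.n≤6Kq)
            where
            positive : ∀ m → 0 < 6 * K * m → 0 < m
            positive zero h = ⊥-elim (<⇒≱ h (≤-reflexive (*-zeroʳ (6 * K))))
            positive (suc m) _ = s≤s z≤n
          quotients : # (B.A ∖ B.A) ≤ K₁ * # B.A
          quotients = subst (λ c → # (B.A ∖ B.A) ≤ 36 * K * K * (4 * (K * K) * c * (4 * (K * K) * c)) * # B.A) E.Δ≡ B.#D₁
          module P = Popular.Quotients SL₂ B.A K₁ q>0 quotients
          X : G → Bool
          X = P.X
          X-size : # X ≤ J * (|F| * |F|)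
          X-size = begin
            # X ≤⟨ P.#X≤2K₁q ⟩
            2 * K₁ * # B.A ≤⟨ *-monoʳ-≤ (2 * K₁) (≤-trans (#-mono B.A⊆S) size) ⟩
            2 * K₁ * (K * (|F| * |F|)) ≡⟨ sym (*-assoc (2 * K₁) K (|F| * |F|)) ⟩
            2 * K₁ * K * (|F| * |F|) ≤⟨ *-monoˡ-≤ (|F| * |F|) (m≤n+m (2 * K₁ * K) ((2 * (K₁ * K₁)) ^ 6 * (K₁ * (2 * K₁)))) ⟩
            J * (|F| * |F|) ∎
          c : ℕ
          c = 24 * (K * (K₁ * K₁))
          c>0 : 0 < c
          c>0 = *-mono-≤ {1} {24} (s≤s z≤n) (*-mono-≤ B.K>0 (*-mono-≤ P.K₁>0 P.K₁>0))
          X-spread : ∀ H → IsSubgroupOf SL₂ H → (∃ λ g → H g ≡ false) → ∀ g → # (λ x → X x ∧ H (g ⁻¹ ∙ x)) * (L * (L * L)) ≤ # X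
          X-spread H sub proper g = *-cancelˡ-≤-pos c>0 (begin
            c * (# (λ x → X x ∧ H (g ⁻¹ ∙ x)) * (L * (L * L))) ≡⟨ move c (# (λ x → X x ∧ H (g ⁻¹ ∙ x))) (L * (L * L)) ⟩
            # (λ x → X x ∧ H (g ⁻¹ ∙ x)) * (c * (L * (L * L))) ≤⟨ P.coset-bound S H (c * (L * (L * L))) B.A⊆S S-inverse (λ g → subst (λ N → # (λ x → S x ∧ H (g ⁻¹ ∙ x)) * N ≤ # S) (spread-constant-def K) (spread H sub proper g)) g ⟩
            2 * K₁ * # S ≤⟨ *-monoʳ-≤ (2 * K₁) (≤-trans B.n≤6Kq (*-monoʳ-≤ (6 * K) P.q≤2K₁#X)) ⟩
            2 * K₁ * (6 * K * (2 * K₁ * # X)) ≡⟨ collect K₁ K (# X) ⟩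
            c * # X ∎)
            where
            move : ∀ a b c → a * (b * c) ≡ b * (a * c)
            move = solve-∀
            collect : ∀ k₁ k x → 2 * k₁ * (6 * k * (2 * k₁ * x)) ≡ 24 * (k * (k₁ * k₁)) * x
            collect = solve-∀

-- The action of SL₂ on the plane.

module PlaneAction where

  open Sums
  open GroupEnergy
  open Fields
  open SpecialLinear
  open import Data.Nat as ℕ using (ℕ)
  import Data.Nat.Properties as ℕ
  open import Data.Bool using (true; false; not)
  open import Data.Product using (_×_; _,_; Σ; proj₁; proj₂)
  open import Data.Sum using (_⊎_; inj₁; inj₂)
  open import Data.Empty using (⊥-elim)
  open import Relation.Binary.PropositionalEquality
  open import Relation.Nullary using (yes; no; Dec)
  open import Relation.Nullary.Decidable using (⌊_⌋)

  module Plane (𝔽 : FiniteField) where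
    open FieldLemmas 𝔽 renaming (_⁻¹ to recip; inverse to inverse-F; _·_ to _·V_) hiding (finite)
    open SL2 𝔽 using (SL; sl; mat; det-mat; SL≡; SL₂; mat-∙)
    open GroupSums SL₂ hiding (finite)

    Pt : Set
    Pt = F × F

    o : Pt
    o = (0# , 0#)

    infixr 7 _⋆_
    _⋆_ : F → Pt → Pt
    t ⋆ (x , y) = (t * x , t * y)

    wedge : Pt → Pt → F
    wedge (x , y) (x' , y') = x * y' - y * x'

    Pt≡ : ∀ {x y x' y' : F} → x ≡ x' → y ≡ y' → (x , y) ≡ (x' , y')
    Pt≡ refl refl = refl

    action : M → Pt → Pt
    action (a , b , c , d) (x , y) = (a * x + b * y , c * x + d * y)

    infixr 6 _▹_
    opaque

      _▹_ : SL → Pt → Pt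
      g ▹ v = action (mat g) v

      ▹-action : ∀ g v → g ▹ v ≡ action (mat g) v
      ▹-action g v = refl

      ▹-∙ : ∀ g h v → (g ∙ h) ▹ v ≡ g ▹ (h ▹ v)
      ▹-∙ g h v = trans (cong (λ m → action m v) (mat-∙ g h)) (compose (mat g) (mat h) v)
        where
        entry : ∀ a b x y z w u v → (a * x + b * z) * u + (a * y + b * w) * v ≡ a * (x * u + y * v) + b * (z * u + w * v)
        entry = solve 8 (λ a b x y z w u v → ((a P.* x P.+ b P.* z) P.* u P.+ (a P.* y P.+ b P.* w) P.* v) ⊜ (a P.* (x P.* u P.+ y P.* v) P.+ b P.* (z P.* u P.+ w P.* v))) refl
        compose : ∀ m n v → action (mul m n) v ≡ action m (action n v)
        compose (a , b , c , d) (x , y , z , w) (u , v) = Pt≡ (entry a b x y z w u v) (entry c d x y z w u v)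

      ▹-ε : ∀ v → ε ▹ v ≡ v
      ▹-ε (x , y) = Pt≡ (t₁ x y) (t₂ x y)
        where
        t₁ : ∀ x y → 1# * x + 0# * y ≡ x
        t₁ = solve 2 (λ x y → (P.1# P.* x P.+ P.0# P.* y) ⊜ x) refl
        t₂ : ∀ x y → 0# * x + 1# * y ≡ y
        t₂ = solve 2 (λ x y → (P.0# P.* x P.+ P.1# P.* y) ⊜ y) refl

      ▹-o : ∀ g → g ▹ o ≡ o
      ▹-o g = compute (mat g)
        where
        zeros : ∀ a b → a * 0# + b * 0# ≡ 0#
        zeros = solve 2 (λ a b → (a P.* P.0# P.+ b P.* P.0#) ⊜ P.0#) refl
        compute : ∀ m → action m o ≡ o
        compute (a , b , c , d) = Pt≡ (zeros a b) (zeros c d)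

      ▹-⋆ : ∀ g t v → g ▹ (t ⋆ v) ≡ t ⋆ (g ▹ v)
      ▹-⋆ g t v = compute (mat g) v
        where
        entry : ∀ a b t x y → a * (t * x) + b * (t * y) ≡ t * (a * x + b * y)
        entry = solve 5 (λ a b t x y → (a P.* (t P.* x) P.+ b P.* (t P.* y)) ⊜ (t P.* (a P.* x P.+ b P.* y))) refl
        compute : ∀ m v → action m (t ⋆ v) ≡ t ⋆ action m v
        compute (a , b , c , d) (x , y) = Pt≡ (entry a b t x y) (entry c d t x y)

      wedge-▹ : ∀ g v w → wedge (g ▹ v) (g ▹ w) ≡ wedge v w
      wedge-▹ g v w = trans (compute (mat g) v w) (trans (cong (λ d → d * wedge v w) (det-mat g)) (*-identityˡ _))
        where
        poly : ∀ a b c d x y z w → (a * x + b * y) * (c * z + d * w) - (c * x + d * y) * (a * z + b * w) ≡ (a * d + - (b * c)) * (x * w - y * z)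
        poly = solve 8 (λ a b c d x y z w → ((a P.* x P.+ b P.* y) P.* (c P.* z P.+ d P.* w) P.- (c P.* x P.+ d P.* y) P.* (a P.* z P.+ b P.* w)) ⊜ ((a P.* d P.+ P.- (b P.* c)) P.* (x P.* w P.- y P.* z))) refl
        compute : ∀ m v w → wedge (action m v) (action m w) ≡ det m * wedge v w
        compute (a , b , c , d) (x , y) (z , w) = poly a b c d x y z w

      ▹-unique : ∀ g h v w → wedge v w ≢ 0# → g ▹ v ≡ h ▹ v → g ▹ w ≡ h ▹ w → g ≡ h
      ▹-unique g h v w ind e e' = SL≡ (compute (mat g) (mat h) v w ind e e')
        where
        row : ∀ a b a' b' x y z w → x * w - y * z ≢ 0# → a * x + b * y ≡ a' * x + b' * y → a * z + b * w ≡ a' * z + b' * w → a ≡ a' × b ≡ b'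
        row a b a' b' x y z w ind e e' =
            cancel-* ind (trans (t₁ a b x y z w) (trans (cong₂ (λ p r → w * p - y * r) e e') (sym (t₁ a' b' x y z w))))
          , cancel-* ind (trans (t₂ a b x y z w) (trans (cong₂ (λ p r → x * r - z * p) e e') (sym (t₂ a' b' x y z w))))
          where
          t₁ : ∀ a b x y z w → (x * w - y * z) * a ≡ w * (a * x + b * y) - y * (a * z + b * w)
          t₁ = solve 6 (λ a b x y z w → ((x P.* w P.- y P.* z) P.* a) ⊜ (w P.* (a P.* x P.+ b P.* y) P.- y P.* (a P.* z P.+ b P.* w))) refl
          t₂ : ∀ a b x y z w → (x * w - y * z) * b ≡ x * (a * z + b * w) - z * (a * x + b * y)
          t₂ = solve 6 (λ a b x y z w → ((x P.* w P.- y P.* z) P.* b) ⊜ (x P.* (a P.* z P.+ b P.* w) P.- z P.* (a P.* x P.+ b P.* y))) refl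
        compute : ∀ m n v w → wedge v w ≢ 0# → action m v ≡ action n v → action m w ≡ action n w → m ≡ n
        compute (a , b , c , d) (a' , b' , c' , d') (x , y) (z , w) ind e e' =
          M≡ (proj₁ r) (proj₂ r) (proj₁ s) (proj₂ s)
          where
          r : a ≡ a' × b ≡ b'
          r = row a b a' b' x y z w ind (cong proj₁ e) (cong proj₁ e')
          s : c ≡ c' × d ≡ d'
          s = row c d c' d' x y z w ind (cong proj₂ e) (cong proj₂ e')

    ▹-inverseˡ : ∀ g v → g ⁻¹ ▹ (g ▹ v) ≡ v
    ▹-inverseˡ g v = trans (sym (▹-∙ (g ⁻¹) g v)) (trans (cong (_▹ v) (inverseˡ g)) (▹-ε v))

    ▹-inverseʳ : ∀ g v → g ▹ (g ⁻¹ ▹ v) ≡ v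
    ▹-inverseʳ g v = trans (sym (▹-∙ g (g ⁻¹) v)) (trans (cong (_▹ v) (inverseʳ g)) (▹-ε v))

    ▹-≢o : ∀ g {v} → v ≢ o → g ▹ v ≢ o
    ▹-≢o g {v} v≢o e = v≢o (trans (sym (▹-inverseˡ g v)) (trans (cong (g ⁻¹ ▹_) e) (▹-o (g ⁻¹))))

    ∑-▹ : ∀ g (f : Pt → ℕ) → ∑ (λ v → f (g ▹ v)) ≡ ∑ f
    ∑-▹ g = ∑-reindex (g ▹_) (g ⁻¹ ▹_) (▹-inverseˡ g) (▹-inverseʳ g)

    ⋆-inverse : ∀ t v → t ≢ 0# → recip t ⋆ (t ⋆ v) ≡ v
    ⋆-inverse t (x , y) t≢0 = Pt≡ (cancel x) (cancel y)
      where
      cancel : ∀ x → recip t * (t * x) ≡ x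
      cancel x = trans (sym (*-assoc (recip t) t x)) (trans (cong (λ s → s * x) (trans (*-comm (recip t) t) (inverse-F t t≢0))) (*-identityˡ x))

    ⋆-inverse′ : ∀ t v → t ≢ 0# → t ⋆ (recip t ⋆ v) ≡ v
    ⋆-inverse′ t (x , y) t≢0 = Pt≡ (cancel x) (cancel y)
      where
      cancel : ∀ x → t * (recip t * x) ≡ x
      cancel x = trans (sym (*-assoc t (recip t) x)) (trans (cong (λ s → s * x) (inverse-F t t≢0)) (*-identityˡ x))

    nonzero-coordinate : ∀ v → v ≢ o → proj₁ v ≢ 0# ⊎ proj₂ v ≢ 0#
    nonzero-coordinate (x , y) h with x ≟ 0# | y ≟ 0#
    ... | no x≢0 | _ = inj₁ x≢0
    ... | yes _ | no y≢0 = inj₂ y≢0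
    ... | yes refl | yes refl = ⊥-elim (h refl)

    wedge-0 : ∀ v w → v ≢ o → wedge v w ≡ 0# → Σ F λ t → w ≡ t ⋆ v
    wedge-0 (x , y) (z , w) h e = pick (nonzero-coordinate (x , y) h)
      where
      e' : x * w ≡ y * z
      e' = x-y≡0 e
      scale : ∀ {a b z w} → a ≢ 0# → a * w ≡ b * z → w ≡ z * recip a * b
      scale {a} {b} {z} {w} a≢0 e = cancel-* a≢0 (trans e (trans (cong (λ s → b * s) (sym (divide z a a≢0))) (rearrange a b (z * recip a))))
        where
        rearrange : ∀ a b s → b * (s * a) ≡ a * (s * b)
        rearrange = solve 3 (λ a b s → (b P.* (s P.* a)) ⊜ (a P.* (s P.* b))) refl
      pick : x ≢ 0# ⊎ y ≢ 0# → Σ F λ t → (z , w) ≡ t ⋆ (x , y)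
      pick (inj₁ x≢0) = z * recip x , Pt≡ (sym (divide z x x≢0)) (scale x≢0 e')
      pick (inj₂ y≢0) = w * recip y , Pt≡ (scale y≢0 (sym e')) (sym (divide w y y≢0))

    affine-solution : ∀ a b c → a ≢ 0# → ∑ (λ y → 𝟙 ⌊ a * y + b ≟ c ⌋) ≡ 1
    affine-solution a b c a≢0 = trans (∑-cong λ y → 𝟙-cong ⌊ a * y + b ≟ c ⌋ ⌊ s ≟ y ⌋
        (λ e → ⇒does (s ≟ y) (cancel-* a≢0 (trans a*s (trans (cong (λ z → z - b) (sym (does⇒ (a * y + b ≟ c) e))) (drop (a * y) b)))))
        (λ e → ⇒does (a * y + b ≟ c) (trans (cong (λ z → a * z + b) (sym (does⇒ (s ≟ y) e))) (trans (cong (λ z → z + b) a*s) (add c b)))))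
        (∑-single s)
      where
      s : F
      s = recip a * (c - b)
      a*s : a * s ≡ c - b
      a*s = trans (sym (*-assoc a (recip a) _)) (trans (cong (λ z → z * (c - b)) (inverse-F a a≢0)) (*-identityˡ _))
      drop : ∀ x b → x + b - b ≡ x
      drop = solve 2 (λ x b → (x P.+ b P.- b) ⊜ x) refl
      add : ∀ c b → c - b + b ≡ c
      add = solve 2 (λ c b → (c P.- b P.+ b) ⊜ c) refl

    ∑-Pt : (f : Pt → ℕ) → ∑ f ≡ ∑ (λ x → ∑ λ y → f (x , y))
    ∑-Pt = ∑-×

    ∑-const : ∀ {A : Set} {{_ : Finite A}} c → ∑ {A} (λ _ → c) ≡ ∑ {A} (λ _ → 1) ℕ.* c
    ∑-const c = trans (∑-cong λ _ → sym (ℕ.*-identityˡ c)) (∑-*ʳ c (λ _ → 1))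

    #Pt : ∑ {Pt} (λ _ → 1) ≡ q ℕ.* q
    #Pt = trans (∑-Pt _) (∑-const q)

    -- A nonzero coordinate of v allows the equation to be solved for the opposite coordinate of w,
    -- once for each value of the remaining one.
    line-count : ∀ v c → v ≢ o → # (λ w → ⌊ wedge v w ≟ c ⌋) ≡ q
    line-count (x , y) c h = pick (nonzero-coordinate (x , y) h)
      where
      pick : x ≢ 0# ⊎ y ≢ 0# → # (λ w → ⌊ wedge (x , y) w ≟ c ⌋) ≡ q
      pick (inj₁ x≢0) = trans (∑-Pt _) (∑-cong λ z → affine-solution x (- (y * z)) c x≢0)
      pick (inj₂ y≢0) = trans (∑-Pt _) (trans (∑-swap _) (∑-cong λ w → trans (∑-cong λ z → cong (λ s → 𝟙 ⌊ s ≟ c ⌋) (flip x y z w)) (affine-solution (- y) (x * w) c (λ e → y≢0 (trans (nn y) (trans (cong -_ e) n0))))))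
        where
        flip : ∀ x y z w → x * w - y * z ≡ - y * z + x * w
        flip = solve 4 (λ x y z w → (x P.* w P.- y P.* z) ⊜ (P.- y P.* z P.+ x P.* w)) refl
        nn : ∀ y → y ≡ - - y
        nn = solve 1 (λ y → y ⊜ (P.- P.- y)) refl
        n0 : - 0# ≡ 0#
        n0 = solve 0 (P.- P.0# ⊜ P.0#) refl

    wedge-unique : ∀ v v' w w' → wedge v v' ≢ 0# → wedge v w ≡ wedge v w' → wedge v' w ≡ wedge v' w' → w ≡ w'
    wedge-unique (x , y) (x' , y') (z , w) (z' , w') ind e e' = Pt≡
        (cancel-* ind (trans (t₁ x y x' y' z w) (trans (cong₂ (λ p r → x' * p - x * r) e e') (sym (t₁ x y x' y' z' w')))))
        (cancel-* ind (trans (t₂ x y x' y' z w) (trans (cong₂ (λ p r → y' * p - y * r) e e') (sym (t₂ x y x' y' z' w')))))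
      where
      t₁ : ∀ x y x' y' z w → (x * y' - y * x') * z ≡ x' * (x * w - y * z) - x * (x' * w - y' * z)
      t₁ = solve 6 (λ x y x' y' z w → ((x P.* y' P.- y P.* x') P.* z) ⊜ (x' P.* (x P.* w P.- y P.* z) P.- x P.* (x' P.* w P.- y' P.* z))) refl
      t₂ : ∀ x y x' y' z w → (x * y' - y * x') * w ≡ y' * (x * w - y * z) - y * (x' * w - y' * z)
      t₂ = solve 6 (λ x y x' y' z w → ((x P.* y' P.- y P.* x') P.* w) ⊜ (y' P.* (x P.* w P.- y P.* z) P.- y P.* (x' P.* w P.- y' P.* z))) refl

    e₀ : Pt
    e₀ = (1# , 0#)

    e₀≢o : e₀ ≢ o
    e₀≢o e = 1≢0 (cong proj₁ e)

    frame : ∀ v → v ≢ o → Σ SL λ g → g ▹ e₀ ≡ v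
    frame (x , y) h = pick (nonzero-coordinate (x , y) h)
      where
      first : ∀ a b → a * 1# + b * 0# ≡ a
      first = solve 2 (λ a b → (a P.* P.1# P.+ b P.* P.0#) ⊜ a) refl
      image : ∀ m → (u : det m ≡ 1#) → e₁₁ m ≡ x → e₂₁ m ≡ y → sl m u ▹ e₀ ≡ (x , y)
      image (a , b , c , d) u e e' = trans (▹-action (sl (a , b , c , d) u) e₀) (Pt≡ (trans (first a b) e) (trans (first c d) e'))
      pick : x ≢ 0# ⊎ y ≢ 0# → Σ SL λ g → g ▹ e₀ ≡ (x , y)
      pick (inj₁ x≢0) = sl (x , 0# , y , recip x) u , image (x , 0# , y , recip x) u refl refl
        where
        u : det (x , 0# , y , recip x) ≡ 1#
        u = trans (simplify (x * recip x) y) (inverse-F x x≢0)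
          where
          simplify : ∀ a y → a + - (0# * y) ≡ a
          simplify = solve 2 (λ a y → (a P.+ P.- (P.0# P.* y)) ⊜ a) refl
      pick (inj₂ y≢0) = sl (x , - recip y , y , 0#) u , image (x , - recip y , y , 0#) u refl refl
        where
        u : det (x , - recip y , y , 0#) ≡ 1#
        u = trans (simplify x y (recip y)) (inverse-F y y≢0)
          where
          simplify : ∀ x y r → x * 0# + - (- r * y) ≡ y * r
          simplify = solve 3 (λ x y r → (x P.* P.0# P.+ P.- (P.- r P.* y)) ⊜ (y P.* r)) refl

    shear : F → SL
    shear b = sl (1# , b , 0# , 1#) (unit b)
      where
      unit : ∀ b → det (1# , b , 0# , 1#) ≡ 1#
      unit = solve 1 (λ b → P.det (P.1# , b , P.0# , P.1#) ⊜ P.1#) refl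

    -- Fixing `e₀` prescribes the first column, and the determinant then leaves only shears.
    #stabilizer : # (λ g → ⌊ g ▹ e₀ ≟ e₀ ⌋) ≡ q
    #stabilizer = begin
      # (λ g → ⌊ g ▹ e₀ ≟ e₀ ⌋) ≡⟨ ∑-cong pointwise ⟩
      ∑ (λ g → ∑ λ b → δ (shear b) g) ≡⟨ ∑-swap _ ⟩
      ∑ (λ b → ∑ λ g → δ (shear b) g) ≡⟨ ∑-cong (λ b → ∑-single (shear b)) ⟩
      q ∎
      where
      open ≡-Reasoning
      column : ∀ a b → a * 1# + b * 0# ≡ a
      column = solve 2 (λ a b → (a P.* P.1# P.+ b P.* P.0#) ⊜ a) refl
      fixes : ∀ b → shear b ▹ e₀ ≡ e₀
      fixes b = trans (▹-action (shear b) e₀) (Pt≡ (column 1# b) (column 0# 1#))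
      is-shear : ∀ g → g ▹ e₀ ≡ e₀ → shear (e₁₂ (mat g)) ≡ g
      is-shear g e = SL≡ (compute (mat g) (det-mat g) (trans (sym (▹-action g e₀)) e))
        where
        compute : ∀ m → det m ≡ 1# → action m e₀ ≡ e₀ → (1# , e₁₂ m , 0# , 1#) ≡ m
        compute (a , b , c , d) u e = M≡ (sym a≡1) refl (sym c≡0) (sym d≡1)
          where
          a≡1 : a ≡ 1#
          a≡1 = trans (sym (column a b)) (cong proj₁ e)
          c≡0 : c ≡ 0#
          c≡0 = trans (sym (column c d)) (cong proj₂ e)
          simplify : ∀ b d → d ≡ 1# * d + - (b * 0#)
          simplify = solve 2 (λ b d → d ⊜ (P.1# P.* d P.+ P.- (b P.* P.0#))) refl
          d≡1 : d ≡ 1#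
          d≡1 = trans (simplify b d) (trans (cong₂ (λ s t → s * d + - (b * t)) (sym a≡1) (sym c≡0)) u)
      pointwise : ∀ g → 𝟙 ⌊ g ▹ e₀ ≟ e₀ ⌋ ≡ ∑ (λ b → δ (shear b) g)
      pointwise g = decide (g ▹ e₀ ≟ e₀)
        where
        decide : (d : Dec (g ▹ e₀ ≡ e₀)) → 𝟙 ⌊ d ⌋ ≡ ∑ (λ b → δ (shear b) g)
        decide (yes e) = sym (trans (∑-cong λ b → 𝟙-cong ⌊ shear b ≟ g ⌋ ⌊ e₁₂ (mat g) ≟ b ⌋
            (λ h → ⇒does (_ ≟ _) (cong (λ k → e₁₂ (mat k)) (sym (does⇒ (shear b ≟ g) h))))
            (λ h → ⇒does (_ ≟ _) (trans (cong shear (sym (does⇒ (e₁₂ (mat g) ≟ b) h))) (is-shear g e)))) (∑-single (e₁₂ (mat g))))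
        decide (no ¬e) = sym (trans (∑-cong λ b → δ-≢ {x = shear b} {y = g} λ h → ¬e (trans (cong (_▹ e₀) (sym h)) (fixes b))) ∑-0)

    -- By transitivity (`frame`), v = a e₀ and w = b e₀, and the set is b Stab(e₀) a⁻¹.
    hits : ∀ v w → v ≢ o → w ≢ o → # (λ g → ⌊ g ▹ v ≟ w ⌋) ≡ q
    hits v w v≢o w≢o = through (frame v v≢o) (frame w w≢o)
      where
      through : (Σ SL λ g → g ▹ e₀ ≡ v) → (Σ SL λ g → g ▹ e₀ ≡ w) → # (λ g → ⌊ g ▹ v ≟ w ⌋) ≡ q
      through (a , refl) (b , refl) = begin
        # (λ g → ⌊ g ▹ (a ▹ e₀) ≟ b ▹ e₀ ⌋) ≡⟨ sym (∑-translateʳ (a ⁻¹) (λ g → 𝟙 ⌊ g ▹ (a ▹ e₀) ≟ b ▹ e₀ ⌋)) ⟩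
        ∑ (λ g → 𝟙 ⌊ (g ∙ a ⁻¹) ▹ (a ▹ e₀) ≟ b ▹ e₀ ⌋) ≡⟨ sym (∑-translateˡ b (λ g → 𝟙 ⌊ (g ∙ a ⁻¹) ▹ (a ▹ e₀) ≟ b ▹ e₀ ⌋)) ⟩
        ∑ (λ g → 𝟙 ⌊ (b ∙ g ∙ a ⁻¹) ▹ (a ▹ e₀) ≟ b ▹ e₀ ⌋) ≡⟨ ∑-cong (λ g → 𝟙-cong ⌊ (b ∙ g ∙ a ⁻¹) ▹ (a ▹ e₀) ≟ b ▹ e₀ ⌋ ⌊ g ▹ e₀ ≟ e₀ ⌋
            (λ h → ⇒does (_ ≟ _) (trans (sym (▹-inverseˡ b (g ▹ e₀))) (trans (cong (b ⁻¹ ▹_) (trans (sym (simplify g)) (does⇒ (_ ≟ _) h))) (▹-inverseˡ b e₀))))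
            (λ h → ⇒does (_ ≟ _) (trans (simplify g) (cong (b ▹_) (does⇒ (g ▹ e₀ ≟ e₀) h))))) ⟩
        # (λ g → ⌊ g ▹ e₀ ≟ e₀ ⌋) ≡⟨ #stabilizer ⟩
        q ∎
        where
        open ≡-Reasoning
        simplify : ∀ g → (b ∙ g ∙ a ⁻¹) ▹ (a ▹ e₀) ≡ b ▹ (g ▹ e₀)
        simplify g = trans (▹-∙ (b ∙ g) (a ⁻¹) _) (trans (cong ((b ∙ g) ▹_) (▹-inverseˡ a e₀)) (▹-∙ b g e₀))

    #G : ℕ
    #G = ∑ {SL} λ _ → 1

    -- Orbit counting: `e₀` is moved to every point except the origin, by q elements each. The order
    -- q³ - q is written without subtraction.
    #G+q : #G ℕ.+ q ≡ q ℕ.* (q ℕ.* q)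
    #G+q = begin
      #G ℕ.+ q ≡⟨ cong₂ ℕ._+_ orbit (sym (ℕ.*-identityˡ q)) ⟩
      s ℕ.* q ℕ.+ 1 ℕ.* q ≡⟨ sym (ℕ.*-distribʳ-+ q s 1) ⟩
      (s ℕ.+ 1) ℕ.* q ≡⟨ cong (ℕ._* q) (trans (cong (s ℕ.+_) (sym (∑-single o))) (trans (sym (∑-+ _ _)) (trans (∑-cong complement) #Pt))) ⟩
      q ℕ.* q ℕ.* q ≡⟨ ℕ.*-comm (q ℕ.* q) q ⟩
      q ℕ.* (q ℕ.* q) ∎
      where
      open ≡-Reasoning
      s : ℕ
      s = # (λ v → not ⌊ o ≟ v ⌋)
      complement : ∀ v → 𝟙 (not ⌊ o ≟ v ⌋) ℕ.+ 𝟙 ⌊ o ≟ v ⌋ ≡ 1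
      complement v = bit ⌊ o ≟ v ⌋
        where
        bit : ∀ b → 𝟙 (not b) ℕ.+ 𝟙 b ≡ 1
        bit true = refl
        bit false = refl
      orbit : #G ≡ s ℕ.* q
      orbit = begin
        ∑ {SL} (λ _ → 1) ≡⟨ ∑-cong (λ g → sym (∑-single (g ▹ e₀))) ⟩
        ∑ (λ g → ∑ λ v → δ (g ▹ e₀) v) ≡⟨ ∑-swap _ ⟩
        ∑ (λ v → ∑ λ g → δ (g ▹ e₀) v) ≡⟨ ∑-cong (λ v → column v (o ≟ v)) ⟩
        ∑ (λ v → 𝟙 (not ⌊ o ≟ v ⌋) ℕ.* q) ≡⟨ ∑-*ʳ q _ ⟩
        s ℕ.* q ∎
        where
        column : ∀ v → (d : Dec (o ≡ v)) → ∑ (λ g → δ (g ▹ e₀) v) ≡ 𝟙 (not ⌊ d ⌋) ℕ.* q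
        column v (no o≢v) = trans (hits e₀ v e₀≢o (λ e → o≢v (sym e))) (sym (ℕ.*-identityˡ q))
        column v (yes refl) = trans (∑-cong λ g → δ-≢ (▹-≢o g e₀≢o)) ∑-0

-- Orthogonal pairs in F⁴ and the second moment of |gE ∩ A|.

module SpectralBound where

  open Sums
  open GroupEnergy
  open Fields
  open SpecialLinear
  open PlaneAction
  open import Data.Nat as ℕ using (ℕ; _≤_; _<_; z≤n) renaming (_+_ to _+ℕ_; _*_ to _*ℕ_)
  import Data.Nat.Properties as ℕ
  open import Data.Bool using (Bool; true; false; _∧_; not)
  open import Data.Product using (_,_; Σ; ∃; proj₁; proj₂)
  open import Data.Sum using (_⊎_; inj₁; inj₂)
  open import Data.Empty using (⊥)
  open import Relation.Binary.PropositionalEquality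
  open import Relation.Nullary using (yes; no; Dec)
  open import Relation.Nullary.Decidable using (⌊_⌋)
  open import Data.Nat.Tactic.RingSolver using (solve-∀)

  module Spectral (𝔽 : FiniteField) where
    open FieldLemmas 𝔽 renaming (_⁻¹ to recip; inverse to inverse-F; _·_ to _·V_) hiding (finite; V)
    open SL2 𝔽 using (SL; SL₂)
    open GroupSums SL₂ hiding (finite)
    open Plane 𝔽 using (Pt; o; _⋆_; wedge; _▹_; ▹-⋆; wedge-▹; ▹-unique; wedge-0; wedge-unique; line-count; hits; #G; #G+q; ∑-const; #Pt; ⋆-inverse; ⋆-inverse′)

    Pairs : Set
    Pairs = Pair Pt Pt

    infixr 7 _⋆⋆_
    _⋆⋆_ : F → Pairs → Pairs
    t ⋆⋆ (v ,, w) = (t ⋆ v) ,, (t ⋆ w)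

    -- Orthogonality for the symplectic form (e ,, a) , (e' ,, a') ↦ e ∧ e' - a ∧ a' on F⁴.
    perp : Pairs → Pairs → Bool
    perp (e ,, a) (e' ,, a') = ⌊ wedge e e' ≟ wedge a a' ⌋

    q>0 : 0 < q
    q>0 = term≤∑ (λ (_ : F) → 1) 0#

    r : ℕ
    r = # λ (t : F) → not ⌊ 0# ≟ t ⌋

    r+1≡q : r +ℕ 1 ≡ q
    r+1≡q = trans (cong (r +ℕ_) (sym (∑-single 0#))) (trans (sym (∑-+ _ _)) (∑-cong λ t → bit ⌊ 0# ≟ t ⌋))
      where
      bit : ∀ b → 𝟙 (not b) +ℕ 𝟙 b ≡ 1
      bit true = refl
      bit false = refl

    r>0 : 0 < r
    r>0 = #-pos _ {1#} (cong not (⇒does¬ (0# ≟ 1#) (λ e → 1≢0 (sym e))))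

    #Pair : ∑ {Pairs} (λ _ → 1) ≡ q *ℕ q *ℕ (q *ℕ q)
    #Pair = trans (∑-Pair (λ _ → 1)) (trans (∑-cong λ v → #Pt) (trans (∑-const (q *ℕ q)) (cong (_*ℕ (q *ℕ q)) #Pt)))

    ∑-perp : ∀ x → fst x ≢ o → ∑ (λ y → 𝟙 (perp x y)) ≡ q *ℕ q *ℕ q
    ∑-perp (e ,, a) e≢o = begin
      ∑ (λ y → 𝟙 (perp (e ,, a) y)) ≡⟨ trans (∑-Pair (λ y → 𝟙 (perp (e ,, a) y))) (∑-swap (λ f b → 𝟙 ⌊ wedge e f ≟ wedge a b ⌋)) ⟩
      ∑ (λ b → ∑ λ f → 𝟙 ⌊ wedge e f ≟ wedge a b ⌋) ≡⟨ ∑-cong (λ b → line-count e (wedge a b) e≢o) ⟩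
      ∑ {Pt} (λ b → q) ≡⟨ trans (∑-const q) (cong (_*ℕ q) #Pt) ⟩
      q *ℕ q *ℕ q ∎
      where open ≡-Reasoning

    -- The number of scalars t with x' = t x, which for nonzero x is the indicator of
    -- proportionality. As a sum over t it can be interchanged with other sums.
    multiples : Pairs → Pairs → ℕ
    multiples x x' = ∑ λ t → δ (t ⋆⋆ x) x'

    multiples-≥1 : ∀ {x x'} t → x' ≡ t ⋆⋆ x → 1 ≤ multiples x x'
    multiples-≥1 {x} t refl = ≤∑-term _ t (ℕ.≤-reflexive (sym (δ-refl (t ⋆⋆ x))))

    wedge-⋆ : ∀ t v w → wedge (t ⋆ v) w ≡ t * wedge v w
    wedge-⋆ t (x , y) (z , w) = identity t x y z w
      where
      identity : ∀ t x y z w → t * x * w - t * y * z ≡ t * (x * w - y * z)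
      identity = solve 5 (λ t x y z w → (t P.* x P.* w P.- t P.* y P.* z) ⊜ (t P.* (x P.* w P.- y P.* z))) refl

    wedge-⋆ʳ : ∀ t v w → wedge v (t ⋆ w) ≡ t * wedge v w
    wedge-⋆ʳ t (x , y) (z , w) = identity t x y z w
      where
      identity : ∀ t x y z w → x * (t * w) - y * (t * z) ≡ t * (x * w - y * z)
      identity = solve 5 (λ t x y z w → (x P.* (t P.* w) P.- y P.* (t P.* z)) ⊜ (t P.* (x P.* w P.- y P.* z))) refl

    infixl 6 _⊝_
    _⊝_ : Pt → Pt → Pt
    (x , y) ⊝ (x' , y') = (x - x' , y - y')

    wedge-⊝ : ∀ v w b → wedge (v ⊝ w) b ≡ wedge v b - wedge w b
    wedge-⊝ (x , y) (x' , y') (z , w) = identity x y x' y' z w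
      where
      identity : ∀ x y x' y' z w → (x - x') * w - (y - y') * z ≡ (x * w - y * z) - (x' * w - y' * z)
      identity = solve 6 (λ x y x' y' z w → ((x P.- x') P.* w P.- (y P.- y') P.* z) ⊜ ((x P.* w P.- y P.* z) P.- (x' P.* w P.- y' P.* z))) refl

    ⊝≡o : ∀ v w → v ⊝ w ≡ o → v ≡ w
    ⊝≡o (x , y) (x' , y') e = cong₂ _,_ (x-y≡0 (cong proj₁ e)) (x-y≡0 (cong proj₂ e))

    -- Two independent linear equations on F⁴ leave q² points; a repeated equation leaves q³, which
    -- is charged to `multiples`. If e' = t e but a' differs from t a, the equations force u ∧ b = 0
    -- for the nonzero u = a' - t a.
    common-perp : ∀ x x' → fst x ≢ o → ∑ (λ y → 𝟙 (perp x y) *ℕ 𝟙 (perp x' y)) ≤ q *ℕ q +ℕ q *ℕ q *ℕ q *ℕ multiples x x'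
    common-perp (e ,, a) (e' ,, a') e≢o = split (wedge e e' ≟ 0#)
      where
      open ℕ.≤-Reasoning
      total : ℕ
      total = ∑ λ y → 𝟙 (perp (e ,, a) y) *ℕ 𝟙 (perp (e' ,, a') y)
      rows : total ≡ ∑ (λ b → ∑ λ f → 𝟙 (perp (e ,, a) (f ,, b)) *ℕ 𝟙 (perp (e' ,, a') (f ,, b)))
      rows = trans (∑-Pair (λ y → 𝟙 (perp (e ,, a) y) *ℕ 𝟙 (perp (e' ,, a') y))) (∑-swap (λ f b → 𝟙 (perp (e ,, a) (f ,, b)) *ℕ 𝟙 (perp (e' ,, a') (f ,, b))))
      independent : wedge e e' ≢ 0# → total ≤ q *ℕ q
      independent ind = begin
        total ≡⟨ rows ⟩
        ∑ (λ b → ∑ λ f → 𝟙 (perp (e ,, a) (f ,, b)) *ℕ 𝟙 (perp (e' ,, a') (f ,, b))) ≤⟨ ∑-mono (λ b → ℕ.≤-trans (ℕ.≤-reflexive (∑-cong λ f → sym (𝟙-∧ (perp (e ,, a) (f ,, b)) _)))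
            (#≤1 (λ f → perp (e ,, a) (f ,, b) ∧ perp (e' ,, a') (f ,, b)) λ f f' h h' → wedge-unique e e' f f' ind
              (trans (does⇒ (_ ≟ _) (∧-fst h)) (sym (does⇒ (_ ≟ _) (∧-fst h'))))
              (trans (does⇒ (_ ≟ _) (∧-snd {perp (e ,, a) (f ,, b)} h)) (sym (does⇒ (_ ≟ _) (∧-snd {perp (e ,, a) (f' ,, b)} h')))))) ⟩
        ∑ {Pt} (λ b → 1) ≡⟨ #Pt ⟩
        q *ℕ q ∎
      dependent : ∀ t → e' ≡ t ⋆ e → Dec (a' ≡ t ⋆ a) → total ≤ q *ℕ q +ℕ q *ℕ q *ℕ q *ℕ multiples (e ,, a) (e' ,, a')
      dependent t e'≡ (yes a'≡) = begin
        total ≤⟨ ∑-mono (λ y → ℕ.≤-trans (ℕ.*-monoʳ-≤ (𝟙 (perp (e ,, a) y)) (𝟙≤1 _)) (ℕ.≤-reflexive (ℕ.*-identityʳ _))) ⟩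
        ∑ (λ y → 𝟙 (perp (e ,, a) y)) ≡⟨ ∑-perp (e ,, a) e≢o ⟩
        q *ℕ q *ℕ q ≡⟨ sym (ℕ.*-identityʳ _) ⟩
        q *ℕ q *ℕ q *ℕ 1 ≤⟨ ℕ.*-monoʳ-≤ (q *ℕ q *ℕ q) (multiples-≥1 t (cong₂ _,,_ e'≡ a'≡)) ⟩
        q *ℕ q *ℕ q *ℕ multiples (e ,, a) (e' ,, a') ≤⟨ ℕ.m≤n+m _ (q *ℕ q) ⟩
        q *ℕ q +ℕ q *ℕ q *ℕ q *ℕ multiples (e ,, a) (e' ,, a') ∎
      dependent t e'≡ (no a'≢) = begin
        total ≡⟨ rows ⟩
        ∑ (λ b → ∑ λ f → 𝟙 (perp (e ,, a) (f ,, b)) *ℕ 𝟙 (perp (e' ,, a') (f ,, b))) ≤⟨ ∑-mono (λ b → ∑-mono λ f → pointwise f b) ⟩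
        ∑ (λ b → ∑ λ f → 𝟙 ⌊ wedge u b ≟ 0# ⌋ *ℕ 𝟙 ⌊ wedge e f ≟ wedge a b ⌋) ≡⟨ ∑-cong (λ b → trans (∑-*ˡ (𝟙 ⌊ wedge u b ≟ 0# ⌋) _) (cong (𝟙 ⌊ wedge u b ≟ 0# ⌋ *ℕ_) (line-count e (wedge a b) e≢o))) ⟩
        ∑ (λ b → 𝟙 ⌊ wedge u b ≟ 0# ⌋ *ℕ q) ≡⟨ trans (∑-*ʳ q _) (cong (_*ℕ q) (line-count u 0# (λ z → a'≢ (⊝≡o a' (t ⋆ a) z)))) ⟩
        q *ℕ q ≤⟨ ℕ.m≤m+n (q *ℕ q) _ ⟩
        q *ℕ q +ℕ q *ℕ q *ℕ q *ℕ multiples (e ,, a) (e' ,, a') ∎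
        where
        u : Pt
        u = a' ⊝ t ⋆ a
        pointwise : ∀ f b → 𝟙 (perp (e ,, a) (f ,, b)) *ℕ 𝟙 (perp (e' ,, a') (f ,, b)) ≤ 𝟙 ⌊ wedge u b ≟ 0# ⌋ *ℕ 𝟙 ⌊ wedge e f ≟ wedge a b ⌋
        pointwise f b = ℕ.≤-trans (ℕ.≤-reflexive (sym (𝟙-∧ (perp (e ,, a) (f ,, b)) _))) (ℕ.≤-trans
          (𝟙-mono (perp (e ,, a) (f ,, b) ∧ perp (e' ,, a') (f ,, b)) (⌊ wedge u b ≟ 0# ⌋ ∧ ⌊ wedge e f ≟ wedge a b ⌋) λ h →
            ∧-intro (⇒does (_ ≟ _) (trans (wedge-⊝ a' (t ⋆ a) b) (x≡y⇒0 (trans (sym (does⇒ (_ ≟ _) (∧-snd {perp (e ,, a) (f ,, b)} h)))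
              (trans (cong (λ v → wedge v f) e'≡) (trans (wedge-⋆ t e f) (trans (cong (λ s → t * s) (does⇒ (wedge e f ≟ wedge a b) (∧-fst h))) (sym (wedge-⋆ t a b)))))))))
              (∧-fst h))
          (ℕ.≤-reflexive (𝟙-∧ ⌊ wedge u b ≟ 0# ⌋ _)))
      split : Dec (wedge e e' ≡ 0#) → total ≤ q *ℕ q +ℕ q *ℕ q *ℕ q *ℕ multiples (e ,, a) (e' ,, a')
      split (no ind) = ℕ.≤-trans (independent ind) (ℕ.m≤m+n (q *ℕ q) _)
      split (yes dep) = scaled (wedge-0 e e' e≢o dep)
        where
        scaled : (Σ F λ t → e' ≡ t ⋆ e) → total ≤ q *ℕ q +ℕ q *ℕ q *ℕ q *ℕ multiples (e ,, a) (e' ,, a')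
        scaled (t , e'≡) = dependent t e'≡ (a' ≟ t ⋆ a)

    hit : SL → Pairs → Bool
    hit g (e ,, a) = ⌊ g ▹ e ≟ a ⌋

    ∑-hit : ∀ x → fst x ≢ o → snd x ≢ o → ∑ (λ g → 𝟙 (hit g x)) ≡ q
    ∑-hit (e ,, a) = hits e a

    -- Independent e and e' determine g, and g can exist only if the pairs are orthogonal, because
    -- it preserves `wedge`. If e' = t e, then a' = t a is forced, and the q elements with g e = a
    -- are charged to `multiples`.
    common-hits : ∀ x x' → fst x ≢ o → snd x ≢ o → ∑ (λ g → 𝟙 (hit g x) *ℕ 𝟙 (hit g x')) ≤ 𝟙 (perp x x') +ℕ q *ℕ multiples x x'
    common-hits (e ,, a) (e' ,, a') e≢o a≢o = split (wedge e e' ≟ 0#)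
      where
      open ℕ.≤-Reasoning
      both : SL → Bool
      both g = hit g (e ,, a) ∧ hit g (e' ,, a')
      first : ∀ g → both g ≡ true → g ▹ e ≡ a
      first g h = does⇒ (_ ≟ _) (∧-fst h)
      second : ∀ g → both g ≡ true → g ▹ e' ≡ a'
      second g h = does⇒ (_ ≟ _) (∧-snd {hit g (e ,, a)} h)
      as-both : ∑ (λ g → 𝟙 (hit g (e ,, a)) *ℕ 𝟙 (hit g (e' ,, a'))) ≡ # both
      as-both = ∑-cong λ g → sym (𝟙-∧ (hit g (e ,, a)) _)
      bound : ℕ
      bound = 𝟙 (perp (e ,, a) (e' ,, a')) +ℕ q *ℕ multiples (e ,, a) (e' ,, a')
      independent : wedge e e' ≢ 0# → (∃ λ g → both g ≡ true) ⊎ (∀ g → both g ≡ false) → # both ≤ bound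
      independent ind (inj₂ none) = ℕ.≤-trans (ℕ.≤-reflexive (trans (∑-cong λ g → cong 𝟙 (none g)) ∑-0)) z≤n
      independent ind (inj₁ (g₀ , h₀)) = begin
        # both ≤⟨ #≤1 both (λ g g' h h' → ▹-unique g g' e e' ind (trans (first g h) (sym (first g' h'))) (trans (second g h) (sym (second g' h')))) ⟩
        1 ≡⟨ sym (cong 𝟙 (⇒does (wedge e e' ≟ wedge a a') (trans (sym (wedge-▹ g₀ e e')) (cong₂ wedge (first g₀ h₀) (second g₀ h₀))))) ⟩
        𝟙 (perp (e ,, a) (e' ,, a')) ≤⟨ ℕ.m≤m+n _ _ ⟩
        bound ∎
      dependent : (Σ F λ t → e' ≡ t ⋆ e) → # both ≤ bound
      dependent (t , e'≡) = begin
        # both ≤⟨ ∑-mono (λ g → 𝟙-bound g) ⟩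
        ∑ (λ g → 𝟙 (hit g (e ,, a)) *ℕ multiples (e ,, a) (e' ,, a')) ≡⟨ trans (∑-*ʳ _ _) (cong (_*ℕ multiples (e ,, a) (e' ,, a')) (hits e a e≢o a≢o)) ⟩
        q *ℕ multiples (e ,, a) (e' ,, a') ≤⟨ ℕ.m≤n+m _ (𝟙 (perp (e ,, a) (e' ,, a'))) ⟩
        bound ∎
        where
        𝟙-bound : ∀ g → 𝟙 (both g) ≤ 𝟙 (hit g (e ,, a)) *ℕ multiples (e ,, a) (e' ,, a')
        𝟙-bound g = 𝟙≤ (both g) λ h → ℕ.≤-trans (multiples-≥1 t (cong₂ _,,_ e'≡ (trans (sym (second g h)) (trans (cong (g ▹_) e'≡) (trans (▹-⋆ g t e) (cong (t ⋆_) (first g h)))))))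
          (ℕ.≤-trans (ℕ.≤-reflexive (sym (ℕ.*-identityˡ _))) (ℕ.*-monoˡ-≤ _ (ℕ.≤-reflexive (sym (cong 𝟙 (∧-fst {hit g (e ,, a)} h))))))
      split : Dec (wedge e e' ≡ 0#) → ∑ (λ g → 𝟙 (hit g (e ,, a)) *ℕ 𝟙 (hit g (e' ,, a'))) ≤ bound
      split (no ind) = ℕ.≤-trans (ℕ.≤-reflexive as-both) (independent ind (exists-dec both))
      split (yes dep) = ℕ.≤-trans (ℕ.≤-reflexive as-both) (dependent (wedge-0 e e' e≢o dep))

    o-⋆ : ∀ t → t ⋆ o ≡ o
    o-⋆ t = cong₂ _,_ (zeroʳ t) (zeroʳ t)

    0-⋆ : ∀ v → 0# ⋆ v ≡ o
    0-⋆ (x , y) = cong₂ _,_ (zeroˡ x) (zeroˡ y)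

    module _ (E A : Pt → Bool) (Eo : E o ≡ false) (Ao : A o ≡ false) (k : ℕ)
      (lines : ∀ v → v ≢ o → ∑ (λ t → 𝟙 (E (t ⋆ v))) ≤ k) where

      N : ℕ
      N = # E *ℕ # A

      opaque

        EA : Pairs → ℕ
        EA (e ,, a) = 𝟙 (E e) *ℕ 𝟙 (A a)

        EA-def : ∀ e a → EA (e ,, a) ≡ 𝟙 (E e) *ℕ 𝟙 (A a)
        EA-def e a = refl

        EA≤E : ∀ x → EA x ≤ 𝟙 (E (fst x))
        EA≤E (e ,, a) = ℕ.≤-trans (ℕ.*-monoʳ-≤ (𝟙 (E e)) (𝟙≤1 (A a))) (ℕ.≤-reflexive (ℕ.*-identityʳ _))

        EA-o : ∀ a → EA (o ,, a) ≡ 0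
        EA-o a = cong (λ b → 𝟙 b *ℕ 𝟙 (A a)) Eo

        ∑EA : ∑ EA ≡ N
        ∑EA = trans (∑-Pair EA) (sym (∑-product (λ e → 𝟙 (E e)) (λ a → 𝟙 (A a))))

        -- On the support of EA both components are nonzero.
        EA-mono : ∀ x {m n} → (fst x ≢ o → snd x ≢ o → m ≤ n) → EA x *ℕ m ≤ EA x *ℕ n
        EA-mono (e ,, a) {m} {n} h = begin
          𝟙 (E e) *ℕ 𝟙 (A a) *ℕ m ≡⟨ cong (_*ℕ m) (sym (𝟙-∧ (E e) (A a))) ⟩
          𝟙 (E e ∧ A a) *ℕ m ≤⟨ 𝟙*-mono (E e ∧ A a) (λ b → h (λ { refl → clash (trans (sym (∧-fst b)) Eo) }) (λ { refl → clash (trans (sym (∧-snd {E e} b)) Ao) })) ⟩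
          𝟙 (E e ∧ A a) *ℕ n ≡⟨ cong (_*ℕ n) (𝟙-∧ (E e) (A a)) ⟩
          𝟙 (E e) *ℕ 𝟙 (A a) *ℕ n ∎
          where
          open ℕ.≤-Reasoning
          clash : true ≡ false → ⊥
          clash ()

      EA-cong : ∀ x {m n} → (fst x ≢ o → snd x ≢ o → m ≡ n) → EA x *ℕ m ≡ EA x *ℕ n
      EA-cong x {m} {n} h = ℕ.≤-antisym (EA-mono x {m} {n} λ u v → ℕ.≤-reflexive (h u v)) (EA-mono x {n} {m} λ u v → ℕ.≤-reflexive (sym (h u v)))

      -- The dilates of z in E × A. Orthogonality is homogeneous, so in the count of orthogonal
      -- pairs the indicator of E × A may be replaced by `W`/r. This average has a second moment
      -- smaller by a factor of at most k/r, which is the gain over a direct use of Cauchy-Schwarz.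
      W : Pairs → ℕ
      W z = ∑ λ t → EA (t ⋆⋆ z)

      W≤k : ∀ z → W z ≤ k
      W≤k (e ,, a) = decide (e ≟ o)
        where
        decide : Dec (e ≡ o) → W (e ,, a) ≤ k
        decide (no e≢o) = ℕ.≤-trans (∑-mono λ t → EA≤E (t ⋆⋆ (e ,, a))) (lines e e≢o)
        decide (yes refl) = ℕ.≤-trans (ℕ.≤-reflexive (trans (∑-cong λ t → trans (cong (λ v → EA (v ,, (t ⋆ a))) (o-⋆ t)) (EA-o (t ⋆ a))) ∑-0)) z≤n

      pairs-multiples : ∑ (λ x → ∑ λ x' → EA x *ℕ (EA x' *ℕ multiples x x')) ≤ k *ℕ N
      pairs-multiples = begin
        ∑ (λ x → ∑ λ x' → EA x *ℕ (EA x' *ℕ multiples x x')) ≡⟨ ∑-cong (λ x → trans (∑-*ˡ (EA x) (λ x' → EA x' *ℕ multiples x x')) (cong (EA x *ℕ_) (inner x))) ⟩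
        ∑ (λ x → EA x *ℕ W x) ≤⟨ ∑-mono (λ x → ℕ.*-monoʳ-≤ (EA x) (W≤k x)) ⟩
        ∑ (λ x → EA x *ℕ k) ≡⟨ trans (∑-*ʳ {Pairs} k EA) (trans (cong (_*ℕ k) ∑EA) (ℕ.*-comm N k)) ⟩
        k *ℕ N ∎
        where
        open ℕ.≤-Reasoning
        inner : ∀ x → ∑ (λ x' → EA x' *ℕ multiples x x') ≡ W x
        inner x = begin-equality
          ∑ (λ x' → EA x' *ℕ multiples x x') ≡⟨ ∑-cong (λ x' → sym (∑-*ˡ (EA x') (λ t → δ (t ⋆⋆ x) x'))) ⟩
          ∑ (λ x' → ∑ λ t → EA x' *ℕ δ (t ⋆⋆ x) x') ≡⟨ ∑-swap {Pairs} {F} (λ x' t → EA x' *ℕ δ (t ⋆⋆ x) x') ⟩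
          ∑ (λ t → ∑ λ x' → EA x' *ℕ δ (t ⋆⋆ x) x') ≡⟨ ∑-cong (λ t → ∑-cong λ x' → ℕ.*-comm (EA x') (δ (t ⋆⋆ x) x')) ⟩
          ∑ (λ t → ∑ λ x' → δ (t ⋆⋆ x) x' *ℕ EA x') ≡⟨ ∑-cong (λ t → sift (t ⋆⋆ x) EA) ⟩
          W x ∎

      L : Pairs → ℕ
      L y = ∑ λ x → EA x *ℕ 𝟙 (perp x y)

      D : ℕ
      D = ∑ λ y → EA y *ℕ L y

      ∑L : ∑ L ≡ q *ℕ q *ℕ q *ℕ N
      ∑L = begin
        ∑ (λ y → ∑ λ x → EA x *ℕ 𝟙 (perp x y)) ≡⟨ ∑-swap _ ⟩
        ∑ (λ x → ∑ λ y → EA x *ℕ 𝟙 (perp x y)) ≡⟨ ∑-cong (λ x → ∑-*ˡ (EA x) (λ y → 𝟙 (perp x y))) ⟩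
        ∑ (λ x → EA x *ℕ ∑ (λ y → 𝟙 (perp x y))) ≡⟨ ∑-cong (λ x → EA-cong x λ h _ → ∑-perp x h) ⟩
        ∑ (λ x → EA x *ℕ (q *ℕ q *ℕ q)) ≡⟨ ∑-*ʳ (q *ℕ q *ℕ q) EA ⟩
        ∑ EA *ℕ (q *ℕ q *ℕ q) ≡⟨ trans (cong (_*ℕ (q *ℕ q *ℕ q)) ∑EA) (ℕ.*-comm N (q *ℕ q *ℕ q)) ⟩
        q *ℕ q *ℕ q *ℕ N ∎
        where open ≡-Reasoning

      square-sum : ∀ {B : Set} {{_ : Finite B}} (φ : Pairs → B → Bool) →
        ∑ (λ y → ∑ (λ x → EA x *ℕ 𝟙 (φ x y)) *ℕ ∑ (λ x → EA x *ℕ 𝟙 (φ x y)))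
          ≡ ∑ λ x → ∑ λ x' → EA x *ℕ (EA x' *ℕ ∑ (λ y → 𝟙 (φ x y) *ℕ 𝟙 (φ x' y)))
      square-sum φ = trans (∑-cong λ y → ∑-product _ _) (trans (∑-swap _) (∑-cong λ x → trans (∑-swap _) (∑-cong λ x' →
          trans (∑-cong λ y → rearrange (EA x) (𝟙 (φ x y)) (EA x') (𝟙 (φ x' y))) (trans (∑-*ˡ (EA x) _) (cong (EA x *ℕ_) (∑-*ˡ (EA x') _))))))
        where
        rearrange : ∀ a p b r → a *ℕ p *ℕ (b *ℕ r) ≡ a *ℕ (b *ℕ (p *ℕ r))
        rearrange = solve-∀

      ∑L² : ∑ (λ y → L y *ℕ L y) ≤ q *ℕ q *ℕ (N *ℕ N) +ℕ q *ℕ q *ℕ q *ℕ (k *ℕ N)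
      ∑L² = begin
        ∑ (λ y → L y *ℕ L y) ≡⟨ square-sum perp ⟩
        ∑ (λ x → ∑ λ x' → EA x *ℕ (EA x' *ℕ ∑ (λ y → 𝟙 (perp x y) *ℕ 𝟙 (perp x' y)))) ≤⟨ ∑-mono (λ x → ∑-mono λ x' → EA-mono x λ h _ → ℕ.*-monoʳ-≤ (EA x') (common-perp x x' h)) ⟩
        ∑ (λ x → ∑ λ x' → EA x *ℕ (EA x' *ℕ (q *ℕ q +ℕ q *ℕ q *ℕ q *ℕ multiples x x'))) ≡⟨ ∑-cong (λ x → trans (∑-cong λ x' → distribute (EA x) (EA x') (q *ℕ q) (q *ℕ q *ℕ q) (multiples x x')) (∑-+ _ _)) ⟩
        ∑ (λ x → ∑ (λ x' → q *ℕ q *ℕ (EA x *ℕ EA x')) +ℕ ∑ (λ x' → q *ℕ q *ℕ q *ℕ (EA x *ℕ (EA x' *ℕ multiples x x')))) ≡⟨ trans (∑-+ _ _) (cong₂ _+ℕ_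
            (trans (∑-cong λ x → ∑-*ˡ (q *ℕ q) _) (trans (∑-*ˡ (q *ℕ q) _) (cong (q *ℕ q *ℕ_) (trans (sym (∑-product EA EA)) (cong₂ _*ℕ_ ∑EA ∑EA)))))
            (trans (∑-cong λ x → ∑-*ˡ (q *ℕ q *ℕ q) _) (∑-*ˡ (q *ℕ q *ℕ q) _))) ⟩
        q *ℕ q *ℕ (N *ℕ N) +ℕ q *ℕ q *ℕ q *ℕ ∑ (λ x → ∑ λ x' → EA x *ℕ (EA x' *ℕ multiples x x')) ≤⟨ ℕ.+-monoʳ-≤ (q *ℕ q *ℕ (N *ℕ N)) (ℕ.*-monoʳ-≤ (q *ℕ q *ℕ q) pairs-multiples) ⟩
        q *ℕ q *ℕ (N *ℕ N) +ℕ q *ℕ q *ℕ q *ℕ (k *ℕ N) ∎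
        where
        open ℕ.≤-Reasoning
        distribute : ∀ a b c d m → a *ℕ (b *ℕ (c +ℕ d *ℕ m)) ≡ c *ℕ (a *ℕ b) +ℕ d *ℕ (a *ℕ (b *ℕ m))
        distribute = solve-∀

      EA-0 : ∀ z → EA (0# ⋆⋆ z) ≡ 0
      EA-0 (e ,, a) = trans (cong (λ v → EA (v ,, (0# ⋆ a))) (0-⋆ e)) (EA-o (0# ⋆ a))

      -- The substitution z ↦ t z; the term t = 0 contributes nothing because E avoids the origin.
      ∑-dilations : (f : Pairs → ℕ) → (∀ t z → t ≢ 0# → f (t ⋆⋆ z) ≡ f z) → ∑ (λ z → W z *ℕ f z) ≡ r *ℕ ∑ (λ z → EA z *ℕ f z)
      ∑-dilations f inv-f = begin
        ∑ (λ z → W z *ℕ f z) ≡⟨ trans (∑-cong λ z → sym (∑-*ʳ (f z) _)) (∑-swap _) ⟩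
        ∑ (λ t → ∑ λ z → EA (t ⋆⋆ z) *ℕ f z) ≡⟨ ∑-cong (λ t → column t (0# ≟ t)) ⟩
        ∑ (λ t → 𝟙 (not ⌊ 0# ≟ t ⌋) *ℕ ∑ (λ z → EA z *ℕ f z)) ≡⟨ ∑-*ʳ _ _ ⟩
        r *ℕ ∑ (λ z → EA z *ℕ f z) ∎
        where
        open ≡-Reasoning
        column : ∀ t → (d : Dec (0# ≡ t)) → ∑ (λ z → EA (t ⋆⋆ z) *ℕ f z) ≡ 𝟙 (not ⌊ d ⌋) *ℕ ∑ (λ z → EA z *ℕ f z)
        column t (yes refl) = trans (∑-cong λ z → cong (_*ℕ f z) (EA-0 z)) ∑-0
        column t (no t≢0') = trans (∑-cong λ z → cong (EA (t ⋆⋆ z) *ℕ_) (sym (inv-f t z t≢0)))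
            (trans (∑-reindex (t ⋆⋆_) (recip t ⋆⋆_) (λ { (e ,, a) → cong₂ _,,_ (⋆-inverse t e t≢0) (⋆-inverse t a t≢0) }) (λ { (e ,, a) → cong₂ _,,_ (⋆-inverse′ t e t≢0) (⋆-inverse′ t a t≢0) }) (λ z → EA z *ℕ f z))
              (sym (ℕ.*-identityˡ _)))
          where
          t≢0 : t ≢ 0#
          t≢0 e = t≢0' (sym e)

      L-homogeneous : ∀ t z → t ≢ 0# → L (t ⋆⋆ z) ≡ L z
      L-homogeneous t (f ,, b) t≢0 = ∑-cong λ { (e ,, a) → cong (EA (e ,, a) *ℕ_) (𝟙-cong (perp (e ,, a) (t ⋆⋆ (f ,, b))) (perp (e ,, a) (f ,, b))
          (λ h → ⇒does (_ ≟ _) (cancel-* t≢0 (trans (sym (wedge-⋆ʳ t e f)) (trans (does⇒ (_ ≟ _) h) (wedge-⋆ʳ t a b)))))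
          (λ h → ⇒does (_ ≟ _) (trans (wedge-⋆ʳ t e f) (trans (cong (λ s → t * s) (does⇒ (wedge e f ≟ wedge a b) h)) (sym (wedge-⋆ʳ t a b)))))) }

      ∑W : ∑ W ≡ r *ℕ N
      ∑W = trans (∑-cong λ z → sym (ℕ.*-identityʳ (W z))) (trans (∑-dilations (λ _ → 1) (λ _ _ _ → refl)) (cong (r *ℕ_) (trans (∑-cong λ z → ℕ.*-identityʳ (EA z)) ∑EA)))

      ∑WL : ∑ (λ z → W z *ℕ L z) ≡ r *ℕ D
      ∑WL = ∑-dilations L L-homogeneous

      ∑W² : ∑ (λ z → W z *ℕ W z) ≤ k *ℕ (r *ℕ N)
      ∑W² = ℕ.≤-trans (∑-mono λ z → ℕ.*-monoˡ-≤ (W z) (W≤k z)) (ℕ.≤-reflexive (trans (∑-*ˡ k W) (cong (k *ℕ_) ∑W)))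

      module _ where
        open ℕ.≤-Reasoning
        private
          Q : ℕ
          Q = q *ℕ q

        -- Σ (q² W + N) q L ≤ ½ Σ ((q² W + N)² + q² L²): Cauchy–Schwarz for the deviations of W and L from their means.
        deviation : 2 *ℕ (q *ℕ q *ℕ q *ℕ (r *ℕ D)) +ℕ 2 *ℕ (Q *ℕ Q *ℕ (N *ℕ N))
          ≤ Q *ℕ Q *ℕ (k *ℕ (r *ℕ N)) +ℕ 2 *ℕ (Q *ℕ (r *ℕ (N *ℕ N))) +ℕ Q *ℕ Q *ℕ (N *ℕ N) +ℕ Q *ℕ (Q *ℕ (N *ℕ N) +ℕ q *ℕ q *ℕ q *ℕ (k *ℕ N))
        deviation = begin
          2 *ℕ (q *ℕ q *ℕ q *ℕ (r *ℕ D)) +ℕ 2 *ℕ (Q *ℕ Q *ℕ (N *ℕ N)) ≡⟨ r₁ q (r *ℕ D) N ⟩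
          2 *ℕ (Q *ℕ q) *ℕ (r *ℕ D) +ℕ 2 *ℕ N *ℕ q *ℕ (q *ℕ q *ℕ q *ℕ N) ≡⟨ cong₂ (λ a b → 2 *ℕ (Q *ℕ q) *ℕ a +ℕ 2 *ℕ N *ℕ q *ℕ b) (sym ∑WL) (sym ∑L) ⟩
          2 *ℕ (Q *ℕ q) *ℕ ∑ (λ z → W z *ℕ L z) +ℕ 2 *ℕ N *ℕ q *ℕ ∑ L ≡⟨ sym (trans (∑-+ _ _) (cong₂ _+ℕ_ (∑-*ˡ (2 *ℕ (Q *ℕ q)) _) (∑-*ˡ (2 *ℕ N *ℕ q) L))) ⟩
          ∑ (λ z → 2 *ℕ (Q *ℕ q) *ℕ (W z *ℕ L z) +ℕ 2 *ℕ N *ℕ q *ℕ L z) ≤⟨ ∑-mono (λ z → ℕ.≤-trans (ℕ.≤-reflexive (r₂ Q q N (W z) (L z))) (ℕ.≤-trans (2ab≤a²+b² (Q *ℕ W z +ℕ N) (q *ℕ L z)) (ℕ.≤-reflexive (r₃ q Q N (W z) (L z))))) ⟩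
          ∑ (λ z → Q *ℕ Q *ℕ (W z *ℕ W z) +ℕ 2 *ℕ (Q *ℕ N) *ℕ W z +ℕ N *ℕ N +ℕ q *ℕ q *ℕ (L z *ℕ L z)) ≡⟨ trans (∑-+ _ _) (cong₂ _+ℕ_ (trans (∑-+ _ _) (cong₂ _+ℕ_ (trans (∑-+ _ _) (cong₂ _+ℕ_ (∑-*ˡ (Q *ℕ Q) _) (∑-*ˡ (2 *ℕ (Q *ℕ N)) W))) (trans (∑-const (N *ℕ N)) (cong (_*ℕ (N *ℕ N)) #Pair)))) (∑-*ˡ Q _)) ⟩
          Q *ℕ Q *ℕ ∑ (λ z → W z *ℕ W z) +ℕ 2 *ℕ (Q *ℕ N) *ℕ ∑ W +ℕ Q *ℕ Q *ℕ (N *ℕ N) +ℕ Q *ℕ ∑ (λ z → L z *ℕ L z) ≤⟨ ℕ.+-mono-≤ (ℕ.+-monoˡ-≤ (Q *ℕ Q *ℕ (N *ℕ N)) (ℕ.+-mono-≤ (ℕ.*-monoʳ-≤ (Q *ℕ Q) ∑W²) (ℕ.≤-reflexive (trans (cong (2 *ℕ (Q *ℕ N) *ℕ_) ∑W) (r₄ Q N r))))) (ℕ.*-monoʳ-≤ Q ∑L²) ⟩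
          Q *ℕ Q *ℕ (k *ℕ (r *ℕ N)) +ℕ 2 *ℕ (Q *ℕ (r *ℕ (N *ℕ N))) +ℕ Q *ℕ Q *ℕ (N *ℕ N) +ℕ Q *ℕ (Q *ℕ (N *ℕ N) +ℕ q *ℕ q *ℕ q *ℕ (k *ℕ N)) ∎
          where
          r₁ : ∀ q d n → 2 *ℕ (q *ℕ q *ℕ q *ℕ d) +ℕ 2 *ℕ (q *ℕ q *ℕ (q *ℕ q) *ℕ (n *ℕ n)) ≡ 2 *ℕ (q *ℕ q *ℕ q) *ℕ d +ℕ 2 *ℕ n *ℕ q *ℕ (q *ℕ q *ℕ q *ℕ n)
          r₁ = solve-∀
          r₂ : ∀ Q q n w l → 2 *ℕ (Q *ℕ q) *ℕ (w *ℕ l) +ℕ 2 *ℕ n *ℕ q *ℕ l ≡ 2 *ℕ ((Q *ℕ w +ℕ n) *ℕ (q *ℕ l))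
          r₂ = solve-∀
          r₃ : ∀ q Q n w l → (Q *ℕ w +ℕ n) *ℕ (Q *ℕ w +ℕ n) +ℕ q *ℕ l *ℕ (q *ℕ l) ≡ Q *ℕ Q *ℕ (w *ℕ w) +ℕ 2 *ℕ (Q *ℕ n) *ℕ w +ℕ n *ℕ n +ℕ q *ℕ q *ℕ (l *ℕ l)
          r₃ = solve-∀
          r₄ : ∀ Q n r → 2 *ℕ (Q *ℕ n) *ℕ (r *ℕ n) ≡ 2 *ℕ (Q *ℕ (r *ℕ (n *ℕ n)))
          r₄ = solve-∀

        D-bound : q *ℕ D ≤ N *ℕ N +ℕ 2 *ℕ (k *ℕ (Q *ℕ N))
        D-bound = ℕ.*-cancelˡ-≤ {q *ℕ D} {N *ℕ N +ℕ 2 *ℕ (k *ℕ (Q *ℕ N))} 2 (*-cancelˡ-≤-pos {Q *ℕ r} {2 *ℕ (q *ℕ D)} {2 *ℕ (N *ℕ N +ℕ 2 *ℕ (k *ℕ (Q *ℕ N)))} (ℕ.*-mono-≤ (ℕ.*-mono-≤ q>0 q>0) r>0)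
          (ℕ.+-cancelʳ-≤ (2 *ℕ (Q *ℕ Q *ℕ (N *ℕ N))) (Q *ℕ r *ℕ (2 *ℕ (q *ℕ D))) (Q *ℕ r *ℕ (2 *ℕ (N *ℕ N +ℕ 2 *ℕ (k *ℕ (Q *ℕ N))))) (begin
          Q *ℕ r *ℕ (2 *ℕ (q *ℕ D)) +ℕ 2 *ℕ (Q *ℕ Q *ℕ (N *ℕ N)) ≡⟨ cong (_+ℕ 2 *ℕ (Q *ℕ Q *ℕ (N *ℕ N))) (r₁ q r D) ⟩
          2 *ℕ (q *ℕ q *ℕ q *ℕ (r *ℕ D)) +ℕ 2 *ℕ (Q *ℕ Q *ℕ (N *ℕ N)) ≤⟨ deviation ⟩
          Q *ℕ Q *ℕ (k *ℕ (r *ℕ N)) +ℕ 2 *ℕ (Q *ℕ (r *ℕ (N *ℕ N))) +ℕ Q *ℕ Q *ℕ (N *ℕ N) +ℕ Q *ℕ (Q *ℕ (N *ℕ N) +ℕ q *ℕ q *ℕ q *ℕ (k *ℕ N)) ≡⟨ r₂ q r k N ⟩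
          Q *ℕ Q *ℕ (k *ℕ N) *ℕ (r +ℕ q) +ℕ 2 *ℕ (Q *ℕ (r *ℕ (N *ℕ N))) +ℕ 2 *ℕ (Q *ℕ Q *ℕ (N *ℕ N)) ≤⟨ ℕ.+-monoˡ-≤ (2 *ℕ (Q *ℕ Q *ℕ (N *ℕ N))) (ℕ.+-monoˡ-≤ (2 *ℕ (Q *ℕ (r *ℕ (N *ℕ N)))) (ℕ.*-monoʳ-≤ (Q *ℕ Q *ℕ (k *ℕ N)) r+q≤4r)) ⟩
          Q *ℕ Q *ℕ (k *ℕ N) *ℕ (4 *ℕ r) +ℕ 2 *ℕ (Q *ℕ (r *ℕ (N *ℕ N))) +ℕ 2 *ℕ (Q *ℕ Q *ℕ (N *ℕ N)) ≡⟨ cong (_+ℕ 2 *ℕ (Q *ℕ Q *ℕ (N *ℕ N))) (r₃ Q k r N) ⟩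
          Q *ℕ r *ℕ (2 *ℕ (N *ℕ N +ℕ 2 *ℕ (k *ℕ (Q *ℕ N)))) +ℕ 2 *ℕ (Q *ℕ Q *ℕ (N *ℕ N)) ∎)))
          where
          r+q≤4r : r +ℕ q ≤ 4 *ℕ r
          r+q≤4r = ℕ.≤-trans (ℕ.≤-reflexive (cong (r +ℕ_) (sym r+1≡q))) (ℕ.+-monoʳ-≤ r (ℕ.≤-trans (ℕ.+-monoʳ-≤ r r>0) (ℕ.+-monoʳ-≤ r (ℕ.m≤m+n r (r +ℕ 0)))))
          r₁ : ∀ q r d → q *ℕ q *ℕ r *ℕ (2 *ℕ (q *ℕ d)) ≡ 2 *ℕ (q *ℕ q *ℕ q *ℕ (r *ℕ d))
          r₁ = solve-∀
          r₂ : ∀ q r k n → q *ℕ q *ℕ (q *ℕ q) *ℕ (k *ℕ (r *ℕ n)) +ℕ 2 *ℕ (q *ℕ q *ℕ (r *ℕ (n *ℕ n))) +ℕ q *ℕ q *ℕ (q *ℕ q) *ℕ (n *ℕ n) +ℕ q *ℕ q *ℕ (q *ℕ q *ℕ (n *ℕ n) +ℕ q *ℕ q *ℕ q *ℕ (k *ℕ n))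
            ≡ q *ℕ q *ℕ (q *ℕ q) *ℕ (k *ℕ n) *ℕ (r +ℕ q) +ℕ 2 *ℕ (q *ℕ q *ℕ (r *ℕ (n *ℕ n))) +ℕ 2 *ℕ (q *ℕ q *ℕ (q *ℕ q) *ℕ (n *ℕ n))
          r₂ = solve-∀
          r₃ : ∀ Q k r n → Q *ℕ Q *ℕ (k *ℕ n) *ℕ (4 *ℕ r) +ℕ 2 *ℕ (Q *ℕ (r *ℕ (n *ℕ n))) ≡ Q *ℕ r *ℕ (2 *ℕ (n *ℕ n +ℕ 2 *ℕ (k *ℕ (Q *ℕ n))))
          r₃ = solve-∀

      V : SL → ℕ
      V g = ∑ λ e → 𝟙 (E e) *ℕ 𝟙 (A (g ▹ e))

      V-pairs : ∀ g → V g ≡ ∑ λ x → EA x *ℕ 𝟙 (hit g x)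
      V-pairs g = sym (trans (∑-Pair (λ x → EA x *ℕ 𝟙 (hit g x))) (∑-cong λ e → trans (∑-cong λ a → trans (cong (_*ℕ δ (g ▹ e) a) (EA-def e a)) (rearrange (𝟙 (E e)) (𝟙 (A a)) (δ (g ▹ e) a))) (sift (g ▹ e) (λ a → 𝟙 (E e) *ℕ 𝟙 (A a)))))
        where
        rearrange : ∀ e a d → e *ℕ a *ℕ d ≡ d *ℕ (e *ℕ a)
        rearrange = solve-∀

      ∑V : ∑ V ≡ q *ℕ N
      ∑V = begin
        ∑ V ≡⟨ trans (∑-cong V-pairs) (∑-swap _) ⟩
        ∑ (λ x → ∑ λ g → EA x *ℕ 𝟙 (hit g x)) ≡⟨ ∑-cong (λ x → ∑-*ˡ (EA x) (λ g → 𝟙 (hit g x))) ⟩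
        ∑ (λ x → EA x *ℕ ∑ (λ g → 𝟙 (hit g x))) ≡⟨ ∑-cong (λ x → EA-cong x λ h h' → ∑-hit x h h') ⟩
        ∑ (λ x → EA x *ℕ q) ≡⟨ ∑-*ʳ q EA ⟩
        ∑ EA *ℕ q ≡⟨ trans (cong (_*ℕ q) ∑EA) (ℕ.*-comm N q) ⟩
        q *ℕ N ∎
        where open ≡-Reasoning

      -- The square counts pairs of points of E × A hit by the same g. By `common-hits` these are
      -- orthogonal pairs, apart from the contribution of proportional ones.
      ∑V² : ∑ (λ g → V g *ℕ V g) ≤ D +ℕ q *ℕ (k *ℕ N)
      ∑V² = begin
        ∑ (λ g → V g *ℕ V g) ≡⟨ trans (∑-cong λ g → cong₂ _*ℕ_ (V-pairs g) (V-pairs g)) (square-sum (λ x g → hit g x)) ⟩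
        ∑ (λ x → ∑ λ x' → EA x *ℕ (EA x' *ℕ ∑ (λ g → 𝟙 (hit g x) *ℕ 𝟙 (hit g x')))) ≤⟨ ∑-mono (λ x → ∑-mono λ x' → EA-mono x λ h h' → ℕ.*-monoʳ-≤ (EA x') (common-hits x x' h h')) ⟩
        ∑ (λ x → ∑ λ x' → EA x *ℕ (EA x' *ℕ (𝟙 (perp x x') +ℕ q *ℕ multiples x x'))) ≡⟨ ∑-cong (λ x → trans (∑-cong λ x' → distribute (EA x) (EA x') (𝟙 (perp x x')) q (multiples x x')) (∑-+ _ _)) ⟩
        ∑ (λ x → ∑ (λ x' → EA x' *ℕ (EA x *ℕ 𝟙 (perp x x'))) +ℕ ∑ (λ x' → q *ℕ (EA x *ℕ (EA x' *ℕ multiples x x')))) ≡⟨ trans (∑-+ _ _) (cong₂ _+ℕ_ (trans (∑-swap _) (∑-cong λ y → ∑-*ˡ (EA y) _)) (trans (∑-cong λ x → ∑-*ˡ q _) (∑-*ˡ q _))) ⟩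
        D +ℕ q *ℕ ∑ (λ x → ∑ λ x' → EA x *ℕ (EA x' *ℕ multiples x x')) ≤⟨ ℕ.+-monoʳ-≤ D (ℕ.*-monoʳ-≤ q pairs-multiples) ⟩
        D +ℕ q *ℕ (k *ℕ N) ∎
        where
        open ℕ.≤-Reasoning
        distribute : ∀ a b p q m → a *ℕ (b *ℕ (p +ℕ q *ℕ m)) ≡ b *ℕ (a *ℕ p) +ℕ q *ℕ (a *ℕ (b *ℕ m))
        distribute = solve-∀

      #G≤q³ : #G ≤ q *ℕ (q *ℕ q)
      #G≤q³ = ℕ.≤-trans (ℕ.m≤m+n #G q) (ℕ.≤-reflexive #G+q)

      -- The mean of `V` is close to N/q² over about q³ elements, so N² is the main term and the
      -- remainder measures the variance.
      q∑V² : q *ℕ ∑ (λ g → V g *ℕ V g) ≤ N *ℕ N +ℕ 3 *ℕ (k *ℕ (q *ℕ q *ℕ N))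
      q∑V² = begin
        q *ℕ ∑ (λ g → V g *ℕ V g) ≤⟨ ℕ.*-monoʳ-≤ q ∑V² ⟩
        q *ℕ (D +ℕ q *ℕ (k *ℕ N)) ≡⟨ r₁ q D k N ⟩
        q *ℕ D +ℕ k *ℕ (q *ℕ q *ℕ N) ≤⟨ ℕ.+-monoˡ-≤ (k *ℕ (q *ℕ q *ℕ N)) D-bound ⟩
        N *ℕ N +ℕ 2 *ℕ (k *ℕ (q *ℕ q *ℕ N)) +ℕ k *ℕ (q *ℕ q *ℕ N) ≡⟨ r₂ (N *ℕ N) (k *ℕ (q *ℕ q *ℕ N)) ⟩
        N *ℕ N +ℕ 3 *ℕ (k *ℕ (q *ℕ q *ℕ N)) ∎
        where
        open ℕ.≤-Reasoning
        r₁ : ∀ q d k n → q *ℕ (d +ℕ q *ℕ (k *ℕ n)) ≡ q *ℕ d +ℕ k *ℕ (q *ℕ q *ℕ n)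
        r₁ = solve-∀
        r₂ : ∀ a b → a +ℕ 2 *ℕ b +ℕ b ≡ a +ℕ 3 *ℕ b
        r₂ = solve-∀

      -- The parameters x and y are optimised in the applications.
      weighted : ∀ (R : SL → ℕ) x y →
        2 *ℕ (x *ℕ y *ℕ (q *ℕ q) *ℕ ∑ (λ g → R g *ℕ V g))
          ≤ x *ℕ x *ℕ ∑ (λ g → R g *ℕ R g) +ℕ 2 *ℕ (x *ℕ y *ℕ N *ℕ ∑ R) +ℕ 3 *ℕ (y *ℕ y *ℕ (k *ℕ (q *ℕ q *ℕ q *ℕ (q *ℕ q) *ℕ N)))
      weighted R x y = ℕ.+-cancelʳ-≤ (2 *ℕ (y *ℕ y *ℕ (q *ℕ q *ℕ q) *ℕ (N *ℕ N))) (2 *ℕ (x *ℕ y *ℕ Q *ℕ ∑ (λ g → R g *ℕ V g)))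
        (x *ℕ x *ℕ R² +ℕ 2 *ℕ (x *ℕ y *ℕ N *ℕ ∑ R) +ℕ 3 *ℕ (y *ℕ y *ℕ (k *ℕ (q *ℕ q *ℕ q *ℕ (q *ℕ q) *ℕ N)))) (begin
        2 *ℕ (x *ℕ y *ℕ Q *ℕ ∑ (λ g → R g *ℕ V g)) +ℕ 2 *ℕ (y *ℕ y *ℕ (q *ℕ q *ℕ q) *ℕ (N *ℕ N)) ≡⟨ r₁ x y q (∑ (λ g → R g *ℕ V g)) N ⟩
        2 *ℕ (x *ℕ y *ℕ Q) *ℕ ∑ (λ g → R g *ℕ V g) +ℕ 2 *ℕ (y *ℕ y *ℕ N *ℕ Q) *ℕ (q *ℕ N) ≡⟨ cong (λ v → 2 *ℕ (x *ℕ y *ℕ Q) *ℕ ∑ (λ g → R g *ℕ V g) +ℕ 2 *ℕ (y *ℕ y *ℕ N *ℕ Q) *ℕ v) (sym ∑V) ⟩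
        2 *ℕ (x *ℕ y *ℕ Q) *ℕ ∑ (λ g → R g *ℕ V g) +ℕ 2 *ℕ (y *ℕ y *ℕ N *ℕ Q) *ℕ ∑ V ≡⟨ sym (trans (∑-+ _ _) (cong₂ _+ℕ_ (∑-*ˡ (2 *ℕ (x *ℕ y *ℕ Q)) _) (∑-*ˡ (2 *ℕ (y *ℕ y *ℕ N *ℕ Q)) V))) ⟩
        ∑ (λ g → 2 *ℕ (x *ℕ y *ℕ Q) *ℕ (R g *ℕ V g) +ℕ 2 *ℕ (y *ℕ y *ℕ N *ℕ Q) *ℕ V g) ≤⟨ ∑-mono (λ g → ℕ.≤-trans (ℕ.≤-reflexive (r₂ x y Q N (R g) (V g))) (ℕ.≤-trans (2ab≤a²+b² (x *ℕ R g +ℕ y *ℕ N) (y *ℕ Q *ℕ V g)) (ℕ.≤-reflexive (r₃ x y Q N (R g) (V g))))) ⟩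
        ∑ (λ g → x *ℕ x *ℕ (R g *ℕ R g) +ℕ 2 *ℕ (x *ℕ y *ℕ N) *ℕ R g +ℕ y *ℕ y *ℕ (N *ℕ N) +ℕ y *ℕ y *ℕ (Q *ℕ Q) *ℕ (V g *ℕ V g)) ≡⟨ trans (∑-+ _ _) (cong₂ _+ℕ_ (trans (∑-+ _ _) (cong₂ _+ℕ_ (trans (∑-+ _ _) (cong₂ _+ℕ_ (∑-*ˡ (x *ℕ x) _) (∑-*ˡ (2 *ℕ (x *ℕ y *ℕ N)) R))) (∑-const (y *ℕ y *ℕ (N *ℕ N))))) (∑-*ˡ (y *ℕ y *ℕ (Q *ℕ Q)) _)) ⟩
        x *ℕ x *ℕ R² +ℕ 2 *ℕ (x *ℕ y *ℕ N) *ℕ ∑ R +ℕ #G *ℕ (y *ℕ y *ℕ (N *ℕ N)) +ℕ y *ℕ y *ℕ (Q *ℕ Q) *ℕ ∑ (λ g → V g *ℕ V g) ≡⟨ cong (x *ℕ x *ℕ R² +ℕ 2 *ℕ (x *ℕ y *ℕ N) *ℕ ∑ R +ℕ #G *ℕ (y *ℕ y *ℕ (N *ℕ N)) +ℕ_) (r₄ y q (∑ (λ g → V g *ℕ V g))) ⟩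
        x *ℕ x *ℕ R² +ℕ 2 *ℕ (x *ℕ y *ℕ N) *ℕ ∑ R +ℕ #G *ℕ (y *ℕ y *ℕ (N *ℕ N)) +ℕ y *ℕ y *ℕ (q *ℕ q *ℕ q) *ℕ (q *ℕ ∑ (λ g → V g *ℕ V g)) ≤⟨ ℕ.+-mono-≤ (ℕ.+-monoʳ-≤ (x *ℕ x *ℕ R² +ℕ 2 *ℕ (x *ℕ y *ℕ N) *ℕ ∑ R) (ℕ.*-monoˡ-≤ (y *ℕ y *ℕ (N *ℕ N)) #G≤q³)) (ℕ.*-monoʳ-≤ (y *ℕ y *ℕ (q *ℕ q *ℕ q)) q∑V²) ⟩
        x *ℕ x *ℕ R² +ℕ 2 *ℕ (x *ℕ y *ℕ N) *ℕ ∑ R +ℕ q *ℕ (q *ℕ q) *ℕ (y *ℕ y *ℕ (N *ℕ N)) +ℕ y *ℕ y *ℕ (q *ℕ q *ℕ q) *ℕ (N *ℕ N +ℕ 3 *ℕ (k *ℕ (q *ℕ q *ℕ N))) ≡⟨ r₅ x y q N k R² (∑ R) ⟩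
        x *ℕ x *ℕ R² +ℕ 2 *ℕ (x *ℕ y *ℕ N *ℕ ∑ R) +ℕ 3 *ℕ (y *ℕ y *ℕ (k *ℕ (q *ℕ q *ℕ q *ℕ (q *ℕ q) *ℕ N))) +ℕ 2 *ℕ (y *ℕ y *ℕ (q *ℕ q *ℕ q) *ℕ (N *ℕ N)) ∎)
        where
        open ℕ.≤-Reasoning
        Q R² : ℕ
        Q = q *ℕ q
        R² = ∑ λ g → R g *ℕ R g
        r₁ : ∀ x y q s n → 2 *ℕ (x *ℕ y *ℕ (q *ℕ q) *ℕ s) +ℕ 2 *ℕ (y *ℕ y *ℕ (q *ℕ q *ℕ q) *ℕ (n *ℕ n)) ≡ 2 *ℕ (x *ℕ y *ℕ (q *ℕ q)) *ℕ s +ℕ 2 *ℕ (y *ℕ y *ℕ n *ℕ (q *ℕ q)) *ℕ (q *ℕ n)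
        r₁ = solve-∀
        r₂ : ∀ x y Q n a v → 2 *ℕ (x *ℕ y *ℕ Q) *ℕ (a *ℕ v) +ℕ 2 *ℕ (y *ℕ y *ℕ n *ℕ Q) *ℕ v ≡ 2 *ℕ ((x *ℕ a +ℕ y *ℕ n) *ℕ (y *ℕ Q *ℕ v))
        r₂ = solve-∀
        r₃ : ∀ x y Q n a v → (x *ℕ a +ℕ y *ℕ n) *ℕ (x *ℕ a +ℕ y *ℕ n) +ℕ y *ℕ Q *ℕ v *ℕ (y *ℕ Q *ℕ v)
          ≡ x *ℕ x *ℕ (a *ℕ a) +ℕ 2 *ℕ (x *ℕ y *ℕ n) *ℕ a +ℕ y *ℕ y *ℕ (n *ℕ n) +ℕ y *ℕ y *ℕ (Q *ℕ Q) *ℕ (v *ℕ v)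
        r₃ = solve-∀
        r₄ : ∀ y q v → y *ℕ y *ℕ (q *ℕ q *ℕ (q *ℕ q)) *ℕ v ≡ y *ℕ y *ℕ (q *ℕ q *ℕ q) *ℕ (q *ℕ v)
        r₄ = solve-∀
        r₅ : ∀ x y q n k a b → x *ℕ x *ℕ a +ℕ 2 *ℕ (x *ℕ y *ℕ n) *ℕ b +ℕ q *ℕ (q *ℕ q) *ℕ (y *ℕ y *ℕ (n *ℕ n)) +ℕ y *ℕ y *ℕ (q *ℕ q *ℕ q) *ℕ (n *ℕ n +ℕ 3 *ℕ (k *ℕ (q *ℕ q *ℕ n)))
          ≡ x *ℕ x *ℕ a +ℕ 2 *ℕ (x *ℕ y *ℕ n *ℕ b) +ℕ 3 *ℕ (y *ℕ y *ℕ (k *ℕ (q *ℕ q *ℕ q *ℕ (q *ℕ q) *ℕ n))) +ℕ 2 *ℕ (y *ℕ y *ℕ (q *ℕ q *ℕ q) *ℕ (n *ℕ n))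
        r₅ = solve-∀

-- Lower bounds for the size of the image.

module ExpansionBound where

  open Sums
  open GroupEnergy
  open Fields
  open SpecialLinear
  open CentralizerBounds
  open EnergyTheorem
  open PlaneAction
  open SpectralBound
  open import Data.Nat hiding (_≟_)
  open import Data.Nat.Properties hiding (_≟_)
  open import Data.Bool using (Bool; true; false; _∧_)
  open import Data.Product using (∃)
  open import Data.Sum using (_⊎_; inj₁; inj₂)
  open import Data.Empty using (⊥; ⊥-elim)
  open import Relation.Binary.PropositionalEquality
  open import Data.Nat.Tactic.RingSolver using (solve-∀)

  module Expansion (𝔽 : FiniteField) where
    open FieldLemmas 𝔽 using (q; Finite-F)
    open SL2 𝔽 using (SL; SL₂)
    open GroupSums SL₂
    open Plane 𝔽 using (Pt; o; _⋆_; _▹_; ∑-▹; ▹-∙; ▹-inverseˡ; #G; #G+q)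
    open Spectral 𝔽 using (V; weighted; q>0; r>0; r+1≡q)
    open EnergyBound 𝔽 using (no-rich-energy)

    module _ (S : SL → Bool) (E A : Pt → Bool) (Eo : E o ≡ false) (Ao : A o ≡ false) (k : ℕ)
      (lines : ∀ v → v ≢ o → ∑ (λ t → 𝟙 (E (t ⋆ v))) ≤ k)
      (image : ∀ g v → S g ≡ true → E v ≡ true → A (g ▹ v) ≡ true)
      (E>0 : 0 < # E) (A-small : 4 * # A ≤ q * q) where

      n e α Q : ℕ
      n = # S
      e = # E
      α = # A
      Q = q * q

      Q>0 : 0 < Q
      Q>0 = *-mono-≤ q>0 q>0

      -- `weighted` for the indicator of `S`, with x = Q e and y = 1. Every g in `S` has gE inside
      -- `A`, so the weighted sum is ne, whereas the expected value neα/Q is at most a quarter of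
      -- it; the error term must make up for the rest.
      many-points : n * e ≤ 6 * (k * (q * α))
      many-points = *-cancelˡ-≤-pos {Q * Q * e} {n * e} {6 * (k * (q * α))} (*-mono-≤ (*-mono-≤ Q>0 Q>0) E>0)
        (+-cancelʳ-≤ (3 * (Q * Q * (e * e) * n)) (Q * Q * e * (n * e)) (Q * Q * e * (6 * (k * (q * α)))) (begin
          Q * Q * e * (n * e) + 3 * (Q * Q * (e * e) * n) ≡⟨ r₁ Q e n ⟩
          2 * (2 * (Q * e * 1 * Q * (n * e))) ≡⟨ cong (λ s → 2 * (2 * (Q * e * 1 * Q * s))) (sym ∑RV) ⟩
          2 * (2 * (Q * e * 1 * Q * ∑ (λ g → 𝟙 (S g) * V E A Eo Ao k lines g))) ≤⟨ *-monoʳ-≤ 2 (weighted E A Eo Ao k lines (λ g → 𝟙 (S g)) (Q * e) 1) ⟩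
          2 * (Q * e * (Q * e) * ∑ (λ g → 𝟙 (S g) * 𝟙 (S g)) + 2 * (Q * e * 1 * (e * α) * n) + 3 * (1 * 1 * (k * (q * q * q * (q * q) * (e * α))))) ≡⟨ cong (λ s → 2 * (Q * e * (Q * e) * s + 2 * (Q * e * 1 * (e * α) * n) + 3 * (1 * 1 * (k * (q * q * q * (q * q) * (e * α)))))) (∑-cong λ g → 𝟙-idem (S g)) ⟩
          2 * (Q * e * (Q * e) * n + 2 * (Q * e * 1 * (e * α) * n) + 3 * (1 * 1 * (k * (q * q * q * (q * q) * (e * α))))) ≡⟨ r₂ q e α n k ⟩
          Q * (e * e) * n * (4 * α) + (2 * (Q * Q * (e * e) * n) + Q * Q * e * (6 * (k * (q * α)))) ≤⟨ +-monoˡ-≤ (2 * (Q * Q * (e * e) * n) + Q * Q * e * (6 * (k * (q * α)))) (*-monoʳ-≤ (Q * (e * e) * n) A-small) ⟩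
          Q * (e * e) * n * Q + (2 * (Q * Q * (e * e) * n) + Q * Q * e * (6 * (k * (q * α)))) ≡⟨ r₃ Q (e * e) n (Q * Q * e * (6 * (k * (q * α)))) ⟩
          Q * Q * e * (6 * (k * (q * α))) + 3 * (Q * Q * (e * e) * n) ∎))
        where
        open ≤-Reasoning
        r₁ : ∀ Q e n → Q * Q * e * (n * e) + 3 * (Q * Q * (e * e) * n) ≡ 2 * (2 * (Q * e * 1 * Q * (n * e)))
        r₁ = solve-∀
        r₂ : ∀ q e α n k → 2 * (q * q * e * (q * q * e) * n + 2 * (q * q * e * 1 * (e * α) * n) + 3 * (1 * 1 * (k * (q * q * q * (q * q) * (e * α)))))
          ≡ q * q * (e * e) * n * (4 * α) + (2 * (q * q * (q * q) * (e * e) * n) + q * q * (q * q) * e * (6 * (k * (q * α))))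
        r₂ = solve-∀
        r₃ : ∀ Q e n c → Q * e * n * Q + (2 * (Q * Q * e * n) + c) ≡ c + 3 * (Q * Q * e * n)
        r₃ = solve-∀
        ∑RV : ∑ (λ g → 𝟙 (S g) * V E A Eo Ao k lines g) ≡ n * e
        ∑RV = trans (∑-cong λ g → 𝟙*-cong (S g) λ Sg → ∑-cong λ v → trans (sym (𝟙-∧ (E v) (A (g ▹ v)))) (𝟙-cong (E v ∧ A (g ▹ v)) (E v) ∧-fst (λ Ev → ∧-intro Ev (image g v Sg Ev))))
          (∑-*ʳ e (λ g → 𝟙 (S g)))

      R : SL → ℕ
      R = corr S S

      En : ℕ
      En = ∑ λ g → R g * R g

      -- The number of ways to write v = a w with a in `S` and w in `E`.
      preimages : Pt → ℕ
      preimages v = ∑ λ a → 𝟙 (S a) * 𝟙 (E (a ⁻¹ ▹ v))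

      ∑preimages : ∑ preimages ≡ n * e
      ∑preimages = trans (∑-swap _) (trans (∑-cong λ a → trans (∑-*ˡ (𝟙 (S a)) (λ v → 𝟙 (E (a ⁻¹ ▹ v)))) (cong (𝟙 (S a) *_) (∑-▹ (a ⁻¹) (λ v → 𝟙 (E v))))) (∑-*ʳ e (λ a → 𝟙 (S a))))

      T : ℕ
      T = ∑ λ v → preimages v * preimages v

      preimages-support : ∀ v → preimages v ≡ 𝟙 (A v) * preimages v
      preimages-support v = trans (∑-cong λ a → pointwise a (E (a ⁻¹ ▹ v)) refl) (∑-*ˡ (𝟙 (A v)) _)
        where
        pointwise : ∀ a b → E (a ⁻¹ ▹ v) ≡ b → 𝟙 (S a) * 𝟙 b ≡ 𝟙 (A v) * (𝟙 (S a) * 𝟙 b)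
        pointwise a false _ = vanish (𝟙 (S a)) (𝟙 (A v))
          where
          vanish : ∀ s t → s * 0 ≡ t * (s * 0)
          vanish = solve-∀
        pointwise a true Ev = trans (𝟙*-cong (S a) λ Sa → sym (cong 𝟙 (trans (cong A (sym (trans (sym (▹-∙ a (a ⁻¹) v)) (trans (cong (_▹ v) (inverseʳ a)) (Plane.▹-ε 𝔽 v))))) (image a (a ⁻¹ ▹ v) Sa Ev))))
            (rearrange (𝟙 (S a)) (𝟙 (A v)))
          where
          rearrange : ∀ s t → s * t ≡ t * (s * 1)
          rearrange = solve-∀

      image-cauchy : n * e * (n * e) ≤ α * T
      image-cauchy = begin
        n * e * (n * e) ≡⟨ cong (λ s → s * s) (trans (sym ∑preimages) (∑-cong preimages-support)) ⟩
        ∑ (λ v → 𝟙 (A v) * preimages v) * ∑ (λ v → 𝟙 (A v) * preimages v) ≤⟨ cauchy-# A preimages ⟩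
        α * ∑ (λ v → 𝟙 (A v) * (preimages v * preimages v)) ≤⟨ *-monoʳ-≤ α (∑-mono λ v → 𝟙* (A v) λ _ → ≤-refl) ⟩
        α * T ∎
        where open ≤-Reasoning

      -- A coincidence a w' = b w says that the quotient g = a⁻¹ b maps w to w', so T is a sum of
      -- |gE ∩ E| weighted by the number of representations of g.
      ∑RV : ∑ (λ g → R g * V E E Eo Eo k lines g) ≡ T
      ∑RV = begin
        ∑ (λ g → R g * V E E Eo Eo k lines g) ≡⟨ ∑-cong (λ g → sym (∑-*ʳ (V′ g) (λ a → 𝟙 (S a) * 𝟙 (S (a ∙ g))))) ⟩
        ∑ (λ g → ∑ λ a → 𝟙 (S a) * 𝟙 (S (a ∙ g)) * V′ g) ≡⟨ ∑-swap _ ⟩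
        ∑ (λ a → ∑ λ g → 𝟙 (S a) * 𝟙 (S (a ∙ g)) * V′ g) ≡⟨ ∑-cong (λ a → ∑-cong λ g → cong (λ h → 𝟙 (S a) * 𝟙 (S (a ∙ g)) * V′ h) (sym (x⁻¹∙xy a g))) ⟩
        ∑ (λ a → ∑ λ g → 𝟙 (S a) * 𝟙 (S (a ∙ g)) * V′ (a ⁻¹ ∙ (a ∙ g))) ≡⟨ ∑-cong (λ a → ∑-translateˡ a (λ b → 𝟙 (S a) * 𝟙 (S b) * V′ (a ⁻¹ ∙ b))) ⟩
        ∑ (λ a → ∑ λ b → 𝟙 (S a) * 𝟙 (S b) * V′ (a ⁻¹ ∙ b)) ≡⟨ ∑-cong (λ a → ∑-cong λ b → expand a b) ⟩
        ∑ (λ a → ∑ λ b → ∑ λ v → 𝟙 (S a) * 𝟙 (E (a ⁻¹ ▹ v)) * (𝟙 (S b) * 𝟙 (E (b ⁻¹ ▹ v)))) ≡⟨ trans (∑-cong λ a → ∑-swap _) (∑-swap _) ⟩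
        ∑ (λ v → ∑ λ a → ∑ λ b → 𝟙 (S a) * 𝟙 (E (a ⁻¹ ▹ v)) * (𝟙 (S b) * 𝟙 (E (b ⁻¹ ▹ v)))) ≡⟨ ∑-cong (λ v → sym (∑-product (λ a → 𝟙 (S a) * 𝟙 (E (a ⁻¹ ▹ v))) (λ b → 𝟙 (S b) * 𝟙 (E (b ⁻¹ ▹ v))))) ⟩
        T ∎
        where
        open ≡-Reasoning
        V′ : SL → ℕ
        V′ = V E E Eo Eo k lines
        rearrange : ∀ a b x y → a * b * (x * y) ≡ a * y * (b * x)
        rearrange = solve-∀
        expand : ∀ a b → 𝟙 (S a) * 𝟙 (S b) * V′ (a ⁻¹ ∙ b) ≡ ∑ (λ v → 𝟙 (S a) * 𝟙 (E (a ⁻¹ ▹ v)) * (𝟙 (S b) * 𝟙 (E (b ⁻¹ ▹ v))))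
        expand a b = begin
          𝟙 (S a) * 𝟙 (S b) * V′ (a ⁻¹ ∙ b) ≡⟨ sym (∑-*ˡ (𝟙 (S a) * 𝟙 (S b)) _) ⟩
          ∑ (λ w → 𝟙 (S a) * 𝟙 (S b) * (𝟙 (E w) * 𝟙 (E ((a ⁻¹ ∙ b) ▹ w)))) ≡⟨ ∑-cong (λ w → trans (rearrange (𝟙 (S a)) (𝟙 (S b)) (𝟙 (E w)) _)
              (cong₂ (λ x y → 𝟙 (S a) * 𝟙 (E x) * (𝟙 (S b) * 𝟙 (E y))) (▹-∙ (a ⁻¹) b w) (sym (▹-inverseˡ b w)))) ⟩
          ∑ (λ w → 𝟙 (S a) * 𝟙 (E (a ⁻¹ ▹ (b ▹ w))) * (𝟙 (S b) * 𝟙 (E (b ⁻¹ ▹ (b ▹ w))))) ≡⟨ ∑-▹ b (λ v → 𝟙 (S a) * 𝟙 (E (a ⁻¹ ▹ v)) * (𝟙 (S b) * 𝟙 (E (b ⁻¹ ▹ v)))) ⟩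
          ∑ (λ v → 𝟙 (S a) * 𝟙 (E (a ⁻¹ ▹ v)) * (𝟙 (S b) * 𝟙 (E (b ⁻¹ ▹ v)))) ∎

      -- `weighted` with x = Q T and y the energy. The expected value n²e²/Q of T is at most T/4, by
      -- `image-cauchy` and 4α ≤ q², so the main term is absorbed and only the error term remains.
      T-bound : 0 < En → T * T ≤ 6 * (En * (k * (q * (e * e))))
      T-bound En>0 = *-cancelˡ-≤-pos {Q * Q * En} {T * T} {6 * (En * (k * (q * (e * e))))} (*-mono-≤ (*-mono-≤ Q>0 Q>0) En>0)
        (+-cancelʳ-≤ (3 * (Q * Q * En * (T * T))) (Q * Q * En * (T * T)) (Q * Q * En * (6 * (En * (k * (q * (e * e)))))) (begin
          Q * Q * En * (T * T) + 3 * (Q * Q * En * (T * T)) ≡⟨ r₁ Q En T ⟩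
          2 * (2 * (Q * T * En * Q * T)) ≡⟨ cong (λ s → 2 * (2 * (Q * T * En * Q * s))) (sym ∑RV) ⟩
          2 * (2 * (Q * T * En * Q * ∑ (λ g → R g * V E E Eo Eo k lines g))) ≤⟨ *-monoʳ-≤ 2 (weighted E E Eo Eo k lines R (Q * T) En) ⟩
          2 * (Q * T * (Q * T) * En + 2 * (Q * T * En * (e * e) * ∑ R) + 3 * (En * En * (k * (q * q * q * (q * q) * (e * e))))) ≡⟨ cong (λ s → 2 * (Q * T * (Q * T) * En + 2 * (Q * T * En * (e * e) * s) + 3 * (En * En * (k * (q * q * q * (q * q) * (e * e)))))) (∑-corr S S) ⟩
          2 * (Q * T * (Q * T) * En + 2 * (Q * T * En * (e * e) * (n * n)) + 3 * (En * En * (k * (q * q * q * (q * q) * (e * e))))) ≡⟨ r₂ q T En e n k ⟩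
          Q * T * En * (4 * (n * e * (n * e))) + (2 * (Q * Q * En * (T * T)) + Q * Q * En * (6 * (En * (k * (q * (e * e)))))) ≤⟨ +-monoˡ-≤ (2 * (Q * Q * En * (T * T)) + Q * Q * En * (6 * (En * (k * (q * (e * e)))))) (*-monoʳ-≤ (Q * T * En) 4n²e²≤QT) ⟩
          Q * T * En * (Q * T) + (2 * (Q * Q * En * (T * T)) + Q * Q * En * (6 * (En * (k * (q * (e * e)))))) ≡⟨ r₃ Q T En (Q * Q * En * (6 * (En * (k * (q * (e * e)))))) ⟩
          Q * Q * En * (6 * (En * (k * (q * (e * e))))) + 3 * (Q * Q * En * (T * T)) ∎))
        where
        open ≤-Reasoning
        4n²e²≤QT : 4 * (n * e * (n * e)) ≤ Q * T
        4n²e²≤QT = ≤-trans (*-monoʳ-≤ 4 image-cauchy) (≤-trans (≤-reflexive (sym (*-assoc 4 α T))) (*-monoˡ-≤ T A-small))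
        r₁ : ∀ Q E T → Q * Q * E * (T * T) + 3 * (Q * Q * E * (T * T)) ≡ 2 * (2 * (Q * T * E * Q * T))
        r₁ = solve-∀
        r₂ : ∀ q T E e n k → 2 * (q * q * T * (q * q * T) * E + 2 * (q * q * T * E * (e * e) * (n * n)) + 3 * (E * E * (k * (q * q * q * (q * q) * (e * e)))))
          ≡ q * q * T * E * (4 * (n * e * (n * e))) + (2 * (q * q * (q * q) * E * (T * T)) + q * q * (q * q) * E * (6 * (E * (k * (q * (e * e))))))
        r₂ = solve-∀
        r₃ : ∀ Q T E c → Q * T * E * (Q * T) + (2 * (Q * Q * E * (T * T)) + c) ≡ c + 3 * (Q * Q * E * (T * T))
        r₃ = solve-∀

      energy-bound : 0 < En → n * n * (n * n) * (e * e) ≤ 6 * (α * α * (En * (k * q)))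
      energy-bound En>0 = *-cancelˡ-≤-pos {e * e} {n * n * (n * n) * (e * e)} {6 * (α * α * (En * (k * q)))} (*-mono-≤ E>0 E>0) (begin
        e * e * (n * n * (n * n) * (e * e)) ≡⟨ r₁ n e ⟩
        n * e * (n * e) * (n * e * (n * e)) ≤⟨ *-mono-≤ image-cauchy image-cauchy ⟩
        α * T * (α * T) ≡⟨ r₂ α T ⟩
        α * α * (T * T) ≤⟨ *-monoʳ-≤ (α * α) (T-bound En>0) ⟩
        α * α * (6 * (En * (k * (q * (e * e))))) ≡⟨ r₃ α En k q e ⟩
        e * e * (6 * (α * α * (En * (k * q)))) ∎)
        where
        open ≤-Reasoning
        r₁ : ∀ n e → e * e * (n * n * (n * n) * (e * e)) ≡ n * e * (n * e) * (n * e * (n * e))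
        r₁ = solve-∀
        r₂ : ∀ a t → a * t * (a * t) ≡ a * a * (t * t)
        r₂ = solve-∀
        r₃ : ∀ a E k q e → a * a * (6 * (E * (k * (q * (e * e))))) ≡ e * e * (6 * (a * a * (E * (k * q))))
        r₃ = solve-∀

      order : q * (q * q) ≤ 2 * #G
      order = ≤-trans (≤-reflexive (sym #G+q)) (≤-trans (+-monoʳ-≤ #G q≤#G) (+-monoʳ-≤ #G (m≤m+n #G 0)))
        where
        open ≤-Reasoning
        2≤q : 2 ≤ q
        2≤q = ≤-trans (+-monoˡ-≤ 1 r>0) (≤-reflexive r+1≡q)
        double : ∀ m → m + m ≡ m * 2
        double = solve-∀
        q≤#G : q ≤ #G
        q≤#G = +-cancelʳ-≤ q q #G (begin
          q + q ≡⟨ double q ⟩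
          q * 2 ≤⟨ *-monoʳ-≤ q (≤-trans 2≤q (m≤m*n q q {{>-nonZero q>0}})) ⟩
          q * (q * q) ≡⟨ sym #G+q ⟩
          #G + q ∎)

      En>0 : 0 < n → 0 < En
      En>0 n>0 = positive En (≤-trans (*-mono-≤ (*-mono-≤ n>0 n>0) (*-mono-≤ n>0 n>0)) (begin
        n * n * (n * n) ≡⟨ cong (λ s → s * s) (trans (sym (∑-corr S S)) (∑-cong λ g → sym (*-identityˡ (R g)))) ⟩
        ∑ (λ g → 1 * R g) * ∑ (λ g → 1 * R g) ≤⟨ cauchy (λ _ → 1) R ⟩
        ∑ {SL} (λ _ → 1 * 1) * En ∎))
        where
        open ≤-Reasoning
        positive : ∀ m → 0 < ∑ {SL} (λ _ → 1 * 1) * m → 0 < m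
        positive zero h = ⊥-elim (<⇒≱ h (≤-reflexive (*-zeroʳ (∑ {SL} (λ _ → 1 * 1)))))
        positive (suc m) _ = s≤s z≤n

      -- For n ≤ KQ the energy gain applies and `energy-bound` is improved by the factor K. For n ≥
      -- KQ the square of `many-points` suffices: one factor n supplies KQ, and kq ≤ Q because k ≤
      -- q.
      expansion : ∀ K → k ≤ q → 0 < n → (∀ x → S x ≡ true → S (x ⁻¹) ≡ true) →
        (∀ H → IsSubgroupOf SL₂ H → (∃ λ g → H g ≡ false) → ∀ g → # (λ x → S x ∧ H (g ⁻¹ ∙ x)) * spread-constant K ≤ # S) →
        K * (n * (e * e)) ≤ 36 * (α * α * (k * q))
      expansion K k≤q n>0 S-inverse spread = decide (≤-total n (K * Q))
        where
        open ≤-Reasoning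
        k>0 : 0 < k
        k>0 = positive k (≤-trans (*-mono-≤ n>0 E>0) many-points)
          where
          positive : ∀ m → 0 < 6 * (m * (q * α)) → 0 < m
          positive (suc _) _ = s≤s z≤n
        poor : n ≤ K * Q → (n * (n * n) ≤ K * En → ⊥)
        poor size = no-rich-energy S S-inverse K n>0 spread size order
        decide : n ≤ K * Q ⊎ K * Q ≤ n → K * (n * (e * e)) ≤ 36 * (α * α * (k * q))
        decide (inj₁ size) = ≤-trans (*-cancelˡ-≤-pos {n * (n * n)} {K * (n * (e * e))} {6 * (α * α * (k * q))} (*-mono-≤ n>0 (*-mono-≤ n>0 n>0)) (begin
          n * (n * n) * (K * (n * (e * e))) ≡⟨ r₁ n K e ⟩
          K * (n * n * (n * n) * (e * e)) ≤⟨ *-monoʳ-≤ K (energy-bound (En>0 n>0)) ⟩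
          K * (6 * (α * α * (En * (k * q)))) ≡⟨ r₂ K α En (k * q) ⟩
          K * En * (6 * (α * α * (k * q))) ≤⟨ *-monoˡ-≤ (6 * (α * α * (k * q))) (<⇒≤ (≰⇒> (poor size))) ⟩
          n * (n * n) * (6 * (α * α * (k * q))) ∎)) (*-monoˡ-≤ (α * α * (k * q)) (m≤m+n 6 30))
          where
          r₁ : ∀ n K e → n * (n * n) * (K * (n * (e * e))) ≡ K * (n * n * (n * n) * (e * e))
          r₁ = solve-∀
          r₂ : ∀ K a E c → K * (6 * (a * a * (E * c))) ≡ K * E * (6 * (a * a * c))
          r₂ = solve-∀
        decide (inj₂ large) = *-cancelˡ-≤-pos {k * q} {K * (n * (e * e))} {36 * (α * α * (k * q))} (*-mono-≤ k>0 q>0) (begin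
          k * q * (K * (n * (e * e))) ≤⟨ *-monoˡ-≤ (K * (n * (e * e))) (*-monoˡ-≤ q k≤q) ⟩
          Q * (K * (n * (e * e))) ≡⟨ r₁ Q K n e ⟩
          K * Q * (n * (e * e)) ≤⟨ *-monoˡ-≤ (n * (e * e)) large ⟩
          n * (n * (e * e)) ≡⟨ r₂ n e ⟩
          n * e * (n * e) ≤⟨ *-mono-≤ many-points many-points ⟩
          6 * (k * (q * α)) * (6 * (k * (q * α))) ≡⟨ r₃ k q α ⟩
          k * q * (36 * (α * α * (k * q))) ∎)
          where
          r₁ : ∀ Q K n e → Q * (K * (n * (e * e))) ≡ K * Q * (n * (e * e))
          r₁ = solve-∀
          r₂ : ∀ n e → n * (n * (e * e)) ≡ n * e * (n * e)
          r₂ = solve-∀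
          r₃ : ∀ k q a → 6 * (k * (q * a)) * (6 * (k * (q * a))) ≡ k * q * (36 * (a * a * (k * q)))
          r₃ = solve-∀

-- Transfer from SL₂ to predicates on matrices.

module MatrixForms where

  open Sums
  open GroupEnergy
  open Fields
  open SpecialLinear
  open CentralizerBounds
  open EnergyTheorem
  open PlaneAction
  open ExpansionBound
  open import Data.Nat using (ℕ; _<_; _≤_) renaming (_*_ to _*ℕ_)
  import Data.Nat.Properties as ℕ
  open import Data.Bool using (Bool; true; false; _∧_)
  open import Data.Product using (_×_; _,_; Σ; ∃)
  open import Data.Empty using (⊥-elim)
  open import Relation.Binary.PropositionalEquality
  open import Relation.Nullary using (yes; no; Dec)
  open import Relation.Nullary.Decidable using (⌊_⌋)

  module MatrixForm (𝔽 : FiniteField) where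
    open FieldLemmas 𝔽 using (M; det; mul; inv; 1#; q; Finite-F; _⁻¹; _*_)
    open SL2 𝔽 using (SL; sl; mat; det-mat; SL≡; SL₂; ∑-SL; mat-∙; mat-inv; idM)
    open GroupSums SL₂ using (Finite-G)
    open FiniteGroup SL₂ using (ε; _∙_) renaming (_⁻¹ to _⁻¹ᴳ)
    open Plane 𝔽 using (Pt; o; _⋆_; ▹-action; action)

    isSL : M → Bool
    isSL m = ⌊ det m ≟ 1# ⌋

    record Subgroup (H : M → Bool) : Set where
      field
        unimodular : ∀ m → H m ≡ true → isSL m ≡ true
        contains-id : H idM ≡ true
        closed-mul : ∀ m n → H m ≡ true → H n ≡ true → H (mul m n) ≡ true
        closed-inv : ∀ m → H m ≡ true → H (inv m) ≡ true

    restrict-# : (U : M → Bool) → (∀ m → U m ≡ true → isSL m ≡ true) → # U ≡ # (λ g → U (mat g))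
    restrict-# U U⊆ = sym (trans (∑-SL f) (∑-cong {M} {f = λ m → 𝟙 (isSL m) *ℕ f m} {g = f} pointwise))
      where
      f : M → ℕ
      f m = 𝟙 (U m)
      pointwise : ∀ m → 𝟙 (isSL m) *ℕ f m ≡ f m
      pointwise m = absorb (isSL m) (U m) (U⊆ m)
        where
        absorb : ∀ a b → (b ≡ true → a ≡ true) → 𝟙 a *ℕ 𝟙 b ≡ 𝟙 b
        absorb true b _ = ℕ.*-identityˡ (𝟙 b)
        absorb false false _ = refl
        absorb false true h = cong 𝟙 (h refl)

    -- A subset of SL₂ becomes a predicate on all matrices, false elsewhere, as in the coset
    -- hypothesis of the theorem. The decision is an argument so that proofs can match on it.
    extend′ : (SL → Bool) → (m : M) → Dec (det m ≡ 1#) → Bool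
    extend′ H m (yes e) = H (sl m e)
    extend′ H m (no _) = false

    extend : (SL → Bool) → M → Bool
    extend H m = extend′ H m (det m ≟ 1#)

    extend-mat : ∀ H g → extend H (mat g) ≡ H g
    extend-mat H g = compute (det (mat g) ≟ 1#)
      where
      compute : (d : Dec (det (mat g) ≡ 1#)) → extend′ H (mat g) d ≡ H g
      compute (yes e) = cong H (SL≡ refl)
      compute (no ¬e) = ⊥-elim (¬e (det-mat g))

    extend⇒ : ∀ H m → extend H m ≡ true → Σ SL λ g → mat g ≡ m × H g ≡ true
    extend⇒ H m = unpack (det m ≟ 1#)
      where
      unpack : (d : Dec (det m ≡ 1#)) → extend′ H m d ≡ true → Σ SL λ g → mat g ≡ m × H g ≡ true
      unpack (yes e) h = sl m e , refl , h

    ⇒extend : ∀ H g {m} → m ≡ mat g → H g ≡ true → extend H m ≡ true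
    ⇒extend H g refl h = trans (extend-mat H g) h

    extend-subgroup : ∀ H → IsSubgroupOf SL₂ H → Subgroup (extend H)
    extend-subgroup H sub = record
      { unimodular = λ m h → unimod m (extend⇒ H m h)
      ; contains-id = ⇒extend H ε refl contains-ε
      ; closed-mul = λ m n h h' → product (extend⇒ H m h) (extend⇒ H n h')
      ; closed-inv = λ m h → inverted (extend⇒ H m h) }
      where
      open IsSubgroupOf sub
      unimod : ∀ m → (Σ SL λ g → mat g ≡ m × H g ≡ true) → isSL m ≡ true
      unimod _ (g , refl , _) = ⇒does (det (mat g) ≟ 1#) (det-mat g)
      product : ∀ {m n} → (Σ SL λ g → mat g ≡ m × H g ≡ true) → (Σ SL λ g → mat g ≡ n × H g ≡ true) → extend H (mul m n) ≡ true
      product (g , refl , h) (g' , refl , h') = ⇒extend H (g ∙ g') (sym (mat-∙ g g')) (closed-∙ g g' h h')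
      inverted : ∀ {m} → (Σ SL λ g → mat g ≡ m × H g ≡ true) → extend H (inv m) ≡ true
      inverted (g , refl , h) = ⇒extend H (g ⁻¹ᴳ) (sym (mat-inv g)) (closed-⁻¹ g h)

    module _ (S : M → Bool) (S⊆ : ∀ m → S m ≡ true → isSL m ≡ true) (S-inv : ∀ m → S m ≡ true → S (inv m) ≡ true)
      (E A : Pt → Bool) (Eo : E o ≡ false) (Ao : A o ≡ false)
      (image : ∀ m v → S m ≡ true → E v ≡ true → A (action m v) ≡ true) where

      matrix-expansion : ∀ k K → k ≤ q → 0 < # S → 0 < # E → 4 *ℕ # A ≤ q *ℕ q →
        (∀ v → v ≢ o → ∑ (λ t → 𝟙 (E (t ⋆ v))) ≤ k) →
        (∀ H → Subgroup H → (∃ λ g → isSL g ≡ true × H g ≡ false) → ∀ g → isSL g ≡ true → # (λ m → S m ∧ H (mul (inv g) m)) *ℕ spread-constant K ≤ # S) →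
        K *ℕ (# S *ℕ (# E *ℕ # E)) ≤ 36 *ℕ (# A *ℕ # A *ℕ (k *ℕ q))
      matrix-expansion k K k≤q S>0 E>0 A-small lines spread =
        subst (λ n → K *ℕ (n *ℕ (# E *ℕ # E)) ≤ 36 *ℕ (# A *ℕ # A *ℕ (k *ℕ q))) (sym #S)
          (Expansion.expansion 𝔽 S′ E A Eo Ao k lines (λ g v Sg Ev → subst (λ w → A w ≡ true) (sym (▹-action g v)) (image (mat g) v Sg Ev)) E>0 A-small K k≤q
            (subst (0 <_) #S S>0) (λ g h → trans (cong S (mat-inv g)) (S-inv (mat g) h)) spread′)
        where
        S′ : SL → Bool
        S′ g = S (mat g)
        #S : # S ≡ # S′
        #S = restrict-# S S⊆
        spread′ : ∀ H → IsSubgroupOf SL₂ H → (∃ λ g → H g ≡ false) → ∀ g → # (λ x → S′ x ∧ H (g ⁻¹ᴳ ∙ x)) *ℕ spread-constant K ≤ # S′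
        spread′ H sub (h , Hh) g = subst₂ (λ c n → c *ℕ spread-constant K ≤ n) coset #S
            (spread (extend H) (extend-subgroup H sub) (mat h , ⇒does (det (mat h) ≟ 1#) (det-mat h) , trans (extend-mat H h) Hh) (mat g) (⇒does (det (mat g) ≟ 1#) (det-mat g)))
          where
          coset : # (λ m → S m ∧ extend H (mul (inv (mat g)) m)) ≡ # (λ x → S′ x ∧ H (g ⁻¹ᴳ ∙ x))
          coset = trans (restrict-# (λ m → S m ∧ extend H (mul (inv (mat g)) m)) (λ m e → S⊆ m (∧-fst e)))
            (∑-cong λ x → cong (λ b → 𝟙 (S (mat x) ∧ b)) (trans (cong (extend H) (trans (cong (λ m → mul m (mat x)) (sym (mat-inv g))) (sym (mat-∙ (g ⁻¹ᴳ) x)))) (extend-mat H (g ⁻¹ᴳ ∙ x))))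

-- The residues modulo an odd prime as a finite field.

module PrimeFields where

  open import Defs
  open Sums
  open Fields
  open import Data.Nat hiding (_≟_)
  open import Data.Nat.Properties hiding (_≟_)
  open import Data.Nat.DivMod using (m%n<n; %-distribˡ-+; %-distribˡ-*; m<n⇒m%n≡m; n%n≡0; m*n%n≡0)
  open import Data.Nat.Primality using (Prime)
  open import Data.Nat.Coprimality using (prime⇒coprime; coprime-Bézout)
  open import Data.Nat.GCD using (module Bézout)
  open import Data.Fin using (Fin; toℕ)
  import Data.Fin as Fin
  import Data.Fin.Properties as Fin
  open import Data.List using (allFin; tabulate)
  open import Data.Product using (_,_; ∃; proj₁; proj₂)
  open import Data.Empty using (⊥-elim)
  open import Algebra.Structures using (IsCommutativeRing)
  open import Relation.Binary.PropositionalEquality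
  open import Relation.Nullary using (yes; no; Dec)
  open import Relation.Nullary.Decidable using (⌊_⌋)

  sumL-tabulate : ∀ {A : Set} {n} (f : Fin n → A) (h : A → ℕ) → sumL (tabulate f) h ≡ sumL (allFin n) (λ i → h (f i))
  sumL-tabulate {n = zero} f h = refl
  sumL-tabulate {n = suc n} f h = cong (h (f Fin.zero) +_) (trans (sumL-tabulate (λ i → f (Fin.suc i)) h) (sym (sumL-tabulate {n = n} Fin.suc (λ i → h (f i)))))

  sumL-allFin-δ : ∀ {n} (i : Fin n) → sumL (allFin n) (λ j → 𝟙 ⌊ i Fin.≟ j ⌋) ≡ 1
  sumL-allFin-δ {suc n} Fin.zero = cong suc (trans (sumL-tabulate {n = n} Fin.suc (λ j → 𝟙 ⌊ Fin.zero Fin.≟ j ⌋)) (sumL-0 (allFin n)))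
  sumL-allFin-δ {suc n} (Fin.suc i) = trans (sumL-tabulate {n = n} Fin.suc (λ j → 𝟙 ⌊ Fin.suc i Fin.≟ j ⌋))
    (trans (sumL-cong (allFin n) {λ j → 𝟙 ⌊ Fin.suc i Fin.≟ Fin.suc j ⌋} {λ j → 𝟙 ⌊ i Fin.≟ j ⌋} λ j → isYes-map′ (i Fin.≟ j)) (sumL-allFin-δ i))

  sumL-allFin-1 : ∀ n → sumL (allFin n) (λ _ → 1) ≡ n
  sumL-allFin-1 zero = refl
  sumL-allFin-1 (suc n) = cong suc (trans (sumL-tabulate {n = n} Fin.suc (λ _ → 1)) (sumL-allFin-1 n))

  Finite-Fin : ∀ n → Finite (Fin n)
  Finite-Fin n = record { elements = allFin n ; _≟_ = Fin._≟_ ; once = sumL-allFin-δ }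

  module PrimeField (p : ℕ) .{{nz : NonZero p}} (prime : Prime p) (3≤p : 3 ≤ p) where

    infixl 6 _+′_
    infixl 7 _*′_
    _+′_ _*′_ : Fp p → Fp p → Fp p
    _+′_ = _+F_ p
    _*′_ = _*F_ p

    toℕ-red : ∀ n → toℕ (red p n) ≡ n % p
    toℕ-red n = Fin.toℕ-fromℕ< (m%n<n n p)

    red-toℕ : ∀ x → red p (toℕ x) ≡ x
    red-toℕ x = Fin.toℕ-injective (trans (toℕ-red (toℕ x)) (m<n⇒m%n≡m (Fin.toℕ<n x)))

    red-≡ : ∀ {m n} → m % p ≡ n % p → red p m ≡ red p n
    red-≡ {m} {n} e = Fin.toℕ-injective (trans (toℕ-red m) (trans e (sym (toℕ-red n))))

    red-+ : ∀ m n → red p m +′ red p n ≡ red p (m + n)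
    red-+ m n = red-≡ (trans (cong₂ (λ a b → (a + b) % p) (toℕ-red m) (toℕ-red n)) (sym (%-distribˡ-+ m n p)))

    red-* : ∀ m n → red p m *′ red p n ≡ red p (m * n)
    red-* m n = red-≡ (trans (cong₂ (λ a b → (a * b) % p) (toℕ-red m) (toℕ-red n)) (sym (%-distribˡ-* m n p)))

    -- Every identity of the semiring ℕ descends along the surjective homomorphism red.
    lift₁ : (P : Fp p → Set) → (∀ n → P (red p n)) → ∀ x → P x
    lift₁ P h x = subst P (red-toℕ x) (h (toℕ x))

    +-assoc′ : ∀ x y z → x +′ y +′ z ≡ x +′ (y +′ z)
    +-assoc′ = lift₁ _ λ a → lift₁ _ λ b → lift₁ _ λ c → begin
      red p a +′ red p b +′ red p c ≡⟨ trans (cong (_+′ red p c) (red-+ a b)) (red-+ (a + b) c) ⟩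
      red p (a + b + c) ≡⟨ cong (red p) (+-assoc a b c) ⟩
      red p (a + (b + c)) ≡⟨ sym (trans (cong (red p a +′_) (red-+ b c)) (red-+ a (b + c))) ⟩
      red p a +′ (red p b +′ red p c) ∎
      where open ≡-Reasoning

    *-assoc′ : ∀ x y z → x *′ y *′ z ≡ x *′ (y *′ z)
    *-assoc′ = lift₁ _ λ a → lift₁ _ λ b → lift₁ _ λ c → begin
      red p a *′ red p b *′ red p c ≡⟨ trans (cong (_*′ red p c) (red-* a b)) (red-* (a * b) c) ⟩
      red p (a * b * c) ≡⟨ cong (red p) (*-assoc a b c) ⟩
      red p (a * (b * c)) ≡⟨ sym (trans (cong (red p a *′_) (red-* b c)) (red-* a (b * c))) ⟩
      red p a *′ (red p b *′ red p c) ∎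
      where open ≡-Reasoning

    +-comm′ : ∀ x y → x +′ y ≡ y +′ x
    +-comm′ x y = cong (red p) (+-comm (toℕ x) (toℕ y))

    *-comm′ : ∀ x y → x *′ y ≡ y *′ x
    *-comm′ x y = cong (red p) (*-comm (toℕ x) (toℕ y))

    +-identityˡ′ : ∀ x → red p 0 +′ x ≡ x
    +-identityˡ′ = lift₁ _ λ a → red-+ 0 a

    *-identityˡ′ : ∀ x → red p 1 *′ x ≡ x
    *-identityˡ′ = lift₁ _ λ a → trans (red-* 1 a) (cong (red p) (*-identityˡ a))

    distribˡ′ : ∀ x y z → x *′ (y +′ z) ≡ x *′ y +′ x *′ z
    distribˡ′ = lift₁ _ λ a → lift₁ _ λ b → lift₁ _ λ c → begin
      red p a *′ (red p b +′ red p c) ≡⟨ trans (cong (red p a *′_) (red-+ b c)) (red-* a (b + c)) ⟩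
      red p (a * (b + c)) ≡⟨ cong (red p) (*-distribˡ-+ a b c) ⟩
      red p (a * b + a * c) ≡⟨ sym (trans (cong₂ _+′_ (red-* a b) (red-* a c)) (red-+ (a * b) (a * c))) ⟩
      red p a *′ red p b +′ red p a *′ red p c ∎
      where open ≡-Reasoning

    red-p : red p p ≡ red p 0
    red-p = red-≡ (trans (n%n≡0 p) (sym (m<n⇒m%n≡m (≤-trans (s≤s z≤n) 3≤p))))

    +-inverseˡ′ : ∀ x → (-F_ p x) +′ x ≡ red p 0
    +-inverseˡ′ x = begin
      red p (p ∸ toℕ x) +′ x ≡⟨ cong (red p (p ∸ toℕ x) +′_) (sym (red-toℕ x)) ⟩
      red p (p ∸ toℕ x) +′ red p (toℕ x) ≡⟨ red-+ (p ∸ toℕ x) (toℕ x) ⟩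
      red p (p ∸ toℕ x + toℕ x) ≡⟨ cong (red p) (m∸n+n≡m (<⇒≤ (Fin.toℕ<n x))) ⟩
      red p p ≡⟨ red-p ⟩
      red p 0 ∎
      where open ≡-Reasoning

    isCommutativeRing′ : IsCommutativeRing _≡_ _+′_ _*′_ (-F_ p) (red p 0) (red p 1)
    isCommutativeRing′ = record
      { isRing = record
        { +-isAbelianGroup = record
          { isGroup = record
            { isMonoid = record
              { isSemigroup = record { isMagma = record { isEquivalence = isEquivalence ; ∙-cong = cong₂ _+′_ } ; assoc = +-assoc′ }
              ; identity = +-identityˡ′ , λ x → trans (+-comm′ x (red p 0)) (+-identityˡ′ x) }
            ; inverse = +-inverseˡ′ , λ x → trans (+-comm′ x (-F_ p x)) (+-inverseˡ′ x)
            ; ⁻¹-cong = cong (-F_ p) }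
          ; comm = +-comm′ }
        ; *-cong = cong₂ _*′_
        ; *-assoc = *-assoc′
        ; *-identity = *-identityˡ′ , λ x → trans (*-comm′ x (red p 1)) (*-identityˡ′ x)
        ; distrib = distribˡ′ , λ x y z → trans (*-comm′ (y +′ z) x) (trans (distribˡ′ x y z) (cong₂ _+′_ (*-comm′ x y) (*-comm′ x z))) }
      ; *-comm = *-comm′ }

    red-small-≢ : ∀ m n → m < p → n < p → m ≢ n → red p m ≢ red p n
    red-small-≢ m n m<p n<p m≢n e = m≢n (trans (sym (m<n⇒m%n≡m m<p)) (trans (trans (sym (toℕ-red m)) (trans (cong toℕ e) (toℕ-red n))) (m<n⇒m%n≡m n<p)))

    has-inverse : ∀ x → x ≢ red p 0 → ∃ λ y → x *′ y ≡ red p 1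
    has-inverse x x≢0 = solve (coprime-Bézout (prime⇒coprime prime {{≢-nonZero toℕ≢0}} (Fin.toℕ<n x)))
      where
      toℕ≢0 : toℕ x ≢ 0
      toℕ≢0 e = x≢0 (trans (sym (red-toℕ x)) (cong (red p) e))
      times : ∀ y → x *′ red p y ≡ red p (toℕ x * y)
      times y = trans (cong (_*′ red p y) (sym (red-toℕ x))) (red-* (toℕ x) y)
      multiple-of-p : ∀ k → red p (k * p) ≡ red p 0
      multiple-of-p k = red-≡ (trans (m*n%n≡0 k p) (sym (m<n⇒m%n≡m (≤-trans (s≤s z≤n) 3≤p))))
      open ≡-Reasoning
      solve : Bézout.Identity 1 p (toℕ x) → ∃ λ y → x *′ y ≡ red p 1
      solve (Bézout.-+ k y eq) = red p y , (begin
        x *′ red p y ≡⟨ times y ⟩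
        red p (toℕ x * y) ≡⟨ cong (red p) (trans (*-comm (toℕ x) y) (sym eq)) ⟩
        red p (1 + k * p) ≡⟨ sym (red-+ 1 (k * p)) ⟩
        red p 1 +′ red p (k * p) ≡⟨ cong (red p 1 +′_) (multiple-of-p k) ⟩
        red p 1 +′ red p 0 ≡⟨ trans (+-comm′ (red p 1) (red p 0)) (+-identityˡ′ (red p 1)) ⟩
        red p 1 ∎)
      -- Here 1 + y x = k p, so the inverse is -y, represented by the natural number (p - 1) y.
      solve (Bézout.+- k y eq) = red p ((p ∸ 1) * y) , (begin
        x *′ red p ((p ∸ 1) * y) ≡⟨ times ((p ∸ 1) * y) ⟩
        red p (toℕ x * ((p ∸ 1) * y)) ≡⟨ sym (+-identityˡ′ (red p (toℕ x * ((p ∸ 1) * y)))) ⟩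
        red p 0 +′ red p (toℕ x * ((p ∸ 1) * y)) ≡⟨ cong (_+′ red p (toℕ x * ((p ∸ 1) * y))) (sym (multiple-of-p k)) ⟩
        red p (k * p) +′ red p (toℕ x * ((p ∸ 1) * y)) ≡⟨ cong (λ m → red p m +′ red p (toℕ x * ((p ∸ 1) * y))) (sym eq) ⟩
        red p (1 + y * toℕ x) +′ red p (toℕ x * ((p ∸ 1) * y)) ≡⟨ red-+ (1 + y * toℕ x) (toℕ x * ((p ∸ 1) * y)) ⟩
        red p (1 + y * toℕ x + toℕ x * ((p ∸ 1) * y)) ≡⟨ cong (red p) (cong suc (trans (cong₂ _+_ (*-comm y (toℕ x)) (trans (cong (toℕ x *_) (*-comm (p ∸ 1) y)) (sym (*-assoc (toℕ x) y (p ∸ 1))))) (sym (*-suc (toℕ x * y) (p ∸ 1))))) ⟩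
        red p (1 + toℕ x * y * suc (p ∸ 1)) ≡⟨ cong (λ m → red p (1 + toℕ x * y * m)) (m+[n∸m]≡n (≤-trans (s≤s z≤n) 3≤p)) ⟩
        red p (1 + toℕ x * y * p) ≡⟨ sym (red-+ 1 (toℕ x * y * p)) ⟩
        red p 1 +′ red p (toℕ x * y * p) ≡⟨ cong (red p 1 +′_) (multiple-of-p (toℕ x * y)) ⟩
        red p 1 +′ red p 0 ≡⟨ trans (+-comm′ (red p 1) (red p 0)) (+-identityˡ′ (red p 1)) ⟩
        red p 1 ∎)

    -- 0 is its own inverse.
    recip : ∀ x → Dec (x ≡ red p 0) → Fp p
    recip x (yes _) = red p 0
    recip x (no x≢0) = proj₁ (has-inverse x x≢0)

    recip-inverse : ∀ x (d : Dec (x ≡ red p 0)) → x ≢ red p 0 → x *′ recip x d ≡ red p 1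
    recip-inverse x (yes x≡0) x≢0 = ⊥-elim (x≢0 x≡0)
    recip-inverse x (no x≢0) _ = proj₂ (has-inverse x x≢0)

    𝔽ₚ : FiniteField
    𝔽ₚ = record
      { ops = record { F = Fp p ; _+_ = _+′_ ; _*_ = _*′_ ; -_ = -F_ p ; 0# = 0F p ; 1# = 1F p }
      ; isCommutativeRing = isCommutativeRing′
      ; 1≢0 = red-small-≢ 1 0 (≤-trans (s≤s (s≤s z≤n)) 3≤p) (≤-trans (s≤s z≤n) 3≤p) (λ ())
      ; 2≢0 = λ e → red-small-≢ 2 0 3≤p (≤-trans (s≤s z≤n) 3≤p) (λ ()) (trans (sym (red-+ 1 1)) e)
      ; _⁻¹ = λ x → recip x (x Fin.≟ red p 0)
      ; inverse = λ x → recip-inverse x (x Fin.≟ red p 0)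
      ; finite = Finite-Fin p
      }

-- From the field to the theorem: cardinalities, exponents and the choice of K.

open import Defs
open Sums
open Fields
open SpecialLinear using (module SL2)
open EnergyTheorem
open PlaneAction using (module Plane)
open MatrixForms
open PrimeFields
open import Data.Nat hiding (_≟_)
open import Data.Nat.Properties hiding (_≟_)
open import Data.Nat.Primality using (Prime)
import Data.Fin as Fin
open import Data.List using (List; []; _∷_; cartesianProduct)
open import Data.Bool using (Bool; true; false; _∧_)
open import Data.Bool.ListAction using (any)
open import Data.Product using (_×_; _,_; Σ; ∃; proj₁; proj₂)
open import Data.Sum using (_⊎_; inj₁; inj₂)
import Data.Sum as Sum
open import Data.Empty using (⊥; ⊥-elim)
open import Relation.Binary.PropositionalEquality
open import Relation.Nullary using (yes; no; Dec)
open import Data.Nat.Tactic.RingSolver using (solve-∀)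

countB-sumL : {A : Set} (f : A → Bool) (xs : List A) → countB f xs ≡ sumL xs (λ x → 𝟙 (f x))
countB-sumL f [] = refl
countB-sumL f (x ∷ xs) with f x
... | true = cong suc (countB-sumL f xs)
... | false = countB-sumL f xs

any⇒ : {A : Set} (f : A → Bool) (xs : List A) → any f xs ≡ true → ∃ λ x → f x ≡ true
any⇒ f (x ∷ xs) h with f x in fx
... | true = x , fx
... | false = any⇒ f xs h

any-sumL : {A : Set} (f : A → Bool) (xs : List A) → 1 ≤ sumL xs (λ x → 𝟙 (f x)) → any f xs ≡ true
any-sumL f (x ∷ xs) h with f x
... | true = refl
... | false = any-sumL f xs h

⇒any : {A : Set} {{FA : Finite A}} (f : A → Bool) {x : A} → f x ≡ true → any f (elements {{FA}}) ≡ true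
⇒any f {x} fx = any-sumL f elements (≤-trans (#-pos f fx) (≤-reflexive (∑≡sumL _)))

-- Induction on N: when N grows by one, the root stays or grows by one, and in the second case N + 1
-- ≤ (K+1)^b < (K+2)^b.
integer-root : ∀ b → 0 < b → ∀ N → ∃ λ K → K ^ b ≤ N × N < suc K ^ b
integer-root (suc b) _ zero = 0 , z≤n , *-mono-≤ {1} {1} ≤-refl (≤-reflexive (sym (^-zeroˡ b)))
integer-root b b>0 (suc N) = next (integer-root b b>0 N)
  where
  next : (∃ λ K → K ^ b ≤ N × N < suc K ^ b) → ∃ λ K → K ^ b ≤ suc N × suc N < suc K ^ b
  next (K , lo , hi) with suc K ^ b ≤? suc N
  ... | yes le = suc K , le , ≤-<-trans hi (^-monoˡ-< b {{>-nonZero b>0}} (n<1+n (suc K)))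
  ... | no gt = K , ≤-trans lo (n≤1+n N) , ≰⇒> gt

*-^ : ∀ m n o → (m * n) ^ o ≡ m ^ o * n ^ o
*-^ m n zero = refl
*-^ m n (suc o) = trans (cong (m * n *_) (*-^ m n o)) (rearrange m n (m ^ o) (n ^ o))
  where
  rearrange : ∀ a b c d → a * b * (c * d) ≡ a * c * (b * d)
  rearrange = solve-∀

^-2* : ∀ m b → m ^ (2 * b) ≡ (m * m) ^ b
^-2* m b = trans (sym (^-*-assoc m 2 b)) (cong (λ k → (m * k) ^ b) (*-identityʳ m))

module Core (p : ℕ) .{{nz : NonZero p}} (prime : Prime p) (3≤p : 3 ≤ p)
  (E : Pt p → Bool) (Eo : E (origin p) ≡ false)
  (S : Mat p → Bool) (S⊆ : SubsetSL p S) (S-sym : Symmetric p S) where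

  open PrimeField p prime 3≤p
  open FieldLemmas 𝔽ₚ using (Finite-F; q; cancel-*; 0#)
  open SL2 𝔽ₚ using (sl)
  open MatrixForm 𝔽ₚ using (matrix-expansion; Subgroup; module Subgroup)
  open Plane 𝔽ₚ using (o; _⋆_; ▹-action; ▹-≢o; nonzero-coordinate)

  A : Pt p → Bool
  A = imageSet p S E

  points : elements {Pt p} ≡ allPts p
  points = elements-×

  matrices : elements {Mat p} ≡ allMats p
  matrices = trans elements-× (cong (cartesianProduct (allFp p)) (trans elements-× (cong (cartesianProduct (allFp p)) elements-×)))

  cardM≡# : ∀ U → cardM p U ≡ # U
  cardM≡# U = trans (countB-sumL U (allMats p)) (sym (trans (∑≡sumL (λ m → 𝟙 (U m))) (cong (λ ms → sumL ms (λ m → 𝟙 (U m))) matrices)))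

  cardP≡# : ∀ U → cardP p U ≡ # U
  cardP≡# U = trans (countB-sumL U (allPts p)) (sym (trans (∑≡sumL (λ v → 𝟙 (U v))) (cong (λ vs → sumL vs (λ v → 𝟙 (U v))) points)))

  q≡p : q ≡ p
  q≡p = trans (∑≡sumL {Fp p} (λ _ → 1)) (sumL-allFin-1 p)

  =P⇒ : ∀ v w → _=P_ p v w ≡ true → v ≡ w
  =P⇒ (x , y) (x' , y') h = cong₂ _,_ (does⇒ (x Fin.≟ x') (∧-fst h)) (does⇒ (y Fin.≟ y') (∧-snd {_=F_ p x x'} h))

  =P-refl : ∀ v → _=P_ p v v ≡ true
  =P-refl (x , y) = ∧-intro (⇒does (x Fin.≟ x) refl) (⇒does (y Fin.≟ y) refl)

  image : ∀ m v → S m ≡ true → E v ≡ true → A (act p m v) ≡ true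
  image m v Sm Ev = subst (λ ms → any (λ θ → S θ ∧ any (λ e → E e ∧ _=P_ p (act p θ e) (act p m v)) (allPts p)) ms ≡ true) matrices
    (⇒any _ {m} (∧-intro Sm (subst (λ vs → any (λ e → E e ∧ _=P_ p (act p m e) (act p m v)) vs ≡ true) points
      (⇒any _ {v} (∧-intro Ev (=P-refl (act p m v)))))))

  -- An invertible matrix sends only the origin to the origin, and `E` avoids it.
  Ao : A o ≡ false
  Ao = exclude (A o) refl
    where
    absurd : true ≡ false → ⊥
    absurd ()
    fixed : ∀ m v → S m ≡ true → E v ≡ true → act p m v ≡ o → Dec (v ≡ o) → ⊥
    fixed m v Sm Ev e (yes refl) = absurd (trans (sym Ev) Eo)
    fixed m v Sm Ev e (no v≢o) = ▹-≢o g v≢o (trans (▹-action g v) e)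
      where g = sl m (does⇒ (det p m Fin.≟ 1F p) (S⊆ m Sm))
    inner : ∀ m → S m ≡ true → (∃ λ v → E v ∧ _=P_ p (act p m v) o ≡ true) → ⊥
    inner m Sm (v , h) = fixed m v Sm (∧-fst h) (=P⇒ (act p m v) o (∧-snd {E v} h)) (v ≟ o)
    outer : (∃ λ m → S m ∧ any (λ v → E v ∧ _=P_ p (act p m v) o) (allPts p) ≡ true) → ⊥
    outer (m , h) = inner m (∧-fst h) (any⇒ _ (allPts p) (∧-snd {S m} h))
    exclude : ∀ b → A o ≡ b → b ≡ false
    exclude false _ = refl
    exclude true h = ⊥-elim (outer (any⇒ _ (allMats p) h))

  -- t ↦ t v is injective because v has a nonzero coordinate, so scalars may be counted in place of
  -- points on the line.
  dilations-≤ : ∀ {k} → LinesAtMost p E k → ∀ v → v ≢ o → ∑ (λ t → 𝟙 (E (t ⋆ v))) ≤ k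
  dilations-≤ {k} lines v v≢o = ≤-trans (∑-inject (_⋆ v) (λ t → E (t ⋆ v)) _
      (λ t Et → ∧-intro Et (⇒any {{Finite-F}} (λ s → _=P_ p (t ⋆ v) (scale p s v)) {t} (=P-refl (t ⋆ v)))) (λ t t' _ _ e → injective t t' e (nonzero-coordinate v v≢o)))
    (≤-trans (≤-reflexive (sym (cardP≡# (λ x → E x ∧ any (λ t → _=P_ p x (scale p t v)) (allFp p))))) (lines v v≢o))
    where
    injective : ∀ t t' → t ⋆ v ≡ t' ⋆ v → proj₁ v ≢ 0# ⊎ proj₂ v ≢ 0# → t ≡ t'
    injective t t' e (inj₁ x≢0) = cancel-* x≢0 (trans (*-comm′ (proj₁ v) t) (trans (cong proj₁ e) (*-comm′ t' (proj₁ v))))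
    injective t t' e (inj₂ y≢0) = cancel-* y≢0 (trans (*-comm′ (proj₂ v) t) (trans (cong proj₂ e) (*-comm′ t' (proj₂ v))))

  Dilations≤ : ℕ → Set
  Dilations≤ k = ∀ v → v ≢ o → ∑ (λ t → 𝟙 (E (t ⋆ v))) ≤ k

  all-dilations : Dilations≤ p
  all-dilations v _ = ≤-trans (∑-mono λ t → 𝟙≤1 (E (t ⋆ v))) (≤-reflexive q≡p)

  n e α : ℕ
  n = cardM p S
  e = cardP p E
  α = cardP p A

  Spread : ℕ → Set
  Spread N = ∀ H → IsSubgroup p H → Proper p H → ∀ g → isSL p g ≡ true → cardSCoset p S g H * N ≤ n

  expanded : ∀ k K → k ≤ q → 0 < # S → 0 < # E → 4 * # A ≤ q * q → Dilations≤ k → Spread (spread-constant K) →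
    K * (# S * (# E * # E)) ≤ 36 * (# A * # A * (k * q))
  expanded k K k≤q S>0 E>0 A-small lines spread = matrix-expansion S S⊆ S-sym E A Eo Ao image k K k≤q S>0 E>0 A-small lines spread#
    where
    spread# : ∀ H → Subgroup H → (∃ λ g → isSL p g ≡ true × H g ≡ false) → ∀ g → isSL p g ≡ true → # (λ m → S m ∧ H (mul p (inv p g) m)) * spread-constant K ≤ # S
    spread# H sub proper g u = subst₂ (λ c n → c * spread-constant K ≤ n) (cardM≡# (λ m → S m ∧ H (mul p (inv p g) m))) (cardM≡# S)
      (spread H (Subgroup.unimodular sub , Subgroup.contains-id sub , Subgroup.closed-mul sub , Subgroup.closed-inv sub) proper g u)

  core : ∀ k K → k ≤ p → 0 < n → Dilations≤ k → Spread (spread-constant K) →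
    p ^ 2 ≤ 9 * α ⊎ K * (n * (e * e)) ≤ 36 * (α * α * (k * p))
  core k K k≤p n>0 lines spread = decide (≤-total (4 * α) (p * p)) (0 <? e)
    where
    vanish : ∀ e → e ≡ 0 → K * (n * (e * e)) ≡ 0
    vanish _ refl = trans (cong (K *_) (*-zeroʳ n)) (*-zeroʳ K)
    -- The four cardinalities are generalised to variables so that all equations between the two
    -- ways of counting can be matched with `refl` at once.
    transport : ∀ n' e' α' q' → n ≡ n' → e ≡ e' → α ≡ α' → q' ≡ p → (k ≤ q' → 0 < n' → 0 < e' → 4 * α' ≤ q' * q' → K * (n' * (e' * e')) ≤ 36 * (α' * α' * (k * q'))) →
      0 < e → 4 * α ≤ p * p → K * (n * (e * e)) ≤ 36 * (α * α * (k * p))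
    transport _ _ _ _ refl refl refl refl h e>0 small = h k≤p n>0 e>0 small
    decide : 4 * α ≤ p * p ⊎ p * p ≤ 4 * α → Dec (0 < e) → p ^ 2 ≤ 9 * α ⊎ K * (n * (e * e)) ≤ 36 * (α * α * (k * p))
    decide (inj₂ large) _ = inj₁ (≤-trans (≤-reflexive (cong (p *_) (*-identityʳ p))) (≤-trans large (*-monoˡ-≤ α (m≤m+n 4 5))))
    decide (inj₁ small) (no e≯0) = inj₂ (≤-trans (≤-reflexive (vanish e (n≤0⇒n≡0 (≮⇒≥ e≯0)))) z≤n)
    decide (inj₁ small) (yes e>0) = inj₂ (transport (# S) (# E) (# A) q (cardM≡# S) (cardP≡# E) (cardP≡# A) q≡p
      (λ k≤q S>0 E>0 A-small → expanded k K k≤q S>0 E>0 A-small lines spread) e>0 small)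

-- From p^a < (K+1)^b ≤ (2K)^b, the integer K may be exchanged for p^(a/b) at the cost of a factor
-- 2. It raises 36 to 72, and 81 = 9² is the next square: this is the origin of the constant 9 in
-- the theorem.
power-form : ∀ {n e α k p K a b} → p ^ a < suc K ^ b → 2 ≤ K → K * (n * (e * e)) ≤ 36 * (α * α * (k * p)) →
  n ^ b * e ^ (2 * b) * p ^ a ≤ (9 * α) ^ (2 * b) * p ^ b * k ^ b
power-form {n} {e} {α} {k} {p} {K} {a} {b} hi 2≤K bound = begin
  n ^ b * e ^ (2 * b) * p ^ a ≤⟨ *-monoʳ-≤ (n ^ b * e ^ (2 * b)) (≤-trans (<⇒≤ hi) (^-monoˡ-≤ b K+1≤2K)) ⟩
  n ^ b * e ^ (2 * b) * (2 * K) ^ b ≡⟨ trans (cong (λ m → n ^ b * m * (2 * K) ^ b) (^-2* e b)) (trans (cong (_* (2 * K) ^ b) (sym (*-^ n (e * e) b))) (sym (*-^ (n * (e * e)) (2 * K) b))) ⟩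
  (n * (e * e) * (2 * K)) ^ b ≤⟨ ^-monoˡ-≤ b base ⟩
  (9 * α * (9 * α) * p * k) ^ b ≡⟨ trans (*-^ (9 * α * (9 * α) * p) k b) (cong (_* k ^ b) (*-^ (9 * α * (9 * α)) p b)) ⟩
  (9 * α * (9 * α)) ^ b * p ^ b * k ^ b ≡⟨ cong (λ m → m * p ^ b * k ^ b) (sym (^-2* (9 * α) b)) ⟩
  (9 * α) ^ (2 * b) * p ^ b * k ^ b ∎
  where
  open ≤-Reasoning
  K+1≤2K : suc K ≤ 2 * K
  K+1≤2K = ≤-trans (+-monoˡ-≤ K (≤-trans (n≤1+n 1) 2≤K)) (+-monoʳ-≤ K (m≤m+n K 0))
  r₁ : ∀ n e K → n * (e * e) * (2 * K) ≡ 2 * (K * (n * (e * e)))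
  r₁ = solve-∀
  r₂ : ∀ c a k p → c * a * (c * a) * p * k ≡ c * c * (a * a * (k * p))
  r₂ = solve-∀
  base : n * (e * e) * (2 * K) ≤ 9 * α * (9 * α) * p * k
  base = begin
    n * (e * e) * (2 * K) ≡⟨ r₁ n e K ⟩
    2 * (K * (n * (e * e))) ≤⟨ *-monoʳ-≤ 2 bound ⟩
    2 * (36 * (α * α * (k * p))) ≡⟨ sym (*-assoc 2 36 (α * α * (k * p))) ⟩
    72 * (α * α * (k * p)) ≤⟨ *-monoˡ-≤ (α * α * (k * p)) (m≤m+n 72 9) ⟩
    81 * (α * α * (k * p)) ≡⟨ sym (r₂ 9 α k p) ⟩
    9 * α * (9 * α) * p * k ∎

-- The first hypothesis says that K^(M+1) is at most p^(u/2v) = p^(γ/2), the saving in the coset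
-- hypothesis. The comparison is made after raising to the power 2v.
spread-root : ∀ {c n p u v M K} → K ^ (2 * v * suc M) ≤ p ^ u → c ^ (2 * v) * p ^ u < n ^ (2 * v) → c * K ^ suc M < n
spread-root {c} {n} {p} {u} {v} {M} {K} lo lt = ≰⇒> λ n≤ → <⇒≱ lt (begin
  n ^ (2 * v) ≤⟨ ^-monoˡ-≤ (2 * v) n≤ ⟩
  (c * K ^ suc M) ^ (2 * v) ≡⟨ *-^ c (K ^ suc M) (2 * v) ⟩
  c ^ (2 * v) * (K ^ suc M) ^ (2 * v) ≡⟨ cong (c ^ (2 * v) *_) (trans (^-*-assoc K (suc M) (2 * v)) (cong (K ^_) (*-comm (suc M) (2 * v)))) ⟩
  c ^ (2 * v) * K ^ (2 * v * suc M) ≤⟨ *-monoʳ-≤ (c ^ (2 * v)) lo ⟩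
  c ^ (2 * v) * p ^ u ∎)
  where open ≤-Reasoning

root-≥2 : ∀ {b p u K} → 0 < u → 2 ^ b ≤ p → p ^ u < suc K ^ b → 2 ≤ K
root-≥2 {b} {p} {u} {K} u>0 2^b≤p hi = ≮⇒≥ λ K<2 → <⇒≱ hi (begin
  suc K ^ b ≤⟨ ^-monoˡ-≤ b K<2 ⟩
  2 ^ b ≤⟨ 2^b≤p ⟩
  p ≡⟨ sym (*-identityʳ p) ⟩
  p ^ 1 ≤⟨ ^-monoʳ-≤ p {{>-nonZero (≤-trans (m^n>0 2 b) 2^b≤p)}} u>0 ⟩
  p ^ u ∎)
  where open ≤-Reasoning

-- Here γ = u/v, ε = a/b and 1/m is the implied constant; real exponents are cleared by raising the
-- inequalities to the powers v, 2v and 2b. Rational γ suffice, since the hypotheses for γ imply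
-- those for any smaller one. A minimum on the right becomes a disjunction.
theorem3p2 : (u v : ℕ) → 0 < u → u < v →
    Σ ℕ λ a → Σ ℕ λ b → 0 < a × 0 < b ×
    Σ ℕ λ m → 0 < m × Σ ℕ λ p0 →
    ∀ p → .{{_ : NonZero p}} → Prime p → p0 ≤ p →
    (E : Pt p → Bool) → E (origin p) ≡ false →
    (S : Mat p → Bool) → SubsetSL p S → Symmetric p S →
    p ^ u < cardM p S ^ v →
    cardM p S ^ v * p ^ (2 * u) < p ^ (3 * v) →
    (∀ H → IsSubgroup p H → Proper p H → ∀ g → isSL p g ≡ true →
    cardSCoset p S g H ^ (2 * v) * p ^ u < cardM p S ^ (2 * v)) →
    ((p ^ 2 ≤ m * cardP p (imageSet p S E)
    ⊎ cardM p S ^ b * cardP p E ^ (2 * b) * p ^ a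
    ≤ (m * cardP p (imageSet p S E)) ^ (2 * b) * p ^ (2 * b))
    × (∀ k → LinesAtMost p E k →
    p ^ 2 ≤ m * cardP p (imageSet p S E)
    ⊎ cardM p S ^ b * cardP p E ^ (2 * b) * p ^ a
    ≤ (m * cardP p (imageSet p S E)) ^ (2 * b) * p ^ b * k ^ b))
-- p ≥ 2^b makes the integer root K at least 2, and p ≥ 3 excludes characteristic 2.
theorem3p2 u v u>0 u<v = u , b , u>0 , b>0 , 9 , s≤s z≤n , 2 ^ b + 3 , main
  where
  M b : ℕ
  M = proj₁ spread-poly
  -- K^b ≤ p^u then means K^(M+1) ≤ p^(γ/2). The successor keeps b positive whatever the exponent M
  -- is.
  b = 2 * v * suc M
  v>0 : 0 < v
  v>0 = ≤-trans u>0 (<⇒≤ u<v)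
  b>0 : 0 < b
  b>0 = *-mono-≤ {1} {2 * v} (*-mono-≤ {1} {2} (s≤s z≤n) v>0) (s≤s z≤n)
  main : ∀ p → .{{_ : NonZero p}} → Prime p → 2 ^ b + 3 ≤ p →
    (E : Pt p → Bool) → E (origin p) ≡ false →
    (S : Mat p → Bool) → SubsetSL p S → Symmetric p S →
    p ^ u < cardM p S ^ v →
    cardM p S ^ v * p ^ (2 * u) < p ^ (3 * v) →
    (∀ H → IsSubgroup p H → Proper p H → ∀ g → isSL p g ≡ true →
    cardSCoset p S g H ^ (2 * v) * p ^ u < cardM p S ^ (2 * v)) →
    ((p ^ 2 ≤ 9 * cardP p (imageSet p S E)
    ⊎ cardM p S ^ b * cardP p E ^ (2 * b) * p ^ u
    ≤ (9 * cardP p (imageSet p S E)) ^ (2 * b) * p ^ (2 * b))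
    × (∀ k → LinesAtMost p E k →
    p ^ 2 ≤ 9 * cardP p (imageSet p S E)
    ⊎ cardM p S ^ b * cardP p E ^ (2 * b) * p ^ u
    ≤ (9 * cardP p (imageSet p S E)) ^ (2 * b) * p ^ b * k ^ b))
  main p p-prime large E Eo S S⊆ S-sym n-large _ coset = general , lines-bounded
    where
    open Core p p-prime (≤-trans (m≤n+m 3 (2 ^ b)) large) E Eo S S⊆ S-sym
    root : ∃ λ K → K ^ b ≤ p ^ u × p ^ u < suc K ^ b
    root = integer-root b b>0 (p ^ u)
    K : ℕ
    K = proj₁ root
    2≤K : 2 ≤ K
    2≤K = root-≥2 {b} {p} {u} u>0 (≤-trans (m≤m+n (2 ^ b) 3) large) (proj₂ (proj₂ root))
    n>0 : 0 < n
    n>0 = ≮⇒≥ λ n<1 → <⇒≱ n-large (≤-trans (≤-reflexive (trans (cong (_^ v) (n≤0⇒n≡0 (≤-pred n<1))) (0^ v v>0))) z≤n)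
      where
      0^ : ∀ v → 0 < v → 0 ^ v ≡ 0
      0^ (suc v) _ = refl
    spread : Spread (spread-constant K)
    spread H sub proper g g∈ = ≤-trans (*-monoʳ-≤ (cardSCoset p S g H) (≤-trans (proj₂ spread-poly K 2≤K) (^-monoʳ-≤ K {{>-nonZero (≤-trans (s≤s z≤n) 2≤K)}} (n≤1+n M))))
      (<⇒≤ (spread-root {cardSCoset p S g H} {n} {p} {u} {v} {M} {K} (proj₁ (proj₂ root)) (coset H sub proper g g∈)))
    bounded : ∀ k → k ≤ p → Dilations≤ k →
      p ^ 2 ≤ 9 * α ⊎ n ^ b * e ^ (2 * b) * p ^ u ≤ (9 * α) ^ (2 * b) * p ^ b * k ^ b
    bounded k k≤p lines = Sum.map₂ (power-form {n} {e} {α} {k} {p} {K} {u} {b} (proj₂ (proj₂ root)) 2≤K) (core k K k≤p n>0 lines spread)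
    general : p ^ 2 ≤ 9 * α ⊎ n ^ b * e ^ (2 * b) * p ^ u ≤ (9 * α) ^ (2 * b) * p ^ (2 * b)
    general = Sum.map₂ (λ h → ≤-trans h (≤-reflexive (trans (*-assoc ((9 * α) ^ (2 * b)) (p ^ b) (p ^ b)) (cong ((9 * α) ^ (2 * b) *_) (sym (trans (^-2* p b) (*-^ p p b)))))))
      (bounded p ≤-refl all-dilations)
    lines-bounded : ∀ k → LinesAtMost p E k → p ^ 2 ≤ 9 * α ⊎ n ^ b * e ^ (2 * b) * p ^ u ≤ (9 * α) ^ (2 * b) * p ^ b * k ^ b
    lines-bounded k lines = decide (≤-total k p)
      where
      decide : k ≤ p ⊎ p ≤ k → p ^ 2 ≤ 9 * α ⊎ n ^ b * e ^ (2 * b) * p ^ u ≤ (9 * α) ^ (2 * b) * p ^ b * k ^ b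
      decide (inj₁ k≤p) = bounded k k≤p (dilations-≤ lines)
      -- For k beyond p the bound with p in place of k is already stronger.
      decide (inj₂ p≤k) = Sum.map₂ (λ h → ≤-trans h (*-monoʳ-≤ ((9 * α) ^ (2 * b) * p ^ b) (^-monoˡ-≤ b p≤k))) (bounded p ≤-refl all-dilations)
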